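{- Let $m,n\geq 2$ be integers and let $k\in[0,n-1]$. If the statement $\mathcal{C}(n,1,k)$ holds (i.e., for the group $C_n\oplus C_n$), then the statement $\mathcal{C}(n,m,k)$ holds (i.e., for the group $C_n\oplus C_{mn}$).
   Context: $C_r$ denotes a cyclic group of order $r$. For integers $x\le y$, $[x,y]=\{z\in\mathbb Z: x\le z\le y\}$. A sequence over an abelian group $G$ is a finite unordered list (multiset) of elements of $G$; $g^{[t]}$ denotes the sequence consisting of $g$ repeated $t\ge 0$ times, and $\boldsymbol{\cdot}$ denotes concatenation of sequences; $\prod^\bullet$ denotes iterated concatenation. For a sequence $S$, $|S|$ is its length, $\sigma(S)$ the sum of its terms, and $\Sigma_{\leq \ell}(S)$ is the set of sums $\sigma(T)$ over all subsequences $T$ of $S$ with $1\le |T|\le \ell$. A basis $(e_1,e_2)$ of $G=C_n\oplus C_{mn}$ is a pair with $G=\langle e_1\rangle\oplus\langle e_2\rangle$ and $\mathrm{ord}(e_1)=n$, $\mathrm{ord}(e_2)=mn$. For $n\ge 2$, $m\ge 1$, $k\in[0,n-1]$, the statement $\mathcal{C}(n,m,k)$ is: for $G=C_n\oplus C_{mn}$ and every sequence $S$ over $G$ with $|S|=mn+n-2+k$ and $0\notin\Sigma_{\leq mn+n-1-k}(S)$, there exists either a basis $(e_1,e_2)$ of $G$ with $\mathrm{ord}(e_2)=mn$ or a generating set $\{g_1,g_2\}$ of $G$ with $\mathrm{ord}(g_1+g_2)=mn$ such that: 1. If $k=0$, then $S\boldsymbol{\cdot} g$, where $g=-\sigma(S)$,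 has one of the forms (a)–(d) listed in item 2. 2. If $k=1$, then $S$ is one of: (a) $e_1^{[n-1]}\boldsymbol{\cdot}\prod^\bullet_{i\in[1,mn]}(x_ie_1+e_2)$ with $x_1,\dots,x_{mn}\in[0,n-1]$, $x_1+\dots+x_{mn}\equiv 1\pmod n$; (b) $e_2^{[mn-1]}\boldsymbol{\cdot}\prod^\bullet_{i\in[1,n]}(x_ie_2+e_1)$ with $x_1,\dots,x_n\in[0,mn-1]$, $x_1+\dots+x_n\equiv 1\pmod{mn}$; (c) $g_1^{[sn-1]}\boldsymbol{\cdot}(g_1+g_2)^{[(m-s)n+1]}\boldsymbol{\cdot}\prod^\bullet_{i\in[1,n-1]}(-x_ig_1+g_2)$ with $s\in[1,m-1]$, $x_1,\dots,x_{n-1}\in[-1,n-2]$, $x_1+\dots+x_{n-1}=0$ and $ng_2=0$; (d) $g_1^{[n-1]}\boldsymbol{\cdot}(g_1+g_2)^{[(m-1)n+1]}\boldsymbol{\cdot}\prod^\bullet_{i\in[1,n-1]}(-x_ig_1+g_2)$ with $x_1,\dots,x_{n-1}\in[-1,n-2]$, $x_1+\dots+x_{n-1}=0$. 3. If $k\in[2,n-2]$, then either (a) $S=e_1^{[n-1]}\boldsymbol{\cdot}e_2^{[sn-1]}\boldsymbol{\cdot}(e_1+e_2)^{[(m-s)n+k]}$ for some $s\in[1,m]$, or (b) $S=g_1^{[n-1]}\boldsymbol{\cdot}g_2^{[n-1]}\boldsymbol{\cdot}(g_1+g_2)^{[(m-1)n+k]}$. 4. If $k=n-1$, then either (a) $S=e_1^{[n-1]}\boldsymbol{\cdot}e_2^{[sn-1]}\boldsymbol{\cdot}(xe_1+e_2)^{[(m-s)n+n-1]}$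 for some $s\in[1,m]$ and $x\in[1,n-1]$ with $\gcd(x,n)=1$, or (b) $S=g_1^{[n-1]}\boldsymbol{\cdot}g_2^{[n-1]}\boldsymbol{\cdot}(g_1+g_2)^{[(m-1)n+n-1]}$. Moreover, if $m=1$, then in each applicable item the alternative (a) holds. -}

module Defs where

open import Data.Nat as ℕ using (ℕ; zero; suc)
open import Data.Nat.GCD using (gcd)
open import Data.Integer as ℤ using (ℤ; +_)
open import Data.Integer.Divisibility using (_∣_)
open import Data.Fin using (Fin)
import Data.Fin as Fin
open import Data.List using (List; []; _∷_; _++_; replicate; length; tabulate; foldr)
open import Data.List.Relation.Binary.Sublist.Propositional using (_⊆_)
open import Data.List.Relation.Binary.Permutation.Homogeneous using (Permutation)
open import Data.Product using (Σ; ∃; ∃-syntax; _×_; _,_)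
open import Data.Sum using (_⊎_)
open import Relation.Nullary using (¬_)
open import Relation.Binary.PropositionalEquality using (_≡_)

-- Elements of G = C_n ⊕ C_{mn} are represented by pairs of integers
-- (a , b) standing for a·ε₁ + b·ε₂, where ε₁ , ε₂ are the standard
-- generators of orders n and mn.  Equality in G is congruence
-- (a mod n , b mod mn).

Elt : Set
Elt = ℤ × ℤ

_≡_[mod_] : ℤ → ℤ → ℕ → Set
a ≡ b [mod d ] = (+ d) ∣ (a ℤ.- b)

Eq : (n m : ℕ) → Elt → Elt → Set
Eq n m (a , b) (c , d) = (a ≡ c [mod n ]) × (b ≡ d [mod (m ℕ.* n) ])

0G : Elt
0G = (+ 0 , + 0)

_⊕_ : Elt → Elt → Elt
(a , b) ⊕ (c , d) = (a ℤ.+ c , b ℤ.+ d)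

⊖_ : Elt → Elt
⊖ (a , b) = (ℤ.- a , ℤ.- b)

_·_ : ℤ → Elt → Elt
z · (a , b) = (z ℤ.* a , z ℤ.* b)

infixl 7 _·_
infixl 6 _⊕_

σ : List Elt → Elt
σ = foldr _⊕_ 0G

Σℤ : {L : ℕ} → (Fin L → ℤ) → ℤ
Σℤ {zero} x = + 0
Σℤ {suc L} x = x Fin.zero ℤ.+ Σℤ (λ i → x (Fin.suc i))

-- Equality of sequences (finite multisets) over G:
-- a permutation up to equality of elements in G.
SeqEq : (n m : ℕ) → List Elt → List Elt → Set
SeqEq n m = Permutation (Eq n m)

HasOrder : (n m : ℕ) → Elt → ℕ → Set
HasOrder n m g d =
  (0 ℕ.< d) × Eq n m ((+ d) · g) 0G ×
  (∀ d' → 0 ℕ.< d' → Eq n m ((+ d') · g) 0G → d ℕ.≤ d')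

IsBasis : (n m : ℕ) → Elt → Elt → Set
IsBasis n m e₁ e₂ =
  (∀ g → ∃[ a ] ∃[ b ] Eq n m g (a · e₁ ⊕ b · e₂)) ×
  (∀ a b → Eq n m (a · e₁) (b · e₂) → Eq n m (a · e₁) 0G) ×
  HasOrder n m e₁ n × HasOrder n m e₂ (m ℕ.* n)

IsGoodGenSet : (n m : ℕ) → Elt → Elt → Set
IsGoodGenSet n m g₁ g₂ =
  (∀ g → ∃[ a ] ∃[ b ] Eq n m g (a · g₁ ⊕ b · g₂)) ×
  HasOrder n m (g₁ ⊕ g₂) (m ℕ.* n)

ZeroNotInΣ≤ : (n m ℓ : ℕ) → List Elt → Set
ZeroNotInΣ≤ n m ℓ S =
  ∀ (T : List Elt) → T ⊆ S → 1 ℕ.≤ length T → length T ℕ.≤ ℓ →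
  ¬ Eq n m (σ T) 0G

InRange : ℤ → ℤ → ℤ → Set
InRange lo hi z = (lo ℤ.≤ z) × (z ℤ.≤ hi)

Form2a : (n m : ℕ) → List Elt → Set
Form2a n m T =
  ∃[ e₁ ] ∃[ e₂ ] IsBasis n m e₁ e₂ ×
  Σ (Fin (m ℕ.* n) → ℤ) λ x →
    (∀ i → InRange (+ 0) (+ (n ℕ.∸ 1)) (x i)) ×
    (Σℤ x ≡ + 1 [mod n ]) ×
    SeqEq n m T (replicate (n ℕ.∸ 1) e₁ ++ tabulate (λ i → x i · e₁ ⊕ e₂))

Form2b : (n m : ℕ) → List Elt → Set
Form2b n m T =
  ∃[ e₁ ] ∃[ e₂ ] IsBasis n m e₁ e₂ ×
  Σ (Fin n → ℤ) λ x →
    (∀ i → InRange (+ 0) (+ (m ℕ.* n ℕ.∸ 1)) (x i)) ×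
    (Σℤ x ≡ + 1 [mod (m ℕ.* n) ]) ×
    SeqEq n m T (replicate (m ℕ.* n ℕ.∸ 1) e₂ ++ tabulate (λ i → x i · e₂ ⊕ e₁))

Form2c : (n m : ℕ) → List Elt → Set
Form2c n m T =
  ∃[ g₁ ] ∃[ g₂ ] IsGoodGenSet n m g₁ g₂ ×
  Σ ℕ λ s → (1 ℕ.≤ s) × (s ℕ.≤ m ℕ.∸ 1) ×
  Σ (Fin (n ℕ.∸ 1) → ℤ) λ x →
    (∀ i → InRange (ℤ.- (+ 1)) (+ (n ℕ.∸ 2)) (x i)) ×
    (Σℤ x ≡ + 0) ×
    Eq n m ((+ n) · g₂) 0G ×
    SeqEq n m T (replicate (s ℕ.* n ℕ.∸ 1) g₁
                 ++ replicate ((m ℕ.∸ s) ℕ.* n ℕ.+ 1) (g₁ ⊕ g₂)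
                 ++ tabulate (λ i → (ℤ.- x i) · g₁ ⊕ g₂))

Form2d : (n m : ℕ) → List Elt → Set
Form2d n m T =
  ∃[ g₁ ] ∃[ g₂ ] IsGoodGenSet n m g₁ g₂ ×
  Σ (Fin (n ℕ.∸ 1) → ℤ) λ x →
    (∀ i → InRange (ℤ.- (+ 1)) (+ (n ℕ.∸ 2)) (x i)) ×
    (Σℤ x ≡ + 0) ×
    SeqEq n m T (replicate (n ℕ.∸ 1) g₁
                 ++ replicate ((m ℕ.∸ 1) ℕ.* n ℕ.+ 1) (g₁ ⊕ g₂)
                 ++ tabulate (λ i → (ℤ.- x i) · g₁ ⊕ g₂))

Item2 : (n m : ℕ) → List Elt → Set
Item2 n m T =
  (Form2a n m T ⊎ Form2b n m T ⊎ Form2c n m T ⊎ Form2d n m T) ×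
  (m ≡ 1 → Form2a n m T)

Form3a : (n m k : ℕ) → List Elt → Set
Form3a n m k S =
  ∃[ e₁ ] ∃[ e₂ ] IsBasis n m e₁ e₂ ×
  Σ ℕ λ s → (1 ℕ.≤ s) × (s ℕ.≤ m) ×
    SeqEq n m S (replicate (n ℕ.∸ 1) e₁
                 ++ replicate (s ℕ.* n ℕ.∸ 1) e₂
                 ++ replicate ((m ℕ.∸ s) ℕ.* n ℕ.+ k) (e₁ ⊕ e₂))

Form3b : (n m k : ℕ) → List Elt → Set
Form3b n m k S =
  ∃[ g₁ ] ∃[ g₂ ] IsGoodGenSet n m g₁ g₂ ×
    SeqEq n m S (replicate (n ℕ.∸ 1) g₁
                 ++ replicate (n ℕ.∸ 1) g₂
                 ++ replicate ((m ℕ.∸ 1) ℕ.* n ℕ.+ k) (g₁ ⊕ g₂))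

Item3 : (n m k : ℕ) → List Elt → Set
Item3 n m k S =
  (Form3a n m k S ⊎ Form3b n m k S) × (m ≡ 1 → Form3a n m k S)

Form4a : (n m : ℕ) → List Elt → Set
Form4a n m S =
  ∃[ e₁ ] ∃[ e₂ ] IsBasis n m e₁ e₂ ×
  Σ ℕ λ s → (1 ℕ.≤ s) × (s ℕ.≤ m) ×
  Σ ℕ λ x → (1 ℕ.≤ x) × (x ℕ.≤ n ℕ.∸ 1) × (gcd x n ≡ 1) ×
    SeqEq n m S (replicate (n ℕ.∸ 1) e₁
                 ++ replicate (s ℕ.* n ℕ.∸ 1) e₂
                 ++ replicate ((m ℕ.∸ s) ℕ.* n ℕ.+ n ℕ.∸ 1) ((+ x) · e₁ ⊕ e₂))

Form4b : (n m : ℕ) → List Elt → Set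
Form4b n m S =
  ∃[ g₁ ] ∃[ g₂ ] IsGoodGenSet n m g₁ g₂ ×
    SeqEq n m S (replicate (n ℕ.∸ 1) g₁
                 ++ replicate (n ℕ.∸ 1) g₂
                 ++ replicate ((m ℕ.∸ 1) ℕ.* n ℕ.+ n ℕ.∸ 1) (g₁ ⊕ g₂))

Item4 : (n m : ℕ) → List Elt → Set
Item4 n m S =
  (Form4a n m S ⊎ Form4b n m S) × (m ≡ 1 → Form4a n m S)

Conclusion : (n m k : ℕ) → List Elt → Set
Conclusion n m k S =
  (k ≡ 0 → Item2 n m (S ++ (⊖ σ S) ∷ [])) ×
  (k ≡ 1 → Item2 n m S) ×
  (2 ℕ.≤ k → k ℕ.≤ n ℕ.∸ 2 → Item3 n m k S) ×
  (k ≡ n ℕ.∸ 1 → Item4 n m S)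

𝒞 : (n m k : ℕ) → Set
𝒞 n m k =
  ∀ (S : List Elt) →
  length S ≡ m ℕ.* n ℕ.+ n ℕ.∸ 2 ℕ.+ k →
  ZeroNotInΣ≤ n m (m ℕ.* n ℕ.+ n ℕ.∸ 1 ℕ.∸ k) S →
  Conclusion n m k S

-- Let φ : C_n ⊕ C_{mn} → C_n ⊕ C_n be the quotient map.  Since η(C_n ⊕ C_n) = 3n - 2, one can split off from S
-- blocks T_1, ..., T_{m-1} of length n with φ-sum zero; the remaining sequence R satisfies the hypothesis of the case
-- m = 1, hence its image is known.  The kernel of φ is cyclic of order m and S has no short zero-sums, so all blocks have
-- the same sum h, a generator of the kernel, and every φ-zero-sum subsequence of T_i R that is not too long also has sum h.
-- Comparing such subsequences that differ in a single term determines the terms of S themselves: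
--   for k ≥ 2 the three values of R are attained by equal elements and every block is constant with one of these values;
--   for k = 1, R consists of n - 1 terms over e₁ and n terms c_i over e₂ + ⟨e₁⟩.  If the terms over e₁ differ, almost all
--   other terms are equal (form b).  Otherwise either n e₁ = 0 and all other terms lie in a coset of ⟨e₁⟩ (form a), or
--   c_i = u - w_i e₁ with 0 ≤ w_i < n, Σ w_i = n - 1, and all blocks are u^n or e₁^n (forms b, c, d), or C is
--   u (u - e₁)^{n-1}, in which case u - e₁ plays the role of e₁ in form a.
-- The case k = 0 reduces to k = 1 by appending -σ(S).
module Submission where

open import Defs
open import Data.Nat as ℕ using (ℕ; zero; suc; _≤_; _<_; _∸_; s≤s; z≤n; _≤?_; nonTrivial⇒n>1)
open import Data.Nat.Properties using (*-comm; *-distribʳ-+; *-identityˡ; *-mono-≤; *-monoˡ-≤; +-assoc; +-cancelʳ-≤; +-cancelˡ-<; +-cancelˡ-≡; +-cancelˡ-≤; +-comm; +-identityʳ; +-mono-<; +-mono-≤; +-mono-≤-<; +-monoʳ-<; +-monoʳ-≤; +-monoˡ-≤; +-suc; 0≢1+n; 1+n≢0; <-trans; <-≤-trans; <⇒≤; <⇒≱; anyUpTo?; m+[n∸m]≡n; m+n∸m≡n; m+n∸n≡m; m<m+n; m<n⇒0<n∸m; m∸n+n≡m; m∸n≡0⇒m≤n; m∸n≤m; m≤m+n; m≤n+m; m≤n⇒m<n∨m≡n; m≤n⇒m⊓n≡m; n<1+n; n∸n≡0; n≤0⇒n≡0; n≤1+n; suc-injective; ≤-<-trans; ≤-antisym;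 ≤-pred; ≤-refl; ≤-reflexive; ≤-total; ≤-trans; ≤∧≢⇒<; ≰⇒>)
import Data.Nat.Properties as ℕ
import Data.Nat.Divisibility as ℕ
import Data.Nat.Coprimality as Coprime
open import Data.Nat.GCD using (gcd; gcd[m,n]∣m; module Bézout)
open import Data.Nat.ListAction using (product)
open import Data.Nat.Primality using (Prime; prime⇒nonZero; prime⇒nonTrivial; euclidsLemma)
open import Data.Nat.Primality.Factorisation using (factorise; PrimeFactorisation)
import Data.Nat.Tactic.RingSolver as ℕS
open import Data.Integer as ℤ using (ℤ; +_; _+_; _*_; _-_; -_)
import Data.Integer.Properties as ℤ
import Data.Integer.DivMod as ℤ
open import Data.Integer.Divisibility.Signed as Sg using (divides)
open import Data.Integer.Tactic.RingSolver using (solve-∀)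
open import Tactic.RingSolver.NonReflective Data.Integer.Tactic.RingSolver.ring using (solve; _⊜_)
open import Tactic.RingSolver.Core.Expression using (Expr; Κ) renaming (_⊕_ to _:+_; _⊗_ to _:*_; ⊝_ to :~_)
open import Data.Fin as Fin using (Fin)
import Data.Fin.Properties as Fin
open import Data.List using (List; []; _∷_; _++_; replicate; length; map; take; drop; concat; lookup; tabulate; foldr; filter; applyUpTo)
import Data.List.Properties as List
import Data.List.Sort ℤ.≤-decTotalOrder as Sort
open import Data.List.Membership.Propositional using (_∈_; find; lose)
open import Data.List.Membership.Propositional.Properties using (∈-++⁻; ∈-++⁺ˡ; ∈-++⁺ʳ; ∈-map⁺; ∈-lookup)
open import Data.List.Relation.Binary.Permutation.Homogeneous as Perm using (Permutation)
open import Data.List.Relation.Binary.Permutation.Propositional as Prop using (_↭_)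
import Data.List.Relation.Binary.Permutation.Propositional.Properties as Prop
import Data.List.Relation.Binary.Permutation.Setoid as PermS
import Data.List.Relation.Binary.Permutation.Setoid.Properties as PermSP
open import Data.List.Relation.Binary.Pointwise as PW using (Pointwise; []; _∷_)
open import Data.List.Relation.Binary.Sublist.Propositional using (_⊆_; []; _∷_; _∷ʳ_)
import Data.List.Relation.Binary.Sublist.Propositional.Properties as Sub
open import Data.List.Relation.Unary.All as All using (All; []; _∷_)
import Data.List.Relation.Unary.All.Properties as All
open import Data.List.Relation.Unary.AllPairs as AllPairs using (AllPairs; []; _∷_)
import Data.List.Relation.Unary.AllPairs.Properties as AllPairs
open import Data.List.Relation.Unary.Any as Any using (Any; here; there)
open import Data.List.Relation.Unary.Linked.Properties using (Linked⇒AllPairs)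
open import Data.Product using (Σ; ∃-syntax; _×_; _,_; proj₁; proj₂)
open import Data.Sum using (_⊎_; inj₁; inj₂)
open import Data.Empty using (⊥; ⊥-elim)
open import Function using (_∘_; id)
open import Relation.Binary using (Setoid)
open import Relation.Binary.PropositionalEquality using (_≡_; refl; sym; trans; cong; cong₂; subst)
open import Relation.Nullary using (¬_; Dec; yes; no)
import Relation.Nullary.Decidable as Dec

-- Polynomial identities over ℤ; those of the form u - v ≡ z * (a - b) + ... derive one congruence from others.

-- Blocks supplied by η have length at most n, so a priori R could be longer than in the case m = 1.
-- This is excluded because 2n - 1 + k terms over C_n ⊕ C_n contain a zero-sum of length at most 2n
-- - 1 - k: for k = 1 and k = n - 1 that follows from the Davenport constant and from η, for the k
-- between them it is drawn from the hypothesis itself. Both constants of C_n ⊕ C_n are bounded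
-- here, by finite differences for primes and then multiplicatively. The obstacle for k = 1 is that
-- a sum determines a coefficient of e₁ only modulo ord(e₁). If n e₁ ≠ 0, then y e₁ = 0 with |y| <
-- 2n forces y = 0, so coefficients are confined to windows of this width and compared as integers.
-- If n e₁ = h, a block may even contain terms outside ⟨e₁⟩ and e₂ + ⟨e₁⟩; then a count over all
-- terms of the block, with C rotated cyclically, pins C down. The case n = 2 stands apart, since
-- the exchanges for k = 1 rely on 2 e₁ being nonzero in the quotient.

infixl 6 _:-_
_:-_ : ∀ {n} → Expr ℤ n → Expr ℤ n → Expr ℤ n
e :- f = e :+ :~ f

k0 : ∀ {n} → Expr ℤ n
k0 = Κ (+ 0)

k1 : ∀ {n} → Expr ℤ n
k1 = Κ (+ 1)

k2 : ∀ {n} → Expr ℤ n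
k2 = Κ (+ 2)

k3 : ∀ {n} → Expr ℤ n
k3 = Κ (+ 3)

ring-1 = solve 7 (λ t t₀ x w x₀ w₀ e → (((x :- w) :- (x₀ :- w₀)) :* e :- k0) ⊜ (k1 :* (t :- (t₀ :+ (x₀ :- w₀) :* e)) :+ :~ k1 :* (t :- (t₀ :+ (x :- w) :* e)))) refl

ring-2 = solve 5 (λ n x w x₀ w₀ → (((k1 :+ n) :+ (k1 :+ n)) :- (k1 :+ ((x :- w) :- (x₀ :- w₀)))) ⊜ ((n :- x) :+ ((w :- k0) :+ ((x₀ :- k0) :+ ((k1 :+ n) :- w₀))))) refl

ring-3 = solve 5 (λ n x w x₀ w₀ → (((x :- w) :- (x₀ :- w₀)) :- (k1 :- ((k1 :+ n) :+ (k1 :+ n)))) ⊜ ((x :- k0) :+ ((n :- w) :+ ((n :- x₀) :+ (w₀ :- (:~ k1)))))) refl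

ring-4 = solve 4 (λ x w x₀ w₀ → (x) ⊜ (((x :- w) :- (x₀ :- w₀)) :+ (w :- (w₀ :- x₀)))) refl

ring-5 = solve 2 (λ d n → (:~ d :- (:~ n)) ⊜ (n :- d)) refl

ring-6 = solve 2 (λ d n → (n :- (:~ d)) ⊜ (d :- (:~ n))) refl

ring-7 = solve 4 (λ c d z e → (c :+ d :* e) ⊜ ((c :+ (z :+ k1) :* e) :+ :~ ((z :+ k1) :- d) :* e)) refl

ring-8 = solve 1 (λ z → (k0) ⊜ (k0 :* (z :+ k1) :- k0)) refl

ring-9 = solve 4 (λ x z l s → (((z :+ k1) :- x) :+ (l :* (z :+ k1) :- s)) ⊜ ((k1 :+ l) :* (z :+ k1) :- (x :+ s))) refl

ring-10 = solve 1 (λ s → (s) ⊜ ((s :- k1) :+ k1)) refl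

ring-11 = solve 2 (λ z ν → ((k1 :+ ν) :* (z :+ k1) :- (z :* (k1 :+ ν) :+ k1)) ⊜ (ν)) refl

ring-12 = solve 6 (λ S c z e h ν → ((k1 :+ ν) :* (c :+ (z :+ k1) :* e) :- h) ⊜ (:~ k1 :* (S :- ((k1 :+ ν) :* c :+ (z :* (k1 :+ ν) :+ k1) :* e)) :+ k1 :* (S :- (h :+ :~ ν :* e)))) refl

ring-13 = solve 5 (λ c x z e f → ((c :+ (z :+ k1) :* e) :- ((x :+ (z :+ k1)) :* e :+ f)) ⊜ (k1 :* (c :- (x :* e :+ f)))) refl

ring-14 = solve 3 (λ z d d′ → (d′ :- d) ⊜ (((z :+ k1) :- d) :- ((z :+ k1) :- d′))) refl

ring-15 = solve 1 (λ ν → (ν :- (k1 :+ ν)) ⊜ ((ν :- k1) :- ν)) refl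

ring-16 = solve 4 (λ A Z b ν → ((ν :- k1) :- (A :+ Z)) ⊜ ((k0 :- A) :+ (((k1 :+ ν) :- (k1 :+ ((k1 :+ b) :+ Z))) :+ (b :- k0)))) refl

ring-17 = solve 3 (λ b l Z → (l :- (k1 :+ l)) ⊜ (((b :+ l) :- (k1 :+ (b :+ Z))) :+ (Z :- l :* k1))) refl

ring-18 = solve 9 (λ v x a c n r f d h → (v :- (r :* f :+ (d :+ :~ c :* f))) ⊜ (k1 :* ((v :- (x :* f :+ d)) :- a :* h) :+ (:~ a :* (n :* f :- h) :+ k1 :* ((((x :+ a :* n) :+ c) :- r) :* f :- k0)))) refl

ring-19 = solve 7 (λ a b A B c e f → (((a :* e :+ b :* f) :+ (A :* e :+ (B :* f :+ c :* (e :+ f)))) :- k0) ⊜ (:~ k1 :* ((:~ a :- (A :+ c)) :* e :- k0) :+ :~ k1 :* ((:~ b :- (B :+ c)) :* f :- k0))) refl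

ring-20 = solve 3 (λ z y h → (k1 :* h :- k0) ⊜ (:~ k1 :* (z :- h) :+ (:~ k1 :* (y :- h) :+ k1 :* ((z :+ y) :- h)))) refl

ring-21 = solve 3 (λ t v e → (v :* e :- k0) ⊜ (k1 :* (t :- (t :+ :~ v :* e)))) refl

ring-22 = solve 3 (λ n w v → (((k1 :+ n) :+ (k1 :+ n)) :- (k1 :+ v)) ⊜ ((n :- w) :+ (((w :- v) :- k0) :+ ((k1 :+ n) :- k0)))) refl

ring-23 = solve 3 (λ n w v → (v :- (k1 :- ((k1 :+ n) :+ (k1 :+ n)))) ⊜ ((w :- k0) :+ ((n :- (w :- v)) :+ ((k1 :+ n) :- k0)))) refl

ring-24 = solve 5 (λ c x l s e → ((c :+ x :* e) :+ (l :* c :+ s :* e)) ⊜ ((k1 :+ l) :* c :+ (x :+ s) :* e)) refl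

ring-25 = solve 5 (λ s c x e n → ((x :- k1) :* e :- k0) ⊜ (:~ k1 :* (s :- (n :* c :+ x :* e)) :+ (k1 :* (s :- e) :+ :~ k1 :* (n :* c :- k0)))) refl

ring-26 = solve 4 (λ x b Z ν → ((k1 :+ ν) :- (k1 :+ ((k1 :+ b) :+ Z))) ⊜ ((ν :- (x :+ Z)) :+ (x :- (k1 :+ b)))) refl

ring-27 = solve 1 (λ y → (k1 :- y) ⊜ (k2 :- (k1 :+ y))) refl

ring-28 = solve 2 (λ Z l → (k0 :- (Z :+ l :* :~ k1)) ⊜ (l :- Z)) refl

ring-29 = solve 1 (λ w → (w) ⊜ ((w :+ (:~ k1)) :+ k1)) refl

ring-30 = solve 3 (λ u w e → (u :+ :~ w :* e) ⊜ (:~ (w :+ :~ k1) :* e :+ (u :+ :~ k1 :* e))) refl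

ring-31 = solve 4 (λ t r t′ r′ → (r′ :- r) ⊜ (k1 :* ((t′ :+ r′) :- (t :+ r)) :+ (:~ k1 :* (t′ :- k0) :+ k1 :* (t :- k0)))) refl

ring-32 = solve 2 (λ a b → (k1 :* a :+ k0 :* b) ⊜ (a)) refl

ring-33 = solve 2 (λ a b → (k0 :* a :+ k1 :* b) ⊜ (b)) refl

ring-34 = solve 2 (λ a b → (k1 :* a :+ k1 :* b) ⊜ (a :+ b)) refl

ring-35 = solve 5 (λ t₀ w e t x → (t :- (t₀ :+ (x :- w) :* e)) ⊜ (:~ k1 :* ((t₀ :+ :~ w :* e) :- (t :+ :~ x :* e)))) refl

ring-36 = solve 2 (λ a b → (b :- a) ⊜ (:~ (a :- b))) refl

ring-37 = solve 7 (λ y c s x n e h → (((s :+ x) :- n) :* e :- k0) ⊜ (k1 :* ((y :+ x :* e) :- h) :+ (:~ k1 :* (y :- (c :+ s :* e)) :+ :~ k1 :* (c :- (h :+ :~ n :* e))))) refl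

ring-38 = solve 6 (λ n a b w v x → (((k1 :+ n) :+ (k1 :+ n)) :- (k1 :+ ((((w :+ a) :- (v :+ b)) :+ x) :- n))) ⊜ ((n :- (a :- b)) :+ ((n :- (w :- v)) :+ ((k1 :+ n) :- x)))) refl

ring-39 = solve 6 (λ n a b w v x → (((((w :+ a) :- (v :+ b)) :+ x) :- n) :- (k1 :- ((k1 :+ n) :+ (k1 :+ n)))) ⊜ (((a :- b) :- k0) :+ (((w :- v) :- k0) :+ ((x :- k0) :+ ((k1 :+ n) :- k0))))) refl

ring-40 = solve 3 (λ s x n → (s) ⊜ (((s :+ x) :- n) :+ (n :- x))) refl

ring-41 = solve 5 (λ c t j x e → (c :+ ((t :+ j) :+ x :* e)) ⊜ ((t :+ (c :+ j)) :+ x :* e)) refl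

ring-42 = solve 7 (λ L q n x u e h → (((L :- (q :- k1) :* n) :- x) :* e :- k0) ⊜ (:~ k1 :* ((((q :* n) :* u :+ :~ L :* e) :+ x :* e) :- h) :+ (q :* (n :* u :- h) :+ :~ (q :- k1) :* (n :* e :- h)))) refl

ring-43 = solve 3 (λ V x ν → (((k1 :+ ν) :+ (k1 :+ ν)) :- (k1 :+ (V :- x))) ⊜ (((k1 :+ ν) :- V) :+ ((x :- k0) :+ (ν :- k0)))) refl

ring-44 = solve 3 (λ V x ν → ((V :- x) :- (k1 :- ((k1 :+ ν) :+ (k1 :+ ν)))) ⊜ ((V :- (:~ (k1 :+ ν))) :+ (ν :- x))) refl

ring-45 = solve 6 (λ x L s K J c → (((x :+ L) :+ s) :- c) ⊜ ((((L :+ (K :+ s)) :- c) :+ (x :+ J)) :- (K :+ J))) refl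

ring-46 = solve 2 (λ Ω b → (Ω :- k0) ⊜ (((k1 :+ Ω) :- b) :+ (b :- k1))) refl

ring-47 = solve 6 (λ x L s J q n → (((x :+ L) :+ (J :+ s)) :- ((k1 :+ q) :- k1) :* n) ⊜ ((((L :+ s) :- (q :- k1) :* n) :+ (x :+ J)) :- n)) refl

ring-48 = solve 1 (λ ν → (ν :- (k1 :+ ν)) ⊜ (((k1 :+ ν) :- k2) :- ν)) refl

ring-49 = solve 4 (λ A Z b l → ((((k2 :+ b) :+ l) :- k2) :- (A :+ Z)) ⊜ ((k0 :- A) :+ ((l :- Z) :+ (b :- k0)))) refl

ring-50 = solve 2 (λ l Z → (l :- (k1 :+ l)) ⊜ ((Z :- l :* k2) :+ ((l :- Z) :+ (l :- k1)))) refl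

ring-51 = solve 7 (λ t a a′ b c e f → (((a′ :- a) :* e :+ (c :- b) :* f) :- k0) ⊜ (:~ k1 :* (t :- (a′ :* e :+ c :* f)) :+ k1 :* (t :- (a :* e :+ b :* f)))) refl

ring-52 = solve 2 (λ x N → (x :- k1) ⊜ (k1 :* (x :- k1 :+ N) :+ :~ k1 :* N)) refl

ring-53 = solve 6 (λ S f d X M n → ((X :- k1 :+ (k1 :+ M)) :* f :- k0) ⊜ (:~ k1 :* (S :- (M :* f :+ (X :* f :+ n :* d))) :+ (k1 :* (S :- k0) :+ :~ k1 :* (n :* d :- k0)))) refl

ring-54 = solve 1 (λ w → ((w :+ :~ k1) :- (:~ k1)) ⊜ (w :- k0)) refl

ring-55 = solve 2 (λ w n → (n :- (w :+ :~ k1)) ⊜ ((k1 :+ n) :- w)) refl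

ring-56 = solve 1 (λ x → (x :+ x :* :~ k1) ⊜ (k0)) refl

ring-57 = solve 4 (λ c τ f e → (c :- (k1 :* f :+ e)) ⊜ (k1 :* (c :- (τ :+ e)) :+ :~ k1 :* (f :- τ))) refl

ring-58 = solve 3 (λ v f e → (v :- (k0 :* f :+ e)) ⊜ (k1 :* (v :- e))) refl

ring-59 = solve 4 (λ t x e c → (t :- (x :* e :+ c)) ⊜ (:~ k1 :* (c :- (t :+ :~ x :* e)))) refl

ring-60 = solve 6 (λ c t x y e c₀ → (c :- ((y :- x) :* e :+ c₀)) ⊜ (k1 :* (c :- (t :+ :~ x :* e)) :+ k1 :* (t :- (y :* e :+ c₀)))) refl

ring-61 = solve 6 (λ s X n e c h → (n :* c :- h) ⊜ (:~ k1 :* (s :- (X :* e :+ n :* c)) :+ (k1 :* (s :- h) :+ :~ k1 :* (X :* e :- k0 :* e)))) refl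

ring-62 = solve 2 (λ X k → (X :- k1) ⊜ (k1 :* (k :+ X) :+ :~ k1 :* (k1 :+ k))) refl

ring-63 = solve 5 (λ k X l e c → ((k :+ X) :* e :+ l :* c) ⊜ (k :* e :+ (X :* e :+ l :* c))) refl

ring-64 = solve 5 (λ u v w x e → ((w :+ x) :* e :- k0) ⊜ (k1 :* (u :- (v :+ :~ w :* e)) :+ k1 :* (v :- (u :+ :~ x :* e)))) refl

ring-65 = solve 3 (λ k w x → (((k1 :+ k) :+ (k1 :+ k)) :- (k1 :+ (w :+ x))) ⊜ ((k :- w) :+ ((k :- x) :+ (k1 :- k0)))) refl

ring-66 = solve 3 (λ k w x → ((w :+ x) :- (k1 :- ((k1 :+ k) :+ (k1 :+ k)))) ⊜ ((w :- k0) :+ ((x :- k0) :+ ((k :+ (k1 :+ k)) :- k0)))) refl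

ring-67 = solve 2 (λ w x → ((w :+ x) :- x) ⊜ (w :- k0)) refl

ring-68 = solve 7 (λ x p q e f s t → (((x :+ p) :* e :+ q :* f) :- k0) ⊜ (:~ k1 :* (s :- (x :* e :+ q :* f)) :+ (:~ k1 :* (t :- p :* e) :+ k1 :* ((s :+ t) :- k0)))) refl

ring-69 = solve 5 (λ j a b f z → (j :* b :- k0) ⊜ (k1 :* (j :* f :- j :* z) :+ (:~ j :* (f :- (a :+ b)) :+ j :* (z :- a)))) refl

ring-70 = solve 5 (λ j a b f z → (j :* a :- k0) ⊜ (k1 :* (j :* f :- j :* z) :+ (:~ j :* (f :- (a :+ b)) :+ j :* (z :- b)))) refl

ring-71 = solve 7 (λ a b c x e f g → (((a :+ c :* x) :* e :+ (c :+ b) :* f) :- k0) ⊜ (k1 :* (((c :* g :+ b :* f) :+ a :* e) :- k0) :+ :~ c :* (g :- (x :* e :+ f)))) refl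

ring-72 = solve 5 (λ n a b c h → (c :- (a :+ b)) ⊜ (:~ k1 :* (((k1 :+ n) :* a :+ ((k1 :+ n) :* b :+ k1 :* c)) :- h) :+ k1 :* ((n :* a :+ (n :* b :+ k2 :* c)) :- h))) refl

ring-73 = solve 5 (λ n a b c h → ((k2 :+ n) :* c :- h) ⊜ (k1 :* ((n :* a :+ (n :* b :+ k2 :* c)) :- h) :+ n :* (c :- (a :+ b)))) refl

ring-74 = solve 2 (λ x y → (k1 :+ x) ⊜ (:~ k1 :* (y :* x :- k1) :+ x :* (y :+ k1))) refl

ring-75 = solve 4 (λ a b c h → (c :- (a :+ b)) ⊜ (k1 :* (k2 :* c :- h) :+ :~ k1 :* ((k1 :* a :+ (k1 :* b :+ k1 :* c)) :- h))) refl

ring-76 = solve 5 (λ d f y x e → ((d :+ (f :+ y)) :- k0) ⊜ (k1 :* (d :- e) :+ (k1 :* (f :- x :* e) :+ k1 :* ((y :+ (k1 :+ x) :* e) :- k0)))) refl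

ring-77 = solve 3 (λ t c d → (c :+ (t :+ d)) ⊜ (t :+ (c :+ d))) refl

ring-78 = solve 2 (λ n c → ((n :+ c) :- c) ⊜ (n)) refl

ring-79 = solve 4 (λ s h x e → ((k1 :+ x) :* e :- k0) ⊜ (:~ k1 :* (s :- e) :+ (k1 :* ((s :+ x :* e) :- h) :+ k1 :* (h :- k0)))) refl

ring-80 = solve 3 (λ a b c → ((a :+ b) :- (c :+ b)) ⊜ (a :- c)) refl

ring-81 = solve 2 (λ n x → ((n :- x) :- k0) ⊜ (n :- x)) refl

ring-82 = solve 2 (λ n x → (n :- (n :- x)) ⊜ (x :- k0)) refl

ring-83 = solve 6 (λ y c s n e h → ((s :- n) :* e :- k0) ⊜ (k1 :* (y :- h) :+ (:~ k1 :* (y :- (c :+ s :* e)) :+ :~ k1 :* (c :- (h :+ :~ n :* e))))) refl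

ring-84 = solve 2 (λ n s → (((k1 :+ n) :+ (k1 :+ n)) :- (k1 :+ (s :- n))) ⊜ ((n :- s) :+ (((k1 :+ n) :+ n) :- k0))) refl

ring-85 = solve 2 (λ n s → ((s :- n) :- (k1 :- ((k1 :+ n) :+ (k1 :+ n)))) ⊜ ((s :- k0) :+ ((k1 :+ n) :- k0))) refl

ring-86 = solve 6 (λ c t w v e n → ((k1 :+ (w :+ n :* :~ v)) :* e :- k0) ⊜ (k1 :* (c :- (n :* t :+ :~ w :* e)) :+ (:~ k1 :* (c :- e) :+ k1 :* (n :* (t :+ :~ v :* e) :- k0)))) refl

ring-87 = solve 3 (λ w v x → (x :- (:~ v)) ⊜ ((w :+ x) :- (w :- v))) refl

ring-88 = solve 3 (λ x y z → (z :- y) ⊜ ((x :- y) :- (x :- z))) refl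

ring-89 = solve 8 (λ t u e h x s b l → (t :- (b :* u :+ :~ (x :- s) :* e)) ⊜ (k1 :* (((t :+ (l :* u :+ :~ s :* e)) :+ x :* e) :- h) :+ :~ k1 :* ((b :+ l) :* u :- h))) refl

ring-90 = solve 5 (λ t u e h x → (t :- (k0 :* u :+ :~ (:~ k1) :* e)) ⊜ (k1 :* (((t :+ k0) :+ x :* e) :- h) :+ :~ k1 :* ((k1 :+ x) :* e :- h))) refl

ring-91 = solve 3 (λ x S b → ((k1 :+ ((x :- S) :+ S)) :- (k1 :+ b)) ⊜ (x :- b)) refl

ring-92 = solve 3 (λ x S ν → (ν :- ((x :- S) :+ S)) ⊜ (ν :- x)) refl

ring-93 = solve 6 (λ u e B x S z → ((x :+ S :- z) :* e :- k0) ⊜ (:~ k1 :* ((B :* u :+ :~ x :* e) :- (B :* u :+ :~ (z :- S) :* e)))) refl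

ring-94 = solve 7 (λ n b x y w E z → (((k2 :+ n) :+ (k2 :+ n)) :- (k1 :+ ((x :+ (w :+ E)) :- z))) ⊜ (((k1 :+ n) :- (x :+ (y :+ E))) :+ ((n :- (w :- y)) :+ ((z :- b) :+ ((k2 :+ b) :- k0))))) refl

ring-95 = solve 7 (λ n b x y w E z → (((x :+ (w :+ E)) :- z) :- (k1 :- ((k2 :+ n) :+ (k2 :+ n)))) ⊜ (((k1 :+ (x :+ (y :+ E))) :- (k1 :+ b)) :+ (((w :- y) :- (:~ n)) :+ (((k1 :+ n) :- z) :+ ((k2 :+ b) :- k0))))) refl

ring-96 = solve 6 (λ B L i s u e → ((B :* u :+ :~ L :* e) :+ (i :* u :+ :~ s :* e)) ⊜ ((B :+ i) :* u :+ :~ (L :+ s) :* e)) refl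

ring-97 = solve 4 (λ q n u y → (((q :* n) :* u :+ y) :- y) ⊜ (q :* (n :* u :- k0))) refl

ring-98 = solve 3 (λ v Ω ν → (((v :+ Ω) :- ν) :- (:~ (k1 :+ ν))) ⊜ ((v :- k0) :+ ((k1 :+ Ω) :- k0))) refl

ring-99 = solve 3 (λ v Ω ν → ((k1 :+ ν) :- ((v :+ Ω) :- ν)) ⊜ (((k1 :+ ν) :- v) :+ (ν :- Ω))) refl

ring-100 = solve 3 (λ v Ω n → (((v :+ Ω) :- n) :- (:~ n)) ⊜ ((v :- k0) :+ (Ω :- k0))) refl

ring-101 = solve 3 (λ v Ω ν → ((k1 :+ ν) :- ((v :+ Ω) :- (k1 :+ ν))) ⊜ (((k1 :+ ν) :- v) :+ ((k1 :+ ν) :- Ω))) refl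

ring-102 = solve 5 (λ b x B l L → (((b :- k1) :- x) :+ ((B :- l) :- L)) ⊜ (((b :+ B) :- (k1 :+ l)) :- (x :+ L))) refl

ring-103 = solve 3 (λ q n L → (k0 :- ((q :* n :- n) :- L)) ⊜ (L :- (q :- k1) :* n)) refl

ring-104 = solve 2 (λ x b → ((((k1 :+ b) :- k1) :- x) :- k0) ⊜ (b :- x)) refl

ring-105 = solve 3 (λ Z l b → (l :- Z) ⊜ ((((k2 :+ b) :+ l) :- k1) :- ((k1 :+ b) :+ Z))) refl

ring-106 = solve 1 (λ ν → (ν) ⊜ ((k1 :+ ν) :- k1)) refl

ring-107 = solve 2 (λ l b → (l :- k1) ⊜ ((b :+ l) :- (k1 :+ b))) refl

ring-108 = solve 3 (λ x l s → ((k1 :- x) :+ (l :- s)) ⊜ ((k1 :+ l) :- (x :+ s))) refl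

ring-109 = solve 1 (λ w → (k1 :- (k1 :- w)) ⊜ (w)) refl

ring-110 = solve 2 (λ x y → (y :- k1) ⊜ (k1 :* (x :- k1) :+ :~ k1 :* (x :- y))) refl

ring-111 = solve 5 (λ n c d f h → (n :* (d :+ :~ c :* f) :- k0) ⊜ (k1 :* (n :* d :- c :* h) :+ :~ c :* (n :* f :- h))) refl

ring-112 = solve 4 (λ t e h k → (t :- e) ⊜ (k1 :* (((t :+ k0) :+ k :* e) :- h) :+ :~ k1 :* ((k1 :+ k) :* e :- h))) refl

ring-113 = solve 5 (λ x c e f a → (c :- (x :* a :+ f)) ⊜ (k1 :* (c :- (x :* e :+ f)) :+ :~ x :* (a :- e))) refl

ring-114 = solve 4 (λ X n e f → ((X :* e :+ n :* f) :- e) ⊜ (k1 :* (X :* e :- k1 :* e) :+ k1 :* (n :* f :- k0))) refl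

ring-115 = solve 2 (λ g s → (g :- (g :+ s)) ⊜ (:~ k1 :* (s :- k0))) refl

ring-116 = solve 4 (λ t g a b → (t :- b) ⊜ (k1 :* ((t :+ g) :- (a :+ b)) :+ :~ k1 :* (g :- a))) refl

ring-117 = solve 4 (λ t g a b → (t :- a) ⊜ (k1 :* ((t :+ g) :- (a :+ b)) :+ :~ k1 :* (g :- b))) refl

ring-118 = solve 2 (λ k v → ((k :* v :+ v) :- k0) ⊜ (k1 :* ((k1 :+ k) :* v :- k0))) refl

ring-119 = solve 6 (λ kf kg f a g b → ((g :+ b) :- (f :+ a)) ⊜ (k1 :* ((kf :+ b) :- (kg :+ a)) :+ (:~ k1 :* ((kf :+ f) :- k0) :+ k1 :* ((kg :+ g) :- k0)))) refl

ring-120 = solve 3 (λ t c g → (g :+ (t :+ c)) ⊜ (t :+ (c :+ g))) refl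

ring-121 = solve 5 (λ j f g a b → (j :* f :- j :* g) ⊜ (k1 :* (((k1 :+ j) :* f :+ b) :- ((k1 :+ j) :* g :+ a)) :+ (:~ k1 :* (f :- a) :+ k1 :* (g :- b)))) refl

ring-122 = solve 5 (λ j f z g c → (j :* g :- k0) ⊜ (:~ k1 :* (j :* f :- j :* z) :+ (j :* ((c :+ g) :- z) :+ j :* (f :- c)))) refl

ring-123 = solve 3 (λ x y z → (k1 :+ z :* x) ⊜ (:~ k1 :* (y :* x :- k1) :+ x :* (y :+ z))) refl

ring-124 = solve 3 (λ x p y → ((x :+ p) :+ y :* x) ⊜ (k1 :* (y :* x :- k1) :+ k1 :* (x :+ (k1 :+ p)))) refl

ring-125 = solve 3 (λ x p y → (p :+ (k1 :+ y) :* x) ⊜ (k1 :* (y :* x :- k1) :+ k1 :* (x :+ (k1 :+ p)))) refl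

ring-126 = solve 3 (λ x p z → ((k2 :+ p) :+ (k1 :+ z) :* x) ⊜ (k1 :* (k1 :+ z :* x) :+ k1 :* (x :+ (k1 :+ p)))) refl

ring-127 = solve 8 (λ x p y z a b c h → (c :- (x :* a :+ b)) ⊜ (:~ k1 :* (((x :+ p) :* a :+ ((k1 :+ z) :* b :+ y :* c)) :- h) :+ k1 :* ((p :* a :+ (z :* b :+ (k1 :+ y) :* c)) :- h))) refl

ring-128 = solve 8 (λ x p y z a b c h → ((x :+ (k1 :+ p)) :* a :- k0) ⊜ (:~ k1 :* ((k1 :* a :+ ((k1 :+ y) :* b :+ z :* c)) :- h) :+ (k1 :* (((k2 :+ p) :* a :+ (y :* b :+ (k1 :+ z) :* c)) :- h) :+ :~ k1 :* (c :- (x :* a :+ b))))) refl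

ring-129 = solve 8 (λ x p y z a b c h → ((y :+ z) :* b :- h) ⊜ (k1 :* (((x :+ p) :* a :+ (z :* b :+ y :* c)) :- h) :+ (:~ y :* (c :- (x :* a :+ b)) :+ :~ k1 :* (((x :+ p) :+ y :* x) :* a :- k0 :* a)))) refl

ring-130 = solve 4 (λ a b c e → (c :- (k1 :* a :+ b)) ⊜ (k1 :* ((b :+ (c :+ k0)) :- e) :+ (:~ k1 :* (a :- e) :+ :~ k1 :* (k2 :* b :- k0)))) refl

ring-131 = solve 3 (λ a b c → (a :+ (b :+ c)) ⊜ (b :+ (a :+ c))) refl

ring-132 = solve 4 (λ m n x h → ((m :* n) :* x :- k0) ⊜ (m :* (n :* x :- h) :+ k1 :* (m :* h :- k0))) refl

ring-133 = solve 4 (λ q n x h → (q :* h :- k0) ⊜ (:~ q :* (n :* x :- h) :+ k1 :* ((q :* n) :* x :- k0))) refl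

ring-134 = solve 4 (λ a b e f → ((a :* e :+ :~ b :* f) :- k0) ⊜ (k1 :* (a :* e :- b :* f))) refl

ring-135 = solve 3 (λ s x e → (s :- e) ⊜ (k1 :* ((s :+ x :* e) :- k0) :+ :~ k1 :* ((k1 :+ x) :* e :- k0))) refl

ring-136 = solve 6 (λ u v t e l k → ((u :+ v) :- l :* e) ⊜ (k1 :* (u :- l :* (t :+ e)) :+ (k1 :* (v :- k :* t) :+ k1 :* ((l :+ k) :* t :- k0)))) refl

ring-137 = solve 3 (λ s l e → ((l :- k1) :* e :- k0) ⊜ (:~ k1 :* (s :- l :* e) :+ k1 :* (s :- e))) refl

ring-138 = solve 3 (λ t τ e → (k2 :* e :- k0) ⊜ (:~ k1 :* (τ :- (t :+ e)) :+ k1 :* ((τ :+ e) :- t))) refl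

ring-139 = solve 3 (λ t τ e → (k1 :* e :- k0) ⊜ (k1 :* ((τ :+ e) :- (t :+ e)) :+ :~ k1 :* (τ :- (t :+ e)))) refl

ring-140 = solve 7 (λ s t a b c h e → (((a :+ b) :- c) :* e :- h) ⊜ (k1 :* ((s :+ a :* e) :- h) :+ (k1 :* ((t :+ b :* e) :- h) :+ :~ k1 :* (((s :+ t) :+ c :* e) :- h)))) refl

ring-141 = solve 6 (λ c t u z e h → (c :- (t :+ :~ z :* e)) ⊜ (k1 :* (((c :+ u) :+ z :* e) :- h) :+ :~ k1 :* ((t :+ u) :- h))) refl

ring-142 = solve 4 (λ s h x e → (s :- (h :+ :~ x :* e)) ⊜ (k1 :* ((s :+ x :* e) :- h))) refl

ring-143 = solve 2 (λ n x → (n :* x :- k0) ⊜ (:~ k1 :* ((:~ k1 :* n) :* x :- k0))) refl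

ring-144 = solve 6 (λ c t x w e n → ((n :* t :+ :~ x :* e) :- (c :+ (w :- x) :* e)) ⊜ (:~ k1 :* (c :- (n :* t :+ :~ w :* e)))) refl

ring-145 = solve 4 (λ y c s e → (y :- (k1 :+ s) :* e) ⊜ (k1 :* (y :- (c :+ s :* e)) :+ k1 :* (c :- e))) refl

ring-146 = solve 2 (λ s n → (s) ⊜ ((s :- n) :+ n)) refl

ring-147 = solve 2 (λ t e → (t :+ :~ k0 :* e) ⊜ (t)) refl

ring-148 = solve 4 (λ x y b n → ((x :- y) :- (:~ n)) ⊜ ((x :- (k1 :+ b)) :+ (((k1 :+ n) :- y) :+ (b :- k0)))) refl

ring-149 = solve 4 (λ x y b n → (n :- (x :- y)) ⊜ (((k1 :+ n) :- x) :+ ((y :- (k1 :+ b)) :+ (b :- k0)))) refl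

ring-150 = solve 7 (λ c d s x y e h → (d :- (c :+ (x :- y) :* e)) ⊜ (:~ k1 :* ((c :+ (s :+ x :* e)) :- h) :+ k1 :* ((d :+ (s :+ y :* e)) :- h))) refl

ring-151 = solve 5 (λ c x d d′ e → ((d :- d′) :* e :- k0) ⊜ (:~ k1 :* (x :- (c :+ d :* e)) :+ k1 :* (x :- (c :+ d′ :* e)))) refl

ring-152 = solve 3 (λ d d′ n → (((k2 :+ n) :+ (k2 :+ n)) :- (k1 :+ (d :- d′))) ⊜ ((n :- d) :+ ((d′ :- (:~ n)) :+ (k3 :- k0)))) refl

ring-153 = solve 3 (λ d d′ n → ((d :- d′) :- (k1 :- ((k2 :+ n) :+ (k2 :+ n)))) ⊜ ((d :- (:~ n)) :+ ((n :- d′) :+ (k3 :- k0)))) refl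

ring-154 = solve 1 (λ ν → ((k1 :+ (:~ k1 :+ ν)) :- k0) ⊜ (ν :- k0)) refl

ring-155 = solve 1 (λ ν → (ν :- (:~ k1 :+ ν)) ⊜ (k1 :- k0)) refl

ring-156 = solve 2 (λ z b → ((k1 :+ z) :- (k1 :+ b)) ⊜ (z :- b)) refl

ring-157 = solve 1 (λ n → (((k0 :+ k0) :- (k0 :- k1) :* n) :- k0) ⊜ (n :- k0)) refl

ring-158 = solve 1 (λ n → (n :- ((k0 :+ k0) :- (k0 :- k1) :* n)) ⊜ (k0 :- k0)) refl

ring-159 = solve 1 (λ ν → ((k1 :+ ν) :- ν) ⊜ (k1)) refl

ring-160 = solve 2 (λ e u → (e :+ (u :+ :~ k1 :* e)) ⊜ (u)) refl

ring-161 = solve 4 (λ n u e h → (n :* (u :+ :~ k1 :* e) :- k0) ⊜ (k1 :* (n :* u :- h) :+ :~ k1 :* (n :* e :- h))) refl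

ring-162 = solve 2 (λ u e → (u) ⊜ (k1 :* (u :+ :~ k1 :* e) :+ e)) refl

ring-163 = solve 2 (λ x e → (e) ⊜ (k0 :* x :+ e)) refl

ring-164 = solve 3 (λ u e k → ((u :+ k :* e) :- (u :+ :~ k1 :* e)) ⊜ (k1 :* ((k1 :+ k) :* e :- k0))) refl

ring-165 = solve 3 (λ a e f → (a :* e :+ k1 :* f) ⊜ (a :* e :+ f)) refl

ring-166 = solve 2 (λ g s → (g :- :~ s) ⊜ (k1 :* ((g :+ s) :- k0))) refl

ring-167 = solve 8 (λ s s′ a b c d e f → ((c :+ (d :+ e)) :- (f :+ (a :+ b))) ⊜ (:~ k1 :* ((s′ :+ (a :+ b)) :- c) :+ (k1 :* ((s :+ (d :+ e)) :- f) :+ :~ k1 :* (s :- s′)))) refl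

ring-168 = solve 9 (λ a b d x y z t c g → ((t :+ g) :- (a :+ b)) ⊜ (k1 :* ((z :+ (x :+ y)) :- (d :+ (a :+ b))) :+ (:~ k1 :* (c :- d) :+ :~ k1 :* ((z :+ (x :+ y)) :- (t :+ (c :+ g)))))) refl

ring-169 = solve 3 (λ w r x → (r :* x :- k1) ⊜ (k1 :* (w :* x :- k1) :+ :~ x :* (w :- r))) refl

ring-170 = solve 2 (λ x p → (x :+ p :* x) ⊜ (x :* (k1 :+ p))) refl

ring-171 = solve 1 (λ x → (x) ⊜ (:~ k1 :* (k0 :- k1 :* x))) refl

ring-172 = solve 1 (λ x → (x) ⊜ (k1 :* (k0 :- (:~ k1) :* x))) refl

ring-173 = solve 2 (λ u v → (u :- v) ⊜ (:~ k1 :* (:~ u :- :~ v))) refl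

ring-174 = solve 1 (λ u → ((u :+ k0) :- k0) ⊜ (k1 :* (u :- k0))) refl

ring-175 = solve 3 (λ x y z → ((x :+ (y :+ z)) :- k0) ⊜ (:~ k1 :* (k0 :- :~ (:~ ((x :+ y) :+ z))))) refl

ring-176 = solve 3 (λ x y z → ((y :+ z) :- k0) ⊜ (:~ k1 :* (x :- :~ (:~ ((x :+ y) :+ z))))) refl

ring-177 = solve 3 (λ x y z → ((x :+ z) :- k0) ⊜ (:~ k1 :* (y :- :~ (:~ ((x :+ y) :+ z))))) refl

ring-178 = solve 3 (λ i j h → ((j :- i) :* h :- k0) ⊜ (:~ k1 :* (i :* h :- j :* h))) refl

ring-179 = solve 4 (λ a b e f → (a :* e :- (:~ b :* f)) ⊜ (k1 :* ((a :* e :+ b :* f) :- k0))) refl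

ring-180 = solve 4 (λ a b e f → (b :* f :- k0) ⊜ (k1 :* ((a :* e :+ b :* f) :- k0) :+ :~ k1 :* (a :* e :- k0))) refl

ring-181 = solve 2 (λ g u → ((g :- u) :- k0) ⊜ (k1 :* (g :- u))) refl

ring-182 = solve 11 (λ x y a b c n g e₁ e₂ h f → (g :- ((x :+ c :* n :* a) :* e₁ :+ (y :+ c :* n :* b) :* e₂)) ⊜ (k1 :* ((g :- (x :* e₁ :+ y :* e₂)) :- c :* h) :+ (:~ c :* (n :* f :- h) :+ (c :* n) :* (f :- (a :* e₁ :+ b :* e₂))))) refl

ring-183 = solve 2 (λ e f → (f) ⊜ (k0 :* e :+ k1 :* f)) refl

ring-184 = solve 2 (λ e f → (e :+ f) ⊜ (k1 :* e :+ k1 :* f)) refl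

ring-185 = solve 2 (λ e f → (e :+ f) ⊜ (k1 :* e :+ f)) refl

ring-186 = solve 1 (λ h → (k1 :* h :- k0) ⊜ (k1 :* (h :- k0))) refl

ring-187 = solve 5 (λ x y l e f → ((x :* e :+ f) :+ (y :* e :+ l :* f)) ⊜ ((x :+ y) :* e :+ (k1 :+ l) :* f)) refl

ring-188 = solve 2 (λ y x → (x :+ y) ⊜ (:~ k1 :* (:~ y :- x))) refl

ring-189 = solve 4 (λ s y x e → ((s :+ x :* e) :- k0) ⊜ (k1 :* (s :- y :* e) :+ k1 :* ((x :+ y) :* e :- k0))) refl

ring-190 = solve 8 (λ t i a b x l e f → ((t :+ i) :- (a :+ x) :* e) ⊜ (k1 :* (t :- (a :* e :+ b :* f)) :+ (k1 :* (i :- (x :* e :+ l :* f)) :+ k1 :* ((b :+ l) :* f :- k0)))) refl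

ring-191 = solve 4 (λ e s l c → (k1 :* e :- k0) ⊜ (:~ k1 :* (s :- e) :+ (k1 :* (s :- l :* c) :+ k1 :* (l :* c :- k0)))) refl

ring-192 = solve 7 (λ c t s x y e f → ((c :+ s) :- (x :- y) :* e) ⊜ (k1 :* (c :- (x :* e :+ f)) :+ (:~ k1 :* (t :- (y :* e :+ f)) :+ k1 :* ((t :+ s) :- k0)))) refl

ring-193 = solve 4 (λ c t s e → (c :- (t :+ e)) ⊜ (k1 :* ((c :+ s) :- e) :+ :~ k1 :* ((t :+ s) :- k0))) refl

ring-194 = solve 5 (λ s t a b e → ((s :+ t) :- (a :+ b) :* e) ⊜ (k1 :* (s :- a :* e) :+ k1 :* (t :- b :* e))) refl

ring-195 = solve 8 (λ v y a x b s e f → ((v :+ y) :- ((x :+ a) :* e :+ (b :+ s) :* f)) ⊜ (k1 :* (v :- (x :* e :+ b :* f)) :+ k1 :* (y :- (a :* e :+ s :* f)))) refl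

ring-196 = solve 6 (λ u e b x B L → ((b :* u :+ :~ x :* e) :+ (B :* u :+ :~ L :* e)) ⊜ ((b :+ B) :* u :+ :~ (x :+ L) :* e)) refl

ring-197 = solve 6 (λ u e f y b x → ((b :* u :+ :~ x :* e) :- ((b :* y :- x) :* e :+ b :* f)) ⊜ (b :* (u :- (y :* e :+ f)))) refl

ring-198 = solve 4 (λ x r a b → ((x :+ a) :- (r :+ b)) ⊜ (k1 :* (x :- r) :+ k1 :* (a :- b))) refl

ring-199 = solve 5 (λ q m n x h → ((q :* (m :* n)) :* x :- k0) ⊜ ((q :* m) :* (n :* x :- h) :+ q :* (m :* h :- k0))) refl

ring-200 = solve 2 (λ a b → (b :- k0) ⊜ (k1 :* ((a :+ b) :- k0) :+ :~ k1 :* (a :- k0))) refl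

ring-201 = solve 1 (λ x → (x :+ (:~ x :+ k0)) ⊜ (k0)) refl

ring-202 = solve 4 (λ x a b c → (((x :- k1) :* a :+ k1 :* b) :- k0) ⊜ (:~ k1 :* (c :- (x :* a :+ b)) :+ k1 :* (c :- a))) refl

ring-203 = solve 4 (λ x a b c → (x :* a :- k0) ⊜ (:~ k1 :* (c :- (x :* a :+ b)) :+ k1 :* (c :- b))) refl

ring-204 = solve 5 (λ p k a b c → (((p :* a :+ (p :* b :+ k :* c)) :+ (a :+ b)) :- k :* c) ⊜ (k1 :* ((k1 :+ p) :* a :- k0) :+ k1 :* ((k1 :+ p) :* b :- k0))) refl

ring-205 = solve 5 (λ n a b c h → (n :* a :- k0) ⊜ (k1 :* (n :* c :- h) :+ (:~ k1 :* (n :* b :- h) :+ :~ n :* (c :- (a :+ b))))) refl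

ring-206 = solve 4 (λ n a b h → (k1 :* h :- k0) ⊜ (:~ k1 :* (n :* a :- h) :+ (:~ k1 :* (n :* b :- h) :+ k1 :* (n :* (a :+ b) :- h)))) refl

ring-207 = solve 2 (λ j v → (v :+ j :* v) ⊜ ((k1 :+ j) :* v)) refl

ring-208 = solve 1 (λ y → ((k0 :+ (y :+ k1) :* k1) :- k1) ⊜ (y)) refl

ring-209 = solve 2 (λ a b → (k0 :* a :+ b) ⊜ (b)) refl

ring-210 = solve 2 (λ a b → (k1 :* a :+ b) ⊜ (a :+ b)) refl

ring-211 = solve 1 (λ a → ((k1 :+ a) :- k1) ⊜ (a)) refl

ring-212 = solve 2 (λ u x → (:~ u :* x :- k1) ⊜ (:~ (k1 :+ u :* x))) refl

ring-213 = solve 7 (λ a b c x e f g → ((a :* e :+ (b :* f :+ c :* g)) :- k0) ⊜ (k1 :* ((a :+ c :* x) :* e :- k0) :+ (k1 :* ((b :+ c) :* f :- k0) :+ c :* (g :- (x :* e :+ f))))) refl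

ring-214 = solve 5 (λ p q s t h → (p :- q) ⊜ (k1 :* (((p :+ s) :+ t) :- h) :+ :~ k1 :* (((q :+ s) :+ t) :- h))) refl

ring-215 = solve 6 (λ p q s t u h → (p :- q) ⊜ (k1 :* ((t :+ ((p :+ s) :+ u)) :- h) :+ :~ k1 :* ((t :+ ((q :+ s) :+ u)) :- h))) refl

ring-216 = solve 5 (λ p q s t h → (p :- q) ⊜ (k1 :* ((s :+ (t :+ (p :+ k0))) :- h) :+ :~ k1 :* ((s :+ (t :+ (q :+ k0))) :- h))) refl

ring-217 = solve 4 (λ x a b c → (b :- (k1 :* a :+ c)) ⊜ (:~ k1 :* (c :- (x :* a :+ b)) :+ :~ k1 :* ((k1 :+ x) :* a :- k0))) refl

ring-218 = solve 3 (λ a b c → (c :- (k1 :* b :+ a)) ⊜ (k1 :* (c :- (a :+ b)))) refl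

ring-219 = solve 3 (λ a b c → (a :- (k1 :* b :+ c)) ⊜ (:~ k1 :* (c :- (a :+ b)) :+ :~ k1 :* (k2 :* b :- k0))) refl

ring-220 = solve 2 (λ u v → (v :- u) ⊜ (:~ (k1) :* (u :- v))) refl

ring-221 = solve 3 (λ u v w → (u :- w) ⊜ (k1 :* (u :- v) :+ k1 :* (v :- w))) refl

ring-222 = solve 3 (λ z u v → (z :* u :- z :* v) ⊜ (z :* (u :- v))) refl

ring-223 = solve 4 (λ a b r h → (a :- b) ⊜ (k1 :* ((a :+ r) :- h) :+ :~ k1 :* ((b :+ r) :- h))) refl

ring-224 = solve 5 (λ a b l m c → (((a :- b) :* (l :- c) :+ (a :- b) :* m) :+ b :* m) ⊜ (a :* ((l :+ m) :- c) :- b :* (l :- c))) refl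

ring-225 = solve 4 (λ a b c d → ((a :- b) :- (c :- d)) ⊜ ((a :- c) :- (b :- d))) refl

ring-226 = solve 1 (λ x → (x :- k1 :* x) ⊜ (k0)) refl

ring-227 = solve 6 (λ a b s t x y → ((a :- b) :- (:~ t) :* y) ⊜ (k1 :* ((a :- s :* x) :+ s :* x) :+ (:~ k1) :* (b :- t :* y))) refl

ring-228 = solve 3 (λ n x q → (n :* (x :* q)) ⊜ (x :* (q :* n))) refl

ring-229 = solve 3 (λ m q n → (m :* (q :* n)) ⊜ (q :* (m :* n))) refl

ring-230 = solve 3 (λ y z n → (y :* n :- z :* n) ⊜ ((y :- z) :* n)) refl

ring-231 = solve 1 (λ u → (:~ u :- k0) ⊜ (:~ k1 :* (u :- k0))) refl

ring-232 = solve 3 (λ s a y → ((a :+ y) :- k0) ⊜ (k1 :* (:~ s :- :~ ((s :+ a) :+ y)))) refl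

ring-233 = solve 2 (λ x y → ((x :+ y) :- k0) ⊜ (k1 :* (x :- :~ (k0 :+ y)))) refl

ring-234 = solve 3 (λ r c h → (r :* h :- k0) ⊜ (k1 :* (c :* h :- k0) :+ :~ k1 :* ((c :- r) :* h :- k0))) refl

ring-235 = solve 3 (λ s a y → (a :+ y) ⊜ (:~ k1 :* (s :- ((s :+ a) :+ y)))) refl

ring-236 = solve 2 (λ x s → (k0 :- x) ⊜ ((s :- k0) :- (x :+ s))) refl

ring-237 = solve 2 (λ k s → (k0) ⊜ (k :* k0 :- k0 :* s)) refl

ring-238 = solve 5 (λ k x s t l → ((k :* x :- s) :+ (k :* t :- l :* s)) ⊜ (k :* (x :+ t) :- (k1 :+ l) :* s)) refl

ring-239 = solve 5 (λ r c q n g → (r :* g :- k0) ⊜ (k1 :* (c :* g :- k0) :+ :~ q :* (n :* g :- k0) :+ (q :* n :- (c :- r)) :* g)) refl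

ring-240 = solve 3 (λ a b g → (a :* g :- b :* g) ⊜ (k1 :* ((a :- b) :* g :- k0))) refl

ring-241 = solve 3 (λ q n g → ((q :* n) :* g) ⊜ (q :* (n :* g :- k0))) refl

ring-242 = solve 7 (λ a b x g e₁ e₂ f → (g :- ((a :- b :* x) :* e₁ :+ b :* f)) ⊜ (k1 :* (g :- (a :* e₁ :+ b :* e₂)) :+ :~ b :* (f :- (x :* e₁ :+ e₂)))) refl

ring-243 = solve 6 (λ a b x e₁ e₂ f → (((a :+ b :* x) :* e₁ :+ b :* e₂) :- k0) ⊜ (k1 :* ((a :* e₁ :+ b :* f) :- k0) :+ :~ b :* (f :- (x :* e₁ :+ e₂)))) refl

ring-244 = solve 3 (λ a b x → (a) ⊜ (k1 :* (a :+ b :* x) :+ :~ x :* b)) refl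

ring-245 = solve 3 (λ f e g → (f :- (k0 :* g :+ e)) ⊜ (k1 :* (f :- e))) refl

ring-246 = solve 5 (λ u e w s l → ((u :+ :~ w :* e) :+ (l :* u :+ :~ s :* e)) ⊜ ((k1 :+ l) :* u :+ :~ (w :+ s) :* e)) refl

ring-247 = solve 2 (λ a b → ((a :+ b) :- a) ⊜ (b)) refl

ring-248 = solve 4 (λ a b c d → ((a :- b) :+ (c :- d)) ⊜ ((a :+ c) :- (b :+ d))) refl

ring-249 = solve 3 (λ a b c → ((a :- b) :* c) ⊜ (a :* c :- b :* c)) refl

ring-250 = solve 3 (λ x y n → (x :* n :+ n :* y) ⊜ (n :* (x :+ y))) refl

ring-251 = solve 3 (λ a b c → (a :- b) ⊜ (k1 :* (a :- c) :+ :~ k1 :* (b :- c))) refl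

ring-252 = solve 2 (λ a b → (b :- a) ⊜ (:~ k1 :* (a :- b))) refl

ring-253 = solve 3 (λ a n b → ((a :- n) :- b) ⊜ (k1 :* (a :- b) :+ :~ k1 :* n)) refl

ring-254 = solve 1 (λ d → (k0) ⊜ (k0 :+ k0 :* d)) refl

ring-255 = solve 4 (λ w d s l → ((w :+ d) :+ (s :+ l :* d)) ⊜ ((w :+ s) :+ (k1 :+ l) :* d)) refl

ring-256 = solve 4 (λ x c l s → ((x :+ s) :- (k1 :+ l) :* c) ⊜ ((x :- c) :+ (s :- l :* c))) refl

ring-257 = solve 3 (λ a b c → ((a :+ b) :+ c) ⊜ ((a :+ c) :+ b)) refl

-- Identities, and certificates for congruences and inequalities.

opaque
  ringℕ-1 : ∀ p q c → suc (p ℕ.+ (q ℕ.+ c)) ℕ.+ suc c ≡ suc (p ℕ.+ c) ℕ.+ suc (q ℕ.+ c)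
  ringℕ-1 = ℕS.solve-∀

  ringℕ-2 : ∀ n → (n ℕ.+ n) ℕ.+ n ≡ 3 ℕ.* n
  ringℕ-2 = ℕS.solve-∀

  ringℕ-3 : ∀ p → (2 ℕ.+ p) ℕ.+ p ≡ (1 ℕ.+ p) ℕ.+ (1 ℕ.+ p)
  ringℕ-3 = ℕS.solve-∀

  ringℕ-4 : ∀ b s j → (b ℕ.+ s) ℕ.+ j ≡ s ℕ.+ (b ℕ.+ j)
  ringℕ-4 = ℕS.solve-∀

  ringℕ-5 : ∀ b s l i → (b ℕ.+ s) ℕ.+ (l ℕ.+ i) ≡ (b ℕ.+ l) ℕ.+ (s ℕ.+ i)
  ringℕ-5 = ℕS.solve-∀

  ringℕ-6 : ∀ n j → suc (suc (3 ℕ.* n)) ℕ.+ j ≡ n ℕ.+ (2 ℕ.* n ℕ.+ (2 ℕ.+ j))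
  ringℕ-6 = ℕS.solve-∀

  ringℕ-7 : ∀ n → 2 ℕ.+ ((1 ℕ.+ n) ℕ.+ (2 ℕ.+ n)) ≡ ((2 ℕ.+ n) ℕ.+ (2 ℕ.+ n)) ℕ.+ 1
  ringℕ-7 = ℕS.solve-∀

  ringℕ-8 : ∀ q → 2 ℕ.* suc q ≡ suc (q ℕ.+ (q ℕ.+ 1))
  ringℕ-8 = ℕS.solve-∀

  ringℕ-9 : ∀ q → 3 ℕ.* suc q ≡ suc (suc (q ℕ.+ (q ℕ.+ (q ℕ.+ 1))))
  ringℕ-9 = ℕS.solve-∀

  ringℕ-10 : ∀ n → n ℕ.+ n ℕ.+ n ≡ 3 ℕ.* n
  ringℕ-10 = ℕS.solve-∀

  ringℕ-11 : ∀ n′ → 3 ℕ.* (2 ℕ.+ n′) ≡ suc (2 ℕ.* (2 ℕ.+ n′) ℕ.+ suc n′)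
  ringℕ-11 = ℕS.solve-∀

  ringℕ-12 : ∀ n′ → suc (suc (n′ ℕ.+ 0 ℕ.+ (2 ℕ.+ n′))) ≡ 2 ℕ.* (2 ℕ.+ n′)
  ringℕ-12 = ℕS.solve-∀

  ringℕ-13 : ∀ n′ → 2 ℕ.* (2 ℕ.+ n′) ≡ suc (suc (n′ ℕ.+ 0 ℕ.+ (2 ℕ.+ n′)))
  ringℕ-13 = ℕS.solve-∀

  ringℕ-14 : ∀ q → 3 ℕ.* suc q ≡ 2 ℕ.+ suc (3 ℕ.* q)
  ringℕ-14 = ℕS.solve-∀

  ringℕ-15 : ∀ q → 2 ℕ.* suc q ≡ 2 ℕ.+ 2 ℕ.* q
  ringℕ-15 = ℕS.solve-∀

-- Identities between elements of ℤ × ℤ follow from one identity for both coordinates.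
both₁ : ∀ {F G : ℤ → ℤ} → (∀ a → F a ≡ G a) → ∀ t → (F (proj₁ t) , F (proj₂ t)) ≡ (G (proj₁ t) , G (proj₂ t))
both₁ r t = cong₂ _,_ (r (proj₁ t)) (r (proj₂ t))

both₂ : ∀ {F G : ℤ → ℤ → ℤ} → (∀ a b → F a b ≡ G a b) → ∀ t u → (F (proj₁ t) (proj₁ u) , F (proj₂ t) (proj₂ u)) ≡ (G (proj₁ t) (proj₁ u) , G (proj₂ t) (proj₂ u))
both₂ r t u = cong₂ _,_ (r (proj₁ t) (proj₁ u)) (r (proj₂ t) (proj₂ u))

both₃ : ∀ {F G : ℤ → ℤ → ℤ → ℤ} → (∀ a b c → F a b c ≡ G a b c) → ∀ t u v → (F (proj₁ t) (proj₁ u) (proj₁ v) , F (proj₂ t) (proj₂ u) (proj₂ v)) ≡ (G (proj₁ t) (proj₁ u) (proj₁ v) , G (proj₂ t) (proj₂ u) (proj₂ v))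
both₃ r t u v = cong₂ _,_ (r (proj₁ t) (proj₁ u) (proj₁ v)) (r (proj₂ t) (proj₂ u) (proj₂ v))

both₄ : ∀ {F G : ℤ → ℤ → ℤ → ℤ → ℤ} → (∀ a b c d → F a b c d ≡ G a b c d) → ∀ t u v w → (F (proj₁ t) (proj₁ u) (proj₁ v) (proj₁ w) , F (proj₂ t) (proj₂ u) (proj₂ v) (proj₂ w)) ≡ (G (proj₁ t) (proj₁ u) (proj₁ v) (proj₁ w) , G (proj₂ t) (proj₂ u) (proj₂ v) (proj₂ w))
both₄ r t u v w = cong₂ _,_ (r (proj₁ t) (proj₁ u) (proj₁ v) (proj₁ w)) (r (proj₂ t) (proj₂ u) (proj₂ v) (proj₂ w))

both₅ : ∀ {F G : ℤ → ℤ → ℤ → ℤ → ℤ → ℤ} → (∀ a b c d e → F a b c d e ≡ G a b c d e) → ∀ t u v w x → (F (proj₁ t) (proj₁ u) (proj₁ v) (proj₁ w) (proj₁ x) , F (proj₂ t) (proj₂ u) (proj₂ v) (proj₂ w) (proj₂ x)) ≡ (G (proj₁ t) (proj₁ u) (proj₁ v) (proj₁ w) (proj₁ x) , G (proj₂ t) (proj₂ u) (proj₂ v) (proj₂ w) (proj₂ x))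
both₅ r t u v w x = cong₂ _,_ (r (proj₁ t) (proj₁ u) (proj₁ v) (proj₁ w) (proj₁ x)) (r (proj₂ t) (proj₂ u) (proj₂ v) (proj₂ w) (proj₂ x))

both₆ : ∀ {F G : ℤ → ℤ → ℤ → ℤ → ℤ → ℤ → ℤ} → (∀ a b c d e f → F a b c d e f ≡ G a b c d e f) → ∀ t u v w x y → (F (proj₁ t) (proj₁ u) (proj₁ v) (proj₁ w) (proj₁ x) (proj₁ y) , F (proj₂ t) (proj₂ u) (proj₂ v) (proj₂ w) (proj₂ x) (proj₂ y)) ≡ (G (proj₁ t) (proj₁ u) (proj₁ v) (proj₁ w) (proj₁ x) (proj₁ y) , G (proj₂ t) (proj₂ u) (proj₂ v) (proj₂ w) (proj₂ x) (proj₂ y))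
both₆ r t u v w x y = cong₂ _,_ (r (proj₁ t) (proj₁ u) (proj₁ v) (proj₁ w) (proj₁ x) (proj₁ y)) (r (proj₂ t) (proj₂ u) (proj₂ v) (proj₂ w) (proj₂ x) (proj₂ y))

both₈ : ∀ {F G : ℤ → ℤ → ℤ → ℤ → ℤ → ℤ → ℤ → ℤ → ℤ} → (∀ a b c d e f g h → F a b c d e f g h ≡ G a b c d e f g h) → ∀ t u v w x y z p → (F (proj₁ t) (proj₁ u) (proj₁ v) (proj₁ w) (proj₁ x) (proj₁ y) (proj₁ z) (proj₁ p) , F (proj₂ t) (proj₂ u) (proj₂ v) (proj₂ w) (proj₂ x) (proj₂ y) (proj₂ z) (proj₂ p)) ≡ (G (proj₁ t) (proj₁ u) (proj₁ v) (proj₁ w) (proj₁ x) (proj₁ y) (proj₁ z) (proj₁ p) , G (proj₂ t) (proj₂ u) (proj₂ v) (proj₂ w) (proj₂ x) (proj₂ y) (proj₂ z) (proj₂ p))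
both₈ r t u v w x y z p = cong₂ _,_ (r (proj₁ t) (proj₁ u) (proj₁ v) (proj₁ w) (proj₁ x) (proj₁ y) (proj₁ z) (proj₁ p)) (r (proj₂ t) (proj₂ u) (proj₂ v) (proj₂ w) (proj₂ x) (proj₂ y) (proj₂ z) (proj₂ p))

both₉ : ∀ {F G : ℤ → ℤ → ℤ → ℤ → ℤ → ℤ → ℤ → ℤ → ℤ → ℤ} → (∀ a b c d e f g h i → F a b c d e f g h i ≡ G a b c d e f g h i) → ∀ t u v w x y z p q → (F (proj₁ t) (proj₁ u) (proj₁ v) (proj₁ w) (proj₁ x) (proj₁ y) (proj₁ z) (proj₁ p) (proj₁ q) , F (proj₂ t) (proj₂ u) (proj₂ v) (proj₂ w) (proj₂ x) (proj₂ y) (proj₂ z) (proj₂ p) (proj₂ q)) ≡ (G (proj₁ t) (proj₁ u) (proj₁ v) (proj₁ w) (proj₁ x) (proj₁ y) (proj₁ z) (proj₁ p) (proj₁ q) , G (proj₂ t) (proj₂ u) (proj₂ v) (proj₂ w) (proj₂ x) (proj₂ y) (proj₂ z) (proj₂ p) (proj₂ q))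
both₉ r t u v w x y z p q = cong₂ _,_ (r (proj₁ t) (proj₁ u) (proj₁ v) (proj₁ w) (proj₁ x) (proj₁ y) (proj₁ z) (proj₁ p) (proj₁ q)) (r (proj₂ t) (proj₂ u) (proj₂ v) (proj₂ w) (proj₂ x) (proj₂ y) (proj₂ z) (proj₂ p) (proj₂ q))

-- Signed divisibility keeps the integer quotient, which later serves as a coefficient; the
-- divisibility of the statement compares absolute values.
D : ℕ → ℤ → Set
D d z = (+ d) Sg.∣ z

opaque
  -- A certificate: the new multiple of d is an explicit integer combination of known ones, and the
  -- combination is checked by the ring solver.
  D-comb₁ : ∀ {d u a} z → u ≡ z * a → D d a → D d u
  D-comb₁ z refl p = Sg.∣n⇒∣m*n z p

  D-comb₂ : ∀ {d u a b} z w → u ≡ z * a + w * b → D d a → D d b → D d u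
  D-comb₂ z w refl p q = Sg.∣m∣n⇒∣m+n (Sg.∣n⇒∣m*n z p) (Sg.∣n⇒∣m*n w q)

  residue : ∀ n .{{_ : ℕ.NonZero n}} x → ∃[ r ] r < n × D n (x - + r)
  residue n x = x ℤ.%ℕ n , ℤ.n%ℕd<d x n , divides (x ℤ./ℕ n)
    (trans (cong (ℤ._- + (x ℤ.%ℕ n)) (ℤ.a≡a%ℕn+[a/ℕn]*n x n)) (ring-247 (+ (x ℤ.%ℕ n)) (x ℤ./ℕ n * + n)))

  0≤-+ : ∀ {a b} → + 0 ℤ.≤ a → + 0 ℤ.≤ b → + 0 ℤ.≤ a + b
  0≤-+ {+ a} {+ b} _ _ = ℤ.+≤+ z≤n

  -- Inequalities are certified in the same spirit: b - a is written as a sum of differences already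
  -- known to be nonnegative, which replaces chains of monotonicity steps.
  ≤-cert₁ : ∀ {a b a₁ b₁} → b - a ≡ b₁ - a₁ → a₁ ℤ.≤ b₁ → a ℤ.≤ b
  ≤-cert₁ e p = ℤ.0≤i-j⇒j≤i (subst (+ 0 ℤ.≤_) (sym e) (ℤ.i≤j⇒0≤j-i p))

  ≤-cert₂ : ∀ {a b a₁ b₁ a₂ b₂} → b - a ≡ (b₁ - a₁) + (b₂ - a₂) →
    a₁ ℤ.≤ b₁ → a₂ ℤ.≤ b₂ → a ℤ.≤ b
  ≤-cert₂ e p q = ℤ.0≤i-j⇒j≤i (subst (+ 0 ℤ.≤_) (sym e) (0≤-+ (ℤ.i≤j⇒0≤j-i p) (ℤ.i≤j⇒0≤j-i q)))

  ≤-cert₃ : ∀ {a b a₁ b₁ a₂ b₂ a₃ b₃} → b - a ≡ (b₁ - a₁) + ((b₂ - a₂) + (b₃ - a₃)) →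
    a₁ ℤ.≤ b₁ → a₂ ℤ.≤ b₂ → a₃ ℤ.≤ b₃ → a ℤ.≤ b
  ≤-cert₃ e p q r = ℤ.0≤i-j⇒j≤i (subst (+ 0 ℤ.≤_) (sym e) (0≤-+ (ℤ.i≤j⇒0≤j-i p) (0≤-+ (ℤ.i≤j⇒0≤j-i q) (ℤ.i≤j⇒0≤j-i r))))

  ≤-cert₄ : ∀ {a b a₁ b₁ a₂ b₂ a₃ b₃ a₄ b₄} →
    b - a ≡ (b₁ - a₁) + ((b₂ - a₂) + ((b₃ - a₃) + (b₄ - a₄))) →
    a₁ ℤ.≤ b₁ → a₂ ℤ.≤ b₂ → a₃ ℤ.≤ b₃ → a₄ ℤ.≤ b₄ → a ℤ.≤ b
  ≤-cert₄ e p q r s = ℤ.0≤i-j⇒j≤i (subst (+ 0 ℤ.≤_) (sym e)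
    (0≤-+ (ℤ.i≤j⇒0≤j-i p) (0≤-+ (ℤ.i≤j⇒0≤j-i q) (0≤-+ (ℤ.i≤j⇒0≤j-i r) (ℤ.i≤j⇒0≤j-i s)))))

opaque
  ⊕-comm : ∀ u v → u ⊕ v ≡ v ⊕ u
  ⊕-comm u v = cong₂ _,_ (ℤ.+-comm (proj₁ u) (proj₁ v)) (ℤ.+-comm (proj₂ u) (proj₂ v))

  ⊕-identityʳ : ∀ u → u ⊕ 0G ≡ u
  ⊕-identityʳ u = cong₂ _,_ (ℤ.+-identityʳ (proj₁ u)) (ℤ.+-identityʳ (proj₂ u))

  σ-++ : ∀ xs ys → σ (xs ++ ys) ≡ σ xs ⊕ σ ys
  σ-++ [] ys = cong₂ _,_ (sym (ℤ.+-identityˡ _)) (sym (ℤ.+-identityˡ _))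
  σ-++ (x ∷ xs) ys rewrite σ-++ xs ys = cong₂ _,_ (sym (ℤ.+-assoc (proj₁ x) _ _)) (sym (ℤ.+-assoc (proj₂ x) _ _))

  σ-replicate : ∀ k e → σ (replicate k e) ≡ (+ k) · e
  σ-replicate zero e = refl
  σ-replicate (suc k) e rewrite σ-replicate k e = both₁ (ring-207 (+ k)) e

-- Permutations and sublists.

module _ {A : Set} where

  opaque
    ∈⇒↭ : ∀ {x : A} {xs} → x ∈ xs → ∃[ ys ] xs ↭ x ∷ ys
    ∈⇒↭ {xs = x ∷ xs} (here refl) = xs , Prop.refl
    ∈⇒↭ {xs = y ∷ xs} (there p) with ∈⇒↭ p
    ... | ys , q = y ∷ ys , Prop.trans (Prop.prep y q) (Prop.swap y _ Prop.refl)

    ∈∈⇒↭ : ∀ {x y : A} {xs} → x ∈ xs → y ∈ xs → x ≡ y ⊎ ∃[ zs ] xs ↭ x ∷ y ∷ zs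
    ∈∈⇒↭ (here refl) (here refl) = inj₁ refl
    ∈∈⇒↭ (here refl) (there q) with ∈⇒↭ q
    ... | zs , r = inj₂ (zs , Prop.prep _ r)
    ∈∈⇒↭ (there p) (here refl) with ∈⇒↭ p
    ... | zs , r = inj₂ (zs , Prop.trans (Prop.prep _ r) (Prop.swap _ _ Prop.refl))
    ∈∈⇒↭ {xs = z ∷ _} (there p) (there q) with ∈∈⇒↭ p q
    ... | inj₁ e = inj₁ e
    ... | inj₂ (zs , r) = inj₂ (z ∷ zs , Prop.trans (Prop.prep z r)
            (Prop.trans (Prop.swap z _ Prop.refl) (Prop.prep _ (Prop.swap z _ Prop.refl))))

    ⊆⇒↭ : ∀ {xs ys : List A} → xs ⊆ ys → ∃[ zs ] ys ↭ xs ++ zs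
    ⊆⇒↭ [] = [] , Prop.refl
    ⊆⇒↭ {xs} (y ∷ʳ p) with ⊆⇒↭ p
    ... | zs , q = y ∷ zs , Prop.trans (Prop.prep y q) (Prop.↭-sym (Prop.shift y xs zs))
    ⊆⇒↭ (refl ∷ p) with ⊆⇒↭ p
    ... | zs , q = zs , Prop.prep _ q

    ++-⊆ : ∀ (xs ys : List A) → xs ⊆ xs ++ ys
    ++-⊆ [] [] = []
    ++-⊆ [] (y ∷ ys) = y ∷ʳ ++-⊆ [] ys
    ++-⊆ (x ∷ xs) ys = refl ∷ ++-⊆ xs ys

    -- A permutation up to R mixes reorderings with replacements by related elements. Moving all
    -- replacements to the end leaves a genuine permutation, so the actual terms of a sequence can
    -- be sorted by the terms of the normal form they are related to.
    Permutation-pull : ∀ {R : A → A → Set} {xs ys} → (∀ {x y z} → R x y → R y z → R x z) → Permutation R xs ys → ∃[ zs ] xs ↭ zs × Pointwise R zs ys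
    Permutation-pull tr (Perm.refl p) = _ , Prop.refl , p
    Permutation-pull tr (Perm.prep e p) with Permutation-pull tr p
    ... | zs , q , r = _ , Prop.prep _ q , e ∷ r
    Permutation-pull tr (Perm.swap e f p) with Permutation-pull tr p
    ... | zs , q , r = _ , Prop.swap _ _ q , f ∷ e ∷ r
    Permutation-pull tr (Perm.trans p q) with Permutation-pull tr p | Permutation-pull tr q
    ... | zs , a , b | ws , c , d with Pointwise-↭ b c
      where
      Pointwise-↭ : ∀ {R : A → A → Set} {xs ys zs} → Pointwise R xs ys → ys ↭ zs → ∃[ ws ] xs ↭ ws × Pointwise R ws zs
      Pointwise-↭ p Prop.refl = _ , Prop.refl , p
      Pointwise-↭ (e ∷ p) (Prop.prep x q) with Pointwise-↭ p q
      ... | _ , a , b = _ , Prop.prep _ a , e ∷ b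
      Pointwise-↭ (e ∷ f ∷ p) (Prop.swap x y q) with Pointwise-↭ p q
      ... | _ , a , b = _ , Prop.swap _ _ a , f ∷ e ∷ b
      Pointwise-↭ p (Prop.trans q r) with Pointwise-↭ p q
      ... | _ , a , b with Pointwise-↭ b r
      ... | _ , c , d = _ , Prop.trans a c , d
    ... | _ , x , y = _ , Prop.trans a x , PW.transitive tr y d

-- The group and multisets over it.

module Grp (n m : ℕ) where

  infix 4 _≈_
  -- `Eq` computes to a pair of divisibilities from which `u` and `v` cannot be inferred; the record
  -- keeps them visible.
  record _≈_ (u v : Elt) : Set where
    constructor mk
    field un : Eq n m u v
  open _≈_ public

  N : Elt → Set
  N (a , b) = D n a × D (m ℕ.* n) b

  opaque
    toN : ∀ {u v} → u ≈ v → N (u ⊕ ⊖ v)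
    toN (mk (p , q)) = Sg.∣ᵤ⇒∣ p , Sg.∣ᵤ⇒∣ q

    fromN : ∀ {u v} → N (u ⊕ ⊖ v) → u ≈ v
    fromN (p , q) = mk (Sg.∣⇒∣ᵤ p , Sg.∣⇒∣ᵤ q)

    N-+ : ∀ {u v} → N u → N v → N (u ⊕ v)
    N-+ (p , q) (r , s) = Sg.∣m∣n⇒∣m+n p r , Sg.∣m∣n⇒∣m+n q s

    N-· : ∀ z {u} → N u → N (z · u)
    N-· z (p , q) = Sg.∣n⇒∣m*n z p , Sg.∣n⇒∣m*n z q

    -- The certificates of `D-comb₁` in both coordinates at once.
    comb₁ : ∀ {u v a b} z → u ⊕ ⊖ v ≡ z · (a ⊕ ⊖ b) → a ≈ b → u ≈ v
    comb₁ z e p = fromN (subst N (sym e) (N-· z (toN p)))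

    comb₂ : ∀ {u v a b c d} z w → u ⊕ ⊖ v ≡ z · (a ⊕ ⊖ b) ⊕ w · (c ⊕ ⊖ d) → a ≈ b → c ≈ d → u ≈ v
    comb₂ z w e p q = fromN (subst N (sym e) (N-+ (N-· z (toN p)) (N-· w (toN q))))

    comb₃ : ∀ {u v a b c d e f} z w y →
      u ⊕ ⊖ v ≡ z · (a ⊕ ⊖ b) ⊕ (w · (c ⊕ ⊖ d) ⊕ y · (e ⊕ ⊖ f)) → a ≈ b → c ≈ d → e ≈ f → u ≈ v
    comb₃ z w y e p q r = fromN (subst N (sym e) (N-+ (N-· z (toN p)) (N-+ (N-· w (toN q)) (N-· y (toN r)))))

    ≈-reflexive : ∀ {u v} → u ≡ v → u ≈ v
    ≈-reflexive {u} refl = fromN (divides (+ 0) (ℤ.+-inverseʳ (proj₁ u)) , divides (+ 0) (ℤ.+-inverseʳ (proj₂ u)))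

    ≈-refl : ∀ {u} → u ≈ u
    ≈-refl = ≈-reflexive refl

    ≈-sym : ∀ {u v} → u ≈ v → v ≈ u
    ≈-sym {u} {v} = comb₁ (- (+ 1)) (both₂ ring-220 u v)

    ≈-trans : ∀ {u v w} → u ≈ v → v ≈ w → u ≈ w
    ≈-trans {u} {v} {w} = comb₂ (+ 1) (+ 1)
      (both₃ ring-221 u v w)

    ⊕-cong : ∀ {u v a b} → u ≈ v → a ≈ b → u ⊕ a ≈ v ⊕ b
    ⊕-cong {u} {v} {a} {b} = comb₂ (+ 1) (+ 1)
      (both₄ ring-198 u v a b)

    ·-cong : ∀ z {u v} → u ≈ v → z · u ≈ z · v
    ·-cong z {u} {v} = comb₁ z (both₂ (ring-222 z) u v)

    cancelʳ : ∀ {a b r h} → a ⊕ r ≈ h → b ⊕ r ≈ h → a ≈ b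
    cancelʳ {a} {b} {r} {h} = comb₂ (+ 1) (- + 1)
      (both₄ ring-223 a b r h)

  _≈?_ : ∀ u v → Dec (u ≈ v)
  u ≈? v = Dec.map′ mk un ((_ ℕ.∣? _) Dec.×-dec (_ ℕ.∣? _))

  setoid : Setoid _ _
  setoid = record { Carrier = Elt ; _≈_ = _≈_
    ; isEquivalence = record { refl = ≈-refl ; sym = ≈-sym ; trans = ≈-trans } }

  open PermS setoid public using () renaming
    (_↭_ to _≋_; ↭-refl to ≋-refl; ↭-sym to ≋-sym; ↭-trans to ≋-trans; ↭-reflexive to ≋-reflexive; ↭-prep to ≋-prep)
  open PermSP setoid public using (++⁺; ++⁺ˡ; ++⁺ʳ; ++-comm; ++-assoc; ++-identityʳ; shifts; ↭-shift) renaming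
    (xs↭ys⇒|xs|≡|ys| to ≋-length; All-resp-↭ to All-resp-≋; dropMiddle to ≋-dropMiddle)

  toSeqEq : ∀ {xs ys} → xs ≋ ys → SeqEq n m xs ys
  toSeqEq = Perm.map un

  fromSeqEq : ∀ {xs ys} → SeqEq n m xs ys → xs ≋ ys
  fromSeqEq = Perm.map mk

  opaque
    ↭⇒≋ : ∀ {xs ys} → xs ↭ ys → xs ≋ ys
    ↭⇒≋ Prop.refl = ≋-refl
    ↭⇒≋ (Prop.prep x p) = ≋-prep x (↭⇒≋ p)
    ↭⇒≋ (Prop.swap x y p) = Perm.swap ≈-refl ≈-refl (↭⇒≋ p)
    ↭⇒≋ (Prop.trans p q) = ≋-trans (↭⇒≋ p) (↭⇒≋ q)

    σ-resp : ∀ {xs ys} → xs ≋ ys → σ xs ≈ σ ys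
    σ-resp (Perm.refl p) = go p
      where
      go : ∀ {xs ys} → Pointwise _≈_ xs ys → σ xs ≈ σ ys
      go [] = ≈-refl
      go (e ∷ p) = ⊕-cong e (go p)
    σ-resp (Perm.prep e p) = ⊕-cong e (σ-resp p)
    σ-resp (Perm.swap {xs} {ys} {x} {y} {x′} {y′} e f p) =
      ≈-trans (⊕-cong e (⊕-cong f (σ-resp p))) (≈-reflexive (cong₂ _,_ (ring-131 (proj₁ x′) (proj₁ y′) _) (ring-131 (proj₂ x′) (proj₂ y′) _)))
    σ-resp (Perm.trans p q) = ≈-trans (σ-resp p) (σ-resp q)

    interchange : ∀ a b c d → (a ++ b) ++ (c ++ d) ≋ (a ++ c) ++ (b ++ d)
    interchange a b c d = ≋-trans (≋-reflexive (List.++-assoc a b (c ++ d)))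
      (≋-trans (++⁺ˡ a (shifts b c)) (≋-reflexive (sym (List.++-assoc a c (b ++ d)))))

  -- Submultisets given by their complement. Unlike `⊆` this is stable under reordering on both
  -- sides, and it hands over the remaining terms.
  Sub : List Elt → List Elt → Set
  Sub z w = ∃[ z′ ] w ≋ z ++ z′

  opaque
    sub-refl : ∀ {w} → Sub w w
    sub-refl = [] , ≋-sym (++-identityʳ _)

    sub-respʳ : ∀ {z w v} → w ≋ v → Sub z w → Sub z v
    sub-respʳ p (_ , q) = _ , ≋-trans (≋-sym p) q

    sub-respˡ : ∀ {z y w} → z ≋ y → Sub z w → Sub y w
    sub-respˡ p (r , q) = r , ≋-trans q (++⁺ʳ r p)

    sub-≋ : ∀ {z w} → z ≋ w → Sub z w
    sub-≋ p = sub-respʳ p sub-refl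

    sub-++ : ∀ {z w y v} → Sub z w → Sub y v → Sub (z ++ y) (w ++ v)
    sub-++ {z} {w} {y} {v} (a , p) (b , q) = a ++ b , ≋-trans (++⁺ p q) (interchange z a y b)

    sub-∷ : ∀ x {z w} → Sub z w → Sub (x ∷ z) (x ∷ w)
    sub-∷ x (a , p) = a , ≋-prep x p

    sub-++ʳ : ∀ v {z w} → Sub z w → Sub z (v ++ w)
    sub-++ʳ v {z} (a , p) = v ++ a , ≋-trans (++⁺ˡ v p) (shifts v z)

    sub-++ˡ : ∀ v {z w} → Sub z w → Sub z (w ++ v)
    sub-++ˡ v {z} (a , p) = a ++ v , ≋-trans (++⁺ʳ v p) (≋-reflexive (List.++-assoc z a v))

    sub-trans : ∀ {x y z} → Sub x y → Sub y z → Sub x z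
    sub-trans {x} (a , p) (b , q) = a ++ b , ≋-trans q (≋-trans (++⁺ʳ b p) (≋-reflexive (List.++-assoc x a b)))

    sub-take : ∀ k w → Sub (take k w) w
    sub-take k w = drop k w , ≋-reflexive (sym (List.take++drop≡id k w))

    replicate-+ : ∀ a b (e : Elt) → replicate (a ℕ.+ b) e ≡ replicate a e ++ replicate b e
    replicate-+ zero b e = refl
    replicate-+ (suc a) b e = cong (e ∷_) (replicate-+ a b e)

    sub-replicate : ∀ {a b} e → a ≤ b → Sub (replicate a e) (replicate b e)
    sub-replicate {a} {b} e p = replicate (b ∸ a) e ,
      ≋-reflexive (trans (cong (λ k → replicate k e) (sym (m+[n∸m]≡n p))) (replicate-+ a (b ∸ a) e))

    sub-length : ∀ {z w} → Sub z w → length z ≤ length w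
    sub-length {z} (a , p) = ≤-trans (m≤m+n _ _)
      (≤-reflexive (trans (sym (List.length-++ z)) (sym (≋-length p))))

    ∈⇒≋ : ∀ {x xs} → x ∈ xs → ∃[ ys ] xs ≋ x ∷ ys
    ∈⇒≋ p = proj₁ (∈⇒↭ p) , ↭⇒≋ (proj₂ (∈⇒↭ p))

    -- The zero-sum hypothesis concerns literal sublists of S; this carries a sublist of a
    -- rearranged sequence back to one of the original.
    ⊆-resp-≋ : ∀ {xs ys zs} → xs ≋ ys → zs ⊆ ys → ∃[ ws ] ws ⊆ xs × ws ≋ zs
    ⊆-resp-≋ (Perm.refl p) q = go p q
      where
      go : ∀ {xs ys zs} → Pointwise _≈_ xs ys → zs ⊆ ys → ∃[ ws ] ws ⊆ xs × ws ≋ zs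
      go [] [] = [] , [] , ≋-refl
      go (e ∷ p) (y ∷ʳ q) with go p q
      ... | ws , a , b = ws , _ ∷ʳ a , b
      go (e ∷ p) (refl ∷ q) with go p q
      ... | ws , a , b = _ , refl ∷ a , Perm.prep e b
    ⊆-resp-≋ (Perm.prep e p) (y ∷ʳ q) with ⊆-resp-≋ p q
    ... | ws , a , b = ws , _ ∷ʳ a , b
    ⊆-resp-≋ (Perm.prep e p) (refl ∷ q) with ⊆-resp-≋ p q
    ... | ws , a , b = _ , refl ∷ a , Perm.prep e b
    ⊆-resp-≋ (Perm.swap e f p) (y ∷ʳ (x ∷ʳ q)) with ⊆-resp-≋ p q
    ... | ws , a , b = ws , _ ∷ʳ (_ ∷ʳ a) , b
    ⊆-resp-≋ (Perm.swap e f p) (y ∷ʳ (refl ∷ q)) with ⊆-resp-≋ p q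
    ... | ws , a , b = _ , refl ∷ (_ ∷ʳ a) , Perm.prep e b
    ⊆-resp-≋ (Perm.swap e f p) (refl ∷ (x ∷ʳ q)) with ⊆-resp-≋ p q
    ... | ws , a , b = _ , _ ∷ʳ (refl ∷ a) , Perm.prep f b
    ⊆-resp-≋ (Perm.swap e f p) (refl ∷ (refl ∷ q)) with ⊆-resp-≋ p q
    ... | ws , a , b = _ , refl ∷ (refl ∷ a) , Perm.swap e f b
    ⊆-resp-≋ (Perm.trans p q) r with ⊆-resp-≋ q r
    ... | ws , a , b with ⊆-resp-≋ p a
    ... | vs , c , d = vs , c , ≋-trans d b

  ZeroFree : ℕ → List Elt → Set
  ZeroFree ℓ s = ∀ z → Sub z s → 1 ≤ length z → length z ≤ ℓ → ¬ σ z ≈ 0G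

  opaque
    fromZeroNotIn : ∀ {ℓ s} → ZeroNotInΣ≤ n m ℓ s → ZeroFree ℓ s
    fromZeroNotIn nz z (z′ , p) l₁ l₂ e with ⊆-resp-≋ p (++-⊆ z z′)
    ... | t , q , r = nz t q (subst (1 ≤_) (sym (≋-length r)) l₁) (subst (_≤ _) (sym (≋-length r)) l₂)
      (un (≈-trans (σ-resp r) e))

    toZeroNotIn : ∀ {ℓ s} → ZeroFree ℓ s → ZeroNotInΣ≤ n m ℓ s
    toZeroNotIn nz t q l₁ l₂ e = nz t (proj₁ (⊆⇒↭ q) , ↭⇒≋ (proj₂ (⊆⇒↭ q))) l₁ l₂ (mk e)

-- Finite differences and the polynomial method.

module Poly {V : Set} (_∔_ : V → V → V) where

  -- Deg d F says that F has degree < d.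
  Deg : ℕ → (V → ℤ) → Set
  Deg zero F = ∀ v → F v ≡ + 0
  Deg (suc d) F = ∀ u → Deg d (λ v → F (v ∔ u) - F v)

  Deg-ext : ∀ d F G → (∀ v → F v ≡ G v) → Deg d F → Deg d G
  Deg-ext zero F G e p v = trans (sym (e v)) (p v)
  Deg-ext (suc d) F G e p u = Deg-ext d (λ v → F (v ∔ u) - F v) (λ v → G (v ∔ u) - G v) (λ v → cong₂ ℤ._-_ (e (v ∔ u)) (e v)) (p u)

  Deg-suc : ∀ d F → Deg d F → Deg (suc d) F
  Deg-suc zero F p u v rewrite p (v ∔ u) | p v = refl
  Deg-suc (suc d) F p u = Deg-suc d (λ v → F (v ∔ u) - F v) (p u)

  Deg-+ : ∀ d F G → Deg d F → Deg d G → Deg d (λ v → F v + G v)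
  Deg-+ zero F G p q v rewrite p v | q v = refl
  Deg-+ (suc d) F G p q u = Deg-ext d (λ v → (F (v ∔ u) - F v) + (G (v ∔ u) - G v)) (λ v → (F (v ∔ u) + G (v ∔ u)) - (F v + G v)) (λ v → ring-248 (F (v ∔ u)) (F v) (G (v ∔ u)) (G v)) (Deg-+ d (λ v → F (v ∔ u) - F v) (λ v → G (v ∔ u) - G v) (p u) (q u))

  Deg-*c : ∀ d c F → Deg d F → Deg d (λ v → F v * c)
  Deg-*c zero c F p v rewrite p v = refl
  Deg-*c (suc d) c F p u = Deg-ext d (λ v → (F (v ∔ u) - F v) * c) (λ v → F (v ∔ u) * c - F v * c) (λ v → ring-249 (F (v ∔ u)) (F v) c) (Deg-*c d c (λ v → F (v ∔ u) - F v) (p u))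

  module _ (ℓ : V → ℤ) (ℓ-+ : ∀ u v → ℓ (u ∔ v) ≡ ℓ u + ℓ v) where

    -- Discrete product rule: the difference of F·(ℓ - c) in direction u is ΔF·(ℓ - c) + ΔF·ℓ(u) +
    -- F·ℓ(u), and each summand obeys the bound by induction.
    Deg-*ℓ : ∀ d c F → Deg d F → Deg (suc d) (λ v → F v * (ℓ v - c))
    Deg-*ℓ zero c F p u v rewrite p (v ∔ u) | p v = refl
    Deg-*ℓ (suc d) c F p u = Deg-ext (suc d)
      (λ v → (ΔF v * (ℓ v - c) + ΔF v * ℓ u) + F v * ℓ u) (λ v → F (v ∔ u) * (ℓ (v ∔ u) - c) - F v * (ℓ v - c)) (λ v → trans
        (ring-224 (F (v ∔ u)) (F v) (ℓ v) (ℓ u) c)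
        (cong (λ z → F (v ∔ u) * (z - c) - F v * (ℓ v - c)) (sym (ℓ-+ v u))))
      (Deg-+ (suc d) (λ v → ΔF v * (ℓ v - c) + ΔF v * ℓ u) (λ v → F v * ℓ u)
        (Deg-+ (suc d) (λ v → ΔF v * (ℓ v - c)) (λ v → ΔF v * ℓ u) (Deg-*ℓ d c ΔF (p u)) (Deg-suc d (λ v → ΔF v * ℓ u) (Deg-*c d (ℓ u) ΔF (p u)))) (Deg-*c (suc d) (ℓ u) F p))
      where
      ΔF : V → ℤ
      ΔF v = F (v ∔ u) - F v

    -- F times the product of ℓ - j over 1 ≤ j ≤ k. For k = p - 1 it vanishes modulo p wherever p
    -- does not divide ℓ, while at a zero of ℓ the new factor is ±k!, which is prime to p.
    punctured : ℕ → (V → ℤ) → V → ℤ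
    punctured zero F v = F v
    punctured (suc k) F v = punctured k F v * (ℓ v - + suc k)

    Deg-punctured : ∀ k d F → Deg d F → Deg (k ℕ.+ d) (punctured k F)
    Deg-punctured zero d F p = p
    Deg-punctured (suc k) d F p = Deg-*ℓ (k ℕ.+ d) (+ suc k) (punctured k F) (Deg-punctured k d F p)

    module _ {p : ℕ} where
      punctured-base : ∀ k F v → D p (F v) → D p (punctured k F v)
      punctured-base zero F v q = q
      punctured-base (suc k) F v q = Sg.∣m⇒∣m*n (ℓ v - + suc k) (punctured-base k F v q)

      punctured-vanish : ∀ k F v j → 1 ≤ j → j ≤ k → D p (ℓ v - + j) → D p (punctured k F v)
      punctured-vanish zero F v j 1≤j j≤0 q = ⊥-elim (<⇒≱ 1≤j j≤0)
      punctured-vanish (suc k) F v j 1≤j j≤k q with j ℕ.≟ suc k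
      ... | yes refl = Sg.∣n⇒∣m*n (punctured k F v) q
      ... | no ne = Sg.∣m⇒∣m*n (ℓ v - + suc k) (punctured-vanish k F v j 1≤j (≤-pred (≤∧≢⇒< j≤k ne)) q)

      punctured-survive : Prime p → ∀ k F v → k < p → ℓ v ≡ + 0 → ¬ D p (F v) → ¬ D p (punctured k F v)
      punctured-survive pp zero F v k<p e q = q
      punctured-survive pp (suc k) F v k<p e q d with euclidsLemma ℤ.∣ punctured k F v ∣ ℤ.∣ ℓ v - + suc k ∣ pp
        (subst (p ℕ.∣_) (ℤ.abs-* (punctured k F v) (ℓ v - + suc k)) (Sg.∣⇒∣ᵤ d))
      ... | inj₁ x = punctured-survive pp k F v (<-trans (n<1+n k) k<p) e q (Sg.∣ᵤ⇒∣ x)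
      ... | inj₂ y rewrite e = <⇒≱ k<p (ℕ.∣⇒≤ y)

  -- The iterated difference of F in the directions `us`: the alternating sum of F over v plus all
  -- subset sums of `us`.
  alt : (V → ℤ) → List V → V → ℤ
  alt F [] v = F v
  alt F (u ∷ us) v = alt F us (v ∔ u) - alt F us v

  alt-cong : ∀ {F G : V → ℤ} us v → (∀ v → F v ≡ G v) → alt F us v ≡ alt G us v
  alt-cong [] v e = e v
  alt-cong (u ∷ us) v e = cong₂ ℤ._-_ (alt-cong us (v ∔ u) e) (alt-cong us v e)

  module _ (∔-swap : ∀ v u w → (v ∔ u) ∔ w ≡ (v ∔ w) ∔ u) where

    alt-Δ : ∀ F u us v → alt F us (v ∔ u) - alt F us v ≡ alt (λ v → F (v ∔ u) - F v) us v
    alt-Δ F u [] v = refl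
    alt-Δ F u (w ∷ us) v = trans (ring-225 (alt F us ((v ∔ u) ∔ w)) (alt F us (v ∔ u)) (alt F us (v ∔ w)) (alt F us v)) (cong₂ ℤ._-_
       (trans (cong (λ z → alt F us z - alt F us (v ∔ w)) (∔-swap v u w)) (alt-Δ F u us (v ∔ w))) (alt-Δ F u us v))

    -- Differences in distinct directions commute, so each direction lowers the degree by one.
    alt-zero : ∀ us {F} → Deg (length us) F → ∀ v → alt F us v ≡ + 0
    alt-zero [] p v = p v
    alt-zero (u ∷ us) {F} p v = trans (alt-Δ F u us v) (alt-zero us {λ v → F (v ∔ u) - F v} (p u) v)

  module _ {A : Set} (f : A → V) (p : ℕ) (F : V → ℤ) where

    sumFrom : V → List A → V
    sumFrom v [] = v
    sumFrom v (a ∷ as) = sumFrom (v ∔ f a) as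

    Found : V → List A → Set
    Found v as = ∃[ z ] ∃[ z′ ] as ↭ z ++ z′ × 1 ≤ length z × ¬ D p (F (sumFrom v z))

    -- Unless some nonempty subsum is a non-zero of F mod p, only the empty subsum contributes to the alternating sum.
    search : ∀ as v → Found v as ⊎ ∃[ s ] (s ≡ + 1 ⊎ s ≡ - + 1) × D p (alt F (map f as) v - s * F v)
    search [] v = inj₂ (+ 1 , inj₁ refl , divides (+ 0) (ring-226 (F v)))
    search (a ∷ as) v with (+ p) Sg.∣? F (v ∔ f a)
    ... | no q = inj₁ (a ∷ [] , as , Prop.refl , s≤s z≤n , q)
    ... | yes q with search as (v ∔ f a)
    ... | inj₁ (z , z′ , x , y , w) = inj₁ (a ∷ z , z′ , Prop.prep a x , s≤s z≤n , w)
    ... | inj₂ (s , _ , d) with search as v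
    ... | inj₁ (z , z′ , x , y , w) = inj₁ (z , a ∷ z′ , Prop.trans (Prop.prep a x) (Prop.↭-sym (Prop.shift a z z′)) , y , w)
    ... | inj₂ (t , t± , d′) = inj₂ (- t , neg t± ,
        D-comb₂ (+ 1) (- + 1) (ring-227 (alt F (map f as) (v ∔ f a)) (alt F (map f as) v) s t (F (v ∔ f a)) (F v))
          (Sg.∣m∣n⇒∣m+n d (Sg.∣n⇒∣m*n s q)) d′)
      where
      neg : t ≡ + 1 ⊎ t ≡ - + 1 → - t ≡ + 1 ⊎ - t ≡ - + 1
      neg (inj₁ refl) = inj₂ refl
      neg (inj₂ refl) = inj₁ refl

-- Davenport constants of C_p² and C_p³ for primes p.

V₃ : Set
V₃ = ℤ × ℤ × ℤ

_∔_ : V₃ → V₃ → V₃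
(a , b , c) ∔ (x , y , z) = a + x , b + y , c + z

open Poly _∔_

∔-swap : ∀ v u w → (v ∔ u) ∔ w ≡ (v ∔ w) ∔ u
∔-swap (a , b , c) (d , e , f) (g , h , i) = cong₂ _,_ (ring-257 a d g) (cong₂ _,_ (ring-257 b e h) (ring-257 c f i))

Σ₃ : {A : Set} → (A → V₃) → List A → V₃
Σ₃ f [] = + 0 , + 0 , + 0
Σ₃ f (a ∷ as) = f a ∔ Σ₃ f as

sumFrom-Σ₃ : ∀ {A : Set} (f : A → V₃) p F v as → sumFrom f p F v as ≡ v ∔ Σ₃ f as
sumFrom-Σ₃ f p F (a , b , c) [] = cong₂ _,_ (sym (ℤ.+-identityʳ a)) (cong₂ _,_ (sym (ℤ.+-identityʳ b)) (sym (ℤ.+-identityʳ c)))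
sumFrom-Σ₃ f p F v@(a , b , c) (x ∷ as) = trans (sumFrom-Σ₃ f p F (v ∔ f x) as)
  (cong₂ _,_ (ℤ.+-assoc a _ _) (cong₂ _,_ (ℤ.+-assoc b _ _) (ℤ.+-assoc c _ _)))

-- Modulo a prime p, the product of the factors ℓ - c over the coordinates ℓ and 1 ≤ c < p detects the zero vector.
module _ {p : ℕ} (pp : Prime p) where

  private
    q : ℕ
    q = p ∸ 1

    1<p : 1 < p
    1<p = nonTrivial⇒n>1 p {{prime⇒nonTrivial pp}}

    1+q≡p : suc q ≡ p
    1+q≡p = m+[n∸m]≡n (<⇒≤ 1<p)

    q<p : q < p
    q<p = ≤-reflexive 1+q≡p

    residueₚ : ∀ x → D p x ⊎ ∃[ j ] 1 ≤ j × j ≤ q × D p (x - + j)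
    residueₚ x with residue p {{prime⇒nonZero pp}} x
    ... | zero , _ , d = inj₁ (subst (D p) (ℤ.+-identityʳ x) d)
    ... | suc j , j<p , d = inj₂ (suc j , s≤s z≤n , ≤-pred (≤-trans j<p (≤-reflexive (sym 1+q≡p))) , d)

    o : V₃
    o = + 0 , + 0 , + 0

    -- The alternating sum over all subsequences vanishes, as there are enough terms for the degree.
    -- If p divided F at every nonempty subsum, only ±F(0) would survive modulo p, and p does not
    -- divide F(0).
    nonzero-subsum : ∀ {A : Set} (f : A → V₃) F as → Deg (length as) F → ¬ D p (F o) →
      ∃[ z ] ∃[ z′ ] as ↭ z ++ z′ × 1 ≤ length z × ¬ D p (F (Σ₃ f z))
    nonzero-subsum f F as dg nz with search f p F as o
    ... | inj₁ (z , z′ , a , b , nd) = z , z′ , a , b ,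
          subst (λ v → ¬ D p (F v)) (trans (sumFrom-Σ₃ f p F o z)
            (cong₂ _,_ (ℤ.+-identityˡ _) (cong₂ _,_ (ℤ.+-identityˡ _) (ℤ.+-identityˡ _)))) nd
    ... | inj₂ (s , s± , d) = ⊥-elim (nz (unit s± (subst (λ x → D p (x - s * F o)) vanish d)))
      where
      vanish : alt F (map f as) o ≡ + 0
      vanish = alt-zero ∔-swap (map f as) {F} (subst (λ k → Deg k F) (sym (List.length-map f as)) dg) o
      unit : ∀ {s x} → s ≡ + 1 ⊎ s ≡ - + 1 → D p (+ 0 - s * x) → D p x
      unit {x = x} (inj₁ refl) = D-comb₁ (- + 1) (ring-171 x)
      unit {x = x} (inj₂ refl) = D-comb₁ (+ 1) (ring-172 x)

    -- Each further coordinate raises the degree bound by p - 1. Starting from the constant 1 with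
    -- bound 1, r coordinates need r(p - 1) + 1 terms, which is the Davenport constant of C_p^r.
    module Coord (ℓ : V₃ → ℤ) (ℓ-+ : ∀ u v → ℓ (u ∔ v) ≡ ℓ u + ℓ v) (ℓo : ℓ o ≡ + 0) (d : ℕ) (F : V₃ → ℤ)
        (dg : Deg d F) (nz : ¬ D p (F o)) where
      G : V₃ → ℤ
      G = punctured ℓ ℓ-+ q F
      G-Deg : Deg (q ℕ.+ d) G
      G-Deg = Deg-punctured ℓ ℓ-+ q d F dg
      G-o : ¬ D p (G o)
      G-o = punctured-survive ℓ ℓ-+ pp q F o q<p ℓo nz
      G-zero : ∀ v → ¬ D p (G v) → D p (ℓ v) × ¬ D p (F v)
      G-zero v nd with residueₚ (ℓ v)
      ... | inj₁ x = x , λ y → nd (punctured-base ℓ ℓ-+ q F v y)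
      ... | inj₂ (j , a , b , c) = ⊥-elim (nd (punctured-vanish ℓ ℓ-+ q F v j a b c))

    module X = Coord proj₁ (λ _ _ → refl) refl 1 (λ _ → + 1) (λ _ _ → refl)
      (λ d → <⇒≱ 1<p (ℕ.∣⇒≤ (Sg.∣⇒∣ᵤ d)))
    module Y = Coord (λ v → proj₁ (proj₂ v)) (λ _ _ → refl) refl (q ℕ.+ 1) X.G X.G-Deg X.G-o
    module Z = Coord (λ v → proj₂ (proj₂ v)) (λ _ _ → refl) refl (q ℕ.+ (q ℕ.+ 1)) Y.G Y.G-Deg Y.G-o

  opaque
    olson₂ : {A : Set} (f : A → V₃) (as : List A) → length as ≡ q ℕ.+ (q ℕ.+ 1) →
      ∃[ z ] ∃[ z′ ] as ↭ z ++ z′ × 1 ≤ length z × D p (proj₁ (Σ₃ f z)) × D p (proj₁ (proj₂ (Σ₃ f z)))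
    olson₂ f as len with nonzero-subsum f Y.G as (subst (λ k → Deg k Y.G) (sym len) Y.G-Deg) Y.G-o
    ... | z , z′ , a , b , nd = z , z′ , a , b , proj₁ (X.G-zero _ (proj₂ (Y.G-zero _ nd))) , proj₁ (Y.G-zero _ nd)

    olson₃ : {A : Set} (f : A → V₃) (as : List A) → length as ≡ q ℕ.+ (q ℕ.+ (q ℕ.+ 1)) →
      ∃[ z ] ∃[ z′ ] as ↭ z ++ z′ × 1 ≤ length z ×
        (D p (proj₁ (Σ₃ f z)) × D p (proj₁ (proj₂ (Σ₃ f z)))) × D p (proj₂ (proj₂ (Σ₃ f z)))
    olson₃ f as len with nonzero-subsum f Z.G as (subst (λ k → Deg k Z.G) (sym len) Z.G-Deg) Z.G-o
    ... | z , z′ , a , b , nd = z , z′ , a , b ,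
      (proj₁ (X.G-zero _ (proj₂ (Y.G-zero _ (proj₂ (Z.G-zero _ nd))))) , proj₁ (Y.G-zero _ (proj₂ (Z.G-zero _ nd)))) ,
      proj₁ (Z.G-zero _ nd)

-- Bounds for η and the Davenport constant of C_n ⊕ C_n by induction on the prime factorisation.

Zero² : ℕ → Elt → Set
Zero² n (a , b) = D n a × D n b

module _ {A : Set} (f : A → Elt) where

  -- Terms are elements of an arbitrary A with a weight map, and blocks exist apart from their host
  -- list; so blocks can become the terms of the next round.
  Block : ℕ → ℕ → Set
  Block n ℓ = ∃[ z ] 1 ≤ length z × length z ≤ ℓ × Zero² n (σ (map f z))

  HasBlock : ℕ → ℕ → List A → Set
  HasBlock n ℓ as = Σ (Block n ℓ) λ b → ∃[ z′ ] as ↭ proj₁ b ++ z′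

-- η(C_n²) ≤ 3n - 2
Eta : ℕ → Set₁
Eta n = ∀ {A : Set} (f : A → Elt) as → 3 ℕ.* n ≤ 2 ℕ.+ length as → HasBlock f n n as

-- D(C_n²) ≤ 2n - 1
Dav : ℕ → Set₁
Dav n = ∀ {A : Set} (f : A → Elt) as → 2 ℕ.* n ≤ 1 ℕ.+ length as → HasBlock f n (length as) as

-- The third coordinate counts terms: a zero-sum over C_p³ is then a zero-sum over C_p² with length
-- divisible by p.
weigh : {A : Set} → (A → Elt) → A → V₃
weigh f a = proj₁ (f a) , proj₂ (f a) , + 1

Σ₃-weigh : {A : Set} (f : A → Elt) (z : List A) → Σ₃ (weigh f) z ≡ (proj₁ (σ (map f z)) , proj₂ (σ (map f z)) , + length z)
Σ₃-weigh f [] = refl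
Σ₃-weigh f (a ∷ z) rewrite Σ₃-weigh f z = refl

↭-take : ∀ {A : Set} k {as z z′ : List A} → take k as ↭ z ++ z′ → as ↭ z ++ (z′ ++ drop k as)
↭-take k {as} {z} {z′} p = Prop.trans (Prop.↭-reflexive (sym (List.take++drop≡id k as)))
  (Prop.trans (Prop.++⁺ʳ (drop k as) p) (Prop.↭-reflexive (List.++-assoc z z′ (drop k as))))

length-take-≤ : ∀ {A : Set} k (as : List A) → k ≤ length as → length (take k as) ≡ k
length-take-≤ k as p = trans (List.length-take k as) (m≤n⇒m⊓n≡m p)

σ-map-↭ : ∀ {A : Set} (f : A → Elt) {as bs} → as ↭ bs → σ (map f as) ≡ σ (map f bs)
σ-map-↭ f Prop.refl = refl
σ-map-↭ f (Prop.prep x p) = cong (f x ⊕_) (σ-map-↭ f p)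
σ-map-↭ f (Prop.swap {xs} {ys} x y p) rewrite σ-map-↭ f p =
  both₃ ring-131 (f x) (f y) (σ (map f ys))
σ-map-↭ f (Prop.trans p q) = trans (σ-map-↭ f p) (σ-map-↭ f q)

Zero²-split : ∀ {n u v} → Zero² n (u ⊕ v) → Zero² n u → Zero² n v
Zero²-split (a , b) (c , d) = Sg.∣m+n∣m⇒∣n a c , Sg.∣m+n∣m⇒∣n b d

module _ {p : ℕ} (pp : Prime p) where

  private
    q : ℕ
    q = p ∸ 1
    1<p : 1 < p
    1<p = nonTrivial⇒n>1 p {{prime⇒nonTrivial pp}}
    p≡ : p ≡ suc q
    p≡ = sym (m+[n∸m]≡n (<⇒≤ 1<p))
    opaque
      2p≡ : 2 ℕ.* p ≡ suc (q ℕ.+ (q ℕ.+ 1))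
      2p≡ = trans (cong (2 ℕ.*_) p≡) (ringℕ-8 q)
      3p≡ : 3 ℕ.* p ≡ suc (suc (q ℕ.+ (q ℕ.+ (q ℕ.+ 1))))
      3p≡ = trans (cong (3 ℕ.*_) p≡) (ringℕ-9 q)

  opaque
    dav-prime : Dav p
    dav-prime f as le with olson₂ pp (weigh f) (take (q ℕ.+ (q ℕ.+ 1)) as)
        (length-take-≤ _ as (≤-pred (subst (_≤ suc (length as)) 2p≡ le)))
    ... | z , z′ , a , b , c , d =
      (z , b , subst (length z ≤_) (sym (trans (Prop.↭-length perm) (List.length-++ z))) (m≤m+n _ _) ,
        subst (λ v → D p (proj₁ v)) (Σ₃-weigh f z) c , subst (λ v → D p (proj₁ (proj₂ v))) (Σ₃-weigh f z) d) , _ , perm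
      where
      perm : as ↭ z ++ (z′ ++ drop (q ℕ.+ (q ℕ.+ 1)) as)
      perm = ↭-take (q ℕ.+ (q ℕ.+ 1)) {as} {z} {z′} a

    -- Among 3p - 2 terms `olson₃` finds a zero-sum whose length is a positive multiple of p below
    -- 3p. Length p is short already; length 2p is left to `halve`.
    eta-prime : Eta p
    eta-prime f as le with olson₃ pp (weigh f) (take (q ℕ.+ (q ℕ.+ (q ℕ.+ 1))) as) len
      where
      len : length (take (q ℕ.+ (q ℕ.+ (q ℕ.+ 1))) as) ≡ q ℕ.+ (q ℕ.+ (q ℕ.+ 1))
      len = length-take-≤ _ as (≤-pred (≤-pred (subst (_≤ suc (suc (length as))) 3p≡ le)))
    ... | z , z′ , a , b , (c , d) , e with length z ≤? p
    ... | yes short = (z , b , short , subst (λ v → D p (proj₁ v)) (Σ₃-weigh f z) c ,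
                       subst (λ v → D p (proj₁ (proj₂ v))) (Σ₃-weigh f z) d) , _ , ↭-take (q ℕ.+ (q ℕ.+ (q ℕ.+ 1))) {as} {z} {z′} a
    ... | no long = halve z refl
      where
      p∣len : p ℕ.∣ length z
      p∣len = Sg.∣⇒∣ᵤ (subst (λ v → D p (proj₂ (proj₂ v))) (Σ₃-weigh f z) e)
      len<3p : length z < 3 ℕ.* p
      len<3p = subst (length z <_) (sym 3p≡) (s≤s (≤-trans (subst (length z ≤_)
        (trans (sym (trans (Prop.↭-length a) (List.length-++ z))) (length-take-≤ _ as (≤-pred (≤-pred (subst (_≤ suc (suc (length as))) 3p≡ le)))))
        (m≤m+n _ _)) (n≤1+n _)))
      len2 : length z ≡ 2 ℕ.* p
      len2 with p∣len
      ... | ℕ.divides 0 x = ⊥-elim (long (subst (_≤ p) (sym x) z≤n))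
      ... | ℕ.divides 1 x = ⊥-elim (long (≤-reflexive (trans x (+-identityʳ p))))
      ... | ℕ.divides 2 x = x
      ... | ℕ.divides (suc (suc (suc k))) x = ⊥-elim (<⇒≱ len<3p (subst (3 ℕ.* p ≤_) (sym x) (*-monoˡ-≤ p {3} {3 ℕ.+ k} (m≤m+n 3 k))))
      zz : Zero² p (σ (map f z))
      zz = subst (λ v → D p (proj₁ v)) (Σ₃-weigh f z) c , subst (λ v → D p (proj₁ (proj₂ v))) (Σ₃-weigh f z) d
      -- A zero-sum sequence of length 2p is longer than D(C_p²), so it splits, and one of the two parts is short.
      halve : ∀ z₀ → z₀ ≡ z → HasBlock f p p as
      halve [] x = ⊥-elim (long (subst (λ k → length k ≤ p) x z≤n))
      -- The term w is set aside, so the zero-sum found among the other 2p - 1 terms is proper and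
      -- its complement, containing w, is nonempty.
      halve (w ∷ ws) refl with dav-prime f ws (≤-reflexive (sym len2))
      ... | (y , l₁ , l₂ , zy) , y′ , pm with length y ≤? p
      ... | yes short = (y , l₁ , short , zy) , w ∷ y′ ++ (z′ ++ drop (q ℕ.+ (q ℕ.+ (q ℕ.+ 1))) as) ,
              Prop.trans (↭-take (q ℕ.+ (q ℕ.+ (q ℕ.+ 1))) {as} {w ∷ ws} {z′} a) (Prop.trans (Prop.prep w (Prop.trans (Prop.++⁺ʳ (z′ ++ drop (q ℕ.+ (q ℕ.+ (q ℕ.+ 1))) as) pm) (Prop.↭-reflexive (List.++-assoc y y′ _))))
                (Prop.↭-sym (Prop.shift w y _)))
      ... | no lng = (w ∷ y′ , s≤s z≤n , sh , Zero²-split (subst (Zero² p) eq zz) zy) , y ++ (z′ ++ drop (q ℕ.+ (q ℕ.+ (q ℕ.+ 1))) as) ,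
              Prop.trans (↭-take (q ℕ.+ (q ℕ.+ (q ℕ.+ 1))) {as} {w ∷ ws} {z′} a) (Prop.prep w (Prop.trans (Prop.++⁺ʳ (z′ ++ drop (q ℕ.+ (q ℕ.+ (q ℕ.+ 1))) as) (Prop.trans pm (Prop.++-comm y y′))) (Prop.↭-reflexive (List.++-assoc y′ y _))))
        where
        lens : length y ℕ.+ suc (length y′) ≡ p ℕ.+ p
        lens = trans (+-suc _ _) (trans (cong suc (trans (sym (List.length-++ y)) (sym (Prop.↭-length pm)))) (trans len2 (cong (p ℕ.+_) (+-identityʳ p))))
        sh : suc (length y′) ≤ p
        sh = +-cancelˡ-≤ p _ _ (≤-trans (+-monoˡ-≤ _ (<⇒≤ (≰⇒> lng))) (≤-reflexive lens))
        eq : f w ⊕ σ (map f ws) ≡ σ (map f y) ⊕ (f w ⊕ σ (map f y′))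
        eq = trans (cong (f w ⊕_) (trans (σ-map-↭ f pm) (trans (cong σ (List.map-++ f y y′)) (σ-++ (map f y) (map f y′)))))
          (both₃ ring-131 (f w) (σ (map f y)) (σ (map f y′)))

concat-↭ : ∀ {A : Set} {xs ys : List (List A)} → xs ↭ ys → concat xs ↭ concat ys
concat-↭ Prop.refl = Prop.refl
concat-↭ (Prop.prep x p) = Prop.++⁺ˡ x (concat-↭ p)
concat-↭ (Prop.swap x y p) = Prop.trans (Prop.shifts x y) (Prop.++⁺ˡ y (Prop.++⁺ˡ x (concat-↭ p)))
concat-↭ (Prop.trans p q) = Prop.trans (concat-↭ p) (concat-↭ q)

module _ {A : Set} (f : A → Elt) {n ℓ : ℕ} where

  pieces : List (Block f n ℓ) → List A
  pieces bs = concat (map proj₁ bs)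

  pieces-++ : ∀ bs cs → pieces (bs ++ cs) ≡ pieces bs ++ pieces cs
  pieces-++ bs cs = trans (cong concat (List.map-++ proj₁ bs cs)) (sym (List.concat-++ (map proj₁ bs) (map proj₁ cs)))

  pieces-length : ∀ bs → length (pieces bs) ≤ length bs ℕ.* ℓ
  pieces-length [] = z≤n
  pieces-length (b ∷ bs) = ≤-trans (≤-reflexive (List.length-++ (proj₁ b)))
    (+-mono-≤ (proj₁ (proj₂ (proj₂ b))) (pieces-length bs))

  pieces-nonempty : ∀ bs → 1 ≤ length bs → 1 ≤ length (pieces bs)
  pieces-nonempty (b ∷ bs) _ = ≤-trans (proj₁ (proj₂ b)) (≤-trans (m≤m+n _ _) (≤-reflexive (sym (List.length-++ (proj₁ b)))))

  share : Block f n ℓ → Elt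
  share (z , _ , _ , d , e) = Sg._∣_.quotient d , Sg._∣_.quotient e

  σ-pieces : ∀ bs → σ (map f (pieces bs)) ≡ (+ n) · σ (map share bs)
  σ-pieces [] = cong₂ _,_ (sym (ℤ.*-zeroʳ (+ n))) (sym (ℤ.*-zeroʳ (+ n)))
  σ-pieces (b@(z , _ , _ , d , e) ∷ bs) = trans (cong σ (List.map-++ f z (pieces bs))) (trans (σ-++ (map f z) _)
    (cong₂ _,_ (trans (cong₂ ℤ._+_ (Sg._∣_.equality d) (cong proj₁ (σ-pieces bs))) (ring-250 (Sg._∣_.quotient d) (proj₁ (σ (map share bs))) (+ n)))
               (trans (cong₂ ℤ._+_ (Sg._∣_.equality e) (cong proj₂ (σ-pieces bs))) (ring-250 (Sg._∣_.quotient e) (proj₂ (σ (map share bs))) (+ n)))))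

  pieces-↭ : ∀ {bs cs} → bs ↭ cs → pieces bs ↭ pieces cs
  pieces-↭ p = concat-↭ (Prop.map⁺ proj₁ p)

  -- The inductive step for products: a sum of shares divisible by q becomes, after multiplication
  -- by n, a sum of terms divisible by qn, and the length bounds multiply.
  merge : ∀ {q k bs as rest} → as ↭ pieces bs ++ rest → HasBlock share q k bs → HasBlock f (q ℕ.* n) (k ℕ.* ℓ) as
  merge {q} {k} {bs} {as} {rest} pm ((cs , l₁ , l₂ , d , e) , cs′ , pc) =
    (pieces cs , pieces-nonempty cs l₁ , ≤-trans (pieces-length cs) (*-monoˡ-≤ ℓ l₂) ,
      subst (Zero² (q ℕ.* n)) (sym (σ-pieces cs)) (up d , up e)) ,
    pieces cs′ ++ rest ,
    Prop.trans pm (Prop.trans (Prop.++⁺ʳ rest (Prop.trans (pieces-↭ pc) (Prop.↭-reflexive (pieces-++ cs cs′))))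
      (Prop.↭-reflexive (List.++-assoc (pieces cs) _ rest)))
    where
    up : ∀ {z} → D q z → D (q ℕ.* n) (+ n * z)
    up {z} (divides x y) = divides x (trans (cong (+ n ℤ.*_) y) (trans (ring-228 (+ n) x (+ q)) (cong (x ℤ.*_) (sym (ℤ.pos-* q n)))))

private
 opaque
  extract-step : ∀ a b → 2 ℕ.+ (a ℕ.+ b) ≡ a ℕ.+ (2 ℕ.+ b)
  extract-step = ℕS.solve-∀

module _ {A : Set} (f : A → Elt) {n : ℕ} (eta : Eta n) where

  opaque
    -- While j ≥ 1 blocks are still wanted, at least (2 + j) n - 2 ≥ 3n - 2 terms are left, enough
    -- for `Eta`, and each block uses up at most n of them.
    extract : ∀ j as → (2 ℕ.+ j) ℕ.* n ≤ 2 ℕ.+ length as →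
      ∃[ bs ] ∃[ rest ] length bs ≡ j × as ↭ pieces f {n} {n} bs ++ rest
    extract zero as le = [] , as , refl , Prop.refl
    extract (suc j) as le with eta f as (≤-trans (*-monoˡ-≤ n {3} {3 ℕ.+ j} (m≤m+n 3 j)) le)
    ... | b@(z , _ , l , _) , z′ , pm with extract j z′ (+-cancelˡ-≤ n _ _ (≤-trans le
              (subst (_≤ n ℕ.+ (2 ℕ.+ length z′)) (cong (2 ℕ.+_) (sym (trans (Prop.↭-length pm) (List.length-++ z))))
                (subst (2 ℕ.+ (length z ℕ.+ length z′) ≤_) (extract-step n (length z′)) (+-monoʳ-≤ 2 (+-monoˡ-≤ (length z′) l))))))
    ... | bs , rest , e , pm′ = b ∷ bs , rest , cong suc e ,
          Prop.trans pm (Prop.trans (Prop.++⁺ˡ z pm′) (Prop.↭-reflexive (sym (List.++-assoc z _ rest))))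

private
 opaque
  eta-*-blocks : ∀ q p → 3 ℕ.* (suc q ℕ.* p) ≡ (2 ℕ.+ suc (3 ℕ.* q)) ℕ.* p
  eta-*-blocks = ℕS.solve-∀

  dav-*-blocks : ∀ q p → 2 ℕ.* (suc q ℕ.* p) ≡ (2 ℕ.+ 2 ℕ.* q) ℕ.* p
  dav-*-blocks = ℕS.solve-∀

  dav-*-rest : ∀ q p → 2 ℕ.* q ℕ.* p ℕ.+ 2 ℕ.* p ≡ 2 ℕ.* (suc q ℕ.* p)
  dav-*-rest = ℕS.solve-∀

-- From 3qp - 2 terms one obtains 3q - 2 blocks over p, exactly what `Eta q` needs for their shares.
eta-* : ∀ {p q} → 1 ≤ q → Eta p → Eta q → Eta (q ℕ.* p)
eta-* {p} {suc q} _ ep eq f as le with extract f ep (suc (3 ℕ.* q)) as (subst (_≤ 2 ℕ.+ length as) (eta-*-blocks q p) le)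
... | bs , rest , e , pm = merge f pm (eq (share f) bs (≤-reflexive (trans (ringℕ-14 q) (cong (2 ℕ.+_) (sym e)))))

widen : ∀ {A : Set} (f : A → Elt) {n k ℓ} → k ≤ ℓ → Block f n k → Block f n ℓ
widen f le (z , a , b , c) = z , a , ≤-trans b le , c

pieces-widen : ∀ {A : Set} (f : A → Elt) {n k ℓ} (le : k ≤ ℓ) bs → pieces f {n} (map (widen f le) bs) ≡ pieces f bs
pieces-widen f le [] = refl
pieces-widen f le (b ∷ bs) = cong (proj₁ b ++_) (pieces-widen f le bs)

shrink : ∀ {A : Set} (f : A → Elt) {n k} as → HasBlock f n k as → HasBlock f n (length as) as
shrink f as ((z , a , b , c) , z′ , pm) = (z , a , subst (length z ≤_) (sym (trans (Prop.↭-length pm) (List.length-++ z))) (m≤m+n _ _) , c) , z′ , pm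

-- Taking 2q - 2 blocks of length at most p leaves at least 2p - 1 terms, in which `Dav p` finds one
-- more, possibly long, block. The shares of these 2q - 1 blocks suffice for `Dav q`.
dav-* : ∀ {p q} → 1 ≤ q → Eta p → Dav p → Dav q → Dav (q ℕ.* p)
dav-* {p} {suc q} _ ep dp dq f as le with extract f ep (2 ℕ.* q) as
    (≤-trans (subst (_≤ 1 ℕ.+ length as) (dav-*-blocks q p) le) (n≤1+n _))
... | bs , rest , e , pm with dp f rest (+-cancelˡ-≤ (2 ℕ.* q ℕ.* p) _ _ (≤-trans (≤-reflexive (dav-*-rest q p)) (≤-trans le
        (≤-trans (≤-reflexive (cong suc (trans (Prop.↭-length pm) (List.length-++ (pieces f bs)))))
          (≤-trans (≤-reflexive (sym (+-suc _ _))) (+-monoˡ-≤ _ (subst (λ k → length (pieces f bs) ≤ k ℕ.* p) e (pieces-length f bs))))))))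
... | b , z′ , pm′ = shrink f as (merge f perm (dq (share f) bs′ (≤-reflexive (trans (ringℕ-15 q) (cong (λ k → suc (suc k)) (sym (trans (List.length-map _ bs) e)))))))
  where
  bs′ : List (Block f p (p ℕ.+ length rest))
  -- One length bound common to the short blocks and to the last one, which is bounded only by the
  -- length of the rest.
  bs′ = widen f (m≤n+m _ p) b ∷ map (widen f (m≤m+n p _)) bs
  perm : as ↭ pieces f bs′ ++ z′
  perm = Prop.trans pm (Prop.trans (Prop.++⁺ˡ _ pm′) (Prop.trans (Prop.shifts (pieces f bs) (proj₁ b))
    (Prop.↭-reflexive (trans (cong (λ k → proj₁ b ++ (k ++ z′)) (sym (pieces-widen f (m≤m+n p (length rest)) bs))) (sym (List.++-assoc (proj₁ b) _ z′))))))

private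
  trivial-block : ∀ {A : Set} (f : A → Elt) a as ℓ → 1 ≤ ℓ → HasBlock f 1 ℓ (a ∷ as)
  trivial-block f a as ℓ le = (a ∷ [] , s≤s z≤n , le , one _ , one _) , as , Prop.refl
    where
    one : ∀ x → D 1 x
    one x = divides x (sym (ℤ.*-identityʳ x))

  eta-1 : Eta 1
  eta-1 f [] (s≤s (s≤s ()))
  eta-1 f (a ∷ as) le = trivial-block f a as 1 (s≤s z≤n)

  dav-1 : Dav 1
  dav-1 f [] (s≤s ())
  dav-1 f (a ∷ as) le = trivial-block f a as _ (s≤s z≤n)

  product-≥1 : ∀ {ps} → All Prime ps → 1 ≤ product ps
  product-≥1 [] = s≤s z≤n
  product-≥1 {p ∷ ps} (pp ∷ pps) = *-mono-≤ {1} {p} {1} (<⇒≤ (nonTrivial⇒n>1 p {{prime⇒nonTrivial pp}})) (product-≥1 pps)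

  product-eta : ∀ {ps} → All Prime ps → Eta (product ps)
  product-eta [] = eta-1
  product-eta {p ∷ ps} (pp ∷ pps) = subst Eta (*-comm (product ps) p) (eta-* (product-≥1 pps) (eta-prime pp) (product-eta pps))

  product-dav : ∀ {ps} → All Prime ps → Dav (product ps)
  product-dav [] = dav-1
  product-dav {p ∷ ps} (pp ∷ pps) = subst Dav (*-comm (product ps) p) (dav-* (product-≥1 pps) (eta-prime pp) (dav-prime pp) (product-dav pps))

  factored-eta : ∀ {n} → PrimeFactorisation n → Eta n
  factored-eta f = subst Eta (sym (PrimeFactorisation.isFactorisation f)) (product-eta (PrimeFactorisation.factorsPrime f))

  factored-dav : ∀ {n} → PrimeFactorisation n → Dav n
  factored-dav f = subst Dav (sym (PrimeFactorisation.isFactorisation f)) (product-dav (PrimeFactorisation.factorsPrime f))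

opaque
  eta-bound : ∀ n .{{_ : ℕ.NonZero n}} → Eta n
  eta-bound n = factored-eta (factorise n)

  dav-bound : ∀ n .{{_ : ℕ.NonZero n}} → Dav n
  dav-bound n = factored-dav (factorise n)

-- Pigeonhole in the kernel of the quotient map.

opaque
  AllPairs-lookup : ∀ {A : Set} {R : A → A → Set} {xs} → AllPairs R xs → ∀ {i j} → i Fin.< j → R (lookup xs i) (lookup xs j)
  AllPairs-lookup (p ∷ ps) {Fin.zero} {Fin.suc j} _ = All.lookup p (∈-lookup j)
  AllPairs-lookup (p ∷ ps) {Fin.suc i} {Fin.suc j} (s≤s lt) = AllPairs-lookup ps lt

  incongruent-length : ∀ m .{{_ : ℕ.NonZero m}} xs → AllPairs (λ a b → ¬ D m (a - b)) xs → length xs ≤ m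
  incongruent-length m xs ps with length xs ≤? m
  ... | yes le = le
  ... | no gt with Fin.pigeonhole (≰⇒> gt) cls
    where
    cls : Fin (length xs) → Fin m
    cls i = Fin.fromℕ< (proj₁ (proj₂ (residue m (lookup xs i))))
  ... | i , j , i<j , e = ⊥-elim (AllPairs-lookup ps i<j (D-comb₂ (+ 1) (- + 1)
          (trans (ring-251 (lookup xs i) (lookup xs j) (+ proj₁ (residue m (lookup xs i))))
             (cong (λ z → + 1 * (lookup xs i - + proj₁ (residue m (lookup xs i))) + - + 1 * (lookup xs j - + z)) same))
          (proj₂ (proj₂ (residue m (lookup xs i)))) (proj₂ (proj₂ (residue m (lookup xs j))))))
    where
    same : proj₁ (residue m (lookup xs i)) ≡ proj₁ (residue m (lookup xs j))
    same = trans (sym (Fin.toℕ-fromℕ< _)) (trans (cong Fin.toℕ e) (Fin.toℕ-fromℕ< _))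

module Quot (n m : ℕ) .{{_ : ℕ.NonZero n}} .{{_ : ℕ.NonZero m}} where

  open Grp n m public
  module P = Grp n 1

  -- Equality in the quotient C_n ⊕ C_n of C_n ⊕ C_{mn}; the kernel of the quotient map is cyclic of order m.
  infix 4 _~_
  _~_ : Elt → Elt → Set
  _~_ = P._≈_

  opaque
    ≈⇒~ : ∀ {u v} → u ≈ v → u ~ v
    ≈⇒~ {u} {v} p with toN p
    ... | a , b = P.fromN (a , Sg.∣-trans (divides (+ m) (trans (ℤ.pos-* m n) (cong (λ k → + m * + k) (sym (*-identityˡ n))))) b)

    Zero²⇒~ : ∀ {u} → Zero² n u → u ~ 0G
    Zero²⇒~ {u} (a , b) = P.fromN (subst (D n) (sym (ℤ.+-identityʳ _)) a , subst (D (1 ℕ.* n)) (sym (ℤ.+-identityʳ _)) (subst (λ k → D k (proj₂ u)) (sym (*-identityˡ n)) b))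

    ~⇒Zero² : ∀ {u} → u ~ 0G → Zero² n u
    ~⇒Zero² {u} p with P.toN p
    ... | a , b = subst (D n) (ℤ.+-identityʳ _) a , subst (λ k → D k (proj₂ u)) (*-identityˡ n) (subst (D (1 ℕ.* n)) (ℤ.+-identityʳ _) b)

    m·≈0 : ∀ {u} → u ~ 0G → (+ m) · u ≈ 0G
    m·≈0 {u} p with ~⇒Zero² p
    ... | a , divides q e = fromN (subst (D n) (sym (ℤ.+-identityʳ _)) (Sg.∣n⇒∣m*n (+ m) a) ,
          subst (D (m ℕ.* n)) (sym (ℤ.+-identityʳ _)) (divides q (trans (cong (+ m ℤ.*_) e) (trans (ring-229 (+ m) q (+ n)) (cong (q ℤ.*_) (sym (ℤ.pos-* m n)))))))

    n·~0 : ∀ u → (+ n) · u ~ 0G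
    n·~0 u = Zero²⇒~ (divides (proj₁ u) (ℤ.*-comm (+ n) (proj₁ u)) , divides (proj₂ u) (ℤ.*-comm (+ n) (proj₂ u)))

  -- Elements of the kernel of C_n ⊕ C_{mn} → C_n ⊕ C_n are determined by a residue mod m.
  level : ∀ {u} → u ~ 0G → ℤ
  level p = Sg._∣_.quotient (proj₂ (~⇒Zero² p))

  opaque
    level-≈ : ∀ {u v} (p : u ~ 0G) (q : v ~ 0G) → D m (level p - level q) → u ≈ v
    level-≈ {u} {v} p q (divides x e) = fromN (Sg.∣m∣n⇒∣m-n (proj₁ (~⇒Zero² p)) (proj₁ (~⇒Zero² q)) ,
          divides x (trans (cong₂ ℤ._-_ (Sg._∣_.equality (proj₂ (~⇒Zero² p))) (Sg._∣_.equality (proj₂ (~⇒Zero² q)))) (trans (ring-230 (level p) (level q) (+ n)) (trans (cong (ℤ._* + n) e) (trans (ℤ.*-assoc x (+ m) (+ n)) (cong (x ℤ.*_) (sym (ℤ.pos-* m n))))))))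

    kernel-length : ∀ us → All (_~ 0G) us → AllPairs (λ u v → ¬ u ≈ v) us → length us ≤ m
    kernel-length us zs ps = subst (_≤ m) (len us zs) (incongruent-length m (levels us zs) (go us zs ps))
      where
      levels : ∀ us → All (_~ 0G) us → List ℤ
      levels [] [] = []
      levels (u ∷ us) (z ∷ zs) = level z ∷ levels us zs
      len : ∀ us zs → length (levels us zs) ≡ length us
      len [] [] = refl
      len (u ∷ us) (z ∷ zs) = cong suc (len us zs)
      one : ∀ {u} (z : u ~ 0G) us zs → All (λ v → ¬ u ≈ v) us → All (λ b → ¬ D m (level z - b)) (levels us zs)
      one z [] [] [] = []
      one z (u ∷ us) (y ∷ ys) (p ∷ ps) = (λ d → p (level-≈ z y d)) ∷ one z us ys ps
      go : ∀ us zs → AllPairs (λ u v → ¬ u ≈ v) us → AllPairs (λ a b → ¬ D m (a - b)) (levels us zs)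
      go [] [] [] = []
      go (u ∷ us) (z ∷ zs) (p ∷ ps) = one z us zs p ∷ go us zs ps

    ~-⊕ : ∀ {u v} → u ~ 0G → v ~ 0G → u ⊕ v ~ 0G
    ~-⊕ p q = P.⊕-cong p q

    ~-⊖ : ∀ {u} → u ~ 0G → ⊖ u ~ 0G
    ~-⊖ {u} = P.comb₁ (- + 1) (both₁ ring-231 u)

  Free : List Elt → Set
  Free as = ∀ y → y ⊆ as → 1 ≤ length y → ¬ σ y ≈ 0G

  opaque
    σ~0 : ∀ {as} → All (_~ 0G) as → σ as ~ 0G
    σ~0 [] = P.≈-refl
    σ~0 (p ∷ ps) = ~-⊕ p (σ~0 ps)

  private
    eqn₁ : ∀ {s a y v} → v ≡ ⊖ ((s ⊕ a) ⊕ y) → ⊖ s ≈ v → a ⊕ y ≈ 0G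
    eqn₁ {s} {a} {y} refl = comb₁ (+ 1) (both₃ ring-232 s a y)

    eqn₂ : ∀ {x y v} → v ≡ ⊖ (0G ⊕ y) → x ≈ v → x ⊕ y ≈ 0G
    eqn₂ {x} {y} refl = comb₁ (+ 1) (both₂ ring-233 x y)

  -- The elements -s, -(s + a₁), -(s + a₁ + a₂), and so on. For a zero-sum free sequence and s = 0
  -- they are distinct, and a further term x keeping the sequence zero-sum free differs from all of
  -- them, because x = -σ(y) would be a zero-sum.
  negPrefixes : Elt → List Elt → List Elt
  negPrefixes s [] = ⊖ s ∷ []
  negPrefixes s (a ∷ as) = ⊖ s ∷ negPrefixes (s ⊕ a) as

  opaque
    negPrefixes-length : ∀ s as → length (negPrefixes s as) ≡ suc (length as)
    negPrefixes-length s [] = refl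
    negPrefixes-length s (a ∷ as) = cong suc (negPrefixes-length (s ⊕ a) as)

    negPrefixes-~ : ∀ {s as} → s ~ 0G → All (_~ 0G) as → All (_~ 0G) (negPrefixes s as)
    negPrefixes-~ p [] = ~-⊖ p ∷ []
    negPrefixes-~ p (q ∷ qs) = ~-⊖ p ∷ negPrefixes-~ (~-⊕ p q) qs

    negPrefixes-form : ∀ s as → All (λ v → ∃[ y ] y ⊆ as × v ≡ ⊖ (s ⊕ σ y)) (negPrefixes s as)
    negPrefixes-form s as = go s as
      where
      base : ∀ s → ⊖ s ≡ ⊖ (s ⊕ 0G)
      base s = cong ⊖_ (cong₂ _,_ (sym (ℤ.+-identityʳ _)) (sym (ℤ.+-identityʳ _)))
      go : ∀ s as → All (λ v → ∃[ y ] y ⊆ as × v ≡ ⊖ (s ⊕ σ y)) (negPrefixes s as)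
      go s [] = ([] , [] , base s) ∷ []
      go s (a ∷ as) = ([] , Sub.[]⊆-universal _ , base s) ∷
        All.map (λ { (y , q , e) → a ∷ y , refl ∷ q , trans e (cong ⊖_ (cong₂ _,_ (ℤ.+-assoc (proj₁ s) _ _) (ℤ.+-assoc (proj₂ s) _ _))) }) (go (s ⊕ a) as)

    negPrefixes-distinct : ∀ s {as} → Free as → AllPairs (λ u v → ¬ u ≈ v) (negPrefixes s as)
    negPrefixes-distinct s {[]} fr = [] ∷ []
    negPrefixes-distinct s {a ∷ as} fr =
      All.map (λ { (y , q , e) eq → fr (a ∷ y) (refl ∷ q) (s≤s z≤n) (eqn₁ e eq) }) (negPrefixes-form (s ⊕ a) as) ∷
      negPrefixes-distinct (s ⊕ a) (λ y q → fr y (a ∷ʳ q))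

    Free-tail : ∀ {a as} → Free (a ∷ as) → Free as
    Free-tail fr y q = fr y (_ ∷ʳ q)

    -- The m - 1 negated prefix sums of `as` are distinct and avoid x and y; if x and y differed
    -- too, the kernel would have m + 1 elements.
    free-heads-≈ : ∀ {x y as} → All (_~ 0G) (x ∷ y ∷ as) → m ≡ suc (suc (length as)) → Free (x ∷ as) → Free (y ∷ as) → x ≈ y
    free-heads-≈ {x} {y} {as} (zx ∷ zy ∷ zas) len fx fy with x ≈? y
    ... | yes p = p
    ... | no ne = ⊥-elim (<⇒≱ (≤-reflexive (cong suc len)) (subst (_≤ m) (cong (suc ∘ suc) (negPrefixes-length 0G as))
          (kernel-length (x ∷ y ∷ negPrefixes 0G as) (zx ∷ zy ∷ negPrefixes-~ P.≈-refl zas)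
            ((ne ∷ avoid fx) ∷ avoid fy ∷ negPrefixes-distinct 0G (Free-tail fx)))))
      where
      avoid : ∀ {x} → Free (x ∷ as) → All (λ v → ¬ x ≈ v) (negPrefixes 0G as)
      avoid {x} fr = All.map (λ { (y , q , e) eq → fr (x ∷ y) (refl ∷ q) (s≤s z≤n) (eqn₂ e eq) }) (negPrefixes-form 0G as)

  -- The m - 1 elements 0, x + y, x + y + a₁, ... are distinct and avoid both x and y.
  opaque
    free-pair-≈ : ∀ {x y as} → All (_~ 0G) (x ∷ y ∷ as) → m ≡ suc (suc (suc (length as))) → Free (x ∷ y ∷ as) → x ≈ y
    free-pair-≈ {x} {y} {as} (zx ∷ zy ∷ zas) len fr with x ≈? y
    ... | yes p = p
    ... | no ne = ⊥-elim (<⇒≱ (≤-reflexive (cong suc len)) (subst (_≤ m) (cong (suc ∘ suc ∘ suc) (trans (List.length-map ⊖_ (negPrefixes (x ⊕ y) as)) (negPrefixes-length (x ⊕ y) as)))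
          (kernel-length (x ∷ y ∷ 0G ∷ map ⊖_ (negPrefixes (x ⊕ y) as)) (zx ∷ zy ∷ P.≈-refl ∷ All.map⁺ (All.map ~-⊖ (negPrefixes-~ (~-⊕ zx zy) zas)))
            ((ne ∷ fr₁ ∷ All.map⁺ (All.map avoid₁ form)) ∷ (fr₂ ∷ All.map⁺ (All.map avoid₂ form)) ∷
               (All.map⁺ (All.map avoid₀ form)) ∷ AllPairs.map⁺ (AllPairs.map (λ f e → f (neg e)) (negPrefixes-distinct (x ⊕ y) (Free-tail (Free-tail fr))))))))
      where
      form : All (λ v → ∃[ z ] z ⊆ as × v ≡ ⊖ ((x ⊕ y) ⊕ σ z)) (negPrefixes (x ⊕ y) as)
      form = negPrefixes-form (x ⊕ y) as
      neg : ∀ {u v} → ⊖ u ≈ ⊖ v → u ≈ v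
      neg {u} {v} = comb₁ (- + 1) (both₂ ring-173 u v)
      single : ∀ {u} → u ≈ 0G → u ⊕ 0G ≈ 0G
      single {u} = comb₁ (+ 1) (both₁ ring-174 u)
      fr₁ : ¬ x ≈ 0G
      fr₁ e = fr (x ∷ []) (refl ∷ Sub.[]⊆-universal _) (s≤s z≤n) (single e)
      fr₂ : ¬ y ≈ 0G
      fr₂ e = fr (y ∷ []) (_ ∷ʳ (refl ∷ Sub.[]⊆-universal _)) (s≤s z≤n) (single e)
      avoid₀ : ∀ {v} → (∃[ z ] z ⊆ as × v ≡ ⊖ ((x ⊕ y) ⊕ σ z)) → ¬ 0G ≈ ⊖ v
      avoid₀ (z , q , refl) e = fr (x ∷ y ∷ z) (refl ∷ refl ∷ q) (s≤s z≤n) (comb₁ (- + 1)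
          (both₃ ring-175 x y (σ z)) e)
      avoid₁ : ∀ {v} → (∃[ z ] z ⊆ as × v ≡ ⊖ ((x ⊕ y) ⊕ σ z)) → ¬ x ≈ ⊖ v
      avoid₁ (z , q , refl) e = fr (y ∷ z) (_ ∷ʳ (refl ∷ q)) (s≤s z≤n) (comb₁ (- + 1)
          (both₃ ring-176 x y (σ z)) e)
      avoid₂ : ∀ {v} → (∃[ z ] z ⊆ as × v ≡ ⊖ ((x ⊕ y) ⊕ σ z)) → ¬ y ≈ ⊖ v
      avoid₂ (z , q , refl) e = fr (x ∷ z) (refl ∷ (_ ∷ʳ q)) (s≤s z≤n) (comb₁ (- + 1)
          (both₃ ring-177 x y (σ z)) e)

  record Generator (h : Elt) : Set where
    field
      h~0 : h ~ 0G
      order : ∀ j → 1 ≤ j → j < m → ¬ (+ j) · h ≈ 0G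

    multiple : ∀ {c} → D m c → c · h ≈ 0G
    multiple {c} (divides q e) = ≈-trans (≈-reflexive (cong₂ _,_ (trans (cong (ℤ._* proj₁ h) e) (ℤ.*-assoc q (+ m) (proj₁ h))) (trans (cong (ℤ._* proj₂ h) e) (ℤ.*-assoc q (+ m) (proj₂ h)))))
      (≈-trans (·-cong q (m·≈0 h~0)) (≈-reflexive (cong₂ _,_ (ℤ.*-zeroʳ q) (ℤ.*-zeroʳ q))))

    divisor : ∀ {c} → c · h ≈ 0G → D m c
    divisor {c} p with residue m c
    ... | zero , _ , d = subst (D m) (ℤ.+-identityʳ c) d
    ... | suc r , lt , d = ⊥-elim (order (suc r) (s≤s z≤n) lt (comb₂ (+ 1) (- + 1)
            (both₁ (ring-234 (+ suc r) c) h) p (multiple d)))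

    -- The m multiples of h are distinct, so an element outside them would be one too many for the
    -- kernel.
    generates : ∀ {z} → z ~ 0G → ∃[ c ] z ≈ c · h
    generates {z} p with anyUpTo? (λ c → z ≈? ((+ c) · h)) m
    ... | yes (c , _ , e) = + c , e
    ... | no ne = ⊥-elim (<⇒≱ (n<1+n m) (subst (_≤ m) (cong suc (List.length-applyUpTo _ m))
            (kernel-length (z ∷ applyUpTo (λ c → (+ c) · h) m) (p ∷ All.applyUpTo⁺₂ _ m (λ c → ·~0 (+ c)))
              (All.applyUpTo⁺₁ _ m (λ lt e → ne (_ , lt , e)) ∷ AllPairs.applyUpTo⁺₁ _ m distinct))))
      where
      ·~0 : ∀ c → c · h ~ 0G
      ·~0 c = P.≈-trans (P.·-cong c h~0) (P.≈-reflexive (cong₂ _,_ (ℤ.*-zeroʳ c) (ℤ.*-zeroʳ c)))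
      distinct : ∀ {i j} → i < j → j < m → ¬ (+ i) · h ≈ (+ j) · h
      distinct {i} {j} i<j j<m e with divisor {+ j - + i} (comb₁ (- + 1) (both₁ (ring-178 (+ i) (+ j)) h) e)
      ... | d = order (j ∸ i) (m<n⇒0<n∸m i<j) (≤-<-trans (m∸n≤m j i) j<m)
              (multiple (subst (D m) (trans (ℤ.m-n≡m⊖n j i) (ℤ.⊖-≥ (<⇒≤ i<j))) d))

-- Auxiliary facts on lists, residues and sums of integers.

⊆-map : ∀ {A B : Set} (f : A → B) xs {ys} → ys ⊆ map f xs → ∃[ zs ] zs ⊆ xs × ys ≡ map f zs
⊆-map f [] [] = [] , [] , refl
⊆-map f (x ∷ xs) (_ ∷ʳ p) with ⊆-map f xs p
... | zs , q , e = zs , x ∷ʳ q , e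
⊆-map f (x ∷ xs) (refl ∷ p) with ⊆-map f xs p
... | zs , q , e = x ∷ zs , refl ∷ q , cong (f x ∷_) e

σ-concat : ∀ zs → σ (concat zs) ≡ σ (map σ zs)
σ-concat [] = refl
σ-concat (z ∷ zs) = trans (σ-++ z (concat zs)) (cong (σ z ⊕_) (σ-concat zs))

length-concat-≤ : ∀ {A : Set} {n} {zs : List (List A)} → All (λ z → length z ≤ n) zs → length (concat zs) ≤ length zs ℕ.* n
length-concat-≤ [] = z≤n
length-concat-≤ {zs = z ∷ zs} (p ∷ ps) = ≤-trans (≤-reflexive (List.length-++ z)) (+-mono-≤ p (length-concat-≤ ps))

length-concat-tight : ∀ {A : Set} {n} {zs : List (List A)} → All (λ z → length z ≤ n) zs → length zs ℕ.* n ≤ length (concat zs) →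
  All (λ z → length z ≡ n) zs
length-concat-tight [] _ = []
length-concat-tight {n = n} {zs = z ∷ zs} (p ∷ ps) le = ≤-antisym p (+-cancelʳ-≤ (length zs ℕ.* n) _ _
      (≤-trans le′ (+-monoʳ-≤ (length z) (length-concat-≤ ps)))) ∷
    length-concat-tight ps (+-cancelˡ-≤ n _ _ (≤-trans le′ (+-monoˡ-≤ _ p)))
  where
  le′ : n ℕ.+ length zs ℕ.* n ≤ length z ℕ.+ length (concat zs)
  le′ = ≤-trans le (≤-reflexive (List.length-++ z))

-- The bound s_{≤2n-1-k}(C_n²) ≤ 2n - 1 + k for zero-sums of restricted length, written without
-- truncated subtraction.
Short : ℕ → ℕ → Set
Short n k = ∀ L → 2 ℕ.* n ℕ.+ k ≤ suc (length L) →
  ∃[ Z ] ∃[ Z′ ] L ↭ Z ++ Z′ × 1 ≤ length Z × length Z ℕ.+ suc k ≤ 2 ℕ.* n × Grp._≈_ n 1 (σ Z) 0G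

private
 opaque
  shuffle₁ : ∀ a b c → a ℕ.+ b ℕ.+ c ≡ (a ℕ.+ c) ℕ.+ b
  shuffle₁ = ℕS.solve-∀
  shuffle₂ : ∀ m′ n → 2 ℕ.* n ℕ.+ suc m′ ℕ.* n ≡ (3 ℕ.+ m′) ℕ.* n
  shuffle₂ = ℕS.solve-∀
  shuffle₃ : ∀ m′ n k → (3 ℕ.+ m′) ℕ.* n ℕ.+ k ≡ suc m′ ℕ.* n ℕ.+ (2 ℕ.* n ℕ.+ k)
  shuffle₃ = ℕS.solve-∀

sumℤ : List ℤ → ℤ
sumℤ = foldr ℤ._+_ (+ 0)
opaque
  -- The forms of the statement index coefficients by `Fin`, whereas the proof computes with lists.
  indexed : ∀ {L} (xs : List ℤ) → length xs ≡ L → (F : ℤ → Elt) (Q : ℤ → Set) → All Q xs →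
    Σ (Fin L → ℤ) λ x → (∀ i → Q (x i)) × Σℤ x ≡ sumℤ xs × tabulate (λ i → F (x i)) ≡ map F xs
  indexed xs refl F Q qs = lookup xs , (λ i → All.lookup qs (∈-lookup i)) , sums xs ,
      trans (sym (List.map-tabulate (lookup xs) F)) (cong (map F) (List.tabulate-lookup xs))
    where
    sums : ∀ xs → Σℤ (lookup xs) ≡ sumℤ xs
    sums [] = refl
    sums (x ∷ xs) = cong (λ s → x + s) (sums xs)

  sumℤ-++ : ∀ xs ys → sumℤ (xs ++ ys) ≡ sumℤ xs + sumℤ ys
  sumℤ-++ [] ys = sym (ℤ.+-identityˡ _)
  sumℤ-++ (x ∷ xs) ys = trans (cong (λ s → x + s) (sumℤ-++ xs ys)) (sym (ℤ.+-assoc x _ _))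

  sumℤ-↭ : ∀ {xs ys} → xs ↭ ys → sumℤ xs ≡ sumℤ ys
  sumℤ-↭ Prop.refl = refl
  sumℤ-↭ (Prop.prep x p) = cong (λ s → x + s) (sumℤ-↭ p)
  sumℤ-↭ (Prop.swap {xs} {ys} x y p) = trans (cong (λ s → x + (y + s)) (sumℤ-↭ p)) (ring-131 x y (sumℤ ys))
  sumℤ-↭ (Prop.trans p q) = trans (sumℤ-↭ p) (sumℤ-↭ q)

  σ-line : ∀ e f xs → σ (map (λ x → x · e ⊕ f) xs) ≡ sumℤ xs · e ⊕ (+ length xs) · f
  σ-line e f [] = refl
  σ-line e f (x ∷ xs) = trans (cong ((x · e ⊕ f) ⊕_) (σ-line e f xs))
    (both₂ (ring-187 x (sumℤ xs) (+ length xs)) e f)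
opaque
  partition-⊎ : ∀ {A : Set} {P Q : A → Set} {xs} → All (λ x → P x ⊎ Q x) xs → ∃[ ps ] ∃[ qs ] xs ↭ qs ++ ps × All P ps × All Q qs
  partition-⊎ [] = [] , [] , Prop.refl , [] , []
  partition-⊎ {xs = x ∷ xs} (inj₁ p ∷ r) with partition-⊎ r
  ... | ps , qs , e , a , b = x ∷ ps , qs , Prop.trans (Prop.prep x e) (Prop.↭-sym (Prop.shift x qs ps)) , p ∷ a , b
  partition-⊎ {xs = x ∷ xs} (inj₂ q ∷ r) with partition-⊎ r
  ... | ps , qs , e , a , b = ps , x ∷ qs , Prop.prep x e , a , q ∷ b

  length-0⇒[] : ∀ {A : Set} {xs : List A} → length xs ≡ 0 → xs ≡ []
  length-0⇒[] {xs = []} _ = refl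

  length-1⇒≡ : ∀ {A : Set} {xs : List A} {p q} → length xs ≡ 1 → p ∈ xs → q ∈ xs → p ≡ q
  length-1⇒≡ {xs = _ ∷ []} _ (here refl) (here refl) = refl

  length-2⇒∷ : ∀ {A : Set} (xs : List A) → length xs ≡ 2 → ∃[ p ] ∃[ q ] xs ≡ p ∷ q ∷ []
  length-2⇒∷ (p ∷ q ∷ []) _ = p , q , refl

  1≤length⇒∈ : ∀ {A : Set} (xs : List A) → 1 ≤ length xs → ∃[ x ] x ∈ xs
  1≤length⇒∈ (x ∷ xs) _ = x , here refl

  1≤⇒suc : ∀ i → 1 ≤ i → ∃[ a ] i ≡ suc a
  1≤⇒suc (suc a) _ = a , refl

  uncons : ∀ {A : Set} {k} (xs : List A) → length xs ≡ suc k → ∃[ x ] ∃[ ys ] xs ≡ x ∷ ys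
  uncons (x ∷ xs) _ = x , xs , refl

  D-small : ∀ {n a} → D n (+ a) → a < n → a ≡ 0
  D-small {a = zero} _ _ = refl
  D-small {a = suc a} d lt = ⊥-elim (<⇒≱ lt (ℕ.∣⇒≤ (Sg.∣⇒∣ᵤ d)))

  D-minus : ∀ {n a b} → b ≤ a → D n (+ a - + b) → D n (+ (a ∸ b))
  D-minus {n} {a} {b} le = subst (D n) (trans (ℤ.m-n≡m⊖n a b) (ℤ.⊖-≥ le))

  D-flip : ∀ {n} a b → D n (a - b) → D n (b - a)
  D-flip a b = D-comb₁ (- + 1) (ring-252 a b)

  congruent-< : ∀ {n a b} → a < n → b < n → D n (+ a - + b) → a ≡ b
  congruent-< {n} {a} {b} la lb d with ≤-total a b
  ... | inj₁ le = ≤-antisym le (m∸n≡0⇒m≤n (D-small (D-minus {n} le (D-flip (+ a) (+ b) d)) (≤-<-trans (m∸n≤m b a) lb)))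
  ... | inj₂ le = ≤-antisym (m∸n≡0⇒m≤n (D-small (D-minus {n} le d) (≤-<-trans (m∸n≤m a b) la))) le

  congruent-<2 : ∀ {n a b} → a < n ℕ.+ n → b < n → D n (+ a - + b) → a ≡ b ⊎ a ≡ n ℕ.+ b
  congruent-<2 {n} {a} {b} la lb d with n ≤? a
  ... | no gt = inj₁ (congruent-< (≰⇒> gt) lb d)
  ... | yes le = inj₂ (trans (sym (m+[n∸m]≡n le)) (cong (n ℕ.+_) (congruent-< (+-cancelˡ-< n _ _ (≤-<-trans (≤-reflexive (m+[n∸m]≡n le)) la)) lb
      (D-comb₂ (+ 1) (- + 1) (trans (cong (ℤ._- + b) (sym (trans (ℤ.m-n≡m⊖n a n) (ℤ.⊖-≥ le)))) (ring-253 (+ a) (+ n) (+ b))) d (divides (+ 1) (sym (ℤ.*-identityˡ (+ n))))))))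
module _ {A : Set} (f : A → ℤ) (n : ℕ) .{{_ : ℕ.NonZero n}} where

  sums : ℤ → List A → List ℤ
  sums s [] = s ∷ []
  sums s (a ∷ as) = s ∷ sums (s + f a) as

  opaque
    sums-length : ∀ s as → length (sums s as) ≡ suc (length as)
    sums-length s [] = refl
    sums-length s (a ∷ as) = cong suc (sums-length (s + f a) as)

    prefix? : ∀ s₀ s as → (∃[ y ] ∃[ z ] as ≡ y ++ z × D n (s₀ - (s + sumℤ (map f y)))) ⊎ All (λ v → ¬ D n (s₀ - v)) (sums s as)
    prefix? s₀ s as with (+ n) Sg.∣? (s₀ - s)
    prefix? s₀ s as | yes d = inj₁ ([] , as , refl , subst (λ v → D n (s₀ - v)) (sym (ℤ.+-identityʳ s)) d)
    prefix? s₀ s [] | no nd = inj₂ (nd ∷ [])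
    prefix? s₀ s (a ∷ as) | no nd with prefix? s₀ (s + f a) as
    ... | inj₁ (y , z , e , d) = inj₁ (a ∷ y , z , cong (a ∷_) e , subst (λ v → D n (s₀ - v)) (ℤ.+-assoc s (f a) (sumℤ (map f y))) d)
    ... | inj₂ p = inj₂ (nd ∷ p)

    segment? : ∀ s as → (∃[ x ] ∃[ y ] ∃[ z ] as ≡ x ++ (y ++ z) × 1 ≤ length y × D n (sumℤ (map f y))) ⊎ AllPairs (λ u v → ¬ D n (u - v)) (sums s as)
    segment? s [] = inj₂ ([] ∷ [])
    segment? s (a ∷ as) with prefix? s (s + f a) as
    ... | inj₁ (y , z , e , d) = inj₁ ([] , a ∷ y , z , cong (a ∷_) e , s≤s z≤n , D-comb₁ (- + 1) (ring-235 s (f a) (sumℤ (map f y))) d)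
    ... | inj₂ p with segment? (s + f a) as
    ... | inj₁ (x , y , z , e , l , d) = inj₁ (a ∷ x , y , z , cong (a ∷_) e , l , d)
    ... | inj₂ q = inj₂ (p ∷ q)

    -- D(C_n) ≤ n
    zero-segment : ∀ as → n ≤ length as → ∃[ x ] ∃[ y ] ∃[ z ] as ≡ x ++ (y ++ z) × 1 ≤ length y × D n (sumℤ (map f y))
    zero-segment as le with segment? (+ 0) as
    ... | inj₁ r = r
    -- There are at least n + 1 prefix sums, too many to be pairwise incongruent modulo n.
    ... | inj₂ p = ⊥-elim (<⇒≱ (s≤s le) (subst (_≤ n) (sums-length (+ 0) as) (incongruent-length n (sums (+ 0) as) p)))
opaque
  interval-multiple : ∀ {n a b c} → a < n → b < n → c < n → D n ((+ a + + b) - + c) → + a + + b ≡ + c ⊎ + a + + b ≡ + n + + c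
  interval-multiple {n} {a} {b} {c} la lb lc d = conclude (congruent-<2 {n} {a ℕ.+ b} {c} (+-mono-< la lb) lc d)
    where
    conclude : a ℕ.+ b ≡ c ⊎ a ℕ.+ b ≡ n ℕ.+ c → + a + + b ≡ + c ⊎ + a + + b ≡ + n + + c
    conclude (inj₁ e) = inj₁ (cong +_ e)
    conclude (inj₂ e) = inj₂ (cong +_ e)
opaque
  sum-nonneg-zero : ∀ xs → All (+ 0 ℤ.≤_) xs → sumℤ xs ≡ + 0 → All (_≡ + 0) xs
  sum-nonneg-zero [] [] _ = []
  sum-nonneg-zero (x ∷ xs) (p ∷ ps) e = x≡0 ∷ sum-nonneg-zero xs ps (trans (sym (ℤ.+-identityˡ _)) (trans (cong (ℤ._+ sumℤ xs) (sym x≡0)) e))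
    where
    nonneg : ∀ {xs} → All (+ 0 ℤ.≤_) xs → + 0 ℤ.≤ sumℤ xs
    nonneg [] = ℤ.≤-refl
    nonneg (p ∷ ps) = 0≤-+ p (nonneg ps)
    x≡0 : x ≡ + 0
    x≡0 = ℤ.≤-antisym (≤-cert₁ (trans (ring-236 x (sumℤ xs)) (cong (λ z → (sumℤ xs - + 0) - z) e)) (subst (_ ℤ.≤_) (sym (ℤ.+-identityʳ _)) (nonneg ps))) p

  -- The k differences between k d and the total are nonnegative and add up to zero, so each of them
  -- vanishes.
  above-mean : ∀ k ds → + length ds ≡ k → All (λ d → sumℤ ds ℤ.≤ k * d) ds → All (λ d → k * d ≡ sumℤ ds) ds
  above-mean k ds e ps = All.map (λ {d} p → ℤ.i-j≡0⇒i≡j (k * d) (sumℤ ds) p) (All.map⁻ (sum-nonneg-zero (map (λ d → k * d - sumℤ ds) ds)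
      (All.map⁺ (All.map ℤ.i≤j⇒0≤j-i ps)) (trans (total ds (sumℤ ds)) (trans (cong (λ z → k * sumℤ ds - z * sumℤ ds) e) (ℤ.+-inverseʳ (k * sumℤ ds))))))
    where
    total : ∀ xs s → sumℤ (map (λ d → k * d - s) xs) ≡ k * sumℤ xs - (+ length xs) * s
    total [] s = ring-237 k s
    total (x ∷ xs) s = trans (cong (λ z → (k * x - s) + z) (total xs s)) (ring-238 k x s (sumℤ xs) (+ length xs))

  sumℤ-shift : ∀ d ws → sumℤ (map (λ w → w + d) ws) ≡ sumℤ ws + (+ length ws) * d
  sumℤ-shift d [] = ring-254 d
  sumℤ-shift d (w ∷ ws) = trans (cong (λ z → (w + d) + z) (sumℤ-shift d ws)) (ring-255 w d (sumℤ ws) (+ length ws))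

  sumℤ-nonneg : ∀ {xs} → All (+ 0 ℤ.≤_) xs → + 0 ℤ.≤ sumℤ xs
  sumℤ-nonneg [] = ℤ.≤-refl
  sumℤ-nonneg (p ∷ ps) = 0≤-+ p (sumℤ-nonneg ps)

  neg-sum : ∀ xs → sumℤ (map ℤ.-_ xs) ≡ - sumℤ xs
  neg-sum [] = refl
  neg-sum (x ∷ xs) = trans (cong (λ z → - x + z) (neg-sum xs)) (sym (ℤ.neg-distrib-+ x (sumℤ xs)))

  D-positive : ∀ {k S} → + 0 ℤ.≤ S → D (suc k) (+ 1 + S) → + k ℤ.≤ S
  D-positive {k} {+ s} _ d = ℤ.+≤+ (≤-pred (ℕ.∣⇒≤ (Sg.∣⇒∣ᵤ d)))
opaque
  drop-take-++ : ∀ {A : Set} k (xs : List A) → xs ≡ take k xs ++ drop k xs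
  drop-take-++ k xs = sym (List.take++drop≡id k xs)

  take-++-≤ : ∀ {A : Set} i (xs ys : List A) → i ≤ length xs → take i (xs ++ ys) ≡ take i xs
  take-++-≤ zero xs ys _ = refl
  take-++-≤ (suc i) (x ∷ xs) ys (s≤s le) = cong (x ∷_) (take-++-≤ i xs ys le)

  take-++-+ : ∀ {A : Set} j (xs ys : List A) → take (length xs ℕ.+ j) (xs ++ ys) ≡ xs ++ take j ys
  take-++-+ j [] ys = refl
  take-++-+ j (x ∷ xs) ys = cong (x ∷_) (take-++-+ j xs ys)

  drop-++-≤ : ∀ {A : Set} i (xs ys : List A) → i ≤ length xs → drop i (xs ++ ys) ≡ drop i xs ++ ys
  drop-++-≤ zero xs ys _ = refl
  drop-++-≤ (suc i) (x ∷ xs) ys (s≤s le) = drop-++-≤ i xs ys le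

  drop-head : ∀ {A : Set} i (xs : List A) → i < length xs → ∃[ x ] x ∈ xs × drop i xs ≡ x ∷ drop (suc i) xs
  drop-head zero (x ∷ xs) _ = x , here refl , refl
  drop-head (suc i) (x ∷ xs) (s≤s lt) = let (y , p , e) = drop-head i xs lt in y , there p , e

  length-drop-+ : ∀ {A : Set} i (xs : List A) {n} → length xs ≡ n → i ≤ n → i ℕ.+ length (drop i xs) ≡ n
  length-drop-+ i xs refl le = trans (cong (i ℕ.+_) (List.length-drop i xs)) (m+[n∸m]≡n le)
opaque
  sum-≤0 : ∀ {xs} → All (ℤ._≤ + 0) xs → sumℤ xs ℤ.≤ + 0
  sum-≤0 [] = ℤ.≤-refl
  sum-≤0 (p ∷ ps) = ℤ.+-mono-≤ p (sum-≤0 ps)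

  sum-≥ : ∀ {xs} c → All (c ℤ.≤_) xs → (+ length xs) * c ℤ.≤ sumℤ xs
  sum-≥ c [] = ℤ.≤-refl
  sum-≥ {x ∷ xs} c (p ∷ ps) = ≤-cert₂ (ring-256 x c (+ length xs) (sumℤ xs)) p (sum-≥ c ps)

  sorted-split : ∀ {x} xs ys → AllPairs ℤ._≤_ (xs ++ x ∷ ys) → All (ℤ._≤ x) xs × All (x ℤ.≤_) (x ∷ ys)
  sorted-split [] ys (p ∷ _) = [] , ℤ.≤-refl ∷ p
  sorted-split (z ∷ xs) ys (p ∷ ps) = let (a , b) = sorted-split xs ys ps in All.lookup p (∈-mid xs) ∷ a , b
    where
    ∈-mid : ∀ {x : ℤ} {ys} xs → x ∈ xs ++ x ∷ ys
    ∈-mid [] = here refl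
    ∈-mid (_ ∷ xs) = there (∈-mid xs)

  unit-sum : ∀ xs → All (+ 0 ℤ.≤_) xs → sumℤ xs ≡ + 1 → ∃[ ys ] xs ↭ + 1 ∷ ys × All (_≡ + 0) ys
  unit-sum [] _ ()
  unit-sum (+ 0 ∷ xs) (p ∷ ps) e = let (ys , q , z) = unit-sum xs ps (trans (sym (ℤ.+-identityˡ _)) e) in + 0 ∷ ys , Prop.trans (Prop.prep (+ 0) q) (Prop.swap (+ 0) (+ 1) Prop.refl) , refl ∷ z
  unit-sum (+ 1 ∷ xs) (p ∷ ps) e = xs , Prop.refl , sum-nonneg-zero xs ps (trans (ring-106 (sumℤ xs)) (cong (ℤ._- + 1) e))
  unit-sum (+ suc (suc x) ∷ xs) (p ∷ ps) e = ⊥-elim (absurd (sumℤ xs) (sumℤ-nonneg ps) e)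
    where
    absurd : ∀ s → + 0 ℤ.≤ s → + suc (suc x) + s ≡ + 1 → ⊥
    absurd (+ s) _ ()
-- A pair (b, x) will stand for the group element b·u - x·e₁; `Σb` and `Σλ` are the coefficients of
-- a sum of such elements.
Σb : List (ℕ × ℤ) → ℕ
Σb [] = 0
Σb ((b , _) ∷ ps) = b ℕ.+ Σb ps
Σλ : List (ℕ × ℤ) → ℤ
Σλ [] = + 0
Σλ ((_ , x) ∷ ps) = x + Σλ ps
opaque
  All-or : ∀ {A : Set} {Q : A → Set} {F : Set} {xs} → All (λ x → Q x ⊎ F) xs → All Q xs ⊎ F
  All-or [] = inj₁ []
  All-or (inj₂ f ∷ _) = inj₂ f
  All-or {Q = Q} {F} {x ∷ xs} (inj₁ q ∷ ps) = go (All-or ps)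
    where
    go : All Q xs ⊎ F → All Q (x ∷ xs) ⊎ F
    go (inj₁ qs) = inj₁ (q ∷ qs)
    go (inj₂ f) = inj₂ f
opaque
  Pointwise-split : ∀ {A B : Set} {R : A → B → Set} xs {ys zs} → Pointwise R zs (xs ++ ys) → ∃[ as ] ∃[ bs ] zs ≡ as ++ bs × Pointwise R as xs × Pointwise R bs ys
  Pointwise-split [] p = [] , _ , refl , [] , p
  Pointwise-split (x ∷ xs) (r ∷ p) = let (as , bs , e , q , s) = Pointwise-split xs p in _ ∷ as , bs , cong (_ ∷_) e , r ∷ q , s

  Pointwise-replicate : ∀ {A B : Set} {R : A → B → Set} k {b as} → Pointwise R as (replicate k b) → All (λ a → R a b) as × length as ≡ k
  Pointwise-replicate zero [] = [] , refl
  Pointwise-replicate (suc k) (r ∷ p) = let (a , l) = Pointwise-replicate k p in r ∷ a , cong suc l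

  Pointwise-map : ∀ {A B C : Set} {R : A → B → Set} (F : C → B) cs {as} → Pointwise R as (map F cs) → All (λ a → ∃[ c ] R a (F c)) as
  Pointwise-map F [] [] = []
  Pointwise-map F (c ∷ cs) (r ∷ p) = (c , r) ∷ Pointwise-map F cs p

  sumℤ-tabulate : ∀ {L} (x : Fin L → ℤ) → sumℤ (tabulate x) ≡ Σℤ x
  sumℤ-tabulate {zero} x = refl
  sumℤ-tabulate {suc L} x = cong (λ s → x Fin.zero + s) (sumℤ-tabulate (λ i → x (Fin.suc i)))
-- A finite search space: running through all divisions into a sublist and its complement decides
-- whether a short zero-sum exists.
splits : ∀ {A : Set} → List A → List (List A × List A)
splits [] = ([] , []) ∷ []
splits (x ∷ xs) = map (λ p → x ∷ proj₁ p , proj₂ p) (splits xs) ++ map (λ p → proj₁ p , x ∷ proj₂ p) (splits xs)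
opaque
  splits-sound : ∀ {A : Set} (xs : List A) → All (λ p → xs ↭ proj₁ p ++ proj₂ p) (splits xs)
  splits-sound [] = Prop.refl ∷ []
  splits-sound (x ∷ xs) = All.++⁺ (All.map⁺ (All.map (Prop.prep x) (splits-sound xs)))
    (All.map⁺ (All.map (λ {p} q → Prop.trans (Prop.prep x q) (Prop.↭-sym (Prop.shift x (proj₁ p) (proj₂ p)))) (splits-sound xs)))

  splits-complete : ∀ {A : Set} {xs zs : List A} → zs ⊆ xs → ∃[ ws ] (zs , ws) ∈ splits xs
  splits-complete [] = [] , here refl
  splits-complete {xs = x ∷ xs} (_ ∷ʳ p) = let (ws , q) = splits-complete p in x ∷ ws , ∈-++⁺ʳ (map (λ p → x ∷ proj₁ p , proj₂ p) (splits xs)) (∈-map⁺ (λ p → proj₁ p , x ∷ proj₂ p) q)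
  splits-complete {xs = x ∷ xs} (refl ∷ p) = let (ws , q) = splits-complete p in ws , ∈-++⁺ˡ (∈-map⁺ (λ p → x ∷ proj₁ p , proj₂ p) q)

  ↭-interchange : ∀ {A : Set} (a b c d : List A) → (a ++ b) ++ (c ++ d) ↭ (a ++ c) ++ (b ++ d)
  ↭-interchange a b c d = Prop.trans (Prop.↭-reflexive (List.++-assoc a b (c ++ d)))
      (Prop.trans (Prop.++⁺ˡ a (Prop.shifts b c)) (Prop.↭-reflexive (sym (List.++-assoc a c (b ++ d)))))

  take-↭ : ∀ {A : Set} j (xs : List A) → xs ↭ take j xs ++ drop j xs
  take-↭ j xs = Prop.↭-reflexive (sym (List.take++drop≡id j xs))

  least-of-three : ∀ a b k → ∃[ c ] c ≤ a × c ≤ b × c ≤ k × (c ≡ k ⊎ c ≡ a ⊎ c ≡ b)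
  least-of-three a b k = go (≤-total a b) (≤-total a k) (≤-total b k)
    where
    go : a ≤ b ⊎ b ≤ a → a ≤ k ⊎ k ≤ a → b ≤ k ⊎ k ≤ b → ∃[ c ] c ≤ a × c ≤ b × c ≤ k × (c ≡ k ⊎ c ≡ a ⊎ c ≡ b)
    go (inj₁ p) (inj₁ q) _ = a , ≤-refl , p , q , inj₂ (inj₁ refl)
    go (inj₁ p) (inj₂ q) _ = k , q , ≤-trans q p , ≤-refl , inj₁ refl
    go (inj₂ p) _ (inj₁ q) = b , p , ≤-refl , q , inj₂ (inj₂ refl)
    go (inj₂ p) _ (inj₂ q) = k , ≤-trans q p , q , ≤-refl , inj₁ refl

-- Splitting S into m - 1 blocks and a residual sequence.

module Main (n′ m′ : ℕ) where

  n m : ℕ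
  n = 2 ℕ.+ n′
  m = 2 ℕ.+ m′

  open Quot n m public

  free-length : ∀ {as} → All (_~ 0G) as → Free as → length as < m
  free-length {as} zs fr = subst (_≤ m) (negPrefixes-length 0G as)
    (kernel-length (negPrefixes 0G as) (negPrefixes-~ P.≈-refl zs) (negPrefixes-distinct 0G fr))

  sub-concat : ∀ {zs ys} → ys ⊆ zs → Sub (concat ys) (concat zs)
  sub-concat [] = sub-refl
  sub-concat (z ∷ʳ p) = sub-++ʳ z (sub-concat p)
  sub-concat (refl ∷ p) = sub-++ sub-refl (sub-concat p)

  record Decomposition (k : ℕ) (S : List Elt) : Set where
    field
      Ts : List (List Elt)
      R : List Elt
      S≋ : S ≋ concat Ts ++ R
      Ts-length : length Ts ≡ suc m′
      T-length : All (λ T → length T ≡ n) Ts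
      T~0 : All (λ T → σ T ~ 0G) Ts
      R-length : suc (suc (length R)) ≡ 2 ℕ.* n ℕ.+ k
      R-free : ∀ Z → P.Sub Z R → 1 ≤ length Z → length Z ℕ.+ suc k ≤ 2 ℕ.* n → ¬ σ Z ~ 0G
      h : Elt
      h-gen : Generator h
      T≈h : All (λ T → σ T ≈ h) Ts
      -- Together with m - 2 blocks such a Z is too short to allow zero-sums, which pins down its sum.
      sum≈h : ∀ {T} → T ∈ Ts → ∀ Z → Sub Z (T ++ R) → 1 ≤ length Z → length Z ℕ.+ suc k ≤ 3 ℕ.* n → σ Z ~ 0G → σ Z ≈ h
      not-short : ∀ {T} → T ∈ Ts → ∀ Z → Sub Z (T ++ R) → 1 ≤ length Z → σ Z ~ 0G → n ≤ length Z

  module _ (k : ℕ) (k≤ : k ≤ suc n′) (short : Short n k) (S : List Elt)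
      (S-length : length S ≡ m ℕ.* n ℕ.+ n ∸ 2 ℕ.+ k) (S-free : ZeroFree (m ℕ.* n ℕ.+ n ∸ 1 ∸ k) S) where

    private
      S-length′ : suc (suc (length S)) ≡ (3 ℕ.+ m′) ℕ.* n ℕ.+ k
      S-length′ = trans (cong (suc ∘ suc) S-length) (cong (ℕ._+ k) (+-comm (m ℕ.* n) n))

      bound : ∀ {l} → l ℕ.+ suc k ≤ (3 ℕ.+ m′) ℕ.* n → l ≤ m ℕ.* n ℕ.+ n ∸ 1 ∸ k
      bound {l} le = +-cancelʳ-≤ k _ _ (≤-trans (≤-pred (≤-trans (≤-reflexive (sym (+-suc l k)))
          (≤-trans le (≤-reflexive (+-comm n (m ℕ.* n)))))) (≤-reflexive (sym (m∸n+n≡m k≤′))))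
        where
        k≤′ : k ≤ m ℕ.* n ℕ.+ n ∸ 1
        k≤′ = ≤-trans k≤ (≤-pred (m≤n+m n (m ℕ.* n)))

      -- A vanishing subsum of the sums of disjoint pieces would join some of these pieces to a
      -- zero-sum of S, and the bound on the total length makes it short.
      family : ∀ Zs → Sub (concat Zs) S → All (λ z → 1 ≤ length z) Zs → length (concat Zs) ℕ.+ suc k ≤ (3 ℕ.+ m′) ℕ.* n →
        Free (map σ Zs)
      family Zs sub ne le y y⊆ 1≤ e with ⊆-map σ Zs y⊆
      ... | Ys , q , refl = S-free (concat Ys) (sub-trans (sub-concat q) sub) (nonempty Ys (Sub.All-resp-⊆ q ne) 1≤)
              (bound (≤-trans (+-monoˡ-≤ (suc k) (sub-length (sub-concat q))) le))
              (≈-trans (≈-reflexive (σ-concat Ys)) e)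
        where
        nonempty : ∀ Ys → All (λ z → 1 ≤ length z) Ys → 1 ≤ length (map σ Ys) → 1 ≤ length (concat Ys)
        nonempty (Y ∷ Ys) (p ∷ ps) _ = ≤-trans p (≤-trans (m≤m+n _ _) (≤-reflexive (sym (List.length-++ Y))))

    opaque
      -- A short zero-sum of R together with the m - 1 blocks would give m elements forming a
      -- zero-sum free sequence in a cyclic group of order m. Hence R contains none, `short` bounds
      -- its length from above, and comparison with |S| forces every block to have length exactly n.
      decompose : Decomposition k S
      decompose with extract id (eta-bound n) (suc m′) S (≤-trans (m≤m+n _ k) (≤-reflexive (sym S-length′)))
      ... | bs , R , bs-len , pm = record
        { Ts = Ts ; R = R ; S≋ = S≋ ; Ts-length = Ts-length ; T-length = T-length ; T~0 = T~0 ; R-length = R-length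
        ; R-free = R-free ; h = h ; h-gen = record { h~0 = h~0 ; order = order } ; T≈h = All.tabulate T≈h
        ; sum≈h = sum≈h ; not-short = not-short }
        where
        Ts : List (List Elt)
        Ts = map proj₁ bs
        Ts-length : length Ts ≡ suc m′
        Ts-length = trans (List.length-map proj₁ bs) bs-len
        S≋ : S ≋ concat Ts ++ R
        S≋ = ↭⇒≋ pm
        blocks : ∀ (bs : List (Block {A = Elt} id n n)) → All (λ T → 1 ≤ length T) (map proj₁ bs) × All (λ T → length T ≤ n) (map proj₁ bs) × All (λ T → σ T ~ 0G) (map proj₁ bs)
        blocks [] = [] , [] , []
        blocks ((z , a , b , c) ∷ bs) with blocks bs
        ... | x , y , w = a ∷ x , b ∷ y , Zero²⇒~ (subst (Zero² n) (cong σ (List.map-id z)) c) ∷ w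
        T-nonempty : All (λ T → 1 ≤ length T) Ts
        T-nonempty = proj₁ (blocks bs)
        T-length≤ : All (λ T → length T ≤ n) Ts
        T-length≤ = proj₁ (proj₂ (blocks bs))
        T~0 : All (λ T → σ T ~ 0G) Ts
        T~0 = proj₂ (proj₂ (blocks bs))

        R-free : ∀ Z → P.Sub Z R → 1 ≤ length Z → length Z ℕ.+ suc k ≤ 2 ℕ.* n → ¬ σ Z ~ 0G
        R-free Z (Z′ , p) 1≤ le z with P.⊆-resp-≋ p (++-⊆ Z Z′)
        ... | Y , q , r = <⇒≱ (free-length (y ∷ All.map⁺ T~0)
                (family (Y ∷ Ts) sub (1≤′ ∷ T-nonempty) le′))
                (≤-reflexive (cong suc (sym (trans (List.length-map σ Ts) Ts-length))))
          where
          lenY : length Y ≡ length Z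
          lenY = P.≋-length r
          y : σ Y ~ 0G
          y = P.≈-trans (P.σ-resp r) z
          1≤′ : 1 ≤ length Y
          1≤′ = subst (1 ≤_) (sym lenY) 1≤
          sub : Sub (Y ++ concat Ts) S
          sub = sub-respʳ (≋-sym S≋) (sub-respʳ (++-comm R (concat Ts)) (sub-++ (proj₁ (⊆⇒↭ q) , ↭⇒≋ (proj₂ (⊆⇒↭ q))) sub-refl))
          le′ : length (Y ++ concat Ts) ℕ.+ suc k ≤ (3 ℕ.+ m′) ℕ.* n
          le′ = ≤-trans (≤-reflexive (trans (cong (ℕ._+ suc k) (trans (List.length-++ Y) (cong (ℕ._+ length (concat Ts)) lenY))) (shuffle₁ (length Z) (length (concat Ts)) (suc k))))
            (≤-trans (+-mono-≤ le (length-concat-≤ T-length≤)) (≤-reflexive (trans (cong (λ x → 2 ℕ.* n ℕ.+ x ℕ.* n) Ts-length) (shuffle₂ m′ n))))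

        R-length≤ : suc (suc (length R)) ≤ 2 ℕ.* n ℕ.+ k
        R-length≤ with suc (suc (length R)) ≤? 2 ℕ.* n ℕ.+ k
        ... | yes le = le
        ... | no gt with short R (≤-pred (≰⇒> gt))
        ... | Z , Z′ , p , 1≤ , le , z = ⊥-elim (R-free Z (Z′ , P.↭⇒≋ p) 1≤ le z)

        total : length (concat Ts) ℕ.+ suc (suc (length R)) ≡ suc m′ ℕ.* n ℕ.+ (2 ℕ.* n ℕ.+ k)
        total = trans (trans (+-suc _ _) (cong suc (+-suc _ _)))
          (trans (cong (suc ∘ suc) (trans (sym (List.length-++ (concat Ts))) (sym (≋-length S≋)))) (trans S-length′ (shuffle₃ m′ n k)))

        T-length : All (λ T → length T ≡ n) Ts
        T-length = length-concat-tight T-length≤ (subst (λ l → l ℕ.* n ≤ length (concat Ts)) (sym Ts-length)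
          (+-cancelʳ-≤ (2 ℕ.* n ℕ.+ k) _ _ (≤-trans (≤-reflexive (sym total)) (+-monoʳ-≤ (length (concat Ts)) R-length≤))))

        R-length : suc (suc (length R)) ≡ 2 ℕ.* n ℕ.+ k
        R-length = ≤-antisym R-length≤ (+-cancelˡ-≤ (suc m′ ℕ.* n) _ _ (≤-trans (≤-reflexive (sym total))
          (+-monoˡ-≤ _ (subst (λ l → length (concat Ts) ≤ l ℕ.* n) Ts-length (length-concat-≤ T-length≤)))))

        first : ∃[ T ] T ∈ Ts
        first with Ts | Ts-length
        ... | T ∷ _ | _ = T , here refl

        h : Elt
        h = σ (proj₁ first)

        h~0 : h ~ 0G
        h~0 = All.lookup T~0 (proj₂ first)

        nonempty′ : ∀ {Us} → Ts ↭ Us → All (λ T → 1 ≤ length T) Us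
        nonempty′ p = Prop.All-resp-↭ p T-nonempty
        zero′ : ∀ {Us} → Ts ↭ Us → All (_~ 0G) (map σ Us)
        zero′ p = All.map⁺ (Prop.All-resp-↭ p T~0)

        Ts-free : ∀ {Us} → Ts ↭ Us → Free (map σ Us)
        Ts-free {Us} p = family Us (sub-respʳ (≋-sym S≋) (sub-++ˡ R (sub-≋ (↭⇒≋ (Prop.↭-sym (concat-↭ p)))))) (nonempty′ p)
          (≤-trans (+-mono-≤ (≤-trans (≤-reflexive (sym (Prop.↭-length (concat-↭ p)))) (subst (λ l → length (concat Ts) ≤ l ℕ.* n) Ts-length (length-concat-≤ T-length≤)))
             (≤-trans (s≤s k≤) (m≤m+n n (n ℕ.+ 0))))
            (≤-reflexive (trans (+-comm (suc m′ ℕ.* n) (2 ℕ.* n)) (shuffle₂ m′ n))))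

        -- The block sums form a zero-sum free sequence of the extremal length m - 1 in a cyclic
        -- group of order m, and such a sequence is constant.
        T≈h : ∀ {T} → T ∈ Ts → σ T ≈ h
        T≈h {T} T∈ with ∈∈⇒↭ T∈ (proj₂ first)
        ... | inj₁ refl = ≈-refl
        ... | inj₂ (Us , p) = free-pair-≈ (zero′ p)
                (cong suc (trans (sym Ts-length) (trans (Prop.↭-length p) (cong (suc ∘ suc) (sym (List.length-map σ Us)))))) (Ts-free p)

        order : ∀ j → 1 ≤ j → j < m → ¬ (+ j) · h ≈ 0G
        order j 1≤ lt e = Ts-free Prop.refl (take j (map σ Ts)) (Sub.take-⊆ j (map σ Ts))
            (subst (1 ≤_) (sym len) 1≤) (≈-trans (≈-trans (sum j (map σ Ts) (All.map⁺ (All.tabulate T≈h))) (≈-reflexive (cong (λ l → (+ l) · h) len))) e)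
          where
          len : length (take j (map σ Ts)) ≡ j
          len = length-take-≤ j (map σ Ts) (subst (j ≤_) (sym (trans (List.length-map σ Ts) Ts-length)) (≤-pred lt))
          sum : ∀ j as → All (_≈ h) as → σ (take j as) ≈ (+ length (take j as)) · h
          sum zero as _ = ≈-refl
          sum (suc j) [] _ = ≈-refl
          sum (suc j) (a ∷ as) (p ∷ ps) = ≈-trans (⊕-cong p (sum j as ps)) (≈-reflexive (trans (cong (h ⊕_) (sym (σ-replicate (length (take j as)) h))) (σ-replicate (suc (length (take j as))) h)))

        sum≈h : ∀ {T} → T ∈ Ts → ∀ Z → Sub Z (T ++ R) → 1 ≤ length Z → length Z ℕ.+ suc k ≤ 3 ℕ.* n → σ Z ~ 0G → σ Z ≈ h
        sum≈h {T} T∈ Z sub 1≤ le z with ∈⇒↭ T∈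
        ... | Us , p = ≈-trans (free-heads-≈ (z ∷ zero′ p) (cong suc (trans (sym Ts-length) (trans (Prop.↭-length p) (cong suc (sym (List.length-map σ Us))))))
                 (family (Z ∷ Us) sub′ (1≤ ∷ All.tail (nonempty′ p)) le′) (Ts-free p)) (T≈h T∈)
          where
          sub′ : Sub (Z ++ concat Us) S
          sub′ = sub-respʳ (≋-sym (≋-trans S≋ (≋-trans (++⁺ʳ R (↭⇒≋ (concat-↭ p))) (≋-trans (≋-reflexive (List.++-assoc T (concat Us) R))
            (≋-trans (++⁺ˡ T (++-comm (concat Us) R)) (≋-reflexive (sym (List.++-assoc T R (concat Us))))))))) (sub-++ sub sub-refl)
          Us-length : suc (length Us) ≡ suc m′
          Us-length = trans (sym (Prop.↭-length p)) Ts-length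
          le′ : length (Z ++ concat Us) ℕ.+ suc k ≤ (3 ℕ.+ m′) ℕ.* n
          le′ = ≤-trans (≤-reflexive (trans (cong (ℕ._+ suc k) (List.length-++ Z)) (shuffle₁ (length Z) (length (concat Us)) (suc k))))
            (≤-trans (+-mono-≤ le (length-concat-≤ (All.tail (Prop.All-resp-↭ p T-length≤))))
              (≤-reflexive (trans (cong (λ x → 3 ℕ.* n ℕ.+ x ℕ.* n) (suc-injective Us-length)) (sym (*-distribʳ-+ n 3 m′)))))

        -- If |Z| < n, the complement of Z in T R has at least 2n - 1 + k terms and contains another
        -- short zero-sum Y. Then Z, Y and their union all have sum h, so h = 2h, against the order
        -- of h.
        not-short : ∀ {T} → T ∈ Ts → ∀ Z → Sub Z (T ++ R) → 1 ≤ length Z → σ Z ~ 0G → n ≤ length Z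
        not-short {T} T∈ Z sub@(Z′ , p) 1≤ z with n ≤? length Z
        ... | yes le = le
        ... | no gt with short Z′ long
          where
          lens : length Z ℕ.+ suc (suc (length Z′)) ≡ n ℕ.+ (2 ℕ.* n ℕ.+ k)
          lens = trans (trans (+-suc _ _) (cong suc (+-suc _ _))) (trans (cong (suc ∘ suc) (trans (sym (List.length-++ Z)) (trans (sym (≋-length p)) (List.length-++ T))))
            (trans (sym (trans (+-suc _ _) (cong suc (+-suc _ _)))) (cong₂ ℕ._+_ (All.lookup T-length T∈) R-length)))
          long : 2 ℕ.* n ℕ.+ k ≤ suc (length Z′)
          long = ≤-pred (+-cancelˡ-≤ (suc n′) _ _ (≤-trans (≤-reflexive (+-suc (suc n′) _)) (≤-trans (≤-reflexive (sym lens)) (+-monoˡ-≤ _ (≤-pred (≰⇒> gt))))))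
        ... | Y , Y′ , q , 1≤Y , leY , y = ⊥-elim (order 1 (s≤s z≤n) (s≤s (s≤s z≤n)) (absurd (sum≈h T∈ Z sub 1≤ leZ z) (sum≈h T∈ Y subY 1≤Y leY′ y)
                 (subst (_≈ h) (σ-++ Z Y) (sum≈h T∈ (Z ++ Y) subZY (≤-trans 1≤ (≤-trans (m≤m+n _ _) (≤-reflexive (sym (List.length-++ Z))))) leZY
                    (subst (_~ 0G) (sym (σ-++ Z Y)) (~-⊕ z y))))))
          where
          Z≤ : length Z ≤ suc n′
          Z≤ = ≤-pred (≰⇒> gt)
          subZY : Sub (Z ++ Y) (T ++ R)
          subZY = Y′ , ≋-trans p (≋-trans (++⁺ˡ Z (↭⇒≋ q)) (≋-reflexive (sym (List.++-assoc Z Y Y′))))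
          subY : Sub Y (T ++ R)
          subY = sub-respʳ (≋-sym p) (sub-++ʳ Z (Y′ , ↭⇒≋ q))
          leZ : length Z ℕ.+ suc k ≤ 3 ℕ.* n
          leZ = ≤-trans (+-mono-≤ (≤-trans Z≤ (n≤1+n _)) (s≤s k≤)) (+-monoʳ-≤ n (m≤m+n n (n ℕ.+ 0)))
          leY′ : length Y ℕ.+ suc k ≤ 3 ℕ.* n
          leY′ = ≤-trans leY (*-monoˡ-≤ n {2} {3} (n≤1+n 2))
          leZY : length (Z ++ Y) ℕ.+ suc k ≤ 3 ℕ.* n
          leZY = ≤-trans (≤-reflexive (trans (cong (ℕ._+ suc k) (List.length-++ Z)) (+-assoc (length Z) _ _)))
            (+-mono-≤ (≤-trans Z≤ (n≤1+n _)) leY)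
          absurd : ∀ {z y h} → z ≈ h → y ≈ h → z ⊕ y ≈ h → (+ 1) · h ≈ 0G
          absurd {z} {y} {h} = comb₃ (- + 1) (- + 1) (+ 1) (both₃ ring-20 z y h)

  -- Bases of the quotient and their lifts to G.

  record PhiBasis (e₁ e₂ : Elt) : Set where
    field
      gen : ∀ g → ∃[ a ] ∃[ b ] g ~ a · e₁ ⊕ b · e₂
      indep : ∀ {a b} → a · e₁ ⊕ b · e₂ ~ 0G → D n a × D n b

  opaque
    fromHasOrder : ∀ {g} → HasOrder n 1 g n → ∀ {c} → c · g ~ 0G → D n c
    fromHasOrder {g} (_ , z , mn) {c} p with residue n c
    ... | zero , _ , d = subst (D n) (ℤ.+-identityʳ c) d
    ... | suc r , lt , divides q e = ⊥-elim (<⇒≱ lt (mn (suc r) (s≤s z≤n) (P.un {(+ suc r) · g} {0G} (P.comb₂ (+ 1) (- q)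
            (both₁ s′ g) p (P.mk {(+ n) · g} {0G} z)))))
      where
      s′ : ∀ x → (+ suc r) * x - + 0 ≡ + 1 * (c * x - + 0) + - q * ((+ n) * x - + 0)
      s′ x = trans (ring-239 (+ suc r) c q (+ n) x) (trans (cong (λ z → + 1 * (c * x - + 0) + - q * ((+ n) * x - + 0) + z * x)
         (trans (cong (λ z → q * + n - z) e) (ℤ.+-inverseʳ (q * + n)))) (ℤ.+-identityʳ _))

    fromIsBasis : ∀ {e₁ e₂} → IsBasis n 1 e₁ e₂ → PhiBasis e₁ e₂
    fromIsBasis {e₁} {e₂} (g , ind , o₁ , o₂) = record
      { gen = λ x → proj₁ (g x) , proj₁ (proj₂ (g x)) , P.mk {x} {proj₁ (g x) · e₁ ⊕ proj₁ (proj₂ (g x)) · e₂} (proj₂ (proj₂ (g x)))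
      ; indep = λ {a} {b} p → let q = P.mk {a · e₁} {0G} (ind a (- b) (P.un {a · e₁} {(- b) · e₂} (move a b p)))
                in fromHasOrder o₁ q , fromHasOrder (subst (HasOrder n 1 e₂) (*-identityˡ n) o₂) (rest a b p q) }
      where
      move : ∀ a b → a · e₁ ⊕ b · e₂ ~ 0G → a · e₁ ~ (- b) · e₂
      move a b = P.comb₁ (+ 1) (both₂ (ring-179 a b) e₁ e₂)
      rest : ∀ a b → a · e₁ ⊕ b · e₂ ~ 0G → a · e₁ ~ 0G → b · e₂ ~ 0G
      rest a b = P.comb₂ (+ 1) (- + 1) (both₂ (ring-180 a b) e₁ e₂)

    D⇒·~0 : ∀ {c} g → D n c → c · g ~ 0G
    D⇒·~0 {c} g (divides q e) = P.≈-trans (P.≈-reflexive (cong₂ _,_ (trans (cong (ℤ._* proj₁ g) e) (ℤ.*-assoc q (+ n) (proj₁ g))) (trans (cong (ℤ._* proj₂ g) e) (ℤ.*-assoc q (+ n) (proj₂ g)))))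
      (P.≈-trans (P.·-cong q (n·~0 g)) (P.≈-reflexive (cong₂ _,_ (ℤ.*-zeroʳ q) (ℤ.*-zeroʳ q))))

    D⇒·~ : ∀ {a b} g → D n (a - b) → a · g ~ b · g
    D⇒·~ {a} {b} g d = P.comb₁ (+ 1) (both₁ (ring-240 a b) g) (D⇒·~0 g d)

    D⇒·≈ : ∀ {a b g} → (+ n) · g ≈ 0G → D n (a - b) → a · g ≈ b · g
    D⇒·≈ {a} {b} {g} z (divides q e) = comb₁ q (both₁ s g) z
      where
      s : ∀ x → a * x - b * x ≡ q * ((+ n) * x - + 0)
      s x = trans (ring-230 a b x) (trans (cong (ℤ._* x) e) (ring-241 q (+ n) x))

    swap-basis : ∀ {e₁ e₂} → PhiBasis e₁ e₂ → PhiBasis e₂ e₁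
    swap-basis {e₁} {e₂} B = record
      { gen = λ g → let (a , b , p) = PhiBasis.gen B g in b , a , P.≈-trans p (P.≈-reflexive (comm a b))
      ; indep = λ {a} {b} p → let (x , y) = PhiBasis.indep B (P.≈-trans (P.≈-reflexive (comm b a)) p) in y , x }
      where
      comm : ∀ a b → a · e₁ ⊕ b · e₂ ≡ b · e₂ ⊕ a · e₁
      comm a b = ⊕-comm (a · e₁) (b · e₂)

    shear-basis : ∀ {e₁ e₂ f} x → PhiBasis e₁ e₂ → f ~ x · e₁ ⊕ e₂ → PhiBasis e₁ f
    shear-basis {e₁} {e₂} {f} x B q = record
      { gen = λ g → let (a , b , p) = PhiBasis.gen B g in a - b * x , b ,
            P.comb₂ (+ 1) (- b) (both₄ (ring-242 a b x) g e₁ e₂ f) p q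
      ; indep = λ {a} {b} p → let (u , v) = PhiBasis.indep B {a + b * x} {b}
                                    (P.comb₂ (+ 1) (- b) (both₃ (ring-243 a b x) e₁ e₂ f) p q)
                in D-comb₂ (+ 1) (- x) (ring-244 a b x) u v , v }

    resp-basis : ∀ {e₁ e₂ f} → PhiBasis e₁ e₂ → f ~ e₁ → PhiBasis f e₂
    resp-basis {e₁} {e₂} {f} B q = swap-basis (shear-basis (+ 0) (swap-basis B) (P.comb₁ (+ 1) (both₃ ring-245 f e₁ e₂) q))

    indep₁ : ∀ {e₁ e₂ a} → PhiBasis e₁ e₂ → a · e₁ ~ 0G → D n a
    indep₁ {e₁} {e₂} {a} B p = proj₁ (PhiBasis.indep B {a} {+ 0} (P.≈-trans (P.≈-reflexive (⊕-identityʳ (a · e₁))) p))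

  module _ {h : Elt} (G : Generator h) where
    open Generator G

    opaque
      order-n : ∀ {e₁ e₂} → PhiBasis e₁ e₂ → (+ n) · e₁ ≈ 0G → HasOrder n m e₁ n
      order-n {e₁} B z = s≤s z≤n , un {(+ n) · e₁} {0G} z , λ { (suc d) _ p → ℕ.∣⇒≤ (Sg.∣⇒∣ᵤ (indep₁ {a = + suc d} B (≈⇒~ (mk {(+ suc d) · e₁} {0G} p)))) }

      -- From d e₁ = 0 the quotient gives n | d; then (d/n) h = 0 gives m | d/n.
      order-mn : ∀ {e₁ e₂} → PhiBasis e₁ e₂ → (+ n) · e₁ ≈ h → HasOrder n m e₁ (m ℕ.* n)
      order-mn {e₁} B z = s≤s z≤n , un {(+ (m ℕ.* n)) · e₁} {0G} top , least
        where
        top : (+ (m ℕ.* n)) · e₁ ≈ 0G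
        top = comb₂ (+ m) (+ 1) (both₂ s e₁ h) z (m·≈0 h~0)
          where
          s : ∀ x h → (+ (m ℕ.* n)) * x - + 0 ≡ (+ m) * ((+ n) * x - h) + + 1 * ((+ m) * h - + 0)
          s x h = trans (cong (λ k → k * x - + 0) (ℤ.pos-* m n)) (ring-132 (+ m) (+ n) x h)
        least : ∀ d → 0 < d → Eq n m ((+ d) · e₁) 0G → m ℕ.* n ≤ d
        least (suc d) _ p with indep₁ {a = + suc d} B (≈⇒~ (mk {(+ suc d) · e₁} {0G} p))
        ... | divides q e = ℕ.∣⇒≤ (Sg.∣⇒∣ᵤ (subst (D (m ℕ.* n)) (sym e) (lift (divisor {q} (comb₂ (- q) (+ 1) (both₂ s e₁ h) z (mk {(+ suc d) · e₁} {0G} p))))))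
          where
          s : ∀ x h → q * h - + 0 ≡ - q * ((+ n) * x - h) + + 1 * ((+ suc d) * x - + 0)
          s x h = trans (ring-133 q (+ n) x h) (cong (λ k → - q * ((+ n) * x - h) + + 1 * (k * x - + 0)) (sym e))
          lift : D m q → D (m ℕ.* n) (q * + n)
          lift (divides w f) = divides w (trans (cong (ℤ._* + n) f) (trans (ℤ.*-assoc w (+ m) (+ n)) (cong (w ℤ.*_) (sym (ℤ.pos-* m n)))))

      -- A basis of the quotient reaches g up to an element of the kernel, which is a multiple of h
      -- = n f and hence again in the span.
      lift-gen : ∀ {e₁ e₂ f} → PhiBasis e₁ e₂ → ∀ a b → f ≈ a · e₁ ⊕ b · e₂ → (+ n) · f ≈ h →
        ∀ g → ∃[ x ] ∃[ y ] Eq n m g (x · e₁ ⊕ y · e₂)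
      lift-gen {e₁} {e₂} {f} B a b pf z g with PhiBasis.gen B g
      ... | x , y , p with generates {g ⊕ ⊖ (x · e₁ ⊕ y · e₂)} (P.comb₁ (+ 1) (both₂ ring-181 g (x · e₁ ⊕ y · e₂)) p)
      ... | c , q = x + c * + n * a , y + c * + n * b ,
            un {g} {(x + c * + n * a) · e₁ ⊕ (y + c * + n * b) · e₂} (comb₃ (+ 1) (- c) (c * + n) (both₅ (ring-182 x y a b c (+ n)) g e₁ e₂ h f) q z pf)

      isBasis : ∀ {e₁ e₂} → PhiBasis e₁ e₂ → (+ n) · e₁ ≈ 0G → (+ n) · e₂ ≈ h → IsBasis n m e₁ e₂
      isBasis {e₁} {e₂} B z₁ z₂ = lift-gen B (+ 0) (+ 1) (≈-reflexive (both₂ ring-183 e₁ e₂)) z₂ ,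
          (λ a b p → un {a · e₁} {0G} (ind a b (mk {a · e₁} {b · e₂} p))) , order-n B z₁ , order-mn (swap-basis B) z₂
        where
        ind : ∀ a b → a · e₁ ≈ b · e₂ → a · e₁ ≈ 0G
        ind a b p = ≈-trans (D⇒·≈ {a} {+ 0} z₁ (subst (D n) (sym (ℤ.+-identityʳ a)) (proj₁ (PhiBasis.indep B {a} { - b}
            (P.comb₁ (+ 1) (both₂ (ring-134 a b) e₁ e₂) (≈⇒~ p)))))) (≈-reflexive refl)

      isGoodGenSet : ∀ {g₁ g₂} → PhiBasis g₁ g₂ → (+ n) · (g₁ ⊕ g₂) ≈ h → IsGoodGenSet n m g₁ g₂
      isGoodGenSet {g₁} {g₂} B z = lift-gen B (+ 1) (+ 1) (≈-reflexive (both₂ ring-184 g₁ g₂)) z ,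
          order-mn (swap-basis (shear-basis (+ 1) B (P.≈-reflexive (both₂ ring-185 g₁ g₂)))) z

  opaque
    σ-const : ∀ {e L} → All (_~ e) L → σ L ~ (+ length L) · e
    σ-const [] = P.≈-refl
    σ-const {e} {x ∷ L} (p ∷ ps) = P.≈-trans (P.⊕-cong p (σ-const ps)) (P.≈-reflexive (trans (cong (e ⊕_) (sym (σ-replicate (length L) e))) (σ-replicate (suc (length L)) e)))

    const-≋ : ∀ {e L} → All (_≈ e) L → L ≋ replicate (length L) e
    const-≋ [] = ≋-refl
    const-≋ (p ∷ ps) = Perm.prep p (const-≋ ps)

  -- A block T together with the residual sequence E C: over C_n ⊕ C_n, E consists of n - 1 copies of e₁ and C lies in e₂ + ⟨e₁⟩.
  record Window (h e₁ e₂ : Elt) (E C T : List Elt) : Set where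
    field
      gen : Generator h
      B : PhiBasis e₁ e₂
      E-length : length E ≡ suc n′
      C-length : length C ≡ n
      T-length : length T ≡ n
      E~ : All (_~ e₁) E
      C∈ : All (λ c → ∃[ x ] c ~ x · e₁ ⊕ e₂) C
      σC~ : σ C ~ e₁
      σT≈ : σ T ≈ h
      sum≈h : ∀ Z → Sub Z (E ++ (C ++ T)) → 1 ≤ length Z → 2 ℕ.+ length Z ≤ 3 ℕ.* n → σ Z ~ 0G → σ Z ≈ h
      not-short : ∀ Z → Sub Z (E ++ (C ++ T)) → 1 ≤ length Z → σ Z ~ 0G → n ≤ length Z

  -- The case k = 1: coordinates and exchanges within one block.

  module Win {h e₁ e₂ E C T} (W : Window h e₁ e₂ E C T) (1≤n′ : 1 ≤ n′) where
    open Window W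
    open Generator gen

    InA : Elt → Set
    InA c = ∃[ x ] c ~ x · e₁ ⊕ e₂

    opaque
      h≉0 : ¬ h ≈ 0G
      h≉0 p = order 1 (s≤s z≤n) (s≤s (s≤s z≤n)) (comb₁ (+ 1) (both₁ ring-186 h) p)

      σT~0 : σ T ~ 0G
      σT~0 = P.≈-trans (≈⇒~ σT≈) h~0

      small : ∀ {x} → D n (+ x) → x < n → x ≡ 0
      small {zero} _ _ = refl
      small {suc x} d lt = ⊥-elim (<⇒≱ lt (ℕ.∣⇒≤ (Sg.∣⇒∣ᵤ d)))

      e₁≁0 : ∀ {x} → 1 ≤ x → x < n → ¬ (+ x) · e₁ ~ 0G
      e₁≁0 {x} 1≤ lt p with small (indep₁ {a = + x} B p) lt
      e₁≁0 {x} () lt p | refl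

      coord : ∀ t → ∃[ a ] ∃[ b ] b < n × t ~ a · e₁ ⊕ (+ b) · e₂
      coord t with PhiBasis.gen B t
      ... | a , b , p with residue n b
      ... | r , lt , d = a , r , lt , P.≈-trans p (P.⊕-cong {a · e₁} {a · e₁} {b · e₂} {(+ r) · e₂} P.≈-refl (D⇒·~ {b} {+ r} e₂ d))

      σ-InA : ∀ {I} → All InA I → ∃[ x ] σ I ~ x · e₁ ⊕ (+ length I) · e₂
      σ-InA [] = + 0 , P.≈-refl
      σ-InA {c ∷ I} ((x , p) ∷ ps) with σ-InA ps
      ... | y , q = x + y , P.≈-trans (P.⊕-cong {c} {x · e₁ ⊕ e₂} {σ I} {y · e₁ ⊕ (+ length I) · e₂} p q) (P.≈-reflexive (both₂ (ring-187 x y (+ length I)) e₁ e₂))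

      top-up : ∀ {s y} → s ~ y · e₁ → ∃[ x ] x < n × s ⊕ (+ x) · e₁ ~ 0G
      top-up {s} {y} p with residue n (- y)
      ... | x , lt , d = x , lt , P.comb₂ (+ 1) (+ 1) (both₂ (λ α β → ring-189 α y (+ x) β) s e₁) p (D⇒·~0 e₁ (D-comb₁ (- + 1) (ring-188 y (+ x)) d))

      line : ∀ {t a b I} → t ~ a · e₁ ⊕ (+ b) · e₂ → All InA I → b ℕ.+ length I ≡ n → ∃[ y ] σ (t ∷ I) ~ y · e₁
      line {t} {a} {b} {I} p q e with σ-InA q
      ... | x , r = a + x , P.comb₃ (+ 1) (+ 1) (+ 1)
            (both₄ (λ α β γ δ → ring-190 α β a (+ b) x (+ length I) γ δ) t (σ I) e₁ e₂)
            p r (D⇒·~0 {+ b + + length I} e₂ (divides (+ 1) (trans (cong +_ e) (sym (ℤ.*-identityˡ (+ n))))))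

      -- In the quotient n equal terms sum to 0, whereas C sums to e₁.
      C-not-const : ∀ {c} → ¬ All (_~ c) C
      C-not-const {c} p = e₁≁0 {1} (s≤s z≤n) (s≤s (s≤s z≤n)) (P.comb₃ (- + 1) (+ 1) (+ 1)
          (both₃ (λ α β γ → ring-191 α β (+ length C) γ) e₁ (σ C) c)
          σC~ (σ-const p) (subst (λ l → (+ l) · c ~ 0G) (sym C-length) (n·~0 c)))

    module NonConst {a b : Elt} {E″ : List Elt} (E≋ : E ≋ a ∷ b ∷ E″) (a≉b : ¬ a ≈ b) where

      opaque
        E″~ : All (_~ e₁) (a ∷ b ∷ E″)
        E″~ = All-resp-≋ (λ x≈y p → P.≈-trans (P.≈-sym (≈⇒~ x≈y)) p) E≋ E~

        -- A choice of x among the n - 1 lifts of e₁, with 1 ≤ x ≤ n - 2, can contain a and not b,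
        -- or b and not a, the rest being the same. Both choices complete Y to the sum h, so a and b
        -- would be equal.
        forbid : ∀ {x Y} → Sub Y (C ++ T) → 1 ≤ length Y → σ Y ⊕ (+ x) · e₁ ~ 0G → 1 ≤ x → x ≤ n′ → ⊥
        forbid {suc x} {Y} sub 1≤ z _ le = a≉b (cancelʳ {r = σ (F ++ Y)} (go (here refl) {b ∷ []} (≋-trans E≋ ≋-refl)) (go (there (here refl)) {a ∷ []} (≋-trans E≋ (Perm.swap ≈-refl ≈-refl ≋-refl))))
          where
          F : List Elt
          F = take x E″
          x≤ : x ≤ length E″
          x≤ = ≤-pred (≤-trans le (≤-reflexive (suc-injective (trans (sym E-length) (≋-length E≋)))))
          F-length : length F ≡ x
          F-length = length-take-≤ x E″ x≤
          σF : σ F ~ (+ x) · e₁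
          σF = P.≈-trans (σ-const (All.take⁺ x (All.tail (All.tail E″~)))) (P.≈-reflexive (cong (λ l → (+ l) · e₁) F-length))
          go : ∀ {d} → d ∈ a ∷ b ∷ E″ → ∀ {o} → E ≋ d ∷ o ++ E″ → d ⊕ σ (F ++ Y) ≈ h
          go {d} d∈ {o} p = sum≈h (d ∷ F ++ Y)
              (sub-++ (sub-respʳ (≋-sym p) (sub-∷ d (sub-++ʳ o (sub-take x E″)))) sub) (s≤s z≤n)
              (≤-trans (≤-reflexive (cong (3 ℕ.+_) (trans (List.length-++ F) (cong (ℕ._+ length Y) F-length))))
                (≤-trans (+-mono-≤ (s≤s (s≤s le)) (sub-length sub)) (≤-reflexive (trans (cong (n ℕ.+_) (trans (List.length-++ C) (cong₂ ℕ._+_ C-length (trans T-length (sym (+-identityʳ n)))))) refl))))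
              (P.≈-trans (P.≈-reflexive (cong (d ⊕_) (σ-++ F Y)))
                (P.comb₃ (+ 1) (+ 1) (+ 1) (both₄ (λ α β γ δ → ring-76 α β γ (+ x) δ) d (σ F) (σ Y) e₁)
                  (All.lookup E″~ d∈) σF z))

        -- Zero-sums use all the lifts of e₁ or none of them.
        dichotomy : ∀ {Y y} → Sub Y (C ++ T) → 1 ≤ length Y → σ Y ~ y · e₁ → σ Y ~ 0G ⊎ σ Y ~ e₁
        dichotomy {Y} {y} sub 1≤ p with top-up {σ Y} {y} p
        ... | zero , _ , z = inj₁ (P.≈-trans (P.≈-reflexive (sym (⊕-identityʳ (σ Y)))) z)
        ... | suc x , lt , z with suc x ≤? n′
        ... | yes le = ⊥-elim (forbid {suc x} {Y} sub 1≤ z (s≤s z≤n) le)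
        ... | no gt = inj₂ (P.comb₂ (+ 1) (- + 1) (both₂ (λ α β → ring-135 α (+ suc x) β) (σ Y) e₁) z
                     (subst (λ l → (+ l) · e₁ ~ 0G) (cong suc (≤-antisym (≰⇒> gt) (≤-pred lt))) (n·~0 e₁)))

        -- A term of T over e₁ could be exchanged for a as well as for b while the sum stays h, and
        -- would equal both.
        T∌e₁ : ∀ {t T′} → T ≋ t ∷ T′ → ¬ t ~ e₁
        T∌e₁ {t} {T′} p q = a≉b (≈-trans (≈-sym (same (here refl) {b ∷ []} E≋)) (same (there (here refl)) {a ∷ []} (≋-trans E≋ (Perm.swap ≈-refl ≈-refl ≋-refl))))
          where
          σ≈ : t ⊕ σ T′ ≈ h
          σ≈ = ≈-trans (≈-sym (σ-resp p)) σT≈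
          same : ∀ {d} → d ∈ a ∷ b ∷ E″ → ∀ {o} → E ≋ d ∷ o ++ E″ → t ≈ d
          same {d} d∈ {o} r = cancelʳ σ≈ (sum≈h (d ∷ T′) (sub-++ (sub-respʳ (≋-sym r) (o ++ E″ , ≋-refl)) (sub-++ʳ C (t ∷ [] , ≋-trans p (++-comm (t ∷ []) T′))))
             (s≤s z≤n) (≤-trans (≤-reflexive (cong (2 ℕ.+_) (trans (sym (≋-length p)) T-length))) (+-mono-≤ {2} {n} (s≤s (s≤s z≤n)) (m≤m+n n _)))
             (P.≈-trans (P.⊕-cong {d} {t} {σ T′} {σ T′} (P.≈-trans (All.lookup E″~ d∈) (P.≈-sym q)) P.≈-refl) (P.≈-trans (≈⇒~ σ≈) h~0)))

        -- Let B be the e₂-coordinate of t. If B = 0, then t lies over 0, which is too short a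
        -- zero-sum, or over e₁. If B ≥ 2, then t with any n - B terms of C has its sum over 0,
        -- again too short, or over e₁; the latter for all choices would make C constant in the
        -- quotient.
        T⊂A : ∀ {t T′} → T ≋ t ∷ T′ → InA t
        T⊂A {t} {T′} p with coord t
        ... | x , zero , _ , q with dichotomy {t ∷ []} {x} subt (s≤s z≤n) (P.≈-trans (P.≈-reflexive (⊕-identityʳ t)) (P.≈-trans q (P.≈-reflexive (⊕-identityʳ (x · e₁)))))
          where
          subt : Sub (t ∷ []) (C ++ T)
          subt = sub-++ʳ C (T′ , p)
        ... | inj₁ z = ⊥-elim (<⇒≱ (s≤s (s≤s z≤n)) (not-short (t ∷ []) (sub-++ʳ E (sub-++ʳ C (T′ , p))) (s≤s z≤n) z))
        ... | inj₂ z = ⊥-elim (T∌e₁ p (P.≈-trans (P.≈-reflexive (sym (⊕-identityʳ t))) z))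
        T⊂A {t} {T′} p | x , suc zero , _ , q = x , P.≈-trans q (P.≈-reflexive (cong ((x · e₁) ⊕_) (cong₂ _,_ (ℤ.*-identityˡ _) (ℤ.*-identityˡ _))))
        T⊂A {t} {T′} p | x , suc (suc b) , lt , q = ⊥-elim (all-same C refl)
          where
          l : ℕ
          -- The coordinates b + 2 of t, 1 of c and l of further terms of C add up to n.
          l = n′ ∸ suc b
          b+l : suc b ℕ.+ l ≡ n′
          b+l = m+[n∸m]≡n (≤-pred (≤-pred lt))
          sum : ∀ {c D} → Sub (c ∷ D) C → length D ≡ l → c ⊕ σ (t ∷ D) ~ e₁
          sum {c} {D} sub e with line {t} {x} {suc (suc b)} {c ∷ D} q (All-sub sub) (trans (cong (suc (suc b) ℕ.+_) (cong suc e)) (trans (+-suc (suc (suc b)) l) (cong (suc ∘ suc) b+l)))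
            where
            All-sub : ∀ {Z} → Sub Z C → All InA Z
            All-sub {Z} (Z′ , p) = All.++⁻ˡ Z (All-resp-≋ (λ x≈y (x , p) → x , P.≈-trans (P.≈-sym (≈⇒~ x≈y)) p) p C∈)
          ... | y , r with dichotomy {t ∷ c ∷ D} {y} sub′ (s≤s z≤n) r
            where
            sub′ : Sub (t ∷ c ∷ D) (C ++ T)
            sub′ = sub-respʳ (++-comm T C) (sub-++ {t ∷ []} (T′ , p) sub)
          ... | inj₂ z = P.≈-trans (P.≈-reflexive (cong₂ _,_ (ring-77 (proj₁ t) (proj₁ c) (proj₁ (σ D))) (ring-77 (proj₂ t) (proj₂ c) (proj₂ (σ D))))) z
          ... | inj₁ z = ⊥-elim (<⇒≱ (s≤s (s≤s (≤-trans (s≤s (≤-trans (≤-reflexive e) (m≤n+m l b))) (≤-reflexive b+l))))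
                   (not-short (t ∷ c ∷ D) (sub-++ʳ E (sub-respʳ (++-comm T C) (sub-++ {t ∷ []} (T′ , p) sub))) (s≤s z≤n) z))
          all-same : ∀ C₀ → C₀ ≡ C → ⊥
          all-same [] refl = ⊥-elim (0≢1+n C-length)
          all-same (c ∷ C′) refl = C-not-const {c} (P.≈-refl ∷ All.tabulate same)
            where
            same : ∀ {c′} → c′ ∈ C′ → c′ ~ c
            same {c′} c′∈ with ∈⇒≋ c′∈
            ... | C″ , r = P.cancelʳ {r = σ (t ∷ take l C″)} (sum (sub-respʳ (≋-prep c (≋-sym r)) (sub-respʳ (Perm.swap ≈-refl ≈-refl ≋-refl) (sub-∷ c′ (sub-++ʳ (c ∷ []) (sub-take l C″))))) len)
                     (sum (sub-respʳ (≋-prep c (≋-sym r)) (sub-∷ c (sub-++ʳ (c′ ∷ []) (sub-take l C″)))) len)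
              where
              len : length (take l C″) ≡ l
              len = length-take-≤ l C″ (≤-trans (m∸n≤m n′ (suc b)) (≤-reflexive (suc-injective (suc-injective (trans (sym C-length) (cong suc (≋-length r)))))))

  -- The case k = 1 with unequal lifts of e₁.

  module NonConstant {h e₁ e₂ E C T} (W : Window h e₁ e₂ E C T) (1≤n′ : 1 ≤ n′)
      {a b : Elt} {E″ : List Elt} (E≋ : E ≋ a ∷ b ∷ E″) (a≉b : ¬ a ≈ b) where
    open Window W
    open Generator gen
    open Win W 1≤n′
    open NonConst E≋ a≉b

    Shape : Elt → List Elt → List Elt → Set
    Shape τ ps qs = C ↭ qs ++ ps × All (_~ τ) ps × All (_~ (τ ⊕ e₁)) qs

    opaque
      -- Putting c in place of t turns the zero-sum T into a sum over ⟨e₁⟩, for which `dichotomy`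
      -- leaves only 0 and e₁.
      exchange : ∀ {t T′ c C′} → T ≋ t ∷ T′ → C ≋ c ∷ C′ → InA c → c ~ t ⊎ c ~ t ⊕ e₁
      exchange {t} {T′} {c} {C′} p q (x , c~) with T⊂A p
      ... | y , t~ with dichotomy {c ∷ T′} {x - y} (sub-++ {c ∷ []} (C′ , q) (t ∷ [] , ≋-trans p (++-comm (t ∷ []) T′))) (s≤s z≤n)
             (P.comb₃ (+ 1) (- + 1) (+ 1) (both₅ (λ α β γ δ ε → ring-192 α β γ x y δ ε) c t (σ T′) e₁ e₂)
               c~ t~ z)
        where
        z : t ⊕ σ T′ ~ 0G
        z = P.≈-trans (P.≈-sym (≈⇒~ (σ-resp p))) σT~0
      ... | inj₁ w = inj₁ (P.cancelʳ w (P.≈-trans (P.≈-sym (≈⇒~ (σ-resp p))) σT~0))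
      ... | inj₂ w = inj₂ (P.comb₂ (+ 1) (- + 1) (both₄ ring-193 c t (σ T′) e₁) w (P.≈-trans (P.≈-sym (≈⇒~ (σ-resp p))) σT~0))

      -- In the quotient σ(C) = n τ + |qs| e₁, and also σ(C) = e₁; so |qs| is 1 modulo n, and it is
      -- at most n.
      shape-count : ∀ {τ ps qs} → Shape τ ps qs → length qs ≡ 1
      shape-count {τ} {ps} {qs} (perm , aps , aqs) = conclude (congruent-<2 {n} {length qs} {1} (≤-<-trans qs≤ (m<m+n n (s≤s z≤n))) (s≤s (s≤s z≤n)) d)
        where
        lens : n ≡ length qs ℕ.+ length ps
        lens = trans (sym C-length) (trans (Prop.↭-length perm) (List.length-++ qs))
        qs≤ : length qs ≤ n
        qs≤ = subst (length qs ≤_) (sym lens) (m≤m+n _ _)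
        σC-split : σ C ~ (+ length qs) · e₁
        σC-split = P.≈-trans (P.≈-trans (P.σ-resp (P.↭⇒≋ perm)) (P.≈-reflexive (σ-++ qs ps)))
          (P.comb₃ (+ 1) (+ 1) (+ 1) (both₄ (λ α β γ δ → ring-136 α β γ δ (+ length qs) (+ length ps)) (σ qs) (σ ps) τ e₁)
            (σ-const aqs) (σ-const aps) (subst (λ l → (+ l) · τ ~ 0G) lens (n·~0 τ)))
        d : D n (+ length qs - + 1)
        d = indep₁ {a = + length qs - + 1} B (P.comb₂ (- + 1) (+ 1) (both₂ (λ α β → ring-137 α (+ length qs) β) (σ C) e₁) σC-split σC~)
        conclude : length qs ≡ 1 ⊎ length qs ≡ n ℕ.+ 1 → length qs ≡ 1
        conclude (inj₁ e) = e
        conclude (inj₂ e) = ⊥-elim (<⇒≱ (≤-reflexive (trans (+-comm 1 n) (sym e))) qs≤)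

      -- By `exchange` both p₀ ~ τ and q ~ τ + e₁ are t or t + e₁. As neither e₁ nor 2 e₁ vanishes
      -- for n ≥ 3, only t ~ τ remains.
      shape-T : ∀ {τ p₀ q t T′ C′} → T ≋ t ∷ T′ → C ↭ q ∷ p₀ ∷ C′ → p₀ ~ τ → q ~ τ ⊕ e₁ → t ~ τ
      shape-T {τ} {p₀} {q} {t} pt perm p₀~ q~ = conclude (exchange pt (≋-trans (↭⇒≋ perm) (Perm.swap ≈-refl ≈-refl ≋-refl)) (All.lookup (Prop.All-resp-↭ perm C∈) (there (here refl))))
          (exchange pt (↭⇒≋ perm) (All.lookup (Prop.All-resp-↭ perm C∈) (here refl)))
        where
        conclude : p₀ ~ t ⊎ p₀ ~ t ⊕ e₁ → q ~ t ⊎ q ~ t ⊕ e₁ → t ~ τ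
        conclude (inj₁ u) _ = P.≈-trans (P.≈-sym u) p₀~
        conclude (inj₂ u) (inj₁ v) = ⊥-elim (e₁≁0 {2} (s≤s z≤n) (s≤s (s≤s 1≤n′)) (P.comb₂ (- + 1) (+ 1) (both₃ ring-138 t τ e₁)
                  (P.≈-trans (P.≈-sym p₀~) u) (P.≈-trans (P.≈-sym q~) v)))
        conclude (inj₂ u) (inj₂ v) = ⊥-elim (e₁≁0 {1} (s≤s z≤n) (s≤s (s≤s z≤n)) (P.comb₂ (+ 1) (- + 1) (both₃ ring-139 t τ e₁)
                  (P.≈-trans (P.≈-sym q~) v) (P.≈-trans (P.≈-sym p₀~) u)))

      nonconstant-shape : ∃[ τ ] All (_~ τ) T × ∃[ c ] ∃[ C′ ] C ↭ c ∷ C′ × c ~ τ ⊕ e₁ × All (_~ τ) C′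
      nonconstant-shape = from (uncons T T-length)
        where
        Goal : Set
        Goal = ∃[ τ ] All (_~ τ) T × ∃[ c ] ∃[ C′ ] C ↭ c ∷ C′ × c ~ τ ⊕ e₁ × All (_~ τ) C′
        finish : ∀ τ ps qs → Shape τ ps qs → length qs ≡ 1 → Goal
        finish τ [] (q ∷ []) (perm , _) _ = ⊥-elim (0≢1+n (sym (suc-injective (trans (sym C-length) (Prop.↭-length perm)))))
        finish τ (p₀ ∷ ps) (q ∷ []) (perm , p₀~ ∷ aps , q~ ∷ []) _ =
          τ , All.tabulate (λ t∈ → shape-T (proj₂ (∈⇒≋ t∈)) perm p₀~ q~) , q , p₀ ∷ ps , perm , q~ , p₀~ ∷ aps
        from : (∃[ τ ] ∃[ T₀ ] T ≡ τ ∷ T₀) → Goal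
        from (τ , T₀ , e) = step (partition-⊎ {P = _~ τ} {Q = _~ (τ ⊕ e₁)} {C} (All.tabulate (λ {c} c∈ → exchange (≋-reflexive e) (proj₂ (∈⇒≋ c∈)) (All.lookup C∈ c∈))))
          where
          step : (∃[ ps ] ∃[ qs ] Shape τ ps qs) → Goal
          step (ps , qs , sh) = finish τ ps qs sh (shape-count sh)

  -- The case k = 1 with all lifts of e₁ equal: completing sums by copies of e₁.

  module Constant {h e₁ e₂ C T} (W : Window h e₁ e₂ (replicate (suc n′) e₁) C T) (1≤n′ : 1 ≤ n′) where
    open Window W
    open Generator gen
    open Win W 1≤n′ public

    opaque
      -- Copies of e₁ fill Y up to a zero-sum of the quotient, whose sum in G is then h. At most n -
      -- 1 copies are needed, so |Y| < 2n keeps the length within 3n - 2; the last component comes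
      -- from `not-short`.
      complete : ∀ {Y y} → Sub Y (C ++ T) → 1 ≤ length Y → length Y < n ℕ.+ n → σ Y ~ y · e₁ →
        ∃[ x ] x < n × σ Y ⊕ (+ x) · e₁ ≈ h × n ≤ x ℕ.+ length Y
      complete {Y} {y} sub 1≤ lt p = finish (top-up {σ Y} {y} p)
        where
        finish : (∃[ x ] x < n × σ Y ⊕ (+ x) · e₁ ~ 0G) → ∃[ x ] x < n × σ Y ⊕ (+ x) · e₁ ≈ h × n ≤ x ℕ.+ length Y
        finish (x , lx , z) = x , lx , ≈-trans (≈-reflexive (sym eq)) (sum≈h Z subZ 1≤Z leZ z′) , ≤-trans (not-short Z subZ 1≤Z z′) (≤-reflexive lenZ)
          where
          Z : List Elt
          Z = replicate x e₁ ++ Y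
          lenZ : length Z ≡ x ℕ.+ length Y
          lenZ = trans (List.length-++ (replicate x e₁)) (cong (ℕ._+ length Y) (List.length-replicate x))
          eq : σ Z ≡ σ Y ⊕ (+ x) · e₁
          eq = trans (σ-++ (replicate x e₁) Y) (trans (cong (_⊕ σ Y) (σ-replicate x e₁)) (⊕-comm ((+ x) · e₁) (σ Y)))
          z′ : σ Z ~ 0G
          z′ = P.≈-trans (P.≈-reflexive eq) z
          subZ : Sub Z (replicate (suc n′) e₁ ++ (C ++ T))
          subZ = sub-++ (sub-replicate e₁ (≤-pred lx)) sub
          1≤Z : 1 ≤ length Z
          1≤Z = ≤-trans 1≤ (≤-trans (m≤n+m _ x) (≤-reflexive (sym lenZ)))
          leZ : 2 ℕ.+ length Z ≤ 3 ℕ.* n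
          leZ = ≤-trans (≤-reflexive (cong (2 ℕ.+_) lenZ)) (≤-trans (≤-reflexive (cong suc (sym (+-suc x (length Y)))))
            (≤-trans (+-mono-≤ lx lt) (≤-reflexive (cong (λ k → n ℕ.+ (n ℕ.+ k)) (sym (+-identityʳ n))))))

      -- If a, b and c copies of e₁ complete Y₁, Y₂ and their union, then (a + b - c) e₁ = h, so a +
      -- b is c modulo n. It is not c, because h ≠ 0; hence it is n + c.
      disjoint-pair : ∀ {Y₁ Y₂ y₁ y₂} → Sub (Y₁ ++ Y₂) (C ++ T) → 1 ≤ length Y₁ → 1 ≤ length Y₂ → length (Y₁ ++ Y₂) < n ℕ.+ n →
        σ Y₁ ~ y₁ · e₁ → σ Y₂ ~ y₂ · e₁ → (+ n) · e₁ ≈ h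
      disjoint-pair {Y₁} {Y₂} {y₁} {y₂} sub 1≤₁ 1≤₂ lt p₁ p₂ = finish
          (complete {Y₁} {y₁} (sub-trans (Y₂ , ≋-refl) sub) 1≤₁ (≤-<-trans (≤-trans (m≤m+n _ _) lens) lt) p₁)
          (complete {Y₂} {y₂} (sub-trans (Y₁ , ++-comm Y₁ Y₂) sub) 1≤₂ (≤-<-trans (≤-trans (m≤n+m _ _) lens) lt) p₂)
          (complete {Y₁ ++ Y₂} {y₁ + y₂} sub (≤-trans 1≤₁ (≤-trans (m≤m+n _ _) lens)) lt (P.≈-trans (P.≈-reflexive (σ-++ Y₁ Y₂))
            (P.comb₂ (+ 1) (+ 1) (both₃ (λ α β γ → ring-194 α β y₁ y₂ γ) (σ Y₁) (σ Y₂) e₁) p₁ p₂)))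
        where
        lens : length Y₁ ℕ.+ length Y₂ ≤ length (Y₁ ++ Y₂)
        lens = ≤-reflexive (sym (List.length-++ Y₁))
        Completion : List Elt → Set
        Completion Y = ∃[ x ] x < n × σ Y ⊕ (+ x) · e₁ ≈ h × n ≤ x ℕ.+ length Y
        finish : Completion Y₁ → Completion Y₂ → Completion (Y₁ ++ Y₂) → (+ n) · e₁ ≈ h
        finish (a , la , p , _) (b , lb , q , _) (c , lc , s , _) = conclude (interval-multiple la lb lc (indep₁ {a = (+ a + + b) - + c} B (P.≈-trans (≈⇒~ rel) h~0)))
          where
          rel : ((+ a + + b) - + c) · e₁ ≈ h
          rel = comb₃ (+ 1) (+ 1) (- + 1) (both₄ (λ α β γ δ → ring-140 α β (+ a) (+ b) (+ c) γ δ) (σ Y₁) (σ Y₂) h e₁)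
            p q (subst (λ u → u ⊕ (+ c) · e₁ ≈ h) (σ-++ Y₁ Y₂) s)
          conclude : + a + + b ≡ + c ⊎ + a + + b ≡ + n + + c → (+ n) · e₁ ≈ h
          conclude (inj₁ e) = ⊥-elim (h≉0 (≈-trans (≈-sym rel) (≈-reflexive (cong (_· e₁) (trans (cong (ℤ._- + c) e) (ℤ.+-inverseʳ (+ c)))))))
          conclude (inj₂ e) = ≈-trans (≈-reflexive (cong (_· e₁) (sym (trans (cong (ℤ._- + c) e) (ring-78 (+ n) (+ c)))))) rel

      ψ : Elt → ℤ
      ψ v = + proj₁ (proj₂ (coord v))

      σ-ψ : ∀ Y → ∃[ a ] σ Y ~ a · e₁ ⊕ sumℤ (map ψ Y) · e₂
      σ-ψ [] = + 0 , P.≈-refl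
      σ-ψ (v ∷ Y) = let (a , p) = σ-ψ Y ; (x , b , _ , q) = coord v in x + a ,
        P.comb₂ (+ 1) (+ 1) (both₄ (λ α β γ δ → ring-195 α β a x (ψ v) (sumℤ (map ψ Y)) γ δ) v (σ Y) e₁ e₂) q p

      line-segment : ∀ L → length L ≡ n → ∃[ Y ] Sub Y L × 1 ≤ length Y × ∃[ y ] σ Y ~ y · e₁
      line-segment L e = finish (zero-segment ψ n L (≤-reflexive (sym e)))
        where
        finish : (∃[ x ] ∃[ y ] ∃[ z ] L ≡ x ++ (y ++ z) × 1 ≤ length y × D n (sumℤ (map ψ y))) → ∃[ Y ] Sub Y L × 1 ≤ length Y × ∃[ y ] σ Y ~ y · e₁
        finish (x , Y , z , refl , l , d) = Y , sub-++ʳ x (z , ≋-refl) , l , proj₁ (σ-ψ Y) ,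
          P.≈-trans (proj₂ (σ-ψ Y)) (P.≈-trans (P.⊕-cong {proj₁ (σ-ψ Y) · e₁} {proj₁ (σ-ψ Y) · e₁} P.≈-refl (D⇒·~0 e₂ d)) (P.≈-reflexive (⊕-identityʳ _)))

      All-subC : ∀ {Z} → Sub Z C → All InA Z
      All-subC {Z} (Z′ , p) = All.++⁻ˡ Z (All-resp-≋ (λ x≈y (x , p) → x , P.≈-trans (P.≈-sym (≈⇒~ x≈y)) p) p C∈)

      -- A term outside the coset would create a disjoint pair of total length below 2n: t and C if
      -- t lies over ⟨e₁⟩, otherwise t with fitting terms of C on one side and some of n remaining
      -- terms on the other.
      T⊂A : ¬ (+ n) · e₁ ≈ h → ∀ {t T′} → T ≋ t ∷ T′ → InA t
      T⊂A ne {t} {T′} p = cases (coord t)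
        where
        cases : (∃[ a ] ∃[ b ] b < n × t ~ a · e₁ ⊕ (+ b) · e₂) → InA t
        cases (a , zero , _ , q) = ⊥-elim (ne (disjoint-pair {t ∷ []} {C} {a} {+ 1} (sub-respʳ (++-comm T C) (sub-++ {t ∷ []} (T′ , p) sub-refl)) (s≤s z≤n)
              (subst (1 ≤_) (sym C-length) (s≤s z≤n)) (≤-trans (≤-reflexive (cong (suc ∘ suc) C-length)) (+-monoˡ-≤ n (s≤s (s≤s z≤n))))
              (P.≈-trans (P.≈-reflexive (⊕-identityʳ t)) (P.≈-trans q (P.≈-reflexive (⊕-identityʳ (a · e₁)))))
              (P.≈-trans σC~ (P.≈-reflexive (cong₂ _,_ (sym (ℤ.*-identityˡ (proj₁ e₁))) (sym (ℤ.*-identityˡ (proj₂ e₁))))))))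
        cases (a , suc zero , _ , q) = a , P.≈-trans q (P.≈-reflexive (cong ((a · e₁) ⊕_) (cong₂ _,_ (ℤ.*-identityˡ (proj₁ e₂)) (ℤ.*-identityˡ (proj₂ e₂)))))
        cases (a , suc (suc b) , lt , q) = ⊥-elim (ne (pair (line {t} {a} {suc (suc b)} {take l C} q (All-subC (sub-take l C)) (trans (cong (suc (suc b) ℕ.+_) I-length) b+l)) (line-segment (take n rest) (length-take-≤ n rest rest-long))))
          where
          l : ℕ
          l = n ∸ suc (suc b)
          b+l : suc (suc b) ℕ.+ l ≡ n
          b+l = m+[n∸m]≡n (<⇒≤ lt)
          I-length : length (take l C) ≡ l
          I-length = length-take-≤ l C (≤-trans (m∸n≤m n (suc (suc b))) (≤-reflexive (sym C-length)))
          rest : List Elt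
          rest = drop l C ++ T′
          T′-length : suc (length T′) ≡ n
          T′-length = trans (sym (≋-length p)) T-length
          drop-length : length (drop l C) ≡ suc (suc b)
          drop-length = trans (List.length-drop l C) (trans (cong (_∸ l) (trans C-length (sym b+l))) (m+n∸n≡m (suc (suc b)) l))
          rest-long : n ≤ length rest
          rest-long = ≤-trans (≤-reflexive (sym T′-length)) (≤-trans (≤-trans (n≤1+n _) (+-monoˡ-≤ (length T′) {2} {suc (suc b)} (s≤s (s≤s z≤n)))) (≤-reflexive (sym (trans (List.length-++ (drop l C)) (cong (ℕ._+ length T′) drop-length)))))
          split : C ++ T ≋ (t ∷ take l C) ++ rest
          split = ≋-trans (++⁺ (≋-reflexive (sym (List.take++drop≡id l C))) p) (≋-trans (interchange (take l C) (drop l C) (t ∷ []) T′) (++⁺ʳ rest (++-comm (take l C) (t ∷ []))))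
          pair : (∃[ y ] σ (t ∷ take l C) ~ y · e₁) → (∃[ Y ] Sub Y (take n rest) × 1 ≤ length Y × ∃[ y ] σ Y ~ y · e₁) → (+ n) · e₁ ≈ h
          pair (y₁ , p₁) (Y , subY , 1≤Y , y₂ , p₂) = disjoint-pair {t ∷ take l C} {Y} {y₁} {y₂}
            (sub-respʳ (≋-sym split) (sub-++ sub-refl (sub-trans subY (sub-take n rest)))) (s≤s z≤n) 1≤Y
            (≤-trans (s≤s (≤-reflexive (trans (List.length-++ (t ∷ take l C)) (cong (λ k → suc k ℕ.+ length Y) I-length))))
              (+-mono-≤ {suc (suc l)} {n} (≤-trans (+-monoˡ-≤ l {2} {suc (suc b)} (s≤s (s≤s z≤n))) (≤-reflexive b+l)) (≤-trans (sub-length subY) (≤-reflexive (length-take-≤ n rest rest-long))))) p₁ p₂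

      -- Putting c in place of t changes the sum h of T by precisely the multiple of e₁ with which
      -- `complete` restores it.
      compare : ∀ {t T′ c C′} → T ≋ t ∷ T′ → C ≋ c ∷ C′ → InA t → InA c → ∃[ x ] x < n × c ≈ t ⊕ (- + x) · e₁
      compare {t} {T′} {c} {C′} p q (y , t~) (x , c~) = finish (complete {c ∷ T′} {x - y} (sub-++ {c ∷ []} (C′ , q) (t ∷ [] , ≋-trans p (++-comm (t ∷ []) T′))) (s≤s z≤n)
             (≤-<-trans (≤-reflexive (trans (sym (≋-length p)) T-length)) (m<m+n n (s≤s z≤n)))
             (P.comb₃ (+ 1) (- + 1) (+ 1) (both₅ (λ α β γ δ ε → ring-192 α β γ x y δ ε) c t (σ T′) e₁ e₂)
               c~ t~ (P.≈-trans (≈⇒~ σ≈) h~0)))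
        where
        σ≈ : t ⊕ σ T′ ≈ h
        σ≈ = ≈-trans (≈-sym (σ-resp p)) σT≈
        finish : (∃[ x ] x < n × σ (c ∷ T′) ⊕ (+ x) · e₁ ≈ h × n ≤ x ℕ.+ length (c ∷ T′)) → ∃[ x ] x < n × c ≈ t ⊕ (- + x) · e₁
        finish (z , lz , w , _) = z , lz , comb₂ (+ 1) (- + 1) (both₅ (λ α β γ δ ε → ring-141 α β γ (+ z) δ ε) c t (σ T′) e₁ h) w σ≈

      -- Since σ(C) lies over e₁, the completion number x < n satisfies n | 1 + x, hence x = n - 1.
      σC≈ : σ C ≈ h ⊕ (- + suc n′) · e₁
      σC≈ = finish (complete {C} {+ 1} (sub-++ˡ T sub-refl) (subst (1 ≤_) (sym C-length) (s≤s z≤n)) (≤-<-trans (≤-reflexive C-length) (m<m+n n (s≤s z≤n)))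
            (P.≈-trans σC~ (P.≈-reflexive (cong₂ _,_ (sym (ℤ.*-identityˡ (proj₁ e₁))) (sym (ℤ.*-identityˡ (proj₂ e₁)))))))
        where
        finish : (∃[ x ] x < n × σ C ⊕ (+ x) · e₁ ≈ h × n ≤ x ℕ.+ length C) → σ C ≈ h ⊕ (- + suc n′) · e₁
        finish (x , lx , p , _) = subst (λ k → σ C ≈ h ⊕ (- + k) · e₁) top (comb₁ (+ 1) (both₃ (λ α β γ → ring-142 α β (+ x) γ) (σ C) h e₁) p)
          where
          d : D n (+ 1 + + x)
          d = indep₁ {a = + 1 + + x} B (P.comb₃ (- + 1) (+ 1) (+ 1) (both₃ (λ α β γ → ring-79 α β (+ x) γ) (σ C) h e₁) σC~ (≈⇒~ p) h~0)
          top : x ≡ suc n′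
          top = ≤-antisym (≤-pred lx) (≤-pred (ℕ.∣⇒≤ (Sg.∣⇒∣ᵤ d)))

  opaque
    gather : ∀ {A : Set} {Q : A → Set} (F : A → Elt) {L} → All (λ c → ∃[ w ] Q w × c ≈ F w) L → ∃[ ws ] length ws ≡ length L × All Q ws × Pointwise _≈_ L (map F ws)
    gather F [] = [] , refl , [] , []
    gather F ((w , q , e) ∷ ps) = let (ws , l , a , b) = gather F ps in w ∷ ws , cong suc l , q ∷ a , e ∷ b

    σ-ray : ∀ u e ws → σ (map (λ w → u ⊕ (- w) · e) ws) ≡ (+ length ws) · u ⊕ (- sumℤ ws) · e
    σ-ray u e [] = refl
    σ-ray u e (w ∷ ws) = trans (cong ((u ⊕ (- w) · e) ⊕_) (σ-ray u e ws)) (both₂ (λ α β → ring-246 α β w (sumℤ ws) (+ length ws)) u e)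

  module Order {e₁ e₂} (B : PhiBasis e₁ e₂) (η≉0 : ¬ (+ n) · e₁ ≈ 0G) where
    opaque
      -- Independence gives n | y, so y is -n, 0 or n, and n e₁ ≠ 0 leaves 0. This is what lets
      -- coefficients of e₁ from a short interval be compared as integers.
      kill : ∀ {y} → y · e₁ ≈ 0G → + 1 + y ℤ.≤ + n + + n → + 1 - (+ n + + n) ℤ.≤ y → y ≡ + 0
      kill {y} p hi′ lo′ = go (indep₁ {a = y} B (≈⇒~ p))
        where
        hi : y ℤ.< + (n ℕ.+ n)
        hi = ℤ.suc[i]≤j⇒i<j hi′
        lo : - + (n ℕ.+ n) ℤ.< y
        lo = ℤ.suc[i]≤j⇒i<j lo′
        go : D n y → y ≡ + 0
        go (divides (+ 0) e) = e
        go (divides (+ 1) e) = ⊥-elim (η≉0 (≈-trans (≈-reflexive (cong (_· e₁) (sym (trans e (ℤ.*-identityˡ (+ n)))))) p))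
        go (divides (+ suc (suc q)) e) = ⊥-elim (ℤ.<⇒≱ hi (subst (+ (n ℕ.+ n) ℤ.≤_) (sym (trans e (sym (ℤ.pos-* (2 ℕ.+ q) n)))) (ℤ.+≤+ (+-monoʳ-≤ n (m≤m+n n (q ℕ.* n))))))
        go (divides ℤ.-[1+ 0 ] e) = ⊥-elim (η≉0 (comb₁ (- + 1) (both₁ s e₁) p))
          where
          s : ∀ x → (+ n) * x - + 0 ≡ - + 1 * (y * x - + 0)
          s x = trans (ring-143 (+ n) x) (cong (λ z → - + 1 * (z * x - + 0)) (sym e))
        go (divides ℤ.-[1+ suc q ] e) = ⊥-elim (ℤ.<⇒≱ lo (subst (ℤ._≤ - + (n ℕ.+ n)) (sym (trans e (trans (sym (ℤ.neg-distribˡ-* (+ (2 ℕ.+ q)) (+ n))) (cong ℤ.-_ (sym (ℤ.pos-* (2 ℕ.+ q) n))))))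
           (ℤ.neg-mono-≤ (ℤ.+≤+ (+-monoʳ-≤ n (m≤m+n n (q ℕ.* n)))))))

  Range : ℤ → Set
  Range w = + 0 ℤ.≤ w × w ℤ.≤ + suc n′

  -- Blocks inside the coset of e₂ when n e₁ ≠ 0.

  module Spread {h e₁ e₂ C T} (W : Window h e₁ e₂ (replicate (suc n′) e₁) C T) (1≤n′ : 1 ≤ n′)
      (T∈ : All (λ t → ∃[ x ] t ~ x · e₁ ⊕ e₂) T) (η≉0 : ¬ (+ n) · e₁ ≈ 0G) where
    open Window W
    open Generator gen
    open Constant W 1≤n′
    open Order B η≉0

    module From (t₀ : Elt) (T₀ : List Elt) (T≡ : T ≡ t₀ ∷ T₀) where

      F : ℤ → Elt
      F w = t₀ ⊕ (- w) · e₁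

      opaque
        weights : ∃[ ws ] length ws ≡ length C × All Range ws × Pointwise _≈_ C (map F ws)
        weights = gather F (All.tabulate (λ {c} c∈ → let (x , lt , e) = compare (≋-reflexive T≡) (proj₂ (∈⇒≋ c∈)) (All.lookup T∈ (subst (t₀ ∈_) (sym T≡) (here refl))) (All.lookup C∈ c∈)
                in + x , (ℤ.+≤+ z≤n , ℤ.+≤+ (≤-pred lt)) , e))

      ws : List ℤ
      ws = proj₁ weights

      -- For a term t₀ - v e₁ of T and a term t₀ - w e₁ of C, w - v is the number of copies of e₁
      -- that makes up for exchanging the former for the latter.
      Fits : ℤ → Set
      Fits v = All (λ w → Range (w - v)) ws

      opaque
        ws-length : length ws ≡ n
        ws-length = trans (proj₁ (proj₂ weights)) C-length
        ws-range : All Range ws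
        ws-range = proj₁ (proj₂ (proj₂ weights))
        C≋ : C ≋ map F ws
        C≋ = Perm.refl (proj₂ (proj₂ (proj₂ weights)))

        column : ∀ {t T′} → T ≋ t ∷ T′ → InA t → ∀ {w} → w ∈ ws → ∃[ x ] Range x × t ≈ t₀ ⊕ (x - w) · e₁
        column {t} {T′} p it {w} w∈ = finish (∈⇒↭ w∈)
          where
          finish : (∃[ vs ] ws ↭ w ∷ vs) → ∃[ x ] Range x × t ≈ t₀ ⊕ (x - w) · e₁
          finish (vs , q) = use (compare p C≋′ it (All.lookup (All-resp-≋ (λ x≈y (x , p) → x , P.≈-trans (P.≈-sym (≈⇒~ x≈y)) p) C≋′ C∈) (here refl)))
            where
            C≋′ : C ≋ F w ∷ map F vs
            C≋′ = ≋-trans C≋ (↭⇒≋ (Prop.map⁺ F q))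
            use : (∃[ x ] x < n × F w ≈ t ⊕ (- + x) · e₁) → ∃[ x ] Range x × t ≈ t₀ ⊕ (x - w) · e₁
            use (x , lt , e) = + x , (ℤ.+≤+ z≤n , ℤ.+≤+ (≤-pred lt)) , comb₁ (- + 1) (both₃ (λ α β γ → ring-35 α w β γ (+ x)) t₀ e₁ t) e

        -- Every weight w yields some coefficient of t by `column`; two of them differ by an integer
        -- that `kill` forces to be 0, so one v serves for all w.
        offset : ∀ {t T′} → T ≋ t ∷ T′ → InA t → ∃[ v ] Fits v × t ≈ F v
        offset {t} {T′} p it = go (uncons ws ws-length)
          where
          go : (∃[ w₀ ] ∃[ vs ] ws ≡ w₀ ∷ vs) → ∃[ v ] Fits v × t ≈ F v
          go (w₀ , vs , e) = base (column p it w₀∈)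
            where
            w₀∈ : w₀ ∈ ws
            w₀∈ = subst (w₀ ∈_) (sym e) (here refl)
            base : (∃[ x ] Range x × t ≈ t₀ ⊕ (x - w₀) · e₁) → ∃[ v ] Fits v × t ≈ F v
            base (x₀ , r₀ , e₀) = w₀ - x₀ , All.tabulate fit , subst (λ z → t ≈ t₀ ⊕ z · e₁) (ring-36 w₀ x₀) e₀
              where
              fit : ∀ {w} → w ∈ ws → Range (w - (w₀ - x₀))
              fit {w} w∈ = use (column p it w∈)
                where
                use : (∃[ x ] Range x × t ≈ t₀ ⊕ (x - w) · e₁) → Range (w - (w₀ - x₀))
                use (x , rx , ex) = subst Range (eq y≡0) rx
                  where
                  y : ℤ
                  y = (x - w) - (x₀ - w₀)
                  rw : Range w
                  rw = All.lookup ws-range w∈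
                  rw₀ : Range w₀
                  rw₀ = All.lookup ws-range w₀∈
                  y≡0 : y ≡ + 0
                  y≡0 = kill (comb₂ (+ 1) (- + 1) (both₃ (λ α β γ → ring-1 α β x w x₀ w₀ γ) t t₀ e₁) e₀ ex)
                        (≤-cert₄ (ring-2 (+ suc n′) x w x₀ w₀) (proj₂ rx) (proj₁ rw) (proj₁ r₀) (ℤ.≤-trans (proj₂ rw₀) (ℤ.+≤+ (n≤1+n _))))
                        (≤-cert₄ (ring-3 (+ suc n′) x w x₀ w₀) (proj₁ rx) (proj₂ rw) (proj₂ r₀) (ℤ.≤-trans ℤ.-≤+ (proj₁ rw₀)))
                  eq : y ≡ + 0 → x ≡ w - (w₀ - x₀)
                  eq e = trans (ring-4 x w x₀ w₀) (trans (cong (λ z → z + (w - (w₀ - x₀))) e) (ℤ.+-identityˡ _))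

      opaque
        offsets : ∃[ vs ] length vs ≡ length T × All Fits vs × Pointwise _≈_ T (map F vs)
        offsets = gather F (All.tabulate (λ {t} t∈ → offset (proj₂ (∈⇒≋ t∈)) (All.lookup T∈ t∈)))

      vs : List ℤ
      vs = proj₁ offsets

      opaque
        vs-length : length vs ≡ n
        vs-length = trans (proj₁ (proj₂ offsets)) T-length
        vs-fit : All Fits vs
        vs-fit = proj₁ (proj₂ (proj₂ offsets))
        T≋ : T ≋ map F vs
        T≋ = Perm.refl (proj₂ (proj₂ (proj₂ offsets)))

        σF : ∀ xs → length xs ≡ n → σ (map F xs) ≈ σ C ⊕ (sumℤ ws - sumℤ xs) · e₁
        σF xs l = ≈-trans (≈-reflexive (trans (σ-ray t₀ e₁ xs) (cong (λ k → (+ k) · t₀ ⊕ (- sumℤ xs) · e₁) l)))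
          (comb₁ (- + 1) (both₃ (λ α β γ → ring-144 α β (sumℤ xs) (sumℤ ws) γ (+ n)) (σ C) t₀ e₁) σC-ray)
          where
          σC-ray : σ C ≈ (+ n) · t₀ ⊕ (- sumℤ ws) · e₁
          σC-ray = ≈-trans (σ-resp C≋) (≈-reflexive (trans (σ-ray t₀ e₁ ws) (cong (λ k → (+ k) · t₀ ⊕ (- sumℤ ws) · e₁) ws-length)))

        -- exchanging the elements of C for those of T one at a time, the weight cannot jump over n - 1
        chain : ∀ vs₁ ws₁ vs₂ ws₂ → vs ↭ vs₁ ++ vs₂ → ws ↭ ws₁ ++ ws₂ → length vs₁ ≡ length ws₁ → length vs₂ ≡ length ws₂ →
          Range (sumℤ ws₁ - sumℤ vs₁) → Range (sumℤ ws - sumℤ vs)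
        chain vs₁ ws₁ [] [] p q l₁ l₂ r = subst Range (cong₂ (λ a b → a - b) (sym (trans (sumℤ-↭ q) (cong sumℤ (List.++-identityʳ ws₁)))) (sym (trans (sumℤ-↭ p) (cong sumℤ (List.++-identityʳ vs₁))))) r
        chain vs₁ ws₁ (v ∷ vs₂) (w ∷ ws₂) p q l₁ l₂ r = chain (v ∷ vs₁) (w ∷ ws₁) vs₂ ws₂ p′ q′ (cong suc l₁) (suc-injective l₂)
            (finish (complete {map F Y} {+ 1 + s} subY (s≤s z≤n) (≤-<-trans (≤-reflexive (trans (List.length-map F Y) Y-length)) (m<m+n n (s≤s z≤n)))
               (P.comb₂ (+ 1) (+ 1) (both₃ (λ α β γ → ring-145 α β s γ) (σ (map F Y)) (σ C) e₁) (≈⇒~ σY) σC~)))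
          where
          p′ : vs ↭ (v ∷ vs₁) ++ vs₂
          p′ = Prop.trans p (Prop.shift v vs₁ vs₂)
          q′ : ws ↭ (w ∷ ws₁) ++ ws₂
          q′ = Prop.trans q (Prop.shift w ws₁ ws₂)
          Y : List ℤ
          Y = (v ∷ vs₁) ++ ws₂
          Y-length : length Y ≡ n
          Y-length = trans (List.length-++ (v ∷ vs₁)) (trans (cong (λ k → suc k ℕ.+ length ws₂) l₁) (trans (sym (List.length-++ (w ∷ ws₁))) (trans (sym (Prop.↭-length q′)) ws-length)))
          subY : Sub (map F Y) (C ++ T)
          subY = sub-respʳ (++-comm T C) (sub-respˡ (≋-reflexive (sym (List.map-++ F (v ∷ vs₁) ws₂)))
            (sub-++ (map F vs₂ , ≋-trans T≋ (≋-trans (↭⇒≋ (Prop.map⁺ F p′)) (≋-reflexive (List.map-++ F (v ∷ vs₁) vs₂))))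
                    (map F (w ∷ ws₁) , ≋-trans C≋ (≋-trans (↭⇒≋ (Prop.map⁺ F q′)) (≋-trans (≋-reflexive (List.map-++ F (w ∷ ws₁) ws₂)) (++-comm (map F (w ∷ ws₁)) (map F ws₂)))))))
          s₀ s : ℤ
          s₀ = sumℤ ws₁ - sumℤ vs₁
          s = sumℤ (w ∷ ws₁) - sumℤ (v ∷ vs₁)
          σY : σ (map F Y) ≈ σ C ⊕ s · e₁
          σY = ≈-trans (σF Y Y-length) (≈-reflexive (cong (λ z → σ C ⊕ z · e₁) (trans (cong₂ (λ a b → a - b) (trans (sumℤ-↭ q′) (sumℤ-++ (w ∷ ws₁) ws₂)) (sumℤ-++ (v ∷ vs₁) ws₂)) (ring-80 (sumℤ (w ∷ ws₁)) (sumℤ ws₂) (sumℤ (v ∷ vs₁))))))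
          rwv : Range (w - v)
          rwv = All.lookup (All.lookup vs-fit (Prop.∈-resp-↭ (Prop.↭-sym p′) (here refl))) (Prop.∈-resp-↭ (Prop.↭-sym q′) (here refl))
          finish : (∃[ x ] x < n × σ (map F Y) ⊕ (+ x) · e₁ ≈ h × n ≤ x ℕ.+ length (map F Y)) → Range s
          finish (x , lx , e , _) = subst Range (sym s≡) (≤-cert₁ (ring-81 (+ suc n′) (+ x)) x≤ , ≤-cert₁ (ring-82 (+ suc n′) (+ x)) (ℤ.+≤+ z≤n))
            where
            x≤ : + x ℤ.≤ + suc n′
            x≤ = ℤ.+≤+ (≤-pred lx)
            y≡0 : (s + + x) - + suc n′ ≡ + 0
            y≡0 = kill (comb₃ (+ 1) (- + 1) (- + 1) (both₄ (λ α β γ δ → ring-37 α β s (+ x) (+ suc n′) γ δ) (σ (map F Y)) (σ C) e₁ h) e σY σC≈)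
                (≤-cert₃ (ring-38 (+ suc n′) (sumℤ ws₁) (sumℤ vs₁) w v (+ x)) (proj₂ r) (proj₂ rwv) (ℤ.≤-trans x≤ (ℤ.+≤+ (n≤1+n _))))
                (≤-cert₄ (ring-39 (+ suc n′) (sumℤ ws₁) (sumℤ vs₁) w v (+ x)) (proj₁ r) (proj₁ rwv) (ℤ.+≤+ (z≤n {x})) (ℤ.+≤+ (z≤n {suc (suc n′)})))
            s≡ : s ≡ + suc n′ - + x
            s≡ = trans (ring-40 s (+ x) (+ suc n′)) (trans (cong (λ z → z + (+ suc n′ - + x)) y≡0) (ℤ.+-identityˡ _))

        -- `chain` ends at σ(T) = σ(C) + (Σw - Σv) e₁ with Σw - Σv in [0, n - 1]. As σ(T) = h and
        -- σ(C) = h - (n - 1) e₁, `kill` identifies the difference.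
        total : sumℤ ws - sumℤ vs ≡ + suc n′
        total = trans (ring-146 (sumℤ ws - sumℤ vs) (+ suc n′)) (trans (cong (λ z → z + + suc n′) y≡0) (ℤ.+-identityˡ _))
          where
          r : Range (sumℤ ws - sumℤ vs)
          r = chain [] [] vs ws Prop.refl Prop.refl refl (trans vs-length (sym ws-length)) (ℤ.+≤+ z≤n , ℤ.+≤+ z≤n)
          y≡0 : (sumℤ ws - sumℤ vs) - + suc n′ ≡ + 0
          y≡0 = kill (comb₃ (+ 1) (- + 1) (- + 1) (both₄ (λ α β γ δ → ring-83 α β (sumℤ ws - sumℤ vs) (+ suc n′) γ δ) (σ (map F vs)) (σ C) e₁ h)
                (≈-trans (≈-sym (σ-resp T≋)) σT≈) (σF vs vs-length) σC≈)
              (≤-cert₂ (ring-84 (+ suc n′) (sumℤ ws - sumℤ vs)) (proj₂ r) (ℤ.+≤+ (z≤n {n ℕ.+ suc n′})))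
              (≤-cert₂ (ring-85 (+ suc n′) (sumℤ ws - sumℤ vs)) (proj₁ r) (ℤ.+≤+ (z≤n {n})))

        -- Relative to t₀ - v e₁ the weights w - v are nonnegative, and their sum is -1 modulo n
        -- because C sums to e₁. So Σw - n v ≥ n - 1 = Σw - Σv.
        row : ∀ {v} → v ∈ vs → sumℤ (map ℤ.-_ vs) ℤ.≤ + n * (- v)
        row {v} v∈ = finish dv
          where
          S : ℤ
          S = sumℤ ws + (+ n) * (- v)
          S≥0 : + 0 ℤ.≤ S
          S≥0 = subst (+ 0 ℤ.≤_) (trans (sumℤ-shift (- v) ws) (cong (λ l → sumℤ ws + (+ l) * (- v)) ws-length)) (sumℤ-nonneg (All.map⁺ (All.map proj₁ (All.lookup vs-fit v∈))))
          dv : D n (+ 1 + S)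
          dv = indep₁ {a = + 1 + S} B (P.comb₃ (+ 1) (- + 1) (+ 1) (both₃ (λ α β γ → ring-86 α β (sumℤ ws) v γ (+ n)) (σ C) t₀ e₁)
              (≈⇒~ σC-ray) σC~ (n·~0 (t₀ ⊕ (- v) · e₁)))
            where
            σC-ray : σ C ≈ (+ n) · t₀ ⊕ (- sumℤ ws) · e₁
            σC-ray = ≈-trans (σ-resp C≋) (≈-reflexive (trans (σ-ray t₀ e₁ ws) (cong (λ k → (+ k) · t₀ ⊕ (- sumℤ ws) · e₁) ws-length)))
          finish : D n (+ 1 + S) → sumℤ (map ℤ.-_ vs) ℤ.≤ + n * (- v)
          finish d = ≤-cert₁ (trans (cong (λ z → + n * (- v) - z) (neg-sum vs)) (trans (ring-87 (sumℤ ws) (sumℤ vs) (+ n * (- v))) (cong (λ z → S - z) total))) (D-positive S≥0 d)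

        -- By `row` no -v lies below the mean of the -v, so all v coincide; and t₀ itself has
        -- coefficient 0.
        vs-zero : All (_≡ + 0) vs
        vs-zero = All.tabulate (λ {v} v∈ → cancel v (trans (All.lookup means (∈-map v∈)) mean≡0))
          where
          neg-length : + length (map ℤ.-_ vs) ≡ + n
          neg-length = cong +_ (trans (List.length-map ℤ.-_ vs) vs-length)
          means : All (λ d → + n * d ≡ sumℤ (map ℤ.-_ vs)) (map ℤ.-_ vs)
          means = above-mean (+ n) (map ℤ.-_ vs) neg-length (All.map⁺ (All.tabulate row))
          ∈-map : ∀ {v xs} → v ∈ xs → - v ∈ map ℤ.-_ xs
          ∈-map (here e) = here (cong ℤ.-_ e)
          ∈-map (there p) = there (∈-map p)
          first : ∀ xs → Pointwise _≈_ (t₀ ∷ T₀) (map F xs) → ∃[ v ] v ∈ xs × t₀ ≈ F v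
          first (v ∷ xs) (e ∷ _) = v , here refl , e
          mean≡0 : sumℤ (map ℤ.-_ vs) ≡ + 0
          mean≡0 = go (first vs (subst (λ L → Pointwise _≈_ L (map F vs)) T≡ (proj₂ (proj₂ (proj₂ offsets))))) (uncons ws ws-length)
            where
            go : (∃[ v ] v ∈ vs × t₀ ≈ F v) → (∃[ w ] ∃[ xs ] ws ≡ w ∷ xs) → sumℤ (map ℤ.-_ vs) ≡ + 0
            go (v , v∈ , e) (w , xs , ew) = trans (sym (All.lookup means (∈-map v∈))) (trans (cong (λ z → + n * - z) v≡0) (ℤ.*-zeroʳ (+ n)))
              where
              w∈ : w ∈ ws
              w∈ = subst (w ∈_) (sym ew) (here refl)
              rw : Range w
              rw = All.lookup ws-range w∈
              rwv : Range (w - v)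
              rwv = All.lookup (All.lookup vs-fit v∈) w∈
              v≡0 : v ≡ + 0
              v≡0 = kill (comb₁ (+ 1) (both₂ (λ α β → ring-21 α v β) t₀ e₁) e)
                  (≤-cert₃ (ring-22 (+ suc n′) w v) (proj₂ rw) (proj₁ rwv) (ℤ.+≤+ (z≤n {n})))
                  (≤-cert₃ (ring-23 (+ suc n′) w v) (proj₁ rw) (proj₂ rwv) (ℤ.+≤+ (z≤n {n})))
          cancel : ∀ v → + n * (- v) ≡ + 0 → v ≡ + 0
          cancel v e = trans (sym (ℤ.neg-involutive v)) (cong ℤ.-_ (ℤ.*-cancelˡ-≡ (+ n) (- v) (+ 0) (trans e (sym (ℤ.*-zeroʳ (+ n))))))

        T-const : All (_≈ t₀) T
        T-const = go T (map F vs) (proj₂ (proj₂ (proj₂ offsets))) (All.map⁺ (All.map (λ e → ≈-reflexive (trans (cong F e) (both₂ ring-147 t₀ e₁))) vs-zero))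
          where
          go : ∀ xs ys → Pointwise _≈_ xs ys → All (_≈ t₀) ys → All (_≈ t₀) xs
          go [] [] [] [] = []
          go (x ∷ xs) (y ∷ ys) (p ∷ ps) (q ∷ qs) = ≈-trans p q ∷ go xs ys ps qs

        ws-sum : sumℤ ws ≡ + suc n′
        ws-sum = trans (trans (sym (ℤ.+-identityʳ _)) (cong (λ z → sumℤ ws - z) (sym (zeros vs-zero)))) total
          where
          zeros : ∀ {xs} → All (_≡ + 0) xs → sumℤ xs ≡ + 0
          zeros [] = refl
          zeros (refl ∷ ps) = trans (ℤ.+-identityˡ _) (zeros ps)

    opaque
      spread : ∃[ u ] ∃[ ws ] All (_≈ u) T × length ws ≡ n × All Range ws × sumℤ ws ≡ + suc n′ × C ≋ map (λ w → u ⊕ (- w) · e₁) ws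
      spread = let (t₀ , T₀ , e) = uncons T T-length in t₀ , From.ws t₀ T₀ e , From.T-const t₀ T₀ e , From.ws-length t₀ T₀ e , From.ws-range t₀ T₀ e , From.ws-sum t₀ T₀ e , From.C≋ t₀ T₀ e

  -- Blocks with a term of e₂-coordinate at least 2, when n e₁ = h.

  module Bad {h e₁ e₂ C T} (W : Window h e₁ e₂ (replicate (suc n′) e₁) C T) (1≤n′ : 1 ≤ n′)
      (η≈h : (+ n) · e₁ ≈ h) where
    open Window W
    open Generator gen
    open Constant W 1≤n′

    opaque
      η≉0 : ¬ (+ n) · e₁ ≈ 0G
      η≉0 p = h≉0 (≈-trans (≈-sym η≈h) p)

    open Order B η≉0 public

    ν : ℤ
    ν = + suc n′

    Gap : ℤ → Set
    Gap d = - + n′ ℤ.≤ d × d ℤ.≤ + n′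

    -- The term t has e₂-coordinate b + 2 and cannot be exchanged for a single term of C. Instead, t
    -- with l + 1 terms of C, where l = n - b - 3, has its sum over ⟨e₁⟩, which compares the terms
    -- of C among themselves.
    module Reps {t T′ a b} (pt : T ≋ t ∷ T′) (t~ : t ~ a · e₁ ⊕ (+ suc (suc b)) · e₂) (b<n : suc (suc b) < n) where

      l : ℕ
      l = n′ ∸ suc b

      opaque
        b+l : suc b ℕ.+ l ≡ n′
        b+l = m+[n∸m]≡n (≤-pred (≤-pred b<n))

        -- replacing one element of C in a zero-sum through t changes the e₁-part by less than n - 1
        probe : ∀ c {J} → Sub (c ∷ J) C → length J ≡ l → ∃[ x ] (+ suc b ℤ.≤ x × x ℤ.≤ ν) × c ⊕ (σ (t ∷ J) ⊕ x · e₁) ≈ h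
        probe c {J} sub e = finish (line {t} {a} {suc (suc b)} {c ∷ J} t~ (All-subC sub) len)
          where
          len : suc (suc b) ℕ.+ suc (length J) ≡ n
          len = trans (cong (λ k → suc (suc b) ℕ.+ suc k) e) (trans (+-suc (suc (suc b)) l) (cong (suc ∘ suc) b+l))
          subY : Sub (t ∷ c ∷ J) (C ++ T)
          subY = sub-respʳ (++-comm T C) (sub-++ {t ∷ []} (T′ , pt) sub)
          len-Y : length (t ∷ c ∷ J) < n ℕ.+ n
          len-Y = ≤-<-trans (s≤s (≤-trans (m≤n+m _ (suc b)) (≤-pred (≤-reflexive len)))) (m<m+n n (s≤s z≤n))
          finish : (∃[ y ] σ (t ∷ c ∷ J) ~ y · e₁) → ∃[ x ] (+ suc b ℤ.≤ x × x ℤ.≤ ν) × c ⊕ (σ (t ∷ J) ⊕ x · e₁) ≈ h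
          finish (y , p) = use (complete {t ∷ c ∷ J} {y} subY (s≤s z≤n) len-Y p)
            where
            use : (∃[ x ] x < n × σ (t ∷ c ∷ J) ⊕ (+ x) · e₁ ≈ h × n ≤ x ℕ.+ length (t ∷ c ∷ J)) → ∃[ x ] (+ suc b ℤ.≤ x × x ℤ.≤ ν) × c ⊕ (σ (t ∷ J) ⊕ x · e₁) ≈ h
            -- The lower bound b + 1 is n - |Y|, because Y has n - b - 1 terms and a zero-sum at
            -- least n.
            use (x , lx , q , ll) = + x , (ℤ.+≤+ (+-cancelʳ-≤ (suc (length J)) _ _ (≤-pred (≤-trans (≤-reflexive len) (≤-trans ll (≤-reflexive (+-suc x (suc (length J)))))))) , ℤ.+≤+ (≤-pred lx)) ,
              ≈-trans (≈-reflexive (both₄ (λ α β γ δ → ring-41 α β γ (+ x) δ) c t (σ J) e₁)) q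

        range-gap : ∀ {x y} → (+ suc b ℤ.≤ x × x ℤ.≤ ν) → (+ suc b ℤ.≤ y × y ℤ.≤ ν) → Gap (x - y)
        range-gap {x} {y} (lx , ux) (ly , uy) = ≤-cert₃ (ring-148 x y (+ b) (+ n′)) lx uy (ℤ.+≤+ (z≤n {b})) , ≤-cert₃ (ring-149 x y (+ b) (+ n′)) ux ly (ℤ.+≤+ (z≤n {b}))

        shift-by : ∀ {c c′ s x y} → c ⊕ (s ⊕ x · e₁) ≈ h → c′ ⊕ (s ⊕ y · e₁) ≈ h → c′ ≈ c ⊕ (x - y) · e₁
        shift-by {c} {c′} {s} {x} {y} p q = comb₂ (- + 1) (+ 1) (both₅ (λ α β γ δ ε → ring-150 α β γ x y δ ε) c c′ s e₁ h) p q

        close : ∀ {c c′ C″} → C ≋ c ∷ c′ ∷ C″ → ∃[ d ] Gap d × c′ ≈ c ⊕ d · e₁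
        close {c} {c′} {C″} p = finish (probe c (sub-respʳ (≋-sym p) (sub-∷ c (sub-++ʳ (c′ ∷ []) (sub-take l C″)))) len)
             (probe c′ (sub-respʳ (≋-sym (≋-trans p (Perm.swap ≈-refl ≈-refl ≋-refl))) (sub-∷ c′ (sub-++ʳ (c ∷ []) (sub-take l C″)))) len)
          where
          len : length (take l C″) ≡ l
          len = length-take-≤ l C″ (≤-trans (m∸n≤m n′ (suc b)) (≤-reflexive (suc-injective (suc-injective (trans (sym C-length) (≋-length p))))))
          finish : (∃[ x ] (+ suc b ℤ.≤ x × x ℤ.≤ ν) × c ⊕ (σ (t ∷ take l C″) ⊕ x · e₁) ≈ h) → (∃[ y ] (+ suc b ℤ.≤ y × y ℤ.≤ ν) × c′ ⊕ (σ (t ∷ take l C″) ⊕ y · e₁) ≈ h) → ∃[ d ] Gap d × c′ ≈ c ⊕ d · e₁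
          finish (x , rx , p) (y , ry , q) = x - y , range-gap rx ry , shift-by {c} {c′} {σ (t ∷ take l C″)} {x} {y} p q

        unique-gap : ∀ {c c′ d d′} → Gap d → Gap d′ → c′ ≈ c ⊕ d · e₁ → c′ ≈ c ⊕ d′ · e₁ → d ≡ d′
        unique-gap {c} {c′} {d} {d′} (a₁ , a₂) (b₁ , b₂) p q = ℤ.i-j≡0⇒i≡j d d′ (kill (comb₂ (- + 1) (+ 1) (both₃ (λ α β γ → ring-151 α β d d′ γ) c c′ e₁) p q)
             (≤-cert₃ (ring-152 d d′ (+ n′)) a₂ b₁ (ℤ.+≤+ (z≤n {3}))) (≤-cert₃ (ring-153 d d′ (+ n′)) a₁ b₂ (ℤ.+≤+ (z≤n {3}))))

        -- Pairwise gaps are found separately and need not be additive. Probing three terms against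
        -- the same remainder yields additive ones, and `unique-gap` identifies them with the given
        -- gaps.
        close₃ : ∀ {c₀ c c′ C‴ d d′} → C ≋ c₀ ∷ c ∷ c′ ∷ C‴ → Gap d → Gap d′ → c ≈ c₀ ⊕ d · e₁ → c′ ≈ c₀ ⊕ d′ · e₁ → Gap (d - d′)
        close₃ {c₀} {c} {c′} {C‴} {d} {d′} p gd gd′ ed ed′ = finish
            (probe c₀ (sub-respʳ (≋-sym p) (sub-∷ c₀ (sub-++ʳ (c ∷ c′ ∷ []) (sub-take l C‴)))) len)
            (probe c (sub-respʳ (≋-sym (≋-trans p (Perm.swap ≈-refl ≈-refl ≋-refl))) (sub-∷ c (sub-++ʳ (c₀ ∷ c′ ∷ []) (sub-take l C‴)))) len)
            (probe c′ (sub-respʳ (≋-sym (≋-trans p (↭-shift (c₀ ∷ c ∷ []) C‴))) (sub-∷ c′ (sub-++ʳ (c₀ ∷ c ∷ []) (sub-take l C‴)))) len)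
          where
          len : length (take l C‴) ≡ l
          len = length-take-≤ l C‴ (≤-pred (≤-trans (≤-trans (s≤s (m≤n+m l b)) (≤-reflexive b+l)) (≤-reflexive (suc-injective (suc-injective (trans (sym C-length) (≋-length p)))))))
          Probe : Elt → Set
          Probe c = ∃[ x ] (+ suc b ℤ.≤ x × x ℤ.≤ ν) × c ⊕ (σ (t ∷ take l C‴) ⊕ x · e₁) ≈ h
          finish : Probe c₀ → Probe c → Probe c′ → Gap (d - d′)
          finish (x , rx , p) (y , ry , q) (z , rz , r) = subst Gap (trans (ring-88 x y z) (cong₂ (λ u v → u - v)
              (unique-gap {c₀} {c} (range-gap rx ry) gd (shift-by {c₀} {c} {σ (t ∷ take l C‴)} {x} {y} p q) ed) (unique-gap {c₀} {c′} (range-gap rx rz) gd′ (shift-by {c₀} {c′} {σ (t ∷ take l C‴)} {x} {z} p r) ed′))) (range-gap rz ry)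

      -- A normal form of C in which the shift in u makes the weights sum to exactly n - 1. In
      -- contrast to `Spread`, weights may be negative here; it is their mutual distance that is
      -- bounded, by n - 2.
      Coordinates : Set
      Coordinates = ∃[ u ] ∃[ ws ] (+ n) · u ≈ h × (∃[ x ] u ~ x · e₁ ⊕ e₂) × C ≋ map (λ w → u ⊕ (- w) · e₁) ws × length ws ≡ n × sumℤ ws ≡ ν ×
        (∀ {w w′} → w ∈ ws → w′ ∈ ws → Gap (w - w′))

      opaque
        coordinates : Coordinates
        coordinates = start (uncons C C-length)
          where
          start : (∃[ c₀ ] ∃[ C₁ ] C ≡ c₀ ∷ C₁) → Coordinates
          start (c₀ , C₁ , e) = collected (gather G (All.tabulate (λ {c} c∈ → close {c₀} {c} (≋-trans (≋-reflexive e) (≋-prep c₀ (proj₂ (∈⇒≋ c∈)))))))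
            where
            G : ℤ → Elt
            G d = c₀ ⊕ d · e₁
            collected : (∃[ ds ] length ds ≡ length C₁ × All Gap ds × Pointwise _≈_ C₁ (map G ds)) → Coordinates
            collected (ds , lds , gds , pw) = shifted dv
              where
              es : List ℤ
              es = + 0 ∷ ds
              c₀≈ : c₀ ≈ G (+ 0)
              c₀≈ = ≈-reflexive (sym (⊕-identityʳ c₀))
              C≋G : C ≋ map G es
              C≋G = ≋-trans (≋-reflexive e) (Perm.prep c₀≈ (Perm.refl pw))
              es-length : length es ≡ n
              es-length = trans (cong suc lds) (trans (cong length (sym e)) C-length)
              σG : ∀ xs → σ (map G xs) ≡ (+ length xs) · c₀ ⊕ sumℤ xs · e₁
              σG [] = refl
              σG (x ∷ xs) = trans (cong (G x ⊕_) (σG xs)) (both₂ (λ α β → ring-24 α x (+ length xs) (sumℤ xs) β) c₀ e₁)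
              σC-G : σ C ≈ (+ n) · c₀ ⊕ sumℤ es · e₁
              σC-G = ≈-trans (σ-resp C≋G) (≈-reflexive (trans (σG es) (cong (λ k → (+ k) · c₀ ⊕ sumℤ es · e₁) es-length)))
              dv : D n (sumℤ es - + 1)
              dv = indep₁ {a = sumℤ es - + 1} B (P.comb₃ (- + 1) (+ 1) (- + 1) (both₃ (λ α β γ → ring-25 α β (sumℤ es) γ (+ n)) (σ C) c₀ e₁) (≈⇒~ σC-G) σC~ (n·~0 c₀))
              gap-es : ∀ {x y} → x ∈ es → y ∈ es → Gap (x - y)
              gap-es (here refl) (here refl) = ℤ.neg-≤-pos {n′} {0} , ℤ.+≤+ z≤n
              gap-es {y = y} (here refl) (there q) = subst Gap (sym (ℤ.+-identityˡ (- y))) (flip (All.lookup gds q))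
                where
                flip : ∀ {d} → Gap d → Gap (- d)
                flip {d} (a , b) = ≤-cert₁ (ring-5 d (+ n′)) b , ≤-cert₁ (ring-6 d (+ n′)) a
              gap-es {x} (there p) (here refl) = subst Gap (sym (ℤ.+-identityʳ x)) (All.lookup gds p)
              gap-es {x} {y} (there p) (there q) = cases (∈∈⇒↭ p q)
                where
                cases : x ≡ y ⊎ (∃[ zs ] ds ↭ x ∷ y ∷ zs) → Gap (x - y)
                cases (inj₁ refl) = subst Gap (sym (ℤ.+-inverseʳ x)) (ℤ.neg-≤-pos {n′} {0} , ℤ.+≤+ z≤n)
                cases (inj₂ (zs , r)) = close₃ {c₀} {G x} {G y} {map G zs} {x} {y} (≋-trans (≋-reflexive e) (≋-prep c₀ (≋-trans (Perm.refl pw) (↭⇒≋ (Prop.map⁺ G r))))) (All.lookup gds p) (All.lookup gds q) ≈-refl ≈-refl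
              shifted : D n (sumℤ es - + 1) → Coordinates
              -- The gaps d from c₀ add up to z n + 1, so the weights z + 1 - d add up to n (z + 1)
              -- - (z n + 1) = n - 1.
              shifted (divides z ez) = u , map g es , nu , u~ , ≋-trans C≋G (≋-reflexive (trans (List.map-cong eqG es) (List.map-∘ es))) , trans (List.length-map g es) es-length , sum-ws , gaps
                where
                g : ℤ → ℤ
                g d = (z + + 1) - d
                u : Elt
                u = c₀ ⊕ (z + + 1) · e₁
                eqG : ∀ d → G d ≡ u ⊕ (- g d) · e₁
                eqG d = both₂ (λ α β → ring-7 α d z β) c₀ e₁
                sum-g : ∀ xs → sumℤ (map g xs) ≡ (+ length xs) * (z + + 1) - sumℤ xs
                sum-g [] = ring-8 z
                sum-g (x ∷ xs) = trans (cong (λ y → g x + y) (sum-g xs)) (ring-9 x z (+ length xs) (sumℤ xs))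
                sum-es : sumℤ es ≡ z * + n + + 1
                sum-es = trans (ring-10 (sumℤ es)) (cong (ℤ._+ + 1) ez)
                sum-ws : sumℤ (map g es) ≡ ν
                sum-ws = trans (sum-g es) (trans (cong₂ (λ k s → (+ k) * (z + + 1) - s) es-length sum-es) (ring-11 z ν))
                nu : (+ n) · u ≈ h
                nu = comb₂ (- + 1) (+ 1) (both₄ s (σ C) c₀ e₁ h) σC-G σC≈
                  where
                  s : ∀ S c e h → (+ n) * (c + (z + + 1) * e) - h ≡ - + 1 * (S - ((+ n) * c + sumℤ es * e)) + + 1 * (S - (h + - ν * e))
                  s S c e h = trans (ring-12 S c z e h ν) (cong (λ k → - + 1 * (S - ((+ n) * c + k * e)) + + 1 * (S - (h + - ν * e))) (sym sum-es))
                u~ : ∃[ x ] u ~ x · e₁ ⊕ e₂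
                u~ = let (x , p) = All.lookup C∈ (subst (c₀ ∈_) (sym e) (here refl)) in x + (z + + 1) ,
                     P.comb₁ (+ 1) (both₃ (λ α β γ → ring-13 α x z β γ) c₀ e₁ e₂) p
                ∈-g : ∀ {w xs} → w ∈ map g xs → ∃[ d ] d ∈ xs × w ≡ g d
                ∈-g {xs = x ∷ xs} (here e) = x , here refl , e
                ∈-g {xs = x ∷ xs} (there p) = let (d , q , e) = ∈-g p in d , there q , e
                gaps : ∀ {w w′} → w ∈ map g es → w′ ∈ map g es → Gap (w - w′)
                gaps {w} {w′} p q = let (d , dp , ed) = ∈-g p ; (d′ , dq , ed′) = ∈-g q in subst Gap (trans (ring-14 z d d′) (cong₂ (λ x y → x - y) (sym ed) (sym ed′))) (gap-es dq dp)

  -- The terms b·u - x·e₁ of T are added one at a time to a changing piece of C, so that the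
  -- coefficient of u stays a multiple of n and the completion number stays under control. Over the
  -- whole block this bounds Σx from below, while sorted weights bound each x from above.
  module Rotation {h e₁ e₂ C T} (W : Window h e₁ e₂ (replicate (suc n′) e₁) C T) (1≤n′ : 1 ≤ n′) (η≈h : (+ n) · e₁ ≈ h)
      (u : Elt) (ws : List ℤ) (nu≈h : (+ n) · u ≈ h) (u∈ : ∃[ x ] u ~ x · e₁ ⊕ e₂) (C≋ : C ≋ map (λ w → u ⊕ (- w) · e₁) ws)
      (ws-length : length ws ≡ n) (ws-sum : sumℤ ws ≡ + suc n′)
      (gaps : ∀ {w w′} → w ∈ ws → w′ ∈ ws → (- + n′ ℤ.≤ w - w′ × w - w′ ℤ.≤ + n′)) where
    open Window W
    open Generator gen
    open Constant W 1≤n′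
    open Bad W 1≤n′ η≈h

    F : ℤ → Elt
    F w = u ⊕ (- w) · e₁

    G : ℕ × ℤ → Elt
    G (b , x) = (+ b) · u ⊕ (- x) · e₁

    -- Since n u = h, the number x + Σ(drop b L) of copies of e₁ completes b·u - x·e₁ together with
    -- the last n - b terms of C. It is at most n - 1, and at least b - 1 because zero-sums have
    -- length at least n.
    Fits : List ℤ → ℕ × ℤ → Set
    Fits L (b , x) = + b ℤ.≤ + 1 + (x + sumℤ (drop b L)) × x + sumℤ (drop b L) ℤ.≤ ν

    -- b is the coordinate of t modulo ⟨e₁⟩
    Placed : Elt → ℕ × ℤ → Set
    Placed t (b , x) = b < n × t ≈ G (b , x) × (b ≡ 0 → x ≡ - + 1)

    opaque
      σG : ∀ ps → σ (map G ps) ≡ (+ Σb ps) · u ⊕ (- Σλ ps) · e₁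
      σG [] = refl
      σG ((b , x) ∷ ps) = trans (cong (G (b , x) ⊕_) (σG ps)) (both₂ (λ α β → ring-196 α β (+ b) x (+ Σb ps) (Σλ ps)) u e₁)

      subF : ∀ {L I J} → ws ↭ L → L ≡ I ++ J → Sub (map F J) C
      subF {L} {I} {J} p refl = map F I , ≋-trans C≋ (≋-trans (↭⇒≋ (Prop.map⁺ F p)) (≋-trans (≋-reflexive (List.map-++ F I J)) (++-comm (map F I) (map F J))))

      measure : ∀ {t T′ b J} → T ≋ t ∷ T′ → ∀ {a} → t ~ a · e₁ ⊕ (+ suc b) · e₂ → Sub (map F J) C → suc b ℕ.+ length J ≡ n →
        ∃[ x ] + b ℤ.≤ x × x ℤ.≤ ν × t ≈ (+ suc b) · u ⊕ (- (x - sumℤ J)) · e₁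
      measure {t} {T′} {b} {J} pt {a} t~ sub len = finish (line {t} {a} {suc b} {map F J} t~ (All-subC sub) (trans (cong (suc b ℕ.+_) (List.length-map F J)) len))
        where
        Y : List Elt
        Y = t ∷ map F J
        Y-length : length Y ≡ suc (length J)
        Y-length = cong suc (List.length-map F J)
        len-Y : length Y < n ℕ.+ n
        len-Y = ≤-<-trans (≤-trans (≤-reflexive Y-length) (≤-trans (s≤s (m≤n+m _ b)) (≤-reflexive len))) (m<m+n n (s≤s z≤n))
        subY : Sub Y (C ++ T)
        subY = sub-respʳ (++-comm T C) (sub-++ {t ∷ []} (T′ , pt) sub)
        finish : (∃[ y ] σ Y ~ y · e₁) → ∃[ x ] + b ℤ.≤ x × x ℤ.≤ ν × t ≈ (+ suc b) · u ⊕ (- (x - sumℤ J)) · e₁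
        finish (y , p) = use (complete {Y} {y} subY (s≤s z≤n) len-Y p)
          where
          use : (∃[ x ] x < n × σ Y ⊕ (+ x) · e₁ ≈ h × n ≤ x ℕ.+ length Y) → ∃[ x ] + b ℤ.≤ x × x ℤ.≤ ν × t ≈ (+ suc b) · u ⊕ (- (x - sumℤ J)) · e₁
          use (x , lx , q , ll) = + x , ℤ.+≤+ (+-cancelʳ-≤ (suc (length J)) _ _ (≤-trans (≤-reflexive (trans (+-suc b _) len)) (≤-trans ll (≤-reflexive (cong (x ℕ.+_) Y-length))))) , ℤ.+≤+ (≤-pred lx) ,
              comb₂ (+ 1) (- + 1) (both₄ s t u e₁ h) (subst (λ v → (t ⊕ v) ⊕ (+ x) · e₁ ≈ h) (σ-ray u e₁ J) q) nu≈h
            where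
            s : ∀ t u e h → t - ((+ suc b) * u + - (+ x - sumℤ J) * e) ≡ + 1 * (((t + ((+ length J) * u + - sumℤ J * e)) + (+ x) * e) - h) + - + 1 * ((+ n) * u - h)
            s t u e h = trans (ring-89 t u e h (+ x) (sumℤ J) (+ suc b) (+ length J)) (cong (λ k → + 1 * (((t + ((+ length J) * u + - sumℤ J * e)) + (+ x) * e) - h) + - + 1 * ((+ k) * u - h)) len)

      place : ∀ {t T′} → T ≋ t ∷ T′ → ∃[ a ] ∃[ p ] t ~ a · e₁ ⊕ (+ proj₁ p) · e₂ × Placed t p × Fits ws p
      place {t} {T′} pt = cases (coord t)
        where
        cases : (∃[ a ] ∃[ b ] b < n × t ~ a · e₁ ⊕ (+ b) · e₂) → ∃[ a ] ∃[ p ] t ~ a · e₁ ⊕ (+ proj₁ p) · e₂ × Placed t p × Fits ws p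
        -- Coordinate 0 forces t = e₁, since n - 1 copies of e₁ must complete it and n e₁ = h. This
        -- is the pair (0, -1), with completion number n - 2.
        cases (a , zero , lt , q) = a , (0 , - + 1) , q , (lt , t≈ (complete {t ∷ []} {a} (sub-++ʳ C (T′ , pt)) (s≤s z≤n) (s≤s (s≤s z≤n)) (P.≈-trans (P.≈-reflexive (⊕-identityʳ t)) (P.≈-trans q (P.≈-reflexive (⊕-identityʳ (a · e₁)))))) , λ _ → refl) ,
            ≤-cert₁ (trans (cong (λ z → (+ 1 + (- + 1 + z)) - + 0) ws-sum) (ring-154 ν)) (ℤ.+≤+ (z≤n {suc n′})) , ≤-cert₁ (trans (cong (λ z → ν - (- + 1 + z)) ws-sum) (ring-155 ν)) (ℤ.+≤+ (z≤n {1}))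
          where
          t≈ : (∃[ x ] x < n × σ (t ∷ []) ⊕ (+ x) · e₁ ≈ h × n ≤ x ℕ.+ 1) → t ≈ G (0 , - + 1)
          t≈ (x , lx , p , ll) = comb₂ (+ 1) (- + 1) (both₄ s t u e₁ h) p η≈h
            where
            x≡ : n ≡ suc x
            x≡ = ≤-antisym (≤-trans ll (≤-reflexive (+-comm x 1))) lx
            s : ∀ t u e h → t - (+ 0 * u + - (- + 1) * e) ≡ + 1 * (((t + + 0) + (+ x) * e) - h) + - + 1 * ((+ n) * e - h)
            s t u e h = trans (ring-90 t u e h (+ x)) (cong (λ k → + 1 * (((t + + 0) + (+ x) * e) - h) + - + 1 * ((+ k) * e - h)) (sym x≡))
        cases (a , suc b , lt , q) = finish (measure {b = b} pt {a} q (subF {ws} {take (suc b) ws} Prop.refl (drop-take-++ (suc b) ws)) (length-drop-+ (suc b) ws ws-length (<⇒≤ lt)))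
          where
          finish : (∃[ x ] + b ℤ.≤ x × x ℤ.≤ ν × t ≈ (+ suc b) · u ⊕ (- (x - sumℤ (drop (suc b) ws))) · e₁) → ∃[ a ] ∃[ p ] t ~ a · e₁ ⊕ (+ proj₁ p) · e₂ × Placed t p × Fits ws p
          finish (x , bx , xn , e) = a , (suc b , x - S) , q , (lt , e , λ ()) , ≤-cert₁ (ring-91 x S (+ b)) bx , ≤-cert₁ (ring-92 x S ν) xn
            where
            S : ℤ
            S = sumℤ (drop (suc b) ws)

      G~ : ∀ b x → ∃[ a ] G (b , x) ~ a · e₁ ⊕ (+ b) · e₂
      G~ b x = let (y , p) = u∈ in + b * y - x , P.comb₁ (+ b) (both₃ (λ α β γ → ring-197 α β γ y (+ b) x) u e₁ e₂) p

      -- Rotating by one step replaces one weight y of the tail by w₀, a change of at most n - 2 by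
      -- `gaps`. The completion number of the new order is so close to the changed old one that
      -- `kill` makes them equal.
      Fits-rot : ∀ {b x T′ w₀ L} → T ≋ G (b , x) ∷ T′ → b < n → ws ↭ w₀ ∷ L → Fits (w₀ ∷ L) (b , x) → Fits (L ++ w₀ ∷ []) (b , x)
      Fits-rot {zero} {x} {T′} {w₀} {L} pt lt p fit = subst (λ z → + 0 ℤ.≤ + 1 + (x + z) × x + z ℤ.≤ ν) (sumℤ-↭ (Prop.++-comm (w₀ ∷ []) L)) fit
      Fits-rot {suc b} {x} {T′} {w₀} {L} pt lt p fit = finish (drop-head b L b<L) (measure {b = b} pt {proj₁ (G~ (suc b) x)} (proj₂ (G~ (suc b) x)) (subF {L ++ w₀ ∷ []} {take (suc b) (L ++ w₀ ∷ [])} (Prop.trans p (Prop.++-comm (w₀ ∷ []) L)) (drop-take-++ (suc b) (L ++ w₀ ∷ [])))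
           (length-drop-+ (suc b) (L ++ w₀ ∷ []) (trans (List.length-++ L) (trans (+-comm (length L) 1) (trans (sym (Prop.↭-length p)) ws-length))) (<⇒≤ lt)))
        where
        L-length : suc (length L) ≡ n
        L-length = trans (sym (Prop.↭-length p)) ws-length
        b<L : b < length L
        b<L = ≤-pred (≤-trans lt (≤-reflexive (sym L-length)))
        J : List ℤ
        J = drop (suc b) (L ++ w₀ ∷ [])
        finish : (∃[ y ] y ∈ L × drop b L ≡ y ∷ drop (suc b) L) → (∃[ z ] + b ℤ.≤ z × z ℤ.≤ ν × G (suc b , x) ≈ (+ suc b) · u ⊕ (- (z - sumℤ J)) · e₁) → Fits (L ++ w₀ ∷ []) (suc b , x)
        finish (y , y∈ , ey) (z , bz , zn , ez) = subst (λ k → + suc b ℤ.≤ + 1 + k × k ℤ.≤ ν) (sym new) (≤-cert₁ (ring-156 z (+ b)) bz , zn)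
          where
          E : List ℤ
          E = drop (suc b) L
          sumJ : sumℤ J ≡ w₀ + sumℤ E
          sumJ = trans (cong sumℤ (drop-++-≤ (suc b) L (w₀ ∷ []) b<L)) (sumℤ-↭ (Prop.++-comm E (w₀ ∷ [])))
          old : ℤ
          old = x + (y + sumℤ E)
          fit′ : + suc b ℤ.≤ + 1 + old × old ℤ.≤ ν
          fit′ = subst (λ k → + suc b ℤ.≤ + 1 + (x + sumℤ k) × x + sumℤ k ℤ.≤ ν) ey fit
          gp : Gap (w₀ - y)
          gp = gaps (Prop.∈-resp-↭ (Prop.↭-sym p) (here refl)) (Prop.∈-resp-↭ (Prop.↭-sym p) (there y∈))
          y≡0 : (x + (w₀ + sumℤ E)) - z ≡ + 0
          y≡0 = kill (comb₁ (- + 1) (both₂ a₁′ u e₁) ez)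
               (≤-cert₄ (ring-94 (+ n′) (+ b) x y w₀ (sumℤ E) z) (proj₂ fit′) (proj₂ gp) bz (ℤ.+≤+ (z≤n {suc (suc b)})))
               (≤-cert₄ (ring-95 (+ n′) (+ b) x y w₀ (sumℤ E) z) (proj₁ fit′) (proj₁ gp) zn (ℤ.+≤+ (z≤n {suc (suc b)})))
            where
            a₁′ : ∀ u e → ((x + (w₀ + sumℤ E)) - z) * e - + 0 ≡ - + 1 * (((+ suc b) * u + - x * e) - ((+ suc b) * u + - (z - sumℤ J) * e))
            a₁′ u e = trans (cong (λ S → ((x + S) - z) * e - + 0) (sym sumJ)) (ring-93 u e (+ suc b) x (sumℤ J) z)
          new : x + sumℤ J ≡ z
          new = trans (cong (λ k → x + k) sumJ) (ℤ.i-j≡0⇒i≡j _ _ y≡0)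

    module Chain (ps : List (ℕ × ℤ)) (T≋ : T ≋ map G ps) (ps-small : All (λ p → proj₁ p < n) ps) where

      opaque
        pick : ∀ {p} → p ∈ ps → ∃[ T′ ] T ≋ G p ∷ T′
        pick p∈ = let (qs , r) = ∈⇒↭ p∈ in map G qs , ≋-trans T≋ (↭⇒≋ (Prop.map⁺ G r))

        rotate : ∀ K J → ws ↭ K ++ J → All (Fits (K ++ J)) ps → All (Fits (J ++ K)) ps
        rotate [] J p fits = subst (λ L → All (Fits L) ps) (sym (List.++-identityʳ J)) fits
        rotate (k ∷ K) J p fits = subst (λ L → All (Fits L) ps) (List.++-assoc J (k ∷ []) K) (rotate K (J ++ k ∷ []) (Prop.trans p (Prop.trans (Prop.++-comm (k ∷ []) (K ++ J)) (Prop.↭-reflexive (List.++-assoc K J (k ∷ [])))))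
             (subst (λ L → All (Fits L) ps) (List.++-assoc K J (k ∷ [])) (All.tabulate (λ {q} q∈ → Fits-rot {proj₁ q} {proj₂ q} (proj₂ (pick q∈)) (All.lookup ps-small q∈) p (All.lookup fits q∈)))))

        ps-length : length ps ≡ n
        ps-length = trans (sym (List.length-map G ps)) (trans (sym (≋-length T≋)) T-length)

      End : Set
      End = ∃[ q ] Σb ps ≡ q ℕ.* n × (+ q - + 1) * + n ℤ.≤ Σλ ps

      -- For the terms `ps₁` of T and `I` of C, with total coefficient q n of u, the sum is q h -
      -- (Σλ + ΣI) e₁. As h = n e₁, this is the number of copies of e₁ completing it to h, up to the
      -- order of e₁.
      value : List (ℕ × ℤ) → List ℤ → ℕ → ℤ
      value ps₁ I q = (Σλ ps₁ + sumℤ I) - (+ q - + 1) * + n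

      opaque
        -- `complete` provides a number in [0, n - 1] with the same multiple of e₁, and the rough
        -- bound n on the absolute value already lets `kill` identify it with `value`.
        advance : ∀ {ps₁ ps₂ I J q} → ps ↭ ps₁ ++ ps₂ → ws ↭ I ++ J → 1 ≤ length ps₁ → length I < n → Σb ps₁ ℕ.+ length I ≡ q ℕ.* n →
          - + n ℤ.≤ value ps₁ I q → value ps₁ I q ℤ.≤ + n → + 0 ℤ.≤ value ps₁ I q × value ps₁ I q ℤ.≤ + n
        advance {ps₁} {ps₂} {I} {J} {q} pp pw 1≤ lI count lo hi = finish (complete {Y} { - (Σλ ps₁ + sumℤ I)} subY 1≤Y len-Y
              (P.≈-trans (P.≈-reflexive σY) (P.comb₁ (+ q) (both₂ a u e₁) (n·~0 u))))
          where
          Y : List Elt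
          Y = map G ps₁ ++ map F I
          Y-length : length Y ≡ length ps₁ ℕ.+ length I
          Y-length = trans (List.length-++ (map G ps₁)) (cong₂ ℕ._+_ (List.length-map G ps₁) (List.length-map F I))
          1≤Y : 1 ≤ length Y
          1≤Y = ≤-trans 1≤ (≤-trans (m≤m+n _ _) (≤-reflexive (sym Y-length)))
          len-Y : length Y < n ℕ.+ n
          len-Y = ≤-<-trans (≤-reflexive Y-length) (+-mono-≤-< (subst (length ps₁ ≤_) (trans (sym (trans (Prop.↭-length pp) (List.length-++ ps₁))) ps-length) (m≤m+n _ _)) lI)
          subY : Sub Y (C ++ T)
          subY = sub-respʳ (++-comm T C) (sub-++ (map G ps₂ , ≋-trans T≋ (≋-trans (↭⇒≋ (Prop.map⁺ G pp)) (≋-reflexive (List.map-++ G ps₁ ps₂))))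
             (map F J , ≋-trans C≋ (≋-trans (↭⇒≋ (Prop.map⁺ F pw)) (≋-reflexive (List.map-++ F I J)))))
          σY : σ Y ≡ ((+ Σb ps₁) · u ⊕ (- Σλ ps₁) · e₁) ⊕ ((+ length I) · u ⊕ (- sumℤ I) · e₁)
          σY = trans (σ-++ (map G ps₁) (map F I)) (cong₂ _⊕_ (σG ps₁) (σ-ray u e₁ I))
          total : + Σb ps₁ + + length I ≡ + q * + n
          total = trans (cong +_ count) (ℤ.pos-* q n)
          comp : ∀ u e → ((+ Σb ps₁) * u + - Σλ ps₁ * e) + ((+ length I) * u + - sumℤ I * e) ≡ (+ q * + n) * u + - (Σλ ps₁ + sumℤ I) * e
          comp u e = trans (ring-96 (+ Σb ps₁) (Σλ ps₁) (+ length I) (sumℤ I) u e) (cong (λ k → k * u + - (Σλ ps₁ + sumℤ I) * e) total)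
          σY′ : σ Y ≡ (+ q * + n) · u ⊕ (- (Σλ ps₁ + sumℤ I)) · e₁
          σY′ = trans σY (cong₂ _,_ (comp (proj₁ u) (proj₁ e₁)) (comp (proj₂ u) (proj₂ e₁)))
          a : ∀ u e → (((+ Σb ps₁) * u + - Σλ ps₁ * e) + ((+ length I) * u + - sumℤ I * e)) - - (Σλ ps₁ + sumℤ I) * e ≡ + q * ((+ n) * u - + 0)
          a u e = trans (cong (λ k → k - - (Σλ ps₁ + sumℤ I) * e) (comp u e)) (ring-97 (+ q) (+ n) u (- (Σλ ps₁ + sumℤ I) * e))
          V : ℤ
          V = value ps₁ I q
          finish : (∃[ x ] x < n × σ Y ⊕ (+ x) · e₁ ≈ h × n ≤ x ℕ.+ length Y) → + 0 ℤ.≤ V × V ℤ.≤ + n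
          finish (x , lx , p , _) = subst (+ 0 ℤ.≤_) (sym V≡) (ℤ.+≤+ z≤n) , hi
            where
            y≡0 : V - + x ≡ + 0
            y≡0 = kill (comb₃ (- + 1) (+ q) (- (+ q - + 1)) (both₃ (ring-42 (Σλ ps₁ + sumℤ I) (+ q) (+ n) (+ x)) u e₁ h)
                   (subst (λ v → v ⊕ (+ x) · e₁ ≈ h) σY′ p) nu≈h η≈h)
                 (≤-cert₃ (ring-43 V (+ x) ν) hi (ℤ.+≤+ (z≤n {x})) (ℤ.+≤+ (z≤n {suc n′}))) (≤-cert₂ (ring-44 V (+ x) ν) lo (ℤ.+≤+ (≤-pred lx)))
            V≡ : V ≡ + x
            V≡ = ℤ.i-j≡0⇒i≡j V (+ x) y≡0

        Σb-↭ : ∀ {xs ys : List (ℕ × ℤ)} → xs ↭ ys → Σb xs ≡ Σb ys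
        Σb-↭ Prop.refl = refl
        Σb-↭ (Prop.prep (b , _) p) = cong (b ℕ.+_) (Σb-↭ p)
        Σb-↭ (Prop.swap {xs} {ys} (b , _) (c , _) p) = trans (cong (λ k → b ℕ.+ (c ℕ.+ k)) (Σb-↭ p)) (trans (sym (+-assoc b c _)) (trans (cong (ℕ._+ Σb ys) (+-comm b c)) (+-assoc c b _)))
        Σb-↭ (Prop.trans p q) = trans (Σb-↭ p) (Σb-↭ q)

        Σλ-↭ : ∀ {xs ys : List (ℕ × ℤ)} → xs ↭ ys → Σλ xs ≡ Σλ ys
        Σλ-↭ Prop.refl = refl
        Σλ-↭ (Prop.prep (_ , b) p) = cong (λ k → b + k) (Σλ-↭ p)
        Σλ-↭ (Prop.swap {xs} {ys} (_ , b) (_ , c) p) = trans (cong (λ k → b + (c + k)) (Σλ-↭ p)) (ring-131 b c (Σλ ys))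
        Σλ-↭ (Prop.trans p q) = trans (Σλ-↭ p) (Σλ-↭ q)

        n∣Σb : D n (+ Σb ps)
        n∣Σb = proj₂ (PhiBasis.indep (shear-basis (proj₁ u∈) B (proj₂ u∈)) { - Σλ ps} {+ Σb ps}
          (P.≈-trans (P.≈-reflexive (trans (⊕-comm ((- Σλ ps) · e₁) ((+ Σb ps) · u)) (sym (σG ps)))) (P.≈-trans (P.≈-sym (≈⇒~ (σ-resp T≋))) σT~0)))

        -- Adding (b, x) works on the first b terms of C in the current order: if b ≤ i they leave
        -- the piece, otherwise the terms after them join it and q grows by one. `Fits` bounds the
        -- change of `value`, and the order is rotated by b so that the piece is initial again.
        chain : ∀ ps₁ ps₂ L i q → ps ↭ ps₁ ++ ps₂ → ws ↭ L → All (Fits L) ps → i < n → Σb ps₁ ℕ.+ i ≡ q ℕ.* n →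
          + 0 ℤ.≤ value ps₁ (take i L) q × value ps₁ (take i L) q ℤ.≤ + n → End
        chain ps₁ [] L i q pp pw fits li count (lo , hi) = q , trans (trans Σb≡ (sym (+-identityʳ _))) (trans (cong (Σb ps₁ ℕ.+_) (sym i≡0)) count) ,
            ≤-cert₁ (trans (cong (ℤ._- (+ q - + 1) * + n) (trans Σλ≡ (sym (ℤ.+-identityʳ _)))) (r (Σλ ps₁ + + 0) ((+ q - + 1) * + n))) (subst (λ j → + 0 ℤ.≤ value ps₁ (take j L) q) i≡0 lo)
          where
          pp′ : ps ↭ ps₁
          pp′ = Prop.trans pp (Prop.↭-reflexive (List.++-identityʳ ps₁))
          Σb≡ : Σb ps ≡ Σb ps₁
          Σb≡ = Σb-↭ pp′
          Σλ≡ : Σλ ps ≡ Σλ ps₁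
          Σλ≡ = Σλ-↭ pp′
          i≡0 : i ≡ 0
          i≡0 = D-small (Sg.∣m+n∣m⇒∣n {m = + Σb ps₁} (divides (+ q) (trans (cong +_ count) (ℤ.pos-* q n))) (subst (λ k → D n (+ k)) Σb≡ n∣Σb)) li
          r : ∀ a b → a - b ≡ (a - b) - + 0
          r = solve-∀
        chain ps₁ ((b , x) ∷ ps₂) L i q pp pw fits li count (lo , hi) = cases (b ≤? i)
          where
          p∈ : (b , x) ∈ ps
          p∈ = Prop.∈-resp-↭ (Prop.↭-sym (Prop.trans pp (Prop.shift (b , x) ps₁ ps₂))) (here refl)
          pp′ : ps ↭ ((b , x) ∷ ps₁) ++ ps₂
          pp′ = Prop.trans pp (Prop.shift (b , x) ps₁ ps₂)
          L-length : length L ≡ n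
          L-length = trans (sym (Prop.↭-length pw)) ws-length
          b<n : b < n
          b<n = All.lookup ps-small p∈
          K J : List ℤ
          K = take b L
          J = drop b L
          L≡ : L ≡ K ++ J
          L≡ = drop-take-++ b L
          K-length : length K ≡ b
          K-length = length-take-≤ b L (≤-trans (<⇒≤ b<n) (≤-reflexive (sym L-length)))
          J-length : b ℕ.+ length J ≡ n
          J-length = length-drop-+ b L L-length (<⇒≤ b<n)
          pw′ : ws ↭ J ++ K
          pw′ = Prop.trans pw (Prop.trans (Prop.↭-reflexive L≡) (Prop.++-comm K J))
          fits′ : All (Fits (J ++ K)) ps
          fits′ = rotate K J (Prop.trans pw (Prop.↭-reflexive L≡)) (subst (λ L → All (Fits L) ps) L≡ fits)
          fit : Fits L (b , x)
          fit = All.lookup fits p∈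
          sumKJ : sumℤ K + sumℤ J ≡ ν
          sumKJ = trans (sym (sumℤ-++ K J)) (trans (cong sumℤ (sym L≡)) (trans (sym (sumℤ-↭ pw)) ws-sum))
          next : ∀ i′ q′ → i′ < n → (b ℕ.+ Σb ps₁) ℕ.+ i′ ≡ q′ ℕ.* n →
            - + n ℤ.≤ value ((b , x) ∷ ps₁) (take i′ (J ++ K)) q′ → value ((b , x) ∷ ps₁) (take i′ (J ++ K)) q′ ℤ.≤ + n → End
          next i′ q′ li′ count′ lo′ hi′ = chain ((b , x) ∷ ps₁) ps₂ (J ++ K) i′ q′ pp′ pw′ fits′ li′ count′
              (advance {(b , x) ∷ ps₁} {ps₂} {take i′ (J ++ K)} {drop i′ (J ++ K)} {q′} pp′ (Prop.trans pw′ (Prop.↭-reflexive (drop-take-++ i′ (J ++ K)))) (s≤s z≤n) (subst (_< n) (sym tl) li′) (trans (cong ((b ℕ.+ Σb ps₁) ℕ.+_) tl) count′) lo′ hi′)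
            where
            tl : length (take i′ (J ++ K)) ≡ i′
            tl = length-take-≤ i′ (J ++ K) (≤-trans (<⇒≤ li′) (≤-reflexive (trans (sym ws-length) (Prop.↭-length pw′))))
          cases : Dec (b ≤ i) → End
          cases (yes b≤i) = next j q (≤-<-trans (m∸n≤m i b) li) cnt
              (≤-cert₂ (trans (cong (λ v → v - (- + n)) v′≡) (ring-98 v Ω ν)) lo Ω≥) (≤-cert₂ (trans (cong (λ v → + n - v) v′≡) (ring-99 v Ω ν)) hi (proj₂ fit))
            where
            j : ℕ
            j = i ∸ b
            b+j : b ℕ.+ j ≡ i
            b+j = m+[n∸m]≡n b≤i
            cnt : (b ℕ.+ Σb ps₁) ℕ.+ j ≡ q ℕ.* n
            cnt = trans (ringℕ-4 b (Σb ps₁) j) (trans (cong (Σb ps₁ ℕ.+_) b+j) count)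
            j≤ : j ≤ length J
            j≤ = +-cancelˡ-≤ b _ _ (≤-trans (≤-reflexive b+j) (≤-trans (<⇒≤ li) (≤-reflexive (sym J-length))))
            new : take j (J ++ K) ≡ take j J
            new = take-++-≤ j J K j≤
            old : take i L ≡ K ++ take j J
            old = trans (cong₂ take (trans (sym b+j) (cong (ℕ._+ j) (sym K-length))) L≡) (take-++-+ j K J)
            v Ω : ℤ
            v = value ps₁ (take i L) q
            Ω = x + sumℤ J
            Ω≥ : + 0 ℤ.≤ + 1 + Ω
            Ω≥ = ℤ.≤-trans (ℤ.+≤+ z≤n) (proj₁ fit)
            v′≡ : value ((b , x) ∷ ps₁) (take j (J ++ K)) q ≡ (v + Ω) - ν
            v′≡ = trans (cong (λ I → ((x + Σλ ps₁) + sumℤ I) - (+ q - + 1) * + n) new)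
                (trans (ring-45 x (Σλ ps₁) (sumℤ (take j J)) (sumℤ K) (sumℤ J) ((+ q - + 1) * + n)) (cong₂ (λ s k → (((Σλ ps₁ + s) - (+ q - + 1) * + n) + Ω) - k) (sym (trans (cong sumℤ old) (sumℤ-++ K (take j J)))) sumKJ))
          cases (no b≰i) = next j (suc q) (<-≤-trans (+-monoʳ-< (length J) i<b) (≤-reflexive (trans (+-comm (length J) b) J-length))) cnt
              (≤-cert₂ (trans (cong (λ v → v - (- + n)) v′≡) (ring-100 v Ω (+ n))) lo Ω≥) (≤-cert₂ (trans (cong (λ v → + n - v) v′≡) (ring-101 v Ω ν)) hi (ℤ.≤-trans (proj₂ fit) (ℤ.+≤+ (n≤1+n _))))
            where
            i<b : i < b
            i<b = ≰⇒> b≰i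
            j : ℕ
            j = length J ℕ.+ i
            cnt : (b ℕ.+ Σb ps₁) ℕ.+ j ≡ suc q ℕ.* n
            cnt = trans (ringℕ-5 b (Σb ps₁) (length J) i) (cong₂ ℕ._+_ J-length count)
            new : take j (J ++ K) ≡ J ++ take i K
            new = take-++-+ i J K
            old : take i L ≡ take i K
            old = trans (cong (take i) L≡) (take-++-≤ i K J (≤-trans (<⇒≤ i<b) (≤-reflexive (sym K-length))))
            v Ω : ℤ
            v = value ps₁ (take i L) q
            Ω = x + sumℤ J
            Ω≥ : + 0 ℤ.≤ Ω
            Ω≥ = ≤-cert₂ (ring-46 Ω (+ b)) (proj₁ fit) (ℤ.+≤+ (≤-trans (s≤s z≤n) i<b))
            v′≡ : value ((b , x) ∷ ps₁) (take j (J ++ K)) (suc q) ≡ (v + Ω) - + n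
            v′≡ = trans (cong (λ I → ((x + Σλ ps₁) + sumℤ I) - (+ suc q - + 1) * + n) new)
                (trans (cong (λ s → ((x + Σλ ps₁) + s) - (+ suc q - + 1) * + n) (sumℤ-++ J (take i K)))
                (trans (ring-47 x (Σλ ps₁) (sumℤ (take i K)) (sumℤ J) (+ q) (+ n)) (cong (λ s → (((Σλ ps₁ + s) - (+ q - + 1) * + n) + Ω) - + n) (sym (cong sumℤ old)))))

        -- the blocks satisfy x ≤ b - 1 termwise, and the chain provides the reverse inequality for the sums
        tight : All (Fits ws) ps → All (λ p → + 0 ℤ.≤ (+ proj₁ p - + 1) - proj₂ p) ps → All (λ p → (+ proj₁ p - + 1) - proj₂ p ≡ + 0) ps
        -- The empty start has q = 0 and therefore value n, the upper end of the interval kept by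
        -- `chain`.
        tight fits bounds = conclude (chain [] ps ws 0 0 Prop.refl Prop.refl fits (s≤s z≤n) refl (≤-cert₁ (ring-157 (+ n)) (ℤ.+≤+ (z≤n {n})) , ≤-cert₁ (ring-158 (+ n)) (ℤ.+≤+ (z≤n {0}))))
          where
          f : ℕ × ℤ → ℤ
          f p = (+ proj₁ p - + 1) - proj₂ p
          sum-f : ∀ qs → sumℤ (map f qs) ≡ (+ Σb qs - + length qs) - Σλ qs
          sum-f [] = refl
          sum-f ((b , x) ∷ qs) = trans (cong (λ z → f (b , x) + z) (sum-f qs)) (ring-102 (+ b) x (+ Σb qs) (+ length qs) (Σλ qs))
          conclude : End → All (λ p → f p ≡ + 0) ps
          conclude (q , e , le) = All.map⁻ (sum-nonneg-zero (map f ps) (All.map⁺ bounds) (ℤ.≤-antisym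
              (≤-cert₁ (trans (cong (λ z → + 0 - z) (trans (sum-f ps) (cong₂ (λ B l → (B - + l) - Σλ ps) (trans (cong +_ e) (ℤ.pos-* q n)) ps-length))) (ring-103 (+ q) (+ n) (Σλ ps))) le) (sumℤ-nonneg (All.map⁺ bounds))))

    module Sorted (ws-sorted : AllPairs ℤ._≤_ ws) where

      opaque
        top-split : ∀ b → b < n → ∃[ y ] All (ℤ._≤ y) (take b ws) × All (y ℤ.≤_) (drop b ws)
        top-split b lt = let (y , _ , e) = drop-head b ws (subst (b <_) (sym ws-length) lt)
                             (p , q) = sorted-split (take b ws) (drop (suc b) ws) (subst (AllPairs ℤ._≤_) (trans (drop-take-++ b ws) (cong (take b ws ++_) e)) ws-sorted)
                         in y , p , subst (All (y ℤ.≤_)) (sym e) q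

        split-sum : ∀ b → sumℤ (take b ws) + sumℤ (drop b ws) ≡ ν
        split-sum b = trans (sym (sumℤ-++ (take b ws) (drop b ws))) (trans (cong sumℤ (sym (drop-take-++ b ws))) ws-sum)

        drop-count : ∀ b → b < n → + b + + length (drop b ws) ≡ + n
        drop-count b lt = cong +_ (length-drop-+ b ws ws-length (<⇒≤ lt))

        -- If b ≥ 1 and x ≥ b, the n - b largest weights sum to at most n - 1 - b, so the least of
        -- them is at most 0. Then the other weights sum to at most 0, and the total falls short of
        -- n - 1.
        bounded : ∀ b x → b < n → (b ≡ 0 → x ≡ - + 1) → Fits ws (b , x) → + 0 ℤ.≤ (+ b - + 1) - x
        bounded zero x lt z fit = subst (λ x → + 0 ℤ.≤ (+ 0 - + 1) - x) (sym (z refl)) (ℤ.+≤+ z≤n)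
        bounded (suc b) x lt z (_ , fit) = cases (ℤ.≤-total x (+ b))
          where
          A Z : ℤ
          A = sumℤ (take (suc b) ws)
          Z = sumℤ (drop (suc b) ws)
          cases : x ℤ.≤ + b ⊎ + b ℤ.≤ x → + 0 ℤ.≤ (+ suc b - + 1) - x
          cases (inj₁ le) = ≤-cert₁ (ring-104 x (+ b)) le
          cases (inj₂ ge) = go (ℤ._≟_ x (+ b))
            where
            go : Dec (x ≡ + b) → + 0 ℤ.≤ (+ suc b - + 1) - x
            go (yes refl) = cases (inj₁ ℤ.≤-refl)
            go (no ne) = ⊥-elim (split (top-split (suc b) lt))
              where
              gt : + 1 + + b ℤ.≤ x
              gt = ℤ.i<j⇒suc[i]≤j (ℤ.≤∧≢⇒< ge (ne ∘ sym))
              light : + 1 + (+ suc b + Z) ℤ.≤ + n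
              light = ≤-cert₂ (ring-26 x (+ b) Z ν) fit gt
              split : (∃[ y ] All (ℤ._≤ y) (take (suc b) ws) × All (y ℤ.≤_) (drop (suc b) ws)) → ⊥
              split (y , lows , highs) = decide (y ℤ.≤? + 0)
                where
                len : ℤ
                len = + length (drop (suc b) ws)
                decide : Dec (y ℤ.≤ + 0) → ⊥
                decide (yes y≤0) = ℤ.<⇒≱ {ν} {ν} (ℤ.suc[i]≤j⇒i<j (≤-cert₃ (trans (ring-15 ν) (trans (cong (λ k → (ν - + 1) - k) (sym (split-sum (suc b)))) (ring-16 A Z (+ b) ν))) (sum-≤0 (All.map (λ p → ℤ.≤-trans p y≤0) lows)) light (ℤ.+≤+ (z≤n {b})))) ℤ.≤-refl
                decide (no y≰0) = ℤ.<⇒≱ {len} {len} (ℤ.suc[i]≤j⇒i<j (≤-cert₂ (trans (ring-17 (+ suc b) len Z) (cong (λ k → (k - (+ 1 + (+ suc b + Z))) + (Z - len * + 1)) (drop-count (suc b) lt))) light (sum-≥ (+ 1) (All.map (ℤ.≤-trans (ℤ.i<j⇒suc[i]≤j (ℤ.≰⇒> y≰0))) highs)))) ℤ.≤-refl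

        -- Put B = b + 2. The n - B largest weights sum to at most n - B. If the least of them were
        -- at most 0, the total would be below n - 1; if it were at least 2, their sum would be too
        -- large. So it is 1, these weights all equal 1, and the others are at most 1.
        all-≤1 : ∀ b → suc (suc b) < n → + suc b + sumℤ (drop (suc (suc b)) ws) ℤ.≤ ν → All (ℤ._≤ + 1) ws
        all-≤1 b lt fit = go (top-split (suc (suc b)) lt)
          where
          A Z len : ℤ
          A = sumℤ (take (suc (suc b)) ws)
          Z = sumℤ (drop (suc (suc b)) ws)
          len = + length (drop (suc (suc b)) ws)
          Z≤len : Z ℤ.≤ len
          Z≤len = ≤-cert₁ (trans (ring-105 Z len (+ b)) (cong (λ k → (k - + 1) - (+ suc b + Z)) (drop-count (suc (suc b)) lt))) (ℤ.≤-trans fit (ℤ.≤-reflexive (ring-106 ν)))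
          1≤len : + 1 ℤ.≤ len
          1≤len = ≤-cert₁ (trans (ring-107 len (+ suc (suc b))) (cong (λ k → k - (+ 1 + + suc (suc b))) (drop-count (suc (suc b)) lt))) (ℤ.+≤+ lt)
          go : (∃[ y ] All (ℤ._≤ y) (take (suc (suc b)) ws) × All (y ℤ.≤_) (drop (suc (suc b)) ws)) → All (ℤ._≤ + 1) ws
          go (y , lows , highs) = decide (y ℤ.≤? + 0) (+ 2 ℤ.≤? y)
            where
            decide : Dec (y ℤ.≤ + 0) → Dec (+ 2 ℤ.≤ y) → All (ℤ._≤ + 1) ws
            decide (yes y≤0) _ = ⊥-elim (ℤ.<⇒≱ {ν} {ν} (ℤ.suc[i]≤j⇒i<j (≤-cert₃ (trans (ring-48 ν) (trans (cong₂ (λ k N → (N - + 2) - k) (sym (split-sum (suc (suc b)))) (sym (drop-count (suc (suc b)) lt))) (ring-49 A Z (+ b) len))) (sum-≤0 (All.map (λ p → ℤ.≤-trans p y≤0) lows)) Z≤len (ℤ.+≤+ (z≤n {b})))) ℤ.≤-refl)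
            decide (no _) (yes 2≤y) = ⊥-elim (ℤ.<⇒≱ {len} {len} (ℤ.suc[i]≤j⇒i<j (≤-cert₃ (ring-50 len Z) (sum-≥ (+ 2) (All.map (ℤ.≤-trans 2≤y) highs)) Z≤len 1≤len)) ℤ.≤-refl)
            decide (no y≰0) (no 2≰y) = subst (All (ℤ._≤ + 1)) (sym (drop-take-++ (suc (suc b)) ws)) (All.++⁺ (All.map (λ p → ℤ.≤-trans p y≤1) lows) tops)
              where
              y≤1 : y ℤ.≤ + 1
              y≤1 = ≤-cert₁ (ring-27 y) (ℤ.i<j⇒suc[i]≤j (ℤ.≰⇒> 2≰y))
              Dp : List ℤ
              Dp = drop (suc (suc b)) ws
              nonneg : All (+ 0 ℤ.≤_) (map (λ w → w + (- + 1)) Dp)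
              nonneg = All.map⁺ (All.map (λ p → ℤ.i≤j⇒0≤j-i (ℤ.≤-trans (ℤ.i<j⇒suc[i]≤j (ℤ.≰⇒> y≰0)) p)) highs)
              zero-sum : sumℤ (map (λ w → w + (- + 1)) Dp) ≡ + 0
              zero-sum = ℤ.≤-antisym (≤-cert₁ (trans (cong (λ k → + 0 - k) (sumℤ-shift (- + 1) Dp)) (ring-28 Z len)) Z≤len) (sumℤ-nonneg nonneg)
              tops : All (ℤ._≤ + 1) Dp
              tops = All.map (λ {w} e → ℤ.≤-reflexive (trans (ring-29 w) (trans (cong (ℤ._+ + 1) e) refl))) (All.map⁻ (sum-nonneg-zero _ nonneg zero-sum))

        -- The nonnegative numbers 1 - w sum to n - (n - 1) = 1, so one weight is 0 and the others
        -- are 1.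
        one-exception : All (ℤ._≤ + 1) ws → C ≋ u ∷ replicate (suc n′) (u ⊕ (- + 1) · e₁)
        one-exception le = finish (unit-sum (map g ws) (All.map⁺ (All.map ℤ.i≤j⇒0≤j-i le)) (trans (sum-g ws) (trans (cong₂ (λ l s → + l - s) ws-length ws-sum) (ring-159 ν))))
          where
          g : ℤ → ℤ
          g w = + 1 - w
          sum-g : ∀ xs → sumℤ (map g xs) ≡ + length xs - sumℤ xs
          sum-g [] = refl
          sum-g (x ∷ xs) = trans (cong (λ z → g x + z) (sum-g xs)) (ring-108 x (+ length xs) (sumℤ xs))
          invol : ∀ w → g (g w) ≡ w
          invol = ring-109
          finish : (∃[ ys ] map g ws ↭ + 1 ∷ ys × All (_≡ + 0) ys) → C ≋ u ∷ replicate (suc n′) (u ⊕ (- + 1) · e₁)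
          finish (ys , p , zs) = ≋-trans C≋ (≋-trans (↭⇒≋ (Prop.map⁺ F (Prop.trans (Prop.↭-reflexive (sym back)) (Prop.map⁺ g p)))) (Perm.prep (≈-reflexive (⊕-identityʳ u))
               (≋-trans (const-≋ (All.map⁺ (All.map⁺ (All.map (λ { refl → ≈-refl }) zs)))) (≋-reflexive (cong (λ k → replicate k (u ⊕ (- + 1) · e₁)) len)))))
            where
            back : map g (map g ws) ≡ ws
            back = trans (sym (List.map-∘ ws)) (trans (List.map-cong invol ws) (List.map-id ws))
            len : length (map F (map g ys)) ≡ suc n′
            len = trans (List.length-map F (map g ys)) (trans (List.length-map g ys) (suc-injective (trans (sym (Prop.↭-length p)) (trans (List.length-map g ws) ws-length))))

        conclude : ∀ {t T′ a b} → T ≋ t ∷ T′ → t ~ a · e₁ ⊕ (+ suc (suc b)) · e₂ → suc (suc b) < n → C ≋ u ∷ replicate (suc n′) (u ⊕ (- + 1) · e₁)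
        conclude {t} {T′} {a} {b} pt t~ lt = finish (place pt) (gather G (All.tabulate (λ {t′} t′∈ → let (_ , p , _ , pl , ft) = place (≋-trans pt (proj₂ (∈⇒≋ {xs = t ∷ T′} (there t′∈)))) in p , ((proj₁ pl , proj₂ (proj₂ pl)) , ft) , proj₁ (proj₂ pl))))
          where
          Q : ℕ × ℤ → Set
          Q p = ((proj₁ p < n) × (proj₁ p ≡ 0 → proj₂ p ≡ - + 1)) × Fits ws p
          finish : (∃[ a ] ∃[ p ] t ~ a · e₁ ⊕ (+ proj₁ p) · e₂ × Placed t p × Fits ws p) → (∃[ ps ] length ps ≡ length T′ × All Q ps × Pointwise _≈_ T′ (map G ps)) → C ≋ u ∷ replicate (suc n′) (u ⊕ (- + 1) · e₁)
          finish (a′ , (c , x) , t~′ , (c<n , t≈ , cz) , ft) (ps , _ , qs , pw) = one-exception (all-≤1 b lt (subst (λ k → k + sumℤ (drop (suc (suc b)) ws) ℤ.≤ ν) x≡ (subst (λ k → x + sumℤ (drop k ws) ℤ.≤ ν) c≡ (proj₂ ft))))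
            where
            c≡ : c ≡ suc (suc b)
            c≡ = congruent-< c<n lt (proj₂ (PhiBasis.indep B {a′ - a} {+ c - + suc (suc b)} (P.comb₂ (- + 1) (+ 1) (both₃ (λ α β γ → ring-51 α a a′ (+ suc (suc b)) (+ c) β γ) t e₁ e₂) t~′ t~)))
            qs′ : All Q ((c , x) ∷ ps)
            qs′ = ((c<n , cz) , ft) ∷ qs
            open Chain ((c , x) ∷ ps) (≋-trans pt (Perm.prep t≈ (Perm.refl pw))) (All.map (proj₁ ∘ proj₁) qs′)
            equalities : All (λ p → (+ proj₁ p - + 1) - proj₂ p ≡ + 0) ((c , x) ∷ ps)
            equalities = tight (All.map proj₂ qs′) (All.map (λ {p} q → bounded (proj₁ p) (proj₂ p) (proj₁ (proj₁ q)) (proj₂ (proj₁ q)) (proj₂ q)) qs′)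
            x≡ : x ≡ + suc b
            x≡ = sym (trans (cong (λ k → + k - + 1) (sym c≡)) (ℤ.i-j≡0⇒i≡j (+ c - + 1) x (All.head equalities)))

  module BadBlock {h e₁ e₂ C T} (W : Window h e₁ e₂ (replicate (suc n′) e₁) C T) (1≤n′ : 1 ≤ n′) (η≈h : (+ n) · e₁ ≈ h) where
    open Window W
    open Bad W 1≤n′ η≈h

    opaque
      bad-shape : ∀ {t T′ a b} → T ≋ t ∷ T′ → t ~ a · e₁ ⊕ (+ suc (suc b)) · e₂ → suc (suc b) < n →
        ∃[ u ] (+ n) · u ≈ h × C ≋ u ∷ replicate (suc n′) (u ⊕ (- + 1) · e₁)
      bad-shape {t} {T′} {a} {b} pt t~ lt = finish (Reps.coordinates {t} {T′} {a} {b} pt t~ lt)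
        where
        finish : Reps.Coordinates {t} {T′} {a} {b} pt t~ lt → ∃[ u ] (+ n) · u ≈ h × C ≋ u ∷ replicate (suc n′) (u ⊕ (- + 1) · e₁)
        finish (u , ws , nu , u∈ , C≋ , len , sm , gp) = u , nu , Rotation.Sorted.conclude W 1≤n′ η≈h u (Sort.sort ws) nu u∈
            (≋-trans C≋ (↭⇒≋ (Prop.map⁺ _ (Prop.↭-sym perm)))) (trans (Prop.↭-length perm) len) (trans (sumℤ-↭ perm) sm)
            (λ p q → gp (Prop.∈-resp-↭ perm p) (Prop.∈-resp-↭ perm q)) (Linked⇒AllPairs ℤ.≤-trans (Sort.sort-↗ ws)) {t} {T′} {a} {b} pt t~ lt
          where
          perm : Sort.sort ws ↭ ws
          perm = Sort.sort-↭ ws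

  -- Producing the forms (a) to (d) of item 2.

  module _ {h : Elt} (G : Generator h) where
    open Generator G

    opaque
      reduce-n : ∀ {e₁} f → (+ n) · e₁ ≈ 0G → ∀ xs → ∃[ ys ] length ys ≡ length xs × All (InRange (+ 0) (+ suc n′)) ys × D n (sumℤ xs - sumℤ ys) ×
        map (λ x → x · e₁ ⊕ f) xs ≋ map (λ x → x · e₁ ⊕ f) ys
      reduce-n f z [] = [] , refl , [] , divides (+ 0) refl , ≋-refl
      reduce-n {e₁} f z (x ∷ xs) = let (ys , l , a , d , p) = reduce-n f z xs ; (r , lt , dr) = residue n x in
        + r ∷ ys , cong suc l , (ℤ.+≤+ z≤n , ℤ.+≤+ (≤-pred lt)) ∷ a , D-comb₂ (+ 1) (+ 1) (ring-198 x (+ r) (sumℤ xs) (sumℤ ys)) dr d ,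
        Perm.prep (⊕-cong {x · e₁} {(+ r) · e₁} (D⇒·≈ {x} {+ r} z dr) ≈-refl) p

      build-a : ∀ {e₁ e₂ xs S} → PhiBasis e₁ e₂ → (+ n) · e₁ ≈ 0G → (+ n) · e₂ ≈ h → length xs ≡ m ℕ.* n → D n (sumℤ xs - + 1) →
        S ≋ replicate (suc n′) e₁ ++ map (λ x → x · e₁ ⊕ e₂) xs → Form2a n m S
      build-a {e₁} {e₂} {xs} {S} B z₁ z₂ len d p = finish (reduce-n e₂ z₁ xs)
        where
        finish : (∃[ ys ] length ys ≡ length xs × All (InRange (+ 0) (+ suc n′)) ys × D n (sumℤ xs - sumℤ ys) ×
          map (λ x → x · e₁ ⊕ e₂) xs ≋ map (λ x → x · e₁ ⊕ e₂) ys) → Form2a n m S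
        finish (ys , l , a , dy , q) = use (indexed ys (trans l len) (λ x → x · e₁ ⊕ e₂) (InRange (+ 0) (+ suc n′)) a)
          where
          use : (Σ (Fin (m ℕ.* n) → ℤ) λ x → (∀ i → InRange (+ 0) (+ suc n′) (x i)) × Σℤ x ≡ sumℤ ys × tabulate (λ i → x i · e₁ ⊕ e₂) ≡ map (λ x → x · e₁ ⊕ e₂) ys) → Form2a n m S
          use (x , rg , sm , tb) = e₁ , e₂ , isBasis G B z₁ z₂ , x , rg ,
            Sg.∣⇒∣ᵤ (subst (λ k → D n (k - + 1)) (sym sm) (D-comb₂ (+ 1) (- + 1) (ring-110 (sumℤ xs) (sumℤ ys)) d dy)) ,
            toSeqEq (≋-trans p (++⁺ˡ (replicate (suc n′) e₁) (≋-trans q (≋-reflexive (sym tb)))))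

      order-D : ∀ {f d} → PhiBasis f d → (+ n) · f ≈ h → ∀ {y} → y · f ≈ 0G → D (m ℕ.* n) y
      order-D {f} B z {y} p = go (indep₁ {a = y} B (≈⇒~ p))
        where
        go : D n y → D (m ℕ.* n) y
        go (divides q e) = lift (divisor {q} (comb₂ (- q) (+ 1) (both₂ s f h) z p))
          where
          s : ∀ x h → q * h - + 0 ≡ - q * ((+ n) * x - h) + + 1 * (y * x - + 0)
          s x h = trans (ring-133 q (+ n) x h) (cong (λ k → - q * ((+ n) * x - h) + + 1 * (k * x - + 0)) (sym e))
          lift : D m q → D (m ℕ.* n) y
          lift (divides w g) = divides w (trans e (trans (cong (ℤ._* + n) g) (trans (ℤ.*-assoc w (+ m) (+ n)) (cong (w ℤ.*_) (sym (ℤ.pos-* m n))))))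

      D-mn⇒≈ : ∀ {f} → (+ n) · f ≈ h → ∀ {y} → D (m ℕ.* n) y → y · f ≈ 0G
      D-mn⇒≈ {f} z {y} (divides q e) = comb₂ (q * + m) q (both₂ s f h) z (m·≈0 h~0)
        where
        s : ∀ x h → y * x - + 0 ≡ (q * + m) * ((+ n) * x - h) + q * ((+ m) * h - + 0)
        s x h = trans (cong (λ k → k * x - + 0) (trans e (cong (q ℤ.*_) (ℤ.pos-* m n)))) (ring-199 q (+ m) (+ n) x h)

      -- Since n d = c h = n (c f), the element d - c f is annihilated by n and forms a basis with
      -- f. The congruence Σx ≡ 1 modulo mn is then the coefficient of f in σ(S) = 0.
      build-b : ∀ {f d L S} → PhiBasis f d → (+ n) · f ≈ h → length L ≡ n → All (λ v → ∃[ x ] v ~ x · f ⊕ d) L → σ S ≈ 0G →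
        S ≋ replicate (m ℕ.* n ∸ 1) f ++ L → Form2b n m S
      build-b {f} {d} {L} {S} B z len L∈ σS p = start (generates (n·~0 d))
        where
        start : (∃[ c ] (+ n) · d ≈ c · h) → Form2b n m S
        start (c , nd) = collected (gather F (All.tabulate coordinate))
          where
          d′ : Elt
          d′ = d ⊕ (- c) · f
          nd′ : (+ n) · d′ ≈ 0G
          nd′ = comb₂ (+ 1) (- c) (both₃ (ring-111 (+ n) c) d f h) nd z
          B′ : PhiBasis f d′
          B′ = shear-basis (- c) B (P.≈-reflexive (⊕-comm d ((- c) · f)))
          F : ℤ → Elt
          F x = x · f ⊕ d′
          Rg : ℤ → Set
          Rg = InRange (+ 0) (+ (m ℕ.* n ∸ 1))
          coordinate : ∀ {v} → v ∈ L → ∃[ x ] Rg x × v ≈ F x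
          coordinate {v} v∈ = go (All.lookup L∈ v∈)
            where
            go : (∃[ x ] v ~ x · f ⊕ d) → ∃[ x ] Rg x × v ≈ F x
            go (x , q) = go₂ (generates {v ⊕ ⊖ (x · f ⊕ d)} (P.comb₁ (+ 1) (both₂ r v (x · f ⊕ d)) q))
              where
              r : ∀ g u → (g - u) - + 0 ≡ + 1 * (g - u)
              r = solve-∀
              go₂ : (∃[ a ] v ⊕ ⊖ (x · f ⊕ d) ≈ a · h) → ∃[ x ] Rg x × v ≈ F x
              go₂ (a , qa) = go₃ (residue (m ℕ.* n) y)
                where
                y : ℤ
                y = (x + a * + n) + c
                go₃ : (∃[ r ] r < m ℕ.* n × D (m ℕ.* n) (y - + r)) → ∃[ x ] Rg x × v ≈ F x
                go₃ (r , lt , dr) = + r , (ℤ.+≤+ z≤n , ℤ.+≤+ (≤-pred lt)) ,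
                  comb₃ (+ 1) (- a) (+ 1) (both₄ (λ α β γ δ → ring-18 α x a c (+ n) (+ r) β γ δ) v f d h) qa z (D-mn⇒≈ z dr)
          collected : (∃[ xs ] length xs ≡ length L × All Rg xs × Pointwise _≈_ L (map F xs)) → Form2b n m S
          collected (xs , lx , rx , pw) = use (indexed xs (trans lx len) F Rg rx)
            where
            S≋ : S ≋ replicate (m ℕ.* n ∸ 1) f ++ map F xs
            S≋ = ≋-trans p (++⁺ˡ (replicate (m ℕ.* n ∸ 1) f) (Perm.refl pw))
            sum≡ : D (m ℕ.* n) (sumℤ xs - + 1)
            sum≡ = D-comb₂ (+ 1) (- + 1) (ring-52 (sumℤ xs) (+ (m ℕ.* n))) (order-D B z {sumℤ xs - + 1 + + (m ℕ.* n)} (comb₃ (- + 1) (+ 1) (- + 1) (both₃ s (σ S) f d′) σS-eq σS nd′)) (divides {k = + (m ℕ.* n)} {z = + (m ℕ.* n)} (+ 1) (sym (ℤ.*-identityˡ (+ (m ℕ.* n)))))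
              where
              M : ℤ
              M = + (m ℕ.* n ∸ 1)
              σS-eq : σ S ≈ M · f ⊕ (sumℤ xs · f ⊕ (+ n) · d′)
              σS-eq = ≈-trans (σ-resp S≋) (≈-reflexive (trans (σ-++ (replicate (m ℕ.* n ∸ 1) f) (map F xs)) (cong₂ _⊕_ (σ-replicate (m ℕ.* n ∸ 1) f) (trans (σ-line f d′ xs) (cong (λ k → sumℤ xs · f ⊕ (+ k) · d′) (trans lx len))))))
              s : ∀ S f d → (sumℤ xs - + 1 + + (m ℕ.* n)) * f - + 0 ≡ - + 1 * (S - (M * f + (sumℤ xs * f + (+ n) * d))) + (+ 1 * (S - + 0) + - + 1 * ((+ n) * d - + 0))
              s S f d = ring-53 S f d (sumℤ xs) M (+ n)
            use : (Σ (Fin n → ℤ) λ x → (∀ i → Rg (x i)) × Σℤ x ≡ sumℤ xs × tabulate (λ i → F (x i)) ≡ map F xs) → Form2b n m S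
            use (x , rg , sm , tb) = d′ , f , isBasis G (swap-basis B′) nd′ z , x , rg , Sg.∣⇒∣ᵤ (subst (λ k → D (m ℕ.* n) (k - + 1)) (sym sm) sum≡) ,
              toSeqEq (≋-trans S≋ (++⁺ˡ (replicate (m ℕ.* n ∸ 1) f) (≋-reflexive (sym tb))))

      -- Nonnegative integers, n in number and with sum n - 1, cannot all be positive.
      split-zero : ∀ ws → length ws ≡ n → All Range ws → sumℤ ws ≡ + suc n′ → ∃[ vs ] ws ↭ + 0 ∷ vs
      split-zero ws len rs sm = go ws rs (λ all1 → ℤ.<⇒≱ {+ suc n′} {+ suc n′} (ℤ.suc[i]≤j⇒i<j (subst (ℤ._≤ + suc n′) (trans (ℤ.*-identityʳ _) (cong +_ len)) (subst ((+ length ws) * + 1 ℤ.≤_) sm (sum-≥ (+ 1) all1)))) ℤ.≤-refl)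
        where
        go : ∀ ws → All Range ws → ¬ All (+ 1 ℤ.≤_) ws → ∃[ vs ] ws ↭ + 0 ∷ vs
        go [] _ ¬all = ⊥-elim (¬all [])
        go (+ 0 ∷ ws) _ _ = ws , Prop.refl
        go (ℤ.-[1+ w ] ∷ ws) ((() , _) ∷ rs) ¬all
        go (+ suc w ∷ ws) (_ ∷ rs) ¬all = let (vs , p) = go ws rs (λ a → ¬all (ℤ.+≤+ (s≤s z≤n) ∷ a)) in + suc w ∷ vs , Prop.trans (Prop.prep _ p) (Prop.swap _ _ Prop.refl)

    -- Here g₁ = e₁ and g₂ = u - e₁, so u - w e₁ = -(w - 1) g₁ + g₂ with w - 1 in [-1, n - 2]. A
    -- weight 0 is the term g₁ + g₂ itself and accounts for the extra 1 in its exponent; the other n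
    -- - 1 numbers w - 1 sum to 0.
    module CD {e₁ u : Elt} {S : List Elt} {ws : List ℤ} (B : PhiBasis e₁ u) (z : (+ n) · u ≈ h) (len : length ws ≡ n) (rs : All Range ws) (sm : sumℤ ws ≡ + suc n′) where

      g₂ : Elt
      g₂ = u ⊕ (- + 1) · e₁

      Xr : ℤ → Set
      Xr = InRange (- (+ 1)) (+ n′)

      Fx : ℤ → Elt
      Fx x = (- x) · e₁ ⊕ g₂

      Tail : Set
      Tail = Σ (Fin (suc n′) → ℤ) λ x → (∀ i → Xr (x i)) × Σℤ x ≡ + 0 × (map (λ w → u ⊕ (- w) · e₁) ws ≋ u ∷ tabulate (λ i → Fx (x i)))

      opaque
        tail : Tail
        tail = finish (split-zero ws len rs sm)
          where
          finish : (∃[ vs ] ws ↭ + 0 ∷ vs) → Tail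
          finish (vs , p) = use (indexed xs (trans (List.length-map _ vs) vs-len) Fx Xr (All.map⁺ (All.map shift rvs)))
            where
            vs-len : length vs ≡ suc n′
            vs-len = suc-injective (trans (sym (Prop.↭-length p)) len)
            rvs : All Range vs
            rvs = All.tail (Prop.All-resp-↭ p rs)
            xs : List ℤ
            xs = map (λ w → w + - + 1) vs
            shift : ∀ {w} → Range w → Xr (w + - + 1)
            shift {w} (a , b) = ≤-cert₁ (ring-54 w) a , ≤-cert₁ (ring-55 w (+ n′)) b
            sum0 : sumℤ xs ≡ + 0
            sum0 = trans (sumℤ-shift (- + 1) vs) (trans (cong₂ (λ s l → s + (+ l) * - + 1) (trans (sym (ℤ.+-identityˡ (sumℤ vs))) (trans (sym (sumℤ-↭ p)) sm)) vs-len) (ring-56 (+ suc n′)))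
            use : (Σ (Fin (suc n′) → ℤ) λ x → (∀ i → Xr (x i)) × Σℤ x ≡ sumℤ xs × tabulate (λ i → Fx (x i)) ≡ map Fx xs) → Tail
            use (x , rg , sx , tb) = x , rg , trans sx sum0 , ≋-trans (↭⇒≋ (Prop.map⁺ _ p)) (Perm.prep (≈-reflexive (⊕-identityʳ u))
                (≋-reflexive (trans (List.map-cong eq vs) (trans (List.map-∘ vs) (sym tb)))))
              where
              eq : ∀ w → u ⊕ (- w) · e₁ ≡ Fx (w + - + 1)
              eq w = both₂ (λ α β → ring-30 α w β) u e₁

        g-sum : e₁ ⊕ g₂ ≡ u
        g-sum = both₂ ring-160 e₁ u

        good : IsGoodGenSet n m e₁ g₂
        good = isGoodGenSet G (shear-basis (- + 1) B (P.≈-reflexive (⊕-comm u ((- + 1) · e₁)))) (subst (λ v → (+ n) · v ≈ h) (sym g-sum) z)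

        arrange : ∀ j k → S ≋ replicate j e₁ ++ (replicate k u ++ map (λ w → u ⊕ (- w) · e₁) ws) → (t : Tail) →
          S ≋ replicate j e₁ ++ (replicate (k ℕ.+ 1) (e₁ ⊕ g₂) ++ tabulate (λ i → Fx (proj₁ t i)))
        arrange j k p (x , _ , _ , q) = ≋-trans p (++⁺ˡ (replicate j e₁) (≋-trans (++⁺ˡ (replicate k u) q) (≋-trans (≋-reflexive (sym (List.++-assoc (replicate k u) (u ∷ []) _)))
           (++⁺ʳ _ (≋-reflexive (trans (sym (replicate-+ k 1 u)) (cong (replicate (k ℕ.+ 1)) (sym g-sum))))))))

        build-d : S ≋ replicate (suc n′) e₁ ++ (replicate (suc m′ ℕ.* n) u ++ map (λ w → u ⊕ (- w) · e₁) ws) → Form2d n m S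
        build-d p = let t = tail in e₁ , g₂ , good , proj₁ t , proj₁ (proj₂ t) , proj₁ (proj₂ (proj₂ t)) , toSeqEq (arrange (suc n′) (suc m′ ℕ.* n) p t)

        build-c : ∀ s → 1 ≤ s → s ≤ suc m′ → (+ n) · e₁ ≈ h →
          S ≋ replicate (s ℕ.* n ∸ 1) e₁ ++ (replicate ((m ∸ s) ℕ.* n) u ++ map (λ w → u ⊕ (- w) · e₁) ws) → Form2c n m S
        build-c s a b z′ p = let t = tail in e₁ , g₂ , good , s , a , b , proj₁ t , proj₁ (proj₂ t) , proj₁ (proj₂ (proj₂ t)) ,
            un {(+ n) · g₂} {0G} (comb₂ (+ 1) (- + 1) (both₃ (ring-161 (+ n)) u e₁ h) z z′) ,
            toSeqEq (arrange (s ℕ.* n ∸ 1) ((m ∸ s) ℕ.* n) p t)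

  -- From single blocks to all of S for k = 1.

  opaque
    -- The conditions on sums see only the multiset formed by E, C and T, so e₁ may be replaced and
    -- the terms of E and C redistributed.
    rebase : ∀ {h e₁ e₂ e₁′ e₂′ E C E′ C′ T} → Window h e₁ e₂ E C T → E ++ C ≋ E′ ++ C′ → PhiBasis e₁′ e₂′ → length E′ ≡ suc n′ → length C′ ≡ n →
      All (_~ e₁′) E′ → All (λ c → ∃[ x ] c ~ x · e₁′ ⊕ e₂′) C′ → σ C′ ~ e₁′ → Window h e₁′ e₂′ E′ C′ T
    rebase {E = E} {C} {E′} {C′} {T} W p B lE lC aE aC sC = record
      { gen = Window.gen W ; B = B ; E-length = lE ; C-length = lC ; T-length = Window.T-length W ; E~ = aE ; C∈ = aC ; σC~ = sC ; σT≈ = Window.σT≈ W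
      ; sum≈h = λ Z sub → Window.sum≈h W Z (sub-respʳ (≋-sym q) sub)
      ; not-short = λ Z sub → Window.not-short W Z (sub-respʳ (≋-sym q) sub) }
      where
      q : E ++ (C ++ T) ≋ E′ ++ (C′ ++ T)
      q = ≋-trans (≋-reflexive (sym (List.++-assoc E C T))) (≋-trans (++⁺ʳ T p) (≋-reflexive (List.++-assoc E′ C′ T)))

    blocks-const : ∀ {f Ts} → All (λ T → length T ≡ n × All (_≈ f) T) Ts → concat Ts ≋ replicate (length Ts ℕ.* n) f
    blocks-const [] = ≋-refl
    blocks-const {f} {T ∷ Ts} ((l , a) ∷ as) = ≋-trans (++⁺ (≋-trans (const-≋ a) (≋-reflexive (cong (λ k → replicate k f) l))) (blocks-const as))
      (≋-reflexive (sym (replicate-+ n (length Ts ℕ.* n) f)))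

    σ-blocks : ∀ {h Ts} → All (λ T → σ T ≈ h) Ts → σ (concat Ts) ≈ (+ length Ts) · h
    σ-blocks [] = ≈-refl
    σ-blocks {h} {T ∷ Ts} (p ∷ ps) = ≈-trans (≈-reflexive (σ-++ T (concat Ts))) (≈-trans (⊕-cong p (σ-blocks ps))
      (≈-reflexive (trans (cong (h ⊕_) (sym (σ-replicate (length Ts) h))) (σ-replicate (suc (length Ts)) h))))

    const-multiple : ∀ {f h T} → length T ≡ n → All (_≈ f) T → σ T ≈ h → (+ n) · f ≈ h
    const-multiple {f} {T = T} l a s = ≈-trans (≈-reflexive (trans (sym (σ-replicate n f)) (cong (λ k → σ (replicate k f)) (sym l)))) (≈-trans (≈-sym (σ-resp (const-≋ a))) s)

  -- All blocks share the same E and C, which makes the conclusions drawn from different blocks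
  -- comparable.
  record Core (h e₁ e₂ : Elt) (E C : List Elt) (Ts : List (List Elt)) : Set where
    field
      Ts-length : length Ts ≡ suc m′
      window : ∀ {T} → T ∈ Ts → Window h e₁ e₂ E C T

    first : ∃[ T ] T ∈ Ts
    first = go (uncons Ts Ts-length)
      where
      go : (∃[ x ] ∃[ ys ] Ts ≡ x ∷ ys) → ∃[ T ] T ∈ Ts
      go (T , Ts′ , eq) = T , subst (T ∈_) (sym eq) (here refl)

    T₀ : List Elt
    T₀ = proj₁ first

    W₀ : Window h e₁ e₂ E C T₀
    W₀ = window (proj₂ first)

    open Window W₀ public using (gen; B; E-length; C-length; E~; C∈; σC~)

    opaque
      -- The m - 1 blocks and the sequence E C each sum to h, and m h = 0.
      σ≈0 : σ (concat Ts ++ (E ++ C)) ≈ 0G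
      σ≈0 = ≈-trans (≈-reflexive (σ-++ (concat Ts) (E ++ C))) (≈-trans (⊕-cong (σ-blocks (All.tabulate (λ T∈ → Window.σT≈ (window T∈)))) R≈h)
          (comb₁ (+ 1) (both₁ s h) (m·≈0 (Generator.h~0 gen))))
        where
        s : ∀ h → ((+ length Ts) * h + h) - + 0 ≡ + 1 * ((+ m) * h - + 0)
        s h = trans (ring-118 (+ length Ts) h) (cong (λ k → + 1 * ((+ suc k) * h - + 0)) Ts-length)
        len : length (E ++ C) ≡ suc n′ ℕ.+ n
        len = trans (List.length-++ E) (cong₂ ℕ._+_ E-length C-length)
        R≈h : σ (E ++ C) ≈ h
        R≈h = Window.sum≈h W₀ (E ++ C) (T₀ , ≋-reflexive (sym (List.++-assoc E C T₀))) (subst (1 ≤_) (sym len) (s≤s z≤n))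
            (≤-trans (≤-reflexive (trans (cong (2 ℕ.+_) len) (ringℕ-7 n′))) (≤-trans (+-monoʳ-≤ (n ℕ.+ n) (s≤s z≤n)) (≤-reflexive (ringℕ-2 n))))
            (P.≈-trans (P.≈-reflexive (σ-++ E C)) (P.≈-trans (P.⊕-cong {σ E} {(+ length E) · e₁} (σ-const E~) σC~)
              (P.comb₁ (+ 1) (both₁ w e₁) (n·~0 e₁))))
          where
          w : ∀ e → ((+ length E) * e + e) - + 0 ≡ + 1 * ((+ n) * e - + 0)
          w e = trans (ring-118 (+ length E) e) (cong (λ k → + 1 * ((+ suc k) * e - + 0)) E-length)

  Shape2 : List Elt → Set
  Shape2 S = Form2a n m S ⊎ Form2b n m S ⊎ Form2c n m S ⊎ Form2d n m S

  module NonConstantCore {h e₁ e₂ E C Ts} (K : Core h e₁ e₂ E C Ts) (1≤n′ : 1 ≤ n′) {a b : Elt} {E″ : List Elt} (E≋ : E ≋ a ∷ b ∷ E″) (a≉b : ¬ a ≈ b) where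
    open Core K

    opaque
      -- Terms of blocks and the n - 1 terms of C over τ can be exchanged for each other, hence all
      -- equal one f with n f = h. The remaining n terms, E and the exceptional c, lie over e₁ +
      -- ⟨f⟩.
      form-b : ∀ {S} → S ≋ concat Ts ++ (E ++ C) → Form2b n m S
      form-b {S} S≋ = from (NonConstant.nonconstant-shape W₀ 1≤n′ E≋ a≉b)
        where
        from : (∃[ τ ] All (_~ τ) T₀ × ∃[ c ] ∃[ C′ ] C ↭ c ∷ C′ × c ~ τ ⊕ e₁ × All (_~ τ) C′) → Form2b n m S
        from (τ , _ , c , C′ , perm , c~ , C′~) = finish (uncons C′ C′-length)
          where
          C′-length : length C′ ≡ suc n′
          C′-length = suc-injective (trans (sym (Prop.↭-length perm)) C-length)
          finish : (∃[ f ] ∃[ C″ ] C′ ≡ f ∷ C″) → Form2b n m S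
          finish (f , C″ , eq) = build-b gen B′ nf (cong suc E-length) (L∈ ∷ All.map E∈ E~)
              (≈-trans (σ-resp S≋) σ≈0) S≋′
            where
            f~ : f ~ τ
            f~ = All.lookup C′~ (subst (f ∈_) (sym eq) (here refl))
            T~ : ∀ {T t} → T ∈ Ts → t ∈ T → t ~ τ
            T~ T∈ t∈ = NonConstant.shape-T (window T∈) 1≤n′ E≋ a≉b {q = c} {C′ = C″} (proj₂ (∈⇒≋ t∈)) (subst (λ l → C ↭ c ∷ l) eq perm) f~ c~
            same : ∀ {T t x} → T ∈ Ts → t ∈ T → x ∈ C′ → t ≈ x
            same {T} {t} {x} T∈ t∈ x∈ = go (∈⇒≋ t∈) (∈⇒≋ x∈)
              where
              open Window (window T∈) using (T-length; σT≈; sum≈h)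
              go : (∃[ T′ ] T ≋ t ∷ T′) → (∃[ C‴ ] C′ ≋ x ∷ C‴) → t ≈ x
              go (T′ , p) (C‴ , q) = cancelʳ {t} {x} {σ T′} {h} (≈-trans (≈-sym (σ-resp p)) σT≈) (sum≈h (x ∷ T′)
                  (sub-++ʳ E (sub-++ {x ∷ []} {C} {T′} {T} (sub-respʳ (↭⇒≋ (Prop.↭-sym perm)) (sub-++ʳ (c ∷ []) (C‴ , q))) (t ∷ [] , ≋-trans p (++-comm (t ∷ []) T′)))) (s≤s z≤n)
                  (≤-trans (≤-reflexive (cong (2 ℕ.+_) (trans (sym (≋-length p)) T-length))) (≤-trans (+-monoˡ-≤ n (≤-trans (s≤s (s≤s z≤n)) (m≤m+n n n))) (≤-reflexive (ringℕ-2 n))))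
                  (P.≈-trans (P.⊕-cong {x} {t} {σ T′} {σ T′} (P.≈-trans (All.lookup C′~ x∈) (P.≈-sym (T~ T∈ t∈))) P.≈-refl) (P.≈-trans (P.≈-sym (≈⇒~ (σ-resp p))) (P.≈-trans (≈⇒~ σT≈) (Generator.h~0 gen)))))
            T≈f : ∀ {T} → T ∈ Ts → All (_≈ f) T
            T≈f T∈ = All.tabulate (λ t∈ → same T∈ t∈ (subst (f ∈_) (sym eq) (here refl)))
            nf : (+ n) · f ≈ h
            nf = const-multiple (Window.T-length W₀) (T≈f (proj₂ first)) (Window.σT≈ W₀)
            t₀ : ∃[ t ] t ∈ T₀
            t₀ = go (uncons T₀ (Window.T-length W₀))
              where
              go : (∃[ x ] ∃[ ys ] T₀ ≡ x ∷ ys) → ∃[ t ] t ∈ T₀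
              go (t , _ , e) = t , subst (t ∈_) (sym e) (here refl)
            C′≈f : All (_≈ f) C′
            C′≈f = All.tabulate (λ x∈ → ≈-trans (≈-sym (same (proj₂ first) (proj₂ t₀) x∈)) (All.lookup (T≈f (proj₂ first)) (proj₂ t₀)))
            B′ : PhiBasis f e₁
            B′ = go (All.lookup (Prop.All-resp-↭ perm C∈) (there (subst (f ∈_) (sym eq) (here refl))))
              where
              go : (∃[ x ] f ~ x · e₁ ⊕ e₂) → PhiBasis f e₁
              go (x , q) = swap-basis (shear-basis x B q)
            L∈ : ∃[ x ] c ~ x · f ⊕ e₁
            L∈ = + 1 , P.comb₂ (+ 1) (- + 1) (both₄ ring-57 c τ f e₁) c~ f~
            E∈ : ∀ {v} → v ~ e₁ → ∃[ x ] v ~ x · f ⊕ e₁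
            E∈ {v} q = + 0 , P.comb₁ (+ 1) (both₃ ring-58 v f e₁) q
            S≋′ : S ≋ replicate (m ℕ.* n ∸ 1) f ++ (c ∷ E)
            S≋′ = ≋-trans S≋ (≋-trans (++⁺ (≋-trans (blocks-const (All.tabulate (λ T∈ → Window.T-length (window T∈) , T≈f T∈))) (≋-reflexive (cong (λ k → replicate (k ℕ.* n) f) Ts-length)))
                  (≋-trans (++-comm E C) (++⁺ʳ E (≋-trans (↭⇒≋ perm) (≋-trans (Perm.prep ≈-refl (≋-trans (const-≋ C′≈f) (≋-reflexive (cong (λ k → replicate k f) C′-length))))
                    (++-comm (c ∷ []) (replicate (suc n′) f)))))))
                (≋-reflexive (trans (cong (replicate (suc m′ ℕ.* n) f ++_) (List.++-assoc (replicate (suc n′) f) (c ∷ []) E))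
                  (trans (sym (List.++-assoc (replicate (suc m′ ℕ.* n) f) (replicate (suc n′) f) (c ∷ E)))
                    (cong (_++ (c ∷ E)) (trans (sym (replicate-+ (suc m′ ℕ.* n) (suc n′) f)) (cong (λ k → replicate k f) (+-comm (suc m′ ℕ.* n) (suc n′)))))))))

  module Cosets {h e₁ e₂ C Ts} (K : Core h e₁ e₂ (replicate (suc n′) e₁) C Ts) (1≤n′ : 1 ≤ n′) where
    open Core K

    InCoset : Elt → Set
    InCoset t = ∃[ x ] t ~ x · e₁ ⊕ e₂

    opaque
      all-InCoset : ¬ (+ n) · e₁ ≈ h → ∀ {T} → T ∈ Ts → All InCoset T
      all-InCoset ne T∈ = All.tabulate (λ t∈ → Constant.T⊂A (window T∈) 1≤n′ ne (proj₂ (∈⇒≋ t∈)))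

      -- `compare` puts the terms of C and of all blocks into c₀ + ⟨e₁⟩ in G itself. In the sum h of
      -- a block the coefficient of e₁ is divisible by n, which leaves n c₀ = h.
      form-a : (+ n) · e₁ ≈ 0G → ∀ {S} → S ≋ concat Ts ++ (replicate (suc n′) e₁ ++ C) → Form2a n m S
      form-a z {S} S≋ = from (uncons C C-length)
        where
        ne : ¬ (+ n) · e₁ ≈ h
        ne p = Win.h≉0 W₀ 1≤n′ (≈-trans (≈-sym p) z)
        from : (∃[ c ] ∃[ C′ ] C ≡ c ∷ C′) → Form2a n m S
        from (c₀ , C′ , eq) = collected (gather {Q = λ _ → Elt} F (All.++⁺ (All.tabulate C≈) (All.concat⁺ (All.tabulate (λ T∈ → All.tabulate (T≈ T∈))))))
          where
          F : ℤ → Elt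
          F x = x · e₁ ⊕ c₀
          c₀∈ : c₀ ∈ C
          c₀∈ = subst (c₀ ∈_) (sym eq) (here refl)
          T≈ : ∀ {T t} → T ∈ Ts → t ∈ T → ∃[ x ] Elt × t ≈ F x
          T≈ {T} {t} T∈ t∈ = go (Constant.compare (window T∈) 1≤n′ (proj₂ (∈⇒≋ t∈)) (≋-reflexive eq) (All.lookup (all-InCoset ne T∈) t∈) (All.lookup C∈ c₀∈))
            where
            go : (∃[ x ] x < n × c₀ ≈ t ⊕ (- + x) · e₁) → ∃[ x ] Elt × t ≈ F x
            go (x , _ , p) = + x , 0G , comb₁ (- + 1) (both₃ (λ α β γ → ring-59 α (+ x) β γ) t e₁ c₀) p
          t₀ : ∃[ t ] t ∈ T₀
          t₀ = go (uncons T₀ (Window.T-length W₀))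
            where
            go : (∃[ x ] ∃[ ys ] T₀ ≡ x ∷ ys) → ∃[ t ] t ∈ T₀
            go (t , _ , e) = t , subst (t ∈_) (sym e) (here refl)
          C≈ : ∀ {c} → c ∈ C → ∃[ x ] Elt × c ≈ F x
          C≈ {c} c∈ = go (Constant.compare W₀ 1≤n′ (proj₂ (∈⇒≋ (proj₂ t₀))) (proj₂ (∈⇒≋ c∈)) (All.lookup (all-InCoset ne (proj₂ first)) (proj₂ t₀)) (All.lookup C∈ c∈)) (T≈ (proj₂ first) (proj₂ t₀))
            where
            t : Elt
            t = proj₁ t₀
            go : (∃[ x ] x < n × c ≈ t ⊕ (- + x) · e₁) → (∃[ y ] Elt × t ≈ F y) → ∃[ x ] Elt × c ≈ F x
            go (x , _ , p) (y , _ , q) = y - + x , 0G , comb₂ (+ 1) (+ 1) (both₄ (λ α β γ δ → ring-60 α β (+ x) y γ δ) c t e₁ c₀) p q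
          B′ : PhiBasis e₁ c₀
          B′ = go (All.lookup C∈ c₀∈)
            where
            go : (∃[ x ] c₀ ~ x · e₁ ⊕ e₂) → PhiBasis e₁ c₀
            go (x , q) = shear-basis x B q
          nc₀ : (+ n) · c₀ ≈ h
          nc₀ = go (gather {Q = λ _ → Elt} F (All.tabulate (T≈ (proj₂ first))))
            where
            go : (∃[ xs ] length xs ≡ length T₀ × All (λ _ → Elt) xs × Pointwise _≈_ T₀ (map F xs)) → (+ n) · c₀ ≈ h
            go (xs , l , _ , pw) = comb₃ (- + 1) (+ 1) (- + 1) (both₄ (λ α β γ δ → ring-61 α (sumℤ xs) (+ n) β γ δ) (σ T₀) e₁ c₀ h)
                eqn (Window.σT≈ W₀) (D⇒·≈ {sumℤ xs} {+ 0} z (subst (D n) (sym (ℤ.+-identityʳ (sumℤ xs))) d))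
              where
              eqn : σ T₀ ≈ sumℤ xs · e₁ ⊕ (+ n) · c₀
              eqn = ≈-trans (σ-resp (Perm.refl pw)) (≈-reflexive (trans (σ-line e₁ c₀ xs) (cong (λ k → sumℤ xs · e₁ ⊕ (+ k) · c₀) (trans l (Window.T-length W₀)))))
              d : D n (sumℤ xs)
              d = proj₁ (PhiBasis.indep B′ {sumℤ xs} {+ n} (P.≈-trans (P.≈-sym (≈⇒~ eqn)) (P.≈-trans (≈⇒~ (Window.σT≈ W₀)) (Generator.h~0 gen))))
          collected : (∃[ xs ] length xs ≡ length (C ++ concat Ts) × All (λ _ → Elt) xs × Pointwise _≈_ (C ++ concat Ts) (map F xs)) → Form2a n m S
          collected (xs , l , _ , pw) = build-a gen {e₁} {c₀} {xs} B′ z nc₀ len d S≋′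
            where
            lens : ∀ (Ts : List (List Elt)) → (∀ {T} → T ∈ Ts → length T ≡ n) → length (concat Ts) ≡ length Ts ℕ.* n
            lens [] f = refl
            lens (T ∷ Ts) f = trans (List.length-++ T {concat Ts}) (cong₂ ℕ._+_ {length T} {n} {length (concat Ts)} {length Ts ℕ.* n} (f (here refl)) (lens Ts (λ T∈ → f (there T∈))))
            len : length xs ≡ m ℕ.* n
            len = trans l (trans (List.length-++ C) (cong₂ ℕ._+_ C-length (trans (lens Ts (λ T∈ → Window.T-length (window T∈))) (cong (ℕ._* n) Ts-length))))
            S≋′ : S ≋ replicate (suc n′) e₁ ++ map F xs
            S≋′ = ≋-trans S≋ (≋-trans (++-comm (concat Ts) (replicate (suc n′) e₁ ++ C)) (≋-trans (≋-reflexive (List.++-assoc (replicate (suc n′) e₁) C (concat Ts))) (++⁺ˡ (replicate (suc n′) e₁) (Perm.refl pw))))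
            σ~ : (+ suc n′) · e₁ ⊕ (sumℤ xs · e₁ ⊕ (+ length xs) · c₀) ~ 0G
            σ~ = P.≈-trans (P.≈-reflexive (sym (trans (σ-++ (replicate (suc n′) e₁) (map F xs)) (cong₂ _⊕_ (σ-replicate (suc n′) e₁) (σ-line e₁ c₀ xs)))))
                 (≈⇒~ (≈-trans (≈-sym (σ-resp S≋′)) (≈-trans (σ-resp S≋) σ≈0)))
            d : D n (sumℤ xs - + 1)
            d = D-comb₂ (+ 1) (- + 1) (ring-62 (sumℤ xs) (+ suc n′)) (proj₁ (PhiBasis.indep B′ {+ suc n′ + sumℤ xs} {+ length xs} (P.≈-trans (P.≈-reflexive (both₂ (ring-63 (+ suc n′) (sumℤ xs) (+ length xs)) e₁ c₀)) σ~)))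
                  (divides {k = + n} {z = + n} (+ 1) (sym (ℤ.*-identityˡ (+ n))))

    module NonZeroOrder (η≉0 : ¬ (+ n) · e₁ ≈ 0G) where

      Weights : Elt → List ℤ → Set
      Weights u ws = length ws ≡ n × All Range ws × sumℤ ws ≡ + suc n′ × C ≋ map (λ w → u ⊕ (- w) · e₁) ws

      opaque
        weights : ∀ {T} → T ∈ Ts → All InCoset T → ∃[ u ] ∃[ ws ] All (_≈ u) T × Weights u ws
        weights T∈ a = let (u , ws , p , q , r , s , t) = Spread.spread (window T∈) 1≤n′ a η≉0 in u , ws , p , q , r , s , t

        below : ∀ {u ws u′ ws′} → Weights u ws → Weights u′ ws′ → ∃[ w ] Range w × u ≈ u′ ⊕ (- w) · e₁
        below {u} {ws} {u′} {ws′} (l , rs , sm , p) (l′ , rs′ , sm′ , p′) = go (split-zero gen ws l rs sm)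
          where
          F F′ : ℤ → Elt
          F w = u ⊕ (- w) · e₁
          F′ w = u′ ⊕ (- w) · e₁
          Q : Elt → Set
          Q v = ∃[ w ] Range w × v ≈ F′ w
          all′ : All Q (map F′ ws′)
          all′ = All.map⁺ (All.map (λ {w} r → w , r , ≈-refl) rs′)
          go : (∃[ vs ] ws ↭ + 0 ∷ vs) → Q u
          go (vs , q) = use (All.head (All-resp-≋ {P = Q} (λ x≈y (w , r , e) → w , r , ≈-trans (≈-sym x≈y) e) (≋-trans (≋-sym p′) (≋-trans p (↭⇒≋ (Prop.map⁺ F q)))) all′))
            where
            use : Q (F (+ 0)) → Q u
            use (w , r , e) = w , r , ≈-trans (≈-sym (≈-reflexive (⊕-identityʳ u))) e

        -- Each of u and u' occurs in C, so u = u' - w e₁ and u' = u - w' e₁ with nonnegative w and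
        -- w'. Then (w + w') e₁ = 0, and `kill` gives w = w' = 0.
        common : ∀ {u ws u′ ws′} → Weights u ws → Weights u′ ws′ → u′ ≈ u
        common {u} {ws} {u′} {ws′} A A′ = go (below {u} {ws} {u′} {ws′} A A′) (below {u′} {ws′} {u} {ws} A′ A)
          where
          go : (∃[ w ] Range w × u ≈ u′ ⊕ (- w) · e₁) → (∃[ w ] Range w × u′ ≈ u ⊕ (- w) · e₁) → u′ ≈ u
          go (w , (lo , hi) , p) (w′ , (lo′ , hi′) , q) = ≈-trans q (≈-trans (≈-reflexive (cong (λ k → u ⊕ (- k) · e₁) w′≡0)) (≈-reflexive (⊕-identityʳ u)))
            where
            y≡0 : w + w′ ≡ + 0
            y≡0 = Order.kill B η≉0 {w + w′} (comb₂ (+ 1) (+ 1) (both₃ (λ α β γ → ring-64 α β w w′ γ) u u′ e₁) p q)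
                (≤-cert₃ (ring-65 (+ suc n′) w w′) hi hi′ (ℤ.+≤+ {0} {1} z≤n)) (≤-cert₃ (ring-66 (+ suc n′) w w′) lo lo′ (ℤ.+≤+ {0} {suc n′ ℕ.+ n} z≤n))
            w′≡0 : w′ ≡ + 0
            w′≡0 = ℤ.≤-antisym (≤-cert₁ (trans (cong (λ k → k - w′) (sym y≡0)) (ring-67 w w′)) lo) lo′

        weights-basis : ∀ {u ws} → Weights u ws → PhiBasis e₁ u
        weights-basis {u} {ws} (l , rs , sm , p) = go (split-zero gen ws l rs sm)
          where
          go : (∃[ vs ] ws ↭ + 0 ∷ vs) → PhiBasis e₁ u
          go (vs , q) = use (All.head (All-resp-≋ {P = InCoset} (λ x≈y (x , e) → x , P.≈-trans (P.≈-sym (≈⇒~ x≈y)) e) (≋-trans p (↭⇒≋ (Prop.map⁺ _ q))) C∈))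
            where
            use : InCoset (u ⊕ (- (+ 0)) · e₁) → PhiBasis e₁ u
            use (x , e) = shear-basis x B (P.≈-trans (P.≈-sym (P.≈-reflexive (⊕-identityʳ u))) e)

        form-d : ¬ (+ n) · e₁ ≈ h → ∀ {S} → S ≋ concat Ts ++ (replicate (suc n′) e₁ ++ C) → Form2d n m S
        form-d ne {S} S≋ = go (weights (proj₂ first) (all-InCoset ne (proj₂ first)))
          where
          go : (∃[ u ] ∃[ ws ] All (_≈ u) T₀ × Weights u ws) → Form2d n m S
          go (u , ws , a , A) = CD.build-d gen {e₁} {u} {S} {ws} (weights-basis {u} {ws} A) (const-multiple (Window.T-length W₀) a (Window.σT≈ W₀)) (proj₁ A) (proj₁ (proj₂ A)) (proj₁ (proj₂ (proj₂ A)))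
              (≋-trans S≋ (≋-trans (shifts (concat Ts) (replicate (suc n′) e₁)) (++⁺ˡ (replicate (suc n′) e₁) (++⁺ blocks (proj₂ (proj₂ (proj₂ A)))))))
            where
            T≈u : ∀ {T} → T ∈ Ts → All (_≈ u) T
            T≈u {T} T∈ = use (weights T∈ (all-InCoset ne T∈))
              where
              use : (∃[ u′ ] ∃[ ws′ ] All (_≈ u′) T × Weights u′ ws′) → All (_≈ u) T
              use (u′ , ws′ , a′ , A′) = All.map (λ e → ≈-trans e (common {u} {ws} {u′} {ws′} A A′)) a′
            blocks : concat Ts ≋ replicate (suc m′ ℕ.* n) u
            blocks = ≋-trans (blocks-const (All.tabulate (λ T∈ → Window.T-length (window T∈) , T≈u T∈))) (≋-reflexive (cong (λ k → replicate (k ℕ.* n) u) Ts-length))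

  module SplitCore {h e₁ e₂ C Ts} (K : Core h e₁ e₂ (replicate (suc n′) e₁) C Ts) (1≤n′ : 1 ≤ n′) (η≈h : (+ n) · e₁ ≈ h)
      {S} (S≋ : S ≋ concat Ts ++ (replicate (suc n′) e₁ ++ C)) where
    open Core K
    open Cosets K 1≤n′

    opaque
      η≉0 : ¬ (+ n) · e₁ ≈ 0G
      η≉0 p = Win.h≉0 W₀ 1≤n′ (≈-trans (≈-sym η≈h) p)

      -- With a block outside ⟨e₁⟩ ∪ (e₂ + ⟨e₁⟩) the roles change: u - e₁ has order n and takes the place of e₁.
      restart : ∀ {u} → (+ n) · u ≈ h → C ≋ u ∷ replicate (suc n′) (u ⊕ (- + 1) · e₁) → Form2a n m S
      restart {u} nu C≋ = Cosets.form-a K′ 1≤n′ z′ (≋-trans S≋ (++⁺ˡ (concat Ts) same))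
        where
        e : Elt
        e = u ⊕ (- + 1) · e₁
        C′ : List Elt
        C′ = u ∷ replicate (suc n′) e₁
        z′ : (+ n) · e ≈ 0G
        z′ = comb₂ (+ 1) (- + 1) (both₃ (ring-161 (+ n)) u e₁ h) nu η≈h
        same : replicate (suc n′) e₁ ++ C ≋ replicate (suc n′) e ++ C′
        same = ≋-trans (++⁺ˡ (replicate (suc n′) e₁) C≋) (≋-trans (++-comm (replicate (suc n′) e₁) (u ∷ replicate (suc n′) e))
          (≋-trans (++⁺ʳ (replicate (suc n′) e₁) (++-comm (u ∷ []) (replicate (suc n′) e))) (≋-reflexive (List.++-assoc (replicate (suc n′) e) (u ∷ []) (replicate (suc n′) e₁)))))
        B′ : PhiBasis e e₁
        B′ = go (All.head (All-resp-≋ {P = InCoset} (λ x≈y (x , e) → x , P.≈-trans (P.≈-sym (≈⇒~ x≈y)) e) C≋ C∈))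
          where
          go : InCoset u → PhiBasis e e₁
          go (x , q) = swap-basis (shear-basis (- + 1) (shear-basis x B q) (P.≈-reflexive (⊕-comm u ((- + 1) · e₁))))
        C′∈ : All (λ c → ∃[ x ] c ~ x · e ⊕ e₁) C′
        C′∈ = (+ 1 , P.≈-reflexive (both₂ ring-162 u e₁)) ∷ All.replicate⁺ (suc n′) (+ 0 , P.≈-reflexive (both₂ ring-163 e e₁))
        σC′ : σ C′ ~ e
        σC′ = P.≈-trans (P.≈-reflexive (cong (u ⊕_) (σ-replicate (suc n′) e₁))) (P.comb₁ (+ 1) (both₂ (λ α β → ring-164 α β (+ suc n′)) u e₁) (n·~0 e₁))
        K′ : Core h e e₁ (replicate (suc n′) e) C′ Ts
        K′ = record { Ts-length = Ts-length ; window = λ T∈ → rebase (window T∈) same B′ (List.length-replicate (suc n′)) (cong suc (List.length-replicate (suc n′)))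
               (All.replicate⁺ (suc n′) P.≈-refl) C′∈ σC′ }

      -- Coordinate 0 leaves only e₁ itself, because completing the single term t takes n - 1 copies
      -- of e₁ and n e₁ = h. Coordinate at least 2 is the situation of `bad-shape`, where `restart`
      -- already yields form (a).
      classify : ∀ {T t} → T ∈ Ts → t ∈ T → (t ≈ e₁ ⊎ InCoset t) ⊎ Form2a n m S
      classify {T} {t} T∈ t∈ = go (∈⇒≋ t∈) (Win.coord (window T∈) 1≤n′ t)
        where
        go : (∃[ T′ ] T ≋ t ∷ T′) → (∃[ a ] ∃[ b ] b < n × t ~ a · e₁ ⊕ (+ b) · e₂) → (t ≈ e₁ ⊎ InCoset t) ⊎ Form2a n m S
        go (T′ , p) (a , zero , _ , q) = inj₁ (inj₁ (use (Constant.complete (window T∈) 1≤n′ {t ∷ []} {a} (sub-++ʳ C (T′ , p)) (s≤s z≤n) (s≤s (s≤s z≤n))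
              (P.≈-trans (P.≈-reflexive (⊕-identityʳ t)) (P.≈-trans q (P.≈-reflexive (⊕-identityʳ (a · e₁))))))))
          where
          use : (∃[ x ] x < n × σ (t ∷ []) ⊕ (+ x) · e₁ ≈ h × n ≤ x ℕ.+ 1) → t ≈ e₁
          use (x , lt , e , le) = comb₂ (+ 1) (- + 1) (both₃ s t e₁ h) e η≈h
            where
            x≡ : x ≡ suc n′
            x≡ = ≤-antisym (≤-pred lt) (≤-pred (≤-trans le (≤-reflexive (+-comm x 1))))
            s : ∀ t e h → t - e ≡ + 1 * (((t + + 0) + (+ x) * e) - h) + - + 1 * ((+ n) * e - h)
            s t e h = trans (ring-112 t e h (+ x)) (cong (λ k → + 1 * (((t + + 0) + (+ x) * e) - h) + - + 1 * ((+ suc k) * e - h)) x≡)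
        go _ (a , suc zero , _ , q) = inj₁ (inj₂ (a , P.≈-trans q (P.≈-reflexive (both₂ (ring-165 a) e₁ e₂))))
        go (T′ , p) (a , suc (suc b) , lt , q) = inj₂ (use (BadBlock.bad-shape (window T∈) 1≤n′ η≈h {t} {T′} {a} {b} p q lt))
          where
          use : (∃[ u ] (+ n) · u ≈ h × C ≋ u ∷ replicate (suc n′) (u ⊕ (- + 1) · e₁)) → Form2a n m S
          use (u , nu , q) = restart nu q

      -- The number of terms of T in the coset is the e₂-coordinate of its sum, hence divisible by
      -- n, and it is at most n.
      pure : ∀ {T} → T ∈ Ts → All (λ t → t ≈ e₁ ⊎ InCoset t) T → All (_≈ e₁) T ⊎ All InCoset T
      pure {T} T∈ a = go (partition-⊎ a)
        where
        open Window (window T∈) using (T-length; σT≈)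
        go : (∃[ ps ] ∃[ qs ] T ↭ qs ++ ps × All (_≈ e₁) ps × All InCoset qs) → All (_≈ e₁) T ⊎ All InCoset T
        go (ps , qs , perm , aps , aqs) = decide (m≤n⇒m<n∨m≡n qs≤)
          where
          lens : n ≡ length qs ℕ.+ length ps
          lens = trans (sym T-length) (trans (Prop.↭-length perm) (List.length-++ qs))
          qs≤ : length qs ≤ n
          qs≤ = ≤-trans (m≤m+n _ _) (≤-reflexive (sym lens))
          d : D n (+ length qs)
          d = use (Win.σ-InA (window T∈) 1≤n′ aqs)
            where
            use : (∃[ x ] σ qs ~ x · e₁ ⊕ (+ length qs) · e₂) → D n (+ length qs)
            use (x , q) = proj₂ (PhiBasis.indep B {x + + length ps} {+ length qs} (P.comb₃ (- + 1) (- + 1) (+ 1)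
                (both₄ (ring-68 x (+ length ps) (+ length qs)) e₁ e₂ (σ qs) (σ ps)) q (σ-const (All.map ≈⇒~ aps)) sum))
              where
              sum : σ qs ⊕ σ ps ~ 0G
              sum = P.≈-trans (P.≈-reflexive (sym (σ-++ qs ps))) (P.≈-trans (≈⇒~ (σ-resp (↭⇒≋ (Prop.↭-sym perm)))) (P.≈-trans (≈⇒~ σT≈) (Generator.h~0 gen)))
          decide : length qs < n ⊎ length qs ≡ n → All (_≈ e₁) T ⊎ All InCoset T
          decide (inj₁ lt) = inj₁ (Prop.All-resp-↭ (Prop.↭-sym perm) (subst (λ l → All (_≈ e₁) (l ++ ps)) (sym (length-0⇒[] (D-small d lt))) aps))
          decide (inj₂ e) = inj₂ (Prop.All-resp-↭ (Prop.↭-sym perm) (All.++⁺ aqs (subst (All InCoset) (sym (length-0⇒[] ps≡0)) [])))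
            where
            ps≡0 : length ps ≡ 0
            ps≡0 = +-cancelˡ-≡ n _ _ (trans (cong (ℕ._+ length ps) (sym e)) (trans (sym lens) (sym (+-identityʳ n))))

      -- If every block consists of copies of e₁, then so does everything outside C, and form (b)
      -- appears. Otherwise s - 1 is the number of such blocks in form (c).
      shape : Shape2 S
      shape = go (All-or (All.tabulate block))
        where
        L I : List Elt → Set
        L T = T ∈ Ts × All (_≈ e₁) T
        I T = T ∈ Ts × All InCoset T
        block : ∀ {T} → T ∈ Ts → (L T ⊎ I T) ⊎ Form2a n m S
        block {T} T∈ = use (All-or (All.tabulate (classify T∈)))
          where
          use₂ : All (_≈ e₁) T ⊎ All InCoset T → L T ⊎ I T
          use₂ (inj₁ a) = inj₁ (T∈ , a)
          use₂ (inj₂ a) = inj₂ (T∈ , a)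
          use : All (λ t → t ≈ e₁ ⊎ InCoset t) T ⊎ Form2a n m S → (L T ⊎ I T) ⊎ Form2a n m S
          use (inj₁ a) = inj₁ (use₂ (pure T∈ a))
          use (inj₂ f) = inj₂ f
        sorted : (∃[ ps ] ∃[ qs ] Ts ↭ qs ++ ps × All L ps × All I qs) → Shape2 S
        sorted (ps , [] , perm , aps , _) = inj₂ (inj₁ (build-b gen B η≈h C-length C∈ (≈-trans (σ-resp S≋) σ≈0)
            (≋-trans S≋ (≋-trans (++⁺ʳ (replicate (suc n′) e₁ ++ C) blocks) (≋-reflexive (trans (sym (List.++-assoc (replicate (suc m′ ℕ.* n) e₁) (replicate (suc n′) e₁) C))
              (cong (_++ C) (trans (sym (replicate-+ (suc m′ ℕ.* n) (suc n′) e₁)) (cong (λ k → replicate k e₁) (+-comm (suc m′ ℕ.* n) (suc n′)))))))))))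
          where
          blocks : concat Ts ≋ replicate (suc m′ ℕ.* n) e₁
          blocks = ≋-trans (blocks-const (All.map (λ (T∈ , a) → Window.T-length (window T∈) , a) (Prop.All-resp-↭ (Prop.↭-sym perm) aps))) (≋-reflexive (cong (λ k → replicate (k ℕ.* n) e₁) Ts-length))
        sorted (ps , T₁ ∷ qs , perm , aps , (T₁∈ , a₁) ∷ aqs) = inj₂ (inj₂ (inj₁ (use (weights T₁∈ a₁))))
          where
          open NonZeroOrder η≉0
          lens : suc (length qs) ℕ.+ length ps ≡ suc m′
          lens = trans (sym (List.length-++ (T₁ ∷ qs))) (trans (sym (Prop.↭-length perm)) Ts-length)
          use : (∃[ u ] ∃[ ws ] All (_≈ u) T₁ × Weights u ws) → Form2c n m S
          use (u , ws , a , A) = CD.build-c gen {e₁} {u} {S} {ws} (weights-basis {u} {ws} A) (const-multiple (Window.T-length (window T₁∈)) a (Window.σT≈ (window T₁∈))) (proj₁ A) (proj₁ (proj₂ A)) (proj₁ (proj₂ (proj₂ A)))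
              (suc (length ps)) (s≤s z≤n) (≤-trans (+-monoˡ-≤ (length ps) {1} {suc (length qs)} (s≤s z≤n)) (≤-reflexive lens)) η≈h
              (≋-trans S≋ (≋-trans (++⁺ (≋-trans blocks (++-comm U V)) (++⁺ˡ (replicate (suc n′) e₁) (proj₂ (proj₂ (proj₂ A))))) (≋-trans (interchange V U (replicate (suc n′) e₁) M)
                (++⁺ (≋-reflexive (trans (sym (replicate-+ (length ps ℕ.* n) (suc n′) e₁)) (cong (λ k → replicate k e₁) (+-comm (length ps ℕ.* n) (suc n′)))))
                  (≋-reflexive (cong (λ k → replicate (k ℕ.* n) u ++ M) (trans (sym (m+n∸n≡m (suc (length qs)) (length ps))) (cong (_∸ length ps) lens))))))))
            where
            M U V : List Elt
            M = map (λ w → u ⊕ (- w) · e₁) ws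
            U = replicate (suc (length qs) ℕ.* n) u
            V = replicate (length ps ℕ.* n) e₁
            T≈u : ∀ {T} → I T → length T ≡ n × All (_≈ u) T
            T≈u {T} (T∈ , b) = use₂ (weights T∈ b)
              where
              use₂ : (∃[ u′ ] ∃[ ws′ ] All (_≈ u′) T × Weights u′ ws′) → length T ≡ n × All (_≈ u) T
              use₂ (u′ , ws′ , a′ , A′) = Window.T-length (window T∈) , All.map (λ e → ≈-trans e (common {u} {ws} {u′} {ws′} A A′)) a′
            blocks : concat Ts ≋ U ++ V
            blocks = ≋-trans (↭⇒≋ (concat-↭ perm)) (≋-trans (≋-reflexive (sym (List.concat-++ (T₁ ∷ qs) ps)))
              (++⁺ (blocks-const (All.map T≈u ((T₁∈ , a₁) ∷ aqs))) (blocks-const (All.map (λ (T∈ , b) → Window.T-length (window T∈) , b) aps))))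
        go : All (λ T → L T ⊎ I T) Ts ⊎ Form2a n m S → Shape2 S
        go (inj₂ f) = inj₁ f
        go (inj₁ a) = sorted (partition-⊎ a)

  opaque
    -- The multiple n e₁ lies in the kernel ⟨h⟩; its values h and 0 are special, and any other value
    -- leads to form (d).
    constant-shape : ∀ {h e₁ e₂ C Ts} → Core h e₁ e₂ (replicate (suc n′) e₁) C Ts → 1 ≤ n′ → ∀ {S} → S ≋ concat Ts ++ (replicate (suc n′) e₁ ++ C) → Shape2 S
    constant-shape {h} {e₁} K 1≤n′ {S} S≋ = go (((+ n) · e₁) ≈? h) (((+ n) · e₁) ≈? 0G)
      where
      go : Dec ((+ n) · e₁ ≈ h) → Dec ((+ n) · e₁ ≈ 0G) → Shape2 S
      go (yes η≈h) _ = SplitCore.shape K 1≤n′ η≈h S≋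
      go (no ne) (yes z) = inj₁ (Cosets.form-a K 1≤n′ z S≋)
      go (no ne) (no nz) = inj₂ (inj₂ (inj₂ (Cosets.NonZeroOrder.form-d K 1≤n′ nz ne S≋)))

    core-shape : ∀ {h e₁ e₂ E C Ts} → Core h e₁ e₂ E C Ts → 1 ≤ n′ → ∀ {S} → S ≋ concat Ts ++ (E ++ C) → Shape2 S
    core-shape {h} {e₁} {e₂} {E} {C} {Ts} K 1≤n′ {S} S≋ = go (uncons E E-length)
      where
      open Core K
      go : (∃[ a ] ∃[ E′ ] E ≡ a ∷ E′) → Shape2 S
      go (a , E′ , eq) = decide (All.all? (a ≈?_) E′)
        where
        a~ : a ~ e₁
        a~ = All.lookup E~ (subst (a ∈_) (sym eq) (here refl))
        decide : Dec (All (a ≈_) E′) → Shape2 S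
        decide (yes all) = constant-shape (record { Ts-length = Ts-length ; window = λ T∈ → rebase (window T∈) (++⁺ʳ C E≋) (resp-basis B a~) (List.length-replicate (suc n′)) C-length
              (All.replicate⁺ (suc n′) P.≈-refl) (All.map (λ {c} → moved {c}) C∈) (P.≈-trans σC~ (P.≈-sym a~)) }) 1≤n′ (≋-trans S≋ (++⁺ˡ (concat Ts) (++⁺ʳ C E≋)))
          where
          E≋ : E ≋ replicate (suc n′) a
          E≋ = ≋-trans (const-≋ (subst (All (_≈ a)) (sym eq) (≈-refl ∷ All.map ≈-sym all))) (≋-reflexive (cong (λ k → replicate k a) E-length))
          moved : ∀ {c} → (∃[ x ] c ~ x · e₁ ⊕ e₂) → ∃[ x ] c ~ x · a ⊕ e₂
          moved {c} (x , p) = x , P.comb₂ (+ 1) (- x) (both₄ (ring-113 x) c e₁ e₂ a) p a~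
        decide (no ¬all) = differ (find (All.¬All⇒Any¬ (a ≈?_) E′ ¬all))
          where
          differ : (∃[ b ] b ∈ E′ × ¬ a ≈ b) → Shape2 S
          differ (b , b∈ , ne) = use (∈⇒≋ b∈)
            where
            use : (∃[ E″ ] E′ ≋ b ∷ E″) → Shape2 S
            use (E″ , q) = inj₂ (inj₁ (NonConstantCore.form-b K 1≤n′ {a} {b} {E″} (≋-trans (≋-reflexive eq) (≋-prep a q)) ne S≋))

  -- Residual sequences and short zero-sums over C_n ⊕ C_n.

  record Line (R : List Elt) : Set where
    field
      {e₁ e₂} : Elt
      {E C} : List Elt
      B : PhiBasis e₁ e₂
      R↭ : R ↭ E ++ C
      E-length : length E ≡ suc n′
      C-length : length C ≡ n
      E~ : All (_~ e₁) E
      C∈ : All (λ c → ∃[ x ] c ~ x · e₁ ⊕ e₂) C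
      σC~ : σ C ~ e₁

  opaque
    form-line : ∀ {R} → Form2a n 1 R → Line R
    form-line {R} (e₁ , e₂ , bas , x , _ , sm , seq) = pulled (Permutation-pull P.≈-trans (P.fromSeqEq seq))
      where
      F : ℤ → Elt
      F y = y · e₁ ⊕ e₂
      pulled : (∃[ zs ] R ↭ zs × Pointwise _~_ zs (replicate (suc n′) e₁ ++ tabulate (λ i → F (x i)))) → Line R
      pulled (zs , perm , pw) = parts (Pointwise-split (replicate (suc n′) e₁) pw)
        where
        parts : (∃[ as ] ∃[ bs ] zs ≡ as ++ bs × Pointwise _~_ as (replicate (suc n′) e₁) × Pointwise _~_ bs (tabulate (λ i → F (x i)))) → Line R
        parts (E , C , eq , pe , pc) = record
          { B = fromIsBasis bas ; R↭ = Prop.trans perm (Prop.↭-reflexive eq)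
          ; E-length = proj₂ (Pointwise-replicate (suc n′) pe) ; C-length = trans (PW.Pointwise-length pc) (trans (List.length-tabulate (λ i → F (x i))) (*-identityˡ n))
          ; E~ = proj₁ (Pointwise-replicate (suc n′) pe)
          ; C∈ = Pointwise-map F (tabulate x) pc′
          ; σC~ = sum }
          where
          pc′ : Pointwise _~_ C (map F (tabulate x))
          pc′ = subst (Pointwise _~_ C) (sym (List.map-tabulate x F)) pc
          sum : σ C ~ e₁
          sum = P.≈-trans (P.σ-resp (Perm.refl pc′)) (P.≈-trans (P.≈-reflexive (trans (σ-line e₁ e₂ (tabulate x)) (cong₂ (λ a b → a · e₁ ⊕ (+ b) · e₂) (sumℤ-tabulate x) (trans (List.length-tabulate x) (*-identityˡ n)))))
             (P.comb₂ (+ 1) (+ 1) (both₂ (ring-114 (Σℤ x) (+ n)) e₁ e₂) (D⇒·~ {Σℤ x} {+ 1} e₁ (Sg.∣ᵤ⇒∣ sm)) (n·~0 e₂)))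

    line-core : ∀ {S} (Δ : Decomposition 1 S) (ℓ : Line (Decomposition.R Δ)) →
      Core (Decomposition.h Δ) (Line.e₁ ℓ) (Line.e₂ ℓ) (Line.E ℓ) (Line.C ℓ) (Decomposition.Ts Δ)
    line-core Δ ℓ = record { Ts-length = Ts-length ; window = λ {T} T∈ → record
        { gen = h-gen ; B = B ; E-length = E-length ; C-length = C-length ; T-length = All.lookup T-length T∈ ; E~ = E~ ; C∈ = C∈ ; σC~ = σC~ ; σT≈ = All.lookup T≈h T∈
        ; sum≈h = λ Z sub 1≤ le → sum≈h T∈ Z (sub-respʳ (≋W T) sub) 1≤ (≤-trans (≤-reflexive (+-comm (length Z) 2)) le)
        ; not-short = λ Z sub → not-short T∈ Z (sub-respʳ (≋W T) sub) } }
      where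
      open Decomposition Δ
      open Line ℓ
      ≋W : ∀ T → E ++ (C ++ T) ≋ T ++ R
      ≋W T = ≋-trans (≋-reflexive (sym (List.++-assoc E C T))) (≋-trans (++-comm (E ++ C) T) (++⁺ˡ T (↭⇒≋ (Prop.↭-sym R↭))))

    line-shape : 1 ≤ n′ → ∀ {S} (Δ : Decomposition 1 S) → Line (Decomposition.R Δ) → Shape2 S
    line-shape 1≤n′ Δ ℓ = core-shape (line-core Δ ℓ) 1≤n′ (≋-trans S≋ (++⁺ˡ (concat Ts) (↭⇒≋ (Line.R↭ ℓ))))
      where open Decomposition Δ

  ShortZeroSum : ℕ → List Elt → Set
  ShortZeroSum k L = ∃[ Z ] ∃[ Z′ ] L ↭ Z ++ Z′ × 1 ≤ length Z × length Z ℕ.+ suc k ≤ 2 ℕ.* n × σ Z ~ 0G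

  -- The residual sequence for k ≥ 2, and for k = 1 if n = 2. For m = 1 the parameter s of form (a)
  -- is 1, which fixes the multiplicities n - 1, n - 1 and k; a factor x other than 1 occurs only
  -- for k = n - 1.
  record Triple (k : ℕ) (L : List Elt) : Set where
    field
      {f₁ f₂ f₃} : Elt
      {E₁ E₂ E₃} : List Elt
      x : ℕ
      1≤x : 1 ≤ x
      x≤ : x ≤ suc n′
      coprime : gcd x n ≡ 1
      B : PhiBasis f₁ f₂
      f₃~ : f₃ ~ (+ x) · f₁ ⊕ f₂
      L↭ : L ↭ E₁ ++ (E₂ ++ E₃)
      len₁ : length E₁ ≡ suc n′
      len₂ : length E₂ ≡ suc n′
      len₃ : length E₃ ≡ k
      E₁~ : All (_~ f₁) E₁
      E₂~ : All (_~ f₂) E₂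
      E₃~ : All (_~ f₃) E₃
      kind : x ≡ 1 ⊎ k ≡ suc n′

  opaque
    found-more : ∀ {k L L′ M} → L ↭ L′ ++ M → ShortZeroSum k L′ → ShortZeroSum k L
    found-more {M = M} p (Z , Z′ , q , a , b , c) = Z , Z′ ++ M , Prop.trans p (Prop.trans (Prop.++⁺ʳ M q) (Prop.↭-reflexive (List.++-assoc Z Z′ M))) , a , b , c

    -- Among 2n - 1 terms the Davenport bound yields a zero-sum; it misses a term and is short, or
    -- it is the whole sequence.
    dav-whole : ∀ L → suc (length L) ≡ 2 ℕ.* n → ShortZeroSum 1 L ⊎ σ L ~ 0G
    dav-whole L len = use (dav-bound n id L (≤-reflexive (sym len)))
      where
      use : HasBlock id n (length L) L → ShortZeroSum 1 L ⊎ σ L ~ 0G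
      use ((Z , 1≤ , Z≤ , z) , Z′ , q) = decide (length Z ℕ.+ 2 ≤? 2 ℕ.* n)
        where
        σZ : σ Z ~ 0G
        σZ = Zero²⇒~ (subst (Zero² n) (cong σ (List.map-id Z)) z)
        decide : Dec (length Z ℕ.+ 2 ≤ 2 ℕ.* n) → ShortZeroSum 1 L ⊎ σ L ~ 0G
        decide (yes short) = inj₁ (Z , Z′ , q , 1≤ , short , σZ)
        decide (no long) = inj₂ (P.≈-trans (P.σ-resp (P.↭⇒≋ q)) (P.≈-trans (P.≈-reflexive (cong σ (trans (cong (Z ++_) (length-0⇒[] Z′≡0)) (List.++-identityʳ Z)))) σZ))
          where
          L≤ : length L ≤ length Z
          L≤ = ≤-pred (≤-trans (≤-reflexive len) (≤-pred (≤-trans (≰⇒> long) (≤-reflexive (+-comm (length Z) 2)))))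
          Z′≡0 : length Z′ ≡ 0
          Z′≡0 = n≤0⇒n≡0 (+-cancelˡ-≤ (length Z) _ _ (≤-trans (≤-reflexive (trans (sym (List.length-++ Z)) (sym (Prop.↭-length q)))) (≤-trans L≤ (≤-reflexive (sym (+-identityʳ _))))))

    -- If no proper zero-sum subsequence of 2n terms is short, every term equals the total sum.
    short-one : Short n 1
    short-one L le = found-more {1} {L} (take-↭ (2 ℕ.* n) L) (go (All-or (All.tabulate each)))
      where
      L₀ : List Elt
      L₀ = take (2 ℕ.* n) L
      len : length L₀ ≡ 2 ℕ.* n
      len = length-take-≤ (2 ℕ.* n) L (≤-pred (subst (_≤ suc (length L)) (+-comm (2 ℕ.* n) 1) le))
      each : ∀ {g} → g ∈ L₀ → g ~ σ L₀ ⊎ ShortZeroSum 1 L₀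
      each {g} g∈ = pick (∈⇒↭ g∈)
        where
        pick : (∃[ L′ ] L₀ ↭ g ∷ L′) → g ~ σ L₀ ⊎ ShortZeroSum 1 L₀
        pick (L′ , perm) = use (dav-whole L′ (trans (sym (Prop.↭-length perm)) len))
          where
          use : ShortZeroSum 1 L′ ⊎ σ L′ ~ 0G → g ~ σ L₀ ⊎ ShortZeroSum 1 L₀
          use (inj₁ f) = inj₂ (found-more {1} {L₀} {L′} {g ∷ []} (Prop.trans perm (Prop.++-comm (g ∷ []) L′)) f)
          use (inj₂ σL′) = inj₁ (P.≈-trans (P.comb₁ (- + 1) (both₂ ring-115 g (σ L′)) σL′) (P.≈-sym (P.σ-resp (P.↭⇒≋ perm))))
      go : All (_~ σ L₀) L₀ ⊎ ShortZeroSum 1 L₀ → ShortZeroSum 1 L₀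
      go (inj₂ f) = f
      go (inj₁ a) = take n L₀ , drop n L₀ , take-↭ n L₀ , subst (1 ≤_) (sym ln) (s≤s z≤n) ,
          subst (λ k → k ℕ.+ 2 ≤ 2 ℕ.* n) (sym ln) (+-monoʳ-≤ n (s≤s (s≤s z≤n))) ,
          P.≈-trans (σ-const (All.take⁺ n a)) (subst (λ k → (+ k) · σ L₀ ~ 0G) (sym ln) (n·~0 (σ L₀)))
        where
        ln : length (take n L₀) ≡ n
        ln = length-take-≤ n L₀ (≤-trans (m≤m+n n (n ℕ.+ 0)) (≤-reflexive (sym len)))

    -- For k = n - 1 this is η(C_n ⊕ C_n) ≤ 3n - 2.
    short-top : Short n (suc n′)
    short-top L le = use (eta-bound n id L (≤-trans (≤-reflexive (ringℕ-11 n′)) (s≤s le)))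
      where
      use : HasBlock id n n L → ShortZeroSum (suc n′) L
      use ((Z , 1≤ , Z≤ , z) , Z′ , q) = Z , Z′ , q , 1≤ , ≤-trans (+-monoˡ-≤ n Z≤) (≤-reflexive (cong (n ℕ.+_) (sym (+-identityʳ n)))) ,
        Zero²⇒~ (subst (Zero² n) (cong σ (List.map-id Z)) z)

    ⇒bound : ∀ {k l} → k ≤ suc n′ → l ≤ 1 ℕ.* n ℕ.+ n ∸ 1 ∸ k → l ℕ.+ suc k ≤ 2 ℕ.* n
    ⇒bound {k} {l} k≤ le = ≤-trans (+-monoˡ-≤ (suc k) le) (≤-reflexive (trans (+-suc _ k) (trans (cong suc (m∸n+n≡m k≤′)) (ringℕ-12 n′))))
      where
      k≤′ : k ≤ 1 ℕ.* n ℕ.+ n ∸ 1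
      k≤′ = ≤-trans k≤ (≤-trans (n≤1+n (suc n′)) (m≤n+m n (suc (n′ ℕ.+ 0))))

    found-or-free : ∀ k → k ≤ suc n′ → ∀ L → ShortZeroSum k L ⊎ ZeroNotInΣ≤ n 1 (1 ℕ.* n ℕ.+ n ∸ 1 ∸ k) L
    found-or-free k k≤ L = go (Any.any? test (splits L))
      where
      Hit : List Elt × List Elt → Set
      Hit p = 1 ≤ length (proj₁ p) × length (proj₁ p) ℕ.+ suc k ≤ 2 ℕ.* n × σ (proj₁ p) ~ 0G
      test : ∀ p → Dec (Hit p)
      test p = (1 ≤? length (proj₁ p)) Dec.×-dec ((length (proj₁ p) ℕ.+ suc k ≤? 2 ℕ.* n) Dec.×-dec (σ (proj₁ p) P.≈? 0G))
      go : Dec (Any Hit (splits L)) → ShortZeroSum k L ⊎ ZeroNotInΣ≤ n 1 (1 ℕ.* n ℕ.+ n ∸ 1 ∸ k) L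
      go (yes a) = inj₁ (use (find a))
        where
        use : (∃[ p ] p ∈ splits L × Hit p) → ShortZeroSum k L
        use (p , p∈ , a , b , c) = proj₁ p , proj₂ p , All.lookup (splits-sound L) p∈ , a , b , c
      go (no ¬a) = inj₂ (λ T T⊆ 1≤ le e → ¬a (hit T 1≤ le e (splits-complete T⊆)))
        where
        hit : ∀ T → 1 ≤ length T → length T ≤ 1 ℕ.* n ℕ.+ n ∸ 1 ∸ k → Eq n 1 (σ T) 0G → (∃[ ws ] (T , ws) ∈ splits L) → Any Hit (splits L)
        hit T 1≤ le e (ws , p∈) = lose p∈ (1≤ , ⇒bound k≤ le , P.mk {σ T} {0G} e)

    -- Without short zero-sums, 2n - 2 + k of the terms are copies of f₁, f₂ and f₁ + f₂. One more
    -- term g = -(A f₁ + B f₂) is cancelled by c = min(A, B, k) copies of f₁ + f₂, A - c of f₁ and B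
    -- - c of f₂. The length 1 + A + B - c is at most 2n - 1 - k: if c = k since A, B ≤ n - 1, and
    -- otherwise since it is at most n ≤ 2n - 1 - k.
    short-triple : ∀ k → k ≤ suc n′ → (∀ L → suc (suc (length L)) ≡ 2 ℕ.* n ℕ.+ k → ZeroNotInΣ≤ n 1 (1 ℕ.* n ℕ.+ n ∸ 1 ∸ k) L → ∃[ τ ] Triple.x {k} {L} τ ≡ 1) → Short n k
    short-triple k k≤ hyp [] le = ⊥-elim (<⇒≱ (s≤s (s≤s z≤n)) le)
    short-triple k k≤ hyp (g ∷ L) le = go (found-or-free k k≤ L₀)
      where
      N₀ : ℕ
      N₀ = n′ ℕ.+ (n ℕ.+ 0) ℕ.+ k
      L₀ M : List Elt
      L₀ = take N₀ L
      M = drop N₀ L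
      len : length L₀ ≡ N₀
      len = length-take-≤ N₀ L (≤-pred (≤-pred le))
      go : ShortZeroSum k L₀ ⊎ ZeroNotInΣ≤ n 1 (1 ℕ.* n ℕ.+ n ∸ 1 ∸ k) L₀ → ShortZeroSum k (g ∷ L)
      go (inj₁ f) = found-more {k} {g ∷ L} {L₀} {g ∷ M} (Prop.trans (Prop.prep g (take-↭ N₀ L)) (Prop.↭-sym (Prop.shift g L₀ M))) f
      go (inj₂ free) = triple (hyp L₀ (cong (suc ∘ suc) len) free)
        where
        triple : (∃[ τ ] Triple.x {k} {L₀} τ ≡ 1) → ShortZeroSum k (g ∷ L)
        triple (τ , x≡1) = coords (PhiBasis.gen B g)
          where
          open Triple τ
          coords : (∃[ a ] ∃[ b ] g ~ a · f₁ ⊕ b · f₂) → ShortZeroSum k (g ∷ L)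
          coords (a , b , g~) = residues (residue n (- a)) (residue n (- b))
            where
            residues : (∃[ r ] r < n × D n (- a - + r)) → (∃[ r ] r < n × D n (- b - + r)) → ShortZeroSum k (g ∷ L)
            residues (A , A< , dA) (b′ , B< , dB) = pick (least-of-three A b′ k)
              where
              pick : (∃[ c ] c ≤ A × c ≤ b′ × c ≤ k × (c ≡ k ⊎ c ≡ A ⊎ c ≡ b′)) → ShortZeroSum k (g ∷ L)
              pick (c , c≤A , c≤B , c≤k , which) = g ∷ (Z₁ ++ (Z₂ ++ Z₃)) , (D₁ ++ (D₂ ++ D₃)) ++ M , Prop.prep g perm , s≤s z≤n , bound which , zero-sum
                where
                A′ B′ : ℕ
                A′ = A ∸ c
                B′ = b′ ∸ c
                Z₁ Z₂ Z₃ D₁ D₂ D₃ : List Elt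
                Z₁ = take A′ E₁
                Z₂ = take B′ E₂
                Z₃ = take c E₃
                D₁ = drop A′ E₁
                D₂ = drop B′ E₂
                D₃ = drop c E₃
                l₁ : length Z₁ ≡ A′
                l₁ = length-take-≤ A′ E₁ (≤-trans (m∸n≤m A c) (≤-trans (≤-pred A<) (≤-reflexive (sym len₁))))
                l₂ : length Z₂ ≡ B′
                l₂ = length-take-≤ B′ E₂ (≤-trans (m∸n≤m b′ c) (≤-trans (≤-pred B<) (≤-reflexive (sym len₂))))
                l₃ : length Z₃ ≡ c
                l₃ = length-take-≤ c E₃ (≤-trans c≤k (≤-reflexive (sym len₃)))
                perm : L ↭ (Z₁ ++ (Z₂ ++ Z₃)) ++ ((D₁ ++ (D₂ ++ D₃)) ++ M)
                perm = Prop.trans (take-↭ N₀ L) (Prop.trans (Prop.++⁺ʳ M (Prop.trans L↭ (Prop.trans (Prop.++⁺ (take-↭ A′ E₁) (Prop.trans (Prop.++⁺ (take-↭ B′ E₂) (take-↭ c E₃)) (↭-interchange Z₂ D₂ Z₃ D₃))) (↭-interchange Z₁ D₁ (Z₂ ++ Z₃) (D₂ ++ D₃)))))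
                  (Prop.↭-reflexive (List.++-assoc (Z₁ ++ (Z₂ ++ Z₃)) _ M)))
                lens : length (Z₁ ++ (Z₂ ++ Z₃)) ≡ A′ ℕ.+ (B′ ℕ.+ c)
                lens = trans (List.length-++ Z₁) (cong₂ ℕ._+_ l₁ (trans (List.length-++ Z₂) (cong₂ ℕ._+_ l₂ l₃)))
                bound : c ≡ k ⊎ c ≡ A ⊎ c ≡ b′ → suc (length (Z₁ ++ (Z₂ ++ Z₃))) ℕ.+ suc k ≤ 2 ℕ.* n
                bound w = ≤-trans (≤-reflexive (cong (λ l → suc l ℕ.+ suc k) lens)) (cases w)
                  where
                  eA : A′ ℕ.+ c ≡ A
                  eA = m∸n+n≡m c≤A
                  eB : B′ ℕ.+ c ≡ b′
                  eB = m∸n+n≡m c≤B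
                  two : ∀ {p q} → p ≤ n → q ≤ n → p ℕ.+ q ≤ 2 ℕ.* n
                  two p q = ≤-trans (+-mono-≤ p q) (≤-reflexive (cong (n ℕ.+_) (sym (+-identityʳ n))))
                  cases : c ≡ k ⊎ c ≡ A ⊎ c ≡ b′ → suc (A′ ℕ.+ (B′ ℕ.+ c)) ℕ.+ suc k ≤ 2 ℕ.* n
                  cases (inj₁ e) = ≤-trans (≤-reflexive (trans (cong (λ j → suc (A′ ℕ.+ (B′ ℕ.+ c)) ℕ.+ suc j) (sym e)) (trans (ringℕ-1 A′ B′ c) (cong₂ (λ p q → suc p ℕ.+ suc q) eA eB)))) (two A< B<)
                  cases (inj₂ (inj₁ e)) = two (≤-trans (≤-reflexive (cong suc (trans (cong (ℕ._+ (B′ ℕ.+ c)) (trans (cong (A ∸_) e) (n∸n≡0 A))) eB))) B<) (s≤s k≤)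
                  cases (inj₂ (inj₂ e)) = two (≤-trans (≤-reflexive (cong suc (trans (cong (λ j → A′ ℕ.+ (j ℕ.+ c)) (trans (cong (b′ ∸_) e) (n∸n≡0 b′))) eA))) A<) (s≤s k≤)
                zero-sum : g ⊕ σ (Z₁ ++ (Z₂ ++ Z₃)) ~ 0G
                zero-sum = P.≈-trans (P.⊕-cong {g} {a · f₁ ⊕ b · f₂} {σ (Z₁ ++ (Z₂ ++ Z₃))} {(+ A′) · f₁ ⊕ ((+ B′) · f₂ ⊕ (+ c) · (f₁ ⊕ f₂))} g~ total)
                    (P.comb₂ (- + 1) (- + 1) (both₂ s f₁ f₂) (D⇒·~0 f₁ dA) (D⇒·~0 f₂ dB))
                  where
                  part : ∀ {f Z} j → length Z ≡ j → All (_~ f) Z → σ Z ~ (+ j) · f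
                  part {f} {Z} j l a = P.≈-trans (σ-const a) (P.≈-reflexive (cong (λ i → (+ i) · f) l))
                  f₃≡ : f₃ ~ f₁ ⊕ f₂
                  f₃≡ = P.≈-trans f₃~ (P.≈-reflexive (trans (cong (λ i → (+ i) · f₁ ⊕ f₂) x≡1) (cong (_⊕ f₂) (cong₂ _,_ (ℤ.*-identityˡ (proj₁ f₁)) (ℤ.*-identityˡ (proj₂ f₁))))))
                  total : σ (Z₁ ++ (Z₂ ++ Z₃)) ~ (+ A′) · f₁ ⊕ ((+ B′) · f₂ ⊕ (+ c) · (f₁ ⊕ f₂))
                  total = P.≈-trans (P.≈-reflexive (trans (σ-++ Z₁ (Z₂ ++ Z₃)) (cong (σ Z₁ ⊕_) (σ-++ Z₂ Z₃))))
                    (P.⊕-cong {σ Z₁} {(+ A′) · f₁} (part A′ l₁ (All.take⁺ A′ E₁~)) (P.⊕-cong {σ Z₂} {(+ B′) · f₂} (part B′ l₂ (All.take⁺ B′ E₂~))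
                      (P.≈-trans (part c l₃ (All.take⁺ c E₃~)) (P.·-cong (+ c) f₃≡))))
                  eA : + A ≡ + A′ + + c
                  eA = cong +_ (sym (m∸n+n≡m c≤A))
                  eB : + b′ ≡ + B′ + + c
                  eB = cong +_ (sym (m∸n+n≡m c≤B))
                  s : ∀ e f → ((a * e + b * f) + ((+ A′) * e + ((+ B′) * f + (+ c) * (e + f)))) - + 0 ≡
                    - + 1 * ((- a - + A) * e - + 0) + - + 1 * ((- b - + b′) * f - + 0)
                  s e f = trans (ring-19 a b (+ A′) (+ B′) (+ c) e f) (cong₂ (λ p q → - + 1 * ((- a - p) * e - + 0) + - + 1 * ((- b - q) * f - + 0)) (sym eA) (sym eB))

  Residual : ℕ → List Elt → Set
  Residual k R = suc (suc (length R)) ≡ 2 ℕ.* n ℕ.+ k × (∀ Z → P.Sub Z R → 1 ≤ length Z → length Z ℕ.+ suc k ≤ 2 ℕ.* n → ¬ σ Z ~ 0G)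

  opaque
    gcd-1 : gcd 1 n ≡ 1
    gcd-1 = ℕ.∣1⇒≡1 (gcd[m,n]∣m 1 n)

    triple-from : ∀ {k L e₁ e₂ f₃} x → 1 ≤ x → x ≤ suc n′ → gcd x n ≡ 1 → PhiBasis e₁ e₂ → f₃ ~ (+ x) · e₁ ⊕ e₂ → x ≡ 1 ⊎ k ≡ suc n′ →
      L P.≋ replicate (suc n′) e₁ ++ (replicate (suc n′) e₂ ++ replicate k f₃) → ∃[ τ ] Triple.x {k} {L} τ ≡ x
    triple-from {k} {L} {e₁} {e₂} {f₃} x 1≤x x≤ cp B f₃~ kd p = pulled (Permutation-pull P.≈-trans p)
      where
      pulled : (∃[ zs ] L ↭ zs × Pointwise _~_ zs (replicate (suc n′) e₁ ++ (replicate (suc n′) e₂ ++ replicate k f₃))) → ∃[ τ ] Triple.x {k} {L} τ ≡ x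
      pulled (zs , perm , pw) = parts (Pointwise-split (replicate (suc n′) e₁) pw)
        where
        parts : (∃[ as ] ∃[ bs ] zs ≡ as ++ bs × Pointwise _~_ as (replicate (suc n′) e₁) × Pointwise _~_ bs (replicate (suc n′) e₂ ++ replicate k f₃)) → ∃[ τ ] Triple.x {k} {L} τ ≡ x
        parts (E₁ , bs , eq , p₁ , pb) = parts₂ (Pointwise-split (replicate (suc n′) e₂) pb)
          where
          parts₂ : (∃[ as ] ∃[ cs ] bs ≡ as ++ cs × Pointwise _~_ as (replicate (suc n′) e₂) × Pointwise _~_ cs (replicate k f₃)) → ∃[ τ ] Triple.x {k} {L} τ ≡ x
          parts₂ (E₂ , E₃ , eq₂ , p₂ , p₃) = record { x = x ; 1≤x = 1≤x ; x≤ = x≤ ; coprime = cp ; B = B ; f₃~ = f₃~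
            ; L↭ = Prop.trans perm (Prop.↭-reflexive (trans eq (cong (E₁ ++_) eq₂)))
            ; len₁ = proj₂ (Pointwise-replicate (suc n′) p₁) ; len₂ = proj₂ (Pointwise-replicate (suc n′) p₂) ; len₃ = proj₂ (Pointwise-replicate k p₃)
            ; E₁~ = proj₁ (Pointwise-replicate (suc n′) p₁) ; E₂~ = proj₁ (Pointwise-replicate (suc n′) p₂) ; E₃~ = proj₁ (Pointwise-replicate k p₃)
            ; kind = kd } , refl

    triple-3a : ∀ {k L} → Form3a n 1 k L → ∃[ τ ] Triple.x {k} {L} τ ≡ 1
    triple-3a {k} {L} (e₁ , e₂ , bas , s , 1≤s , s≤1 , seq) = triple-from 1 ≤-refl (s≤s z≤n) gcd-1 (fromIsBasis bas)
        (P.≈-reflexive (cong (_⊕ e₂) (cong₂ _,_ (sym (ℤ.*-identityˡ (proj₁ e₁))) (sym (ℤ.*-identityˡ (proj₂ e₁)))))) (inj₁ refl)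
        (subst (λ j → L P.≋ replicate (suc n′) e₁ ++ (replicate (suc j) e₂ ++ replicate k (e₁ ⊕ e₂))) (+-identityʳ n′)
          (subst (λ j → L P.≋ replicate (suc n′) e₁ ++ (replicate (j ℕ.* n ∸ 1) e₂ ++ replicate ((1 ∸ j) ℕ.* n ℕ.+ k) (e₁ ⊕ e₂))) (≤-antisym s≤1 1≤s) (P.fromSeqEq seq)))

    triple-4a : ∀ {L} → Form4a n 1 L → Triple (suc n′) L
    triple-4a {L} (e₁ , e₂ , bas , s , 1≤s , s≤1 , x , 1≤x , x≤ , cp , seq) = proj₁ (triple-from x 1≤x x≤ cp (fromIsBasis bas) P.≈-refl (inj₂ refl)
        (subst (λ j → L P.≋ replicate (suc n′) e₁ ++ (replicate (suc j) e₂ ++ replicate (suc n′) ((+ x) · e₁ ⊕ e₂))) (+-identityʳ n′)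
          (subst (λ j → L P.≋ replicate (suc n′) e₁ ++ (replicate (j ℕ.* n ∸ 1) e₂ ++ replicate ((1 ∸ j) ℕ.* n ℕ.+ n ∸ 1) ((+ x) · e₁ ⊕ e₂))) (≤-antisym s≤1 1≤s) (P.fromSeqEq seq))))

    residual-length : ∀ {k} (R : List Elt) → suc (suc (length R)) ≡ 2 ℕ.* n ℕ.+ k → length R ≡ 1 ℕ.* n ℕ.+ n ∸ 2 ℕ.+ k
    residual-length {k} R e = suc-injective (suc-injective (trans e (cong (ℕ._+ k) (ringℕ-13 n′))))

    apply : ∀ {k} → k ≤ suc n′ → 𝒞 n 1 k → ∀ {R} → Residual k R → Conclusion n 1 k R
    apply k≤ hyp {R} (len , free) = hyp R (residual-length R len) (P.toZeroNotIn (λ Z sub 1≤ le → free Z sub 1≤ (⇒bound k≤ le)))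

    line-one : 𝒞 n 1 1 → ∀ {R} → Residual 1 R → Line R
    line-one hyp res = form-line (proj₂ (proj₁ (proj₂ (apply (s≤s z≤n) hyp res)) refl) refl)

    -- The case k = 0 describes R' with -σ(R') appended, for R' of length 2n - 2. By `dav-whole` the
    -- 2n - 1 terms of R sum to 0, so R arises in this way from R without its first term.
    line-zero : 𝒞 n 1 0 → ∀ {R} → Residual 1 R → Line R
    line-zero hyp {R} (len , free) = go (uncons R (suc-injective len₂))
      where
      len₂ : suc (length R) ≡ 2 ℕ.* n
      len₂ = suc-injective (trans len (+-comm (2 ℕ.* n) 1))
      go : (∃[ g ] ∃[ R′ ] R ≡ g ∷ R′) → Line R
      go (g , R′ , eq) = form-line (transfer (proj₂ (proj₁ (apply z≤n hyp (len′ , free′)) refl) refl))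
        where
        len′ : suc (suc (length R′)) ≡ 2 ℕ.* n ℕ.+ 0
        len′ = trans (trans (cong (suc ∘ length) (sym eq)) len₂) (sym (+-identityʳ _))
        free′ : ∀ Z → P.Sub Z R′ → 1 ≤ length Z → length Z ℕ.+ 1 ≤ 2 ℕ.* n → ¬ σ Z ~ 0G
        free′ Z sub 1≤ _ = free Z (subst (P.Sub Z) (sym eq) (P.sub-++ʳ (g ∷ []) sub)) 1≤
          (≤-trans (+-monoˡ-≤ 2 (P.sub-length sub)) (≤-reflexive (trans (+-comm (length R′) 2) (trans len′ (+-identityʳ _)))))
        whole : σ R ~ 0G
        whole = use (dav-whole R len₂)
          where
          use : ShortZeroSum 1 R ⊎ σ R ~ 0G → σ R ~ 0G
          use (inj₂ z) = z
          use (inj₁ (Z , Z′ , q , a , b , c)) = ⊥-elim (free Z (Z′ , P.↭⇒≋ q) a b c)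
        last : g ~ ⊖ σ R′
        last = P.comb₁ (+ 1) (both₂ ring-166 g (σ R′)) (subst (λ l → σ l ~ 0G) eq whole)
        transfer : Form2a n 1 (R′ ++ (⊖ σ R′) ∷ []) → Form2a n 1 R
        transfer (e₁ , e₂ , bas , x , rg , sm , seq) = e₁ , e₂ , bas , x , rg , sm ,
          P.toSeqEq (P.≋-trans (P.≋-reflexive eq) (P.≋-trans (Perm.prep last P.≋-refl) (P.≋-trans (P.++-comm ((⊖ σ R′) ∷ []) R′) (P.fromSeqEq seq))))

    -- With -σ(S) appended the total is 0, so the complement of a zero-sum Z is also a zero-sum,
    -- nonempty because |Z| ≤ |S|. One of the two avoids the appended term and is a zero-sum of S.
    extend-free : ∀ {S} → length S ≡ m ℕ.* n ℕ.+ n ∸ 2 ℕ.+ 0 → ZeroFree (m ℕ.* n ℕ.+ n ∸ 1 ∸ 0) S → ZeroFree (m ℕ.* n ℕ.+ n ∸ 1 ∸ 1) (S ++ (⊖ σ S) ∷ [])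
    extend-free {S} len free Z (Z′ , p) 1≤ le e = pulled (Permutation-pull ≈-trans (≋-trans (≋-sym p) (++-comm S (g ∷ []))))
      where
      g : Elt
      g = ⊖ σ S
      σZ′ : σ Z′ ≈ 0G
      σZ′ = comb₂ (+ 1) (- + 1) (both₂ ring-200 (σ Z) (σ Z′)) total e
        where
        total : σ Z ⊕ σ Z′ ≈ 0G
        total = ≈-trans (≈-reflexive (sym (σ-++ Z Z′))) (≈-trans (≈-sym (σ-resp p)) (≈-reflexive (trans (σ-++ S (g ∷ [])) (both₁ ring-201 (σ S)))))
      lens : length S ℕ.+ 1 ≡ length Z ℕ.+ length Z′
      lens = trans (sym (List.length-++ S)) (trans (≋-length p) (List.length-++ Z))
      Z≤S : length Z ≤ length S
      Z≤S = ≤-trans le (≤-reflexive (sym (trans len (+-identityʳ _))))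
      1≤Z′ : 1 ≤ length Z′
      1≤Z′ = +-cancelˡ-≤ (length S) _ _ (≤-trans (≤-reflexive lens) (+-monoˡ-≤ (length Z′) Z≤S))
      small : ∀ {Y} → Sub Y S → length Y ≤ m ℕ.* n ℕ.+ n ∸ 1 ∸ 0
      small sub = ≤-trans (sub-length sub) (≤-trans (≤-reflexive (trans len (+-identityʳ _))) (n≤1+n _))
      pulled : (∃[ zs ] Z ++ Z′ ↭ zs × Pointwise _≈_ zs (g ∷ S)) → ⊥
      pulled (a ∷ as , perm , _ ∷ pw) = side (∈-++⁻ Z (Prop.∈-resp-↭ (Prop.↭-sym perm) (here refl)))
        where
        side : a ∈ Z ⊎ a ∈ Z′ → ⊥
        side (inj₁ a∈) = use (∈⇒↭ a∈)
          where
          use : (∃[ Y ] Z ↭ a ∷ Y) → ⊥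
          use (Y , q) = free Z′ sub 1≤Z′ (small sub) σZ′
            where
            sub : Sub Z′ S
            sub = Y , ≋-trans (≋-sym (≋-trans (↭⇒≋ (Prop.drop-∷ (Prop.trans (Prop.++⁺ʳ Z′ (Prop.↭-sym q)) perm))) (Perm.refl pw))) (++-comm Y Z′)
        side (inj₂ a∈) = use (∈⇒↭ a∈)
          where
          use : (∃[ Y ] Z′ ↭ a ∷ Y) → ⊥
          use (Y , q) = free Z sub 1≤ (small sub) e
            where
            sub : Sub Z S
            sub = Y , ≋-sym (≋-trans (↭⇒≋ (Prop.drop-∷ (Prop.trans (Prop.↭-sym (Prop.shift a Z Y)) (Prop.trans (Prop.++⁺ˡ Z (Prop.↭-sym q)) perm)))) (Perm.refl pw))

  -- The case k ≥ 2: blocks take only the three values of R in the quotient.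

  module Values {k L} (τ : Triple k L) where
    open Triple τ

    Near Low : Elt → Set
    Near v = v ~ f₁ ⊎ v ~ f₂ ⊎ v ~ f₃
    Low v = v ~ f₁ ⊎ v ~ f₂

    near? : ∀ v → Dec (Near v)
    near? v = (v P.≈? f₁) Dec.⊎-dec ((v P.≈? f₂) Dec.⊎-dec (v P.≈? f₃))

    low? : ∀ v → Dec (Low v)
    low? v = (v P.≈? f₁) Dec.⊎-dec (v P.≈? f₂)

    opaque
      all-near : All Near L
      all-near = Prop.All-resp-↭ (Prop.↭-sym L↭) (All.++⁺ (All.map inj₁ E₁~) (All.++⁺ (All.map (inj₂ ∘ inj₁) E₂~) (All.map (inj₂ ∘ inj₂) E₃~)))

      f₁≁0 : ∀ {a} → 1 ≤ a → a < n → ¬ (+ a) · f₁ ~ 0G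
      f₁≁0 {suc a} _ lt p = 1+n≢0 (D-small (indep₁ {a = + suc a} B p) lt)

      f₂≁0 : ∀ {a} → 1 ≤ a → a < n → ¬ (+ a) · f₂ ~ 0G
      f₂≁0 {suc a} _ lt p = 1+n≢0 (D-small (indep₁ {a = + suc a} (swap-basis B) p) lt)

      f₃≁f₁ : ¬ f₃ ~ f₁
      f₃≁f₁ p = 1+n≢0 (D-small {n} {1} (proj₂ (PhiBasis.indep B {+ x - + 1} {+ 1} (P.comb₂ (- + 1) (+ 1) (both₃ (ring-202 (+ x)) f₁ f₂ f₃) f₃~ p))) (s≤s (s≤s z≤n)))

      f₃≁f₂ : ¬ f₃ ~ f₂
      f₃≁f₂ p = f₁≁0 1≤x (s≤s x≤) (P.comb₂ (- + 1) (+ 1) (both₃ (ring-203 (+ x)) f₁ f₂ f₃) f₃~ p)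

      unit : x ≡ 1 → f₃ ~ f₁ ⊕ f₂
      unit e = P.≈-trans f₃~ (P.≈-reflexive (trans (cong (λ i → (+ i) · f₁ ⊕ f₂) e) (cong (_⊕ f₂) (cong₂ _,_ (ℤ.*-identityˡ (proj₁ f₁)) (ℤ.*-identityˡ (proj₂ f₁))))))

      -- One more f₁ and f₂ complete the n - 1 copies of each to a multiple of n.
      σL~ : σ L ⊕ (f₁ ⊕ f₂) ~ (+ k) · f₃
      σL~ = P.≈-trans (P.⊕-cong {σ L} {(+ suc n′) · f₁ ⊕ ((+ suc n′) · f₂ ⊕ (+ k) · f₃)} (P.≈-trans (P.σ-resp (P.↭⇒≋ L↭)) (P.≈-trans (P.≈-reflexive (trans (σ-++ E₁ (E₂ ++ E₃)) (cong (σ E₁ ⊕_) (σ-++ E₂ E₃))))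
            (P.⊕-cong {σ E₁} {(+ suc n′) · f₁} (part len₁ E₁~) (P.⊕-cong {σ E₂} {(+ suc n′) · f₂} (part len₂ E₂~) (part len₃ E₃~))))) (P.≈-refl {f₁ ⊕ f₂}))
          (P.comb₂ (+ 1) (+ 1) (both₃ (ring-204 (+ suc n′) (+ k)) f₁ f₂ f₃) (n·~0 f₁) (n·~0 f₂))
        where
        part : ∀ {f Z j} → length Z ≡ j → All (_~ f) Z → σ Z ~ (+ j) · f
        part {f} {Z} l a = P.≈-trans (σ-const a) (P.≈-reflexive (cong (λ i → (+ i) · f) l))

  opaque
    ~-sums : ∀ {a b c d} → a ~ c → b ~ d → c ⊕ d ~ a ⊕ b
    ~-sums {a} {b} {c} {d} p q = P.≈-sym (P.⊕-cong {a} {c} {b} {d} p q)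

    ~-sums′ : ∀ {a b c d} → a ~ c → b ~ d → d ⊕ c ~ a ⊕ b
    ~-sums′ {a} {b} {c} {d} p q = P.≈-trans (P.≈-reflexive (⊕-comm d c)) (~-sums {a} {b} p q)

    -- Three pairwise distinct elements with values among g₁, g₂, g₃ exhaust these values, so the
    -- outcome depends only on which of them is g₃.
    assign : ∀ {g₁ g₂ g₃ a b c : Elt} → ¬ a ~ b → ¬ a ~ c → ¬ b ~ c →
      a ~ g₁ ⊎ a ~ g₂ ⊎ a ~ g₃ → b ~ g₁ ⊎ b ~ g₂ ⊎ b ~ g₃ → c ~ g₁ ⊎ c ~ g₂ ⊎ c ~ g₃ →
      (g₃ ~ a × g₁ ⊕ g₂ ~ b ⊕ c) ⊎ (g₃ ~ b × g₁ ⊕ g₂ ~ a ⊕ c) ⊎ (g₃ ~ c × g₁ ⊕ g₂ ~ a ⊕ b)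
    assign ab ac bc (inj₁ p) (inj₁ q) _ = ⊥-elim (ab (P.≈-trans p (P.≈-sym q)))
    assign ab ac bc (inj₂ (inj₁ p)) (inj₂ (inj₁ q)) _ = ⊥-elim (ab (P.≈-trans p (P.≈-sym q)))
    assign ab ac bc (inj₂ (inj₂ p)) (inj₂ (inj₂ q)) _ = ⊥-elim (ab (P.≈-trans p (P.≈-sym q)))
    assign ab ac bc (inj₁ p) _ (inj₁ q) = ⊥-elim (ac (P.≈-trans p (P.≈-sym q)))
    assign ab ac bc (inj₂ (inj₁ p)) _ (inj₂ (inj₁ q)) = ⊥-elim (ac (P.≈-trans p (P.≈-sym q)))
    assign ab ac bc (inj₂ (inj₂ p)) _ (inj₂ (inj₂ q)) = ⊥-elim (ac (P.≈-trans p (P.≈-sym q)))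
    assign ab ac bc _ (inj₁ p) (inj₁ q) = ⊥-elim (bc (P.≈-trans p (P.≈-sym q)))
    assign ab ac bc _ (inj₂ (inj₁ p)) (inj₂ (inj₁ q)) = ⊥-elim (bc (P.≈-trans p (P.≈-sym q)))
    assign ab ac bc _ (inj₂ (inj₂ p)) (inj₂ (inj₂ q)) = ⊥-elim (bc (P.≈-trans p (P.≈-sym q)))
    assign _ _ _ (inj₁ p) (inj₂ (inj₁ q)) (inj₂ (inj₂ r)) = inj₂ (inj₂ (P.≈-sym r , ~-sums p q))
    assign _ _ _ (inj₁ p) (inj₂ (inj₂ q)) (inj₂ (inj₁ r)) = inj₂ (inj₁ (P.≈-sym q , ~-sums p r))
    assign _ _ _ (inj₂ (inj₁ p)) (inj₁ q) (inj₂ (inj₂ r)) = inj₂ (inj₂ (P.≈-sym r , ~-sums′ p q))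
    assign _ _ _ (inj₂ (inj₁ p)) (inj₂ (inj₂ q)) (inj₁ r) = inj₂ (inj₁ (P.≈-sym q , ~-sums′ p r))
    assign _ _ _ (inj₂ (inj₂ p)) (inj₁ q) (inj₂ (inj₁ r)) = inj₁ (P.≈-sym p , ~-sums q r)
    assign _ _ _ (inj₂ (inj₂ p)) (inj₂ (inj₁ q)) (inj₁ r) = inj₁ (P.≈-sym p , ~-sums′ q r)

  module Supported {j S} (Δ : Decomposition (2 ℕ.+ j) S) (k≤ : 2 ℕ.+ j ≤ suc n′) (hyp : ∀ {L} → Residual (2 ℕ.+ j) L → Triple (2 ℕ.+ j) L)
      (τ : Triple (2 ℕ.+ j) (Decomposition.R Δ)) where
    open Decomposition Δ
    open Triple τ
    open Values τ

    k : ℕ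
    k = 2 ℕ.+ j

    opaque
      -- Equal totals give k f₃ + g₁ + g₂ = k g₃ + f₁ + f₂ in the quotient. If k = n - 1, then f₁ +
      -- f₂ + f₃ = t + c + g, and t would be f₁ or f₂. Otherwise f₃ = f₁ + f₂ and g₃ = g₁ + g₂, so
      -- (k - 1) f₃ = (k - 1) g₃; according to which element is g₃, this annihilates f₁ or f₂ by k -
      -- 1 < n, or t is again f₁ or f₂.
      contradictory : ∀ {L} (τ′ : Triple k L) → σ L ~ σ R → ∀ {t c g} → ¬ Near t → c ~ f₃ → Low g →
        (Triple.f₃ τ′ ~ t × Triple.f₁ τ′ ⊕ Triple.f₂ τ′ ~ c ⊕ g) ⊎ (Triple.f₃ τ′ ~ c × Triple.f₁ τ′ ⊕ Triple.f₂ τ′ ~ t ⊕ g) ⊎ (Triple.f₃ τ′ ~ g × Triple.f₁ τ′ ⊕ Triple.f₂ τ′ ~ t ⊕ c) → ⊥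
      contradictory {L} τ′ σ~ {t} {c} {g} far c~ low w = split (Triple.kind τ) (Triple.kind τ′)
        where
        g₁ g₂ g₃ : Elt
        g₁ = Triple.f₁ τ′
        g₂ = Triple.f₂ τ′
        g₃ = Triple.f₃ τ′
        bal : (+ k) · f₃ ⊕ (g₁ ⊕ g₂) ~ (+ k) · g₃ ⊕ (f₁ ⊕ f₂)
        bal = P.comb₃ (- + 1) (+ 1) (- + 1) (both₈ ring-167 (σ L) (σ R) f₁ f₂ ((+ k) · f₃) g₁ g₂ ((+ k) · g₃))
             σL~ (Values.σL~ τ′) σ~
        partner : t ⊕ g ~ f₁ ⊕ f₂ → ⊥
        partner p = go low
          where
          go : Low g → ⊥
          go (inj₁ q) = far (inj₂ (inj₁ (P.comb₂ (+ 1) (- + 1) (both₄ ring-116 t g f₁ f₂) p q)))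
          go (inj₂ q) = far (inj₁ (P.comb₂ (+ 1) (- + 1) (both₄ ring-117 t g f₁ f₂) p q))
        full : k ≡ suc n′ → ⊥
        full e = partner (P.comb₃ (+ 1) (- + 1) (- + 1) (both₉ ring-168 f₁ f₂ f₃ g₁ g₂ g₃ t c g) sums₂ c~ total)
          where
          neg : ∀ v → (+ k) · v ⊕ v ~ 0G
          neg v = P.comb₁ (+ 1) (both₁ q v) (n·~0 v)
            where
            q : ∀ v → ((+ k) * v + v) - + 0 ≡ + 1 * ((+ n) * v - + 0)
            q v = trans (ring-118 (+ k) v) (cong (λ i → + 1 * ((+ suc i) * v - + 0)) e)
          sums₂ : g₃ ⊕ (g₁ ⊕ g₂) ~ f₃ ⊕ (f₁ ⊕ f₂)
          sums₂ = P.comb₃ (+ 1) (- + 1) (+ 1) (both₆ ring-119 ((+ k) · f₃) ((+ k) · g₃) f₃ (f₁ ⊕ f₂) g₃ (g₁ ⊕ g₂)) bal (neg f₃) (neg g₃)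
          total : g₃ ⊕ (g₁ ⊕ g₂) ~ t ⊕ (c ⊕ g)
          total = go w
            where
            perm : ∀ {u v y} → g₃ ~ u → g₁ ⊕ g₂ ~ v ⊕ y → u ⊕ (v ⊕ y) ≡ t ⊕ (c ⊕ g) → g₃ ⊕ (g₁ ⊕ g₂) ~ t ⊕ (c ⊕ g)
            perm {u} {v} {y} p q e = P.≈-trans (P.⊕-cong {g₃} {u} {g₁ ⊕ g₂} {v ⊕ y} p q) (P.≈-reflexive e)
            go : (g₃ ~ t × g₁ ⊕ g₂ ~ c ⊕ g) ⊎ (g₃ ~ c × g₁ ⊕ g₂ ~ t ⊕ g) ⊎ (g₃ ~ g × g₁ ⊕ g₂ ~ t ⊕ c) → g₃ ⊕ (g₁ ⊕ g₂) ~ t ⊕ (c ⊕ g)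
            go (inj₁ (p , q)) = perm {t} {c} {g} p q refl
            go (inj₂ (inj₁ (p , q))) = perm {c} {t} {g} p q (both₃ ring-77 t c g)
            go (inj₂ (inj₂ (p , q))) = perm {g} {t} {c} p q (both₃ ring-120 t c g)
        small : suc j < n
        small = ≤-trans k≤ (n≤1+n _)
        middle : x ≡ 1 → Triple.x τ′ ≡ 1 → ⊥
        middle e e′ = go w
          where
          u₁ : f₃ ~ f₁ ⊕ f₂
          u₁ = unit e
          u₂ : g₃ ~ g₁ ⊕ g₂
          u₂ = Values.unit τ′ e′
          diff : (+ suc j) · f₃ ~ (+ suc j) · g₃
          diff = P.comb₃ (+ 1) (- + 1) (+ 1) (both₄ (ring-121 (+ suc j)) f₃ g₃ (f₁ ⊕ f₂) (g₁ ⊕ g₂)) bal u₁ u₂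
          kill : (+ suc j) · g ~ 0G → Low g → ⊥
          kill p (inj₁ q) = f₁≁0 (s≤s z≤n) small (P.≈-trans (P.·-cong (+ suc j) (P.≈-sym q)) p)
          kill p (inj₂ q) = f₂≁0 (s≤s z≤n) small (P.≈-trans (P.·-cong (+ suc j) (P.≈-sym q)) p)
          go : (g₃ ~ t × g₁ ⊕ g₂ ~ c ⊕ g) ⊎ (g₃ ~ c × g₁ ⊕ g₂ ~ t ⊕ g) ⊎ (g₃ ~ g × g₁ ⊕ g₂ ~ t ⊕ c) → ⊥
          go (inj₁ (p , q)) = kill (P.comb₃ (- + 1) (+ suc j) (+ suc j) (both₄ (ring-122 (+ suc j)) f₃ g₃ g c) diff (P.≈-trans (P.≈-sym q) (P.≈-sym u₂)) (P.≈-sym c~)) low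
          go (inj₂ (inj₁ (p , q))) = partner (P.≈-trans (P.≈-sym q) (P.≈-trans (P.≈-sym u₂) (P.≈-trans p (P.≈-trans c~ u₁))))
          go (inj₂ (inj₂ (p , q))) = other low
            where
            other : Low g → ⊥
            other (inj₁ s) = f₂≁0 (s≤s z≤n) small (P.comb₃ (+ 1) (- + suc j) (+ suc j) (both₄ (ring-69 (+ suc j)) f₁ f₂ f₃ g₃) diff u₁ (P.≈-trans p s))
            other (inj₂ s) = f₁≁0 (s≤s z≤n) small (P.comb₃ (+ 1) (- + suc j) (+ suc j) (both₄ (ring-70 (+ suc j)) f₁ f₂ f₃ g₃) diff u₁ (P.≈-trans p s))
        split : x ≡ 1 ⊎ k ≡ suc n′ → Triple.x τ′ ≡ 1 ⊎ k ≡ suc n′ → ⊥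
        split (inj₂ e) _ = full e
        split (inj₁ _) (inj₂ e) = full e
        split (inj₁ e) (inj₁ e′) = middle e e′

      -- If t had a fourth value, remove t and a term c over f₃ from T R. The remaining 3n + k - 4 ≥
      -- 3n - 2 terms contain a block T', and what is left besides T' is again residual. It contains
      -- t, c and a term over f₁ or f₂, which `contradictory` excludes.
      support : ∀ {T t} → T ∈ Ts → t ∈ T → Near t
      support {T} {t} T∈ t∈ = decide (near? t)
        where
        Tn : length T ≡ n
        Tn = All.lookup T-length T∈
        decide : Dec (Near t) → Near t
        decide (yes p) = p
        decide (no far) = ⊥-elim (start (uncons E₃ len₃) (∈⇒↭ t∈))
          where
          start : (∃[ c ] ∃[ E₃′ ] E₃ ≡ c ∷ E₃′) → (∃[ T₁ ] T ↭ t ∷ T₁) → ⊥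
          start (c , E₃′ , eq) (T₁ , T↭) = block (eta-bound n id V V-long)
            where
            V : List Elt
            V = T₁ ++ (E₁ ++ (E₂ ++ E₃′))
            R↭ : R ↭ c ∷ (E₁ ++ (E₂ ++ E₃′))
            R↭ = Prop.trans L↭ (Prop.trans (Prop.++⁺ˡ E₁ (Prop.trans (Prop.↭-reflexive (cong (E₂ ++_) eq)) (Prop.shift c E₂ E₃′))) (Prop.shift c E₁ (E₂ ++ E₃′)))
            W↭ : T ++ R ↭ t ∷ c ∷ V
            W↭ = Prop.trans (Prop.++⁺ T↭ R↭) (Prop.prep t (Prop.shift c T₁ (E₁ ++ (E₂ ++ E₃′))))
            V-length : suc (suc (suc (suc (length V)))) ≡ n ℕ.+ (2 ℕ.* n ℕ.+ k)
            V-length = trans (cong (suc ∘ suc) (trans (sym (Prop.↭-length W↭)) (List.length-++ T))) (trans (sym (trans (+-suc _ _) (cong suc (+-suc _ _)))) (cong₂ ℕ._+_ Tn R-length))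
            V-long : 3 ℕ.* n ≤ 2 ℕ.+ length V
            V-long = ≤-pred (≤-pred (≤-trans (≤-trans (m≤m+n (suc (suc (3 ℕ.* n))) j) (≤-reflexive (ringℕ-6 n j))) (≤-reflexive (sym V-length))))
            block : HasBlock id n n V → ⊥
            block ((T′ , 1≤ , T′≤ , z) , V′ , q) = use (Any.any? low? R′)
              where
              R′ : List Elt
              R′ = t ∷ c ∷ V′
              perm : T ++ R ↭ T′ ++ R′
              perm = Prop.trans W↭ (Prop.trans (Prop.prep t (Prop.prep c q)) (Prop.trans (Prop.prep t (Prop.↭-sym (Prop.shift c T′ V′))) (Prop.↭-sym (Prop.shift t T′ (c ∷ V′)))))
              σT′ : σ T′ ~ 0G
              σT′ = Zero²⇒~ (subst (Zero² n) (cong σ (List.map-id T′)) z)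
              T′n : length T′ ≡ n
              T′n = ≤-antisym T′≤ (not-short T∈ T′ (R′ , ↭⇒≋ perm) 1≤ σT′)
              k<2n : ∀ {l} → l ≤ n → l ℕ.+ suc k ≤ 3 ℕ.* n
              k<2n le = +-mono-≤ le (≤-trans (s≤s k≤) (m≤m+n n (n ℕ.+ 0)))
              σT′≈ : σ T′ ≈ h
              σT′≈ = sum≈h T∈ T′ (R′ , ↭⇒≋ perm) 1≤ (k<2n T′≤) σT′
              R′-length : suc (suc (length R′)) ≡ 2 ℕ.* n ℕ.+ k
              R′-length = +-cancelˡ-≡ n _ _ (trans (cong (ℕ._+ suc (suc (length R′))) (sym T′n)) (trans (trans (+-suc _ _) (cong suc (+-suc _ _)))
                (trans (cong (suc ∘ suc) (trans (sym (List.length-++ T′)) (trans (sym (Prop.↭-length perm)) (Prop.↭-length W↭)))) V-length)))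
              free : ∀ Z → P.Sub Z R′ → 1 ≤ length Z → length Z ℕ.+ suc k ≤ 2 ℕ.* n → ¬ σ Z ~ 0G
              free Z (Z′ , p) 1≤Z le σZ = lifted (P.⊆-resp-≋ p (++-⊆ Z Z′))
                where
                lifted : (∃[ Y ] Y ⊆ R′ × Y P.≋ Z) → ⊥
                lifted (Y , Y⊆ , r) = Generator.order h-gen 1 (s≤s z≤n) (s≤s (s≤s z≤n))
                    (comb₃ (- + 1) (- + 1) (+ 1) (both₃ ring-20 (σ Y) (σ T′) h) Y≈ σT′≈ both)
                  where
                  sub : Sub Y R′
                  sub = proj₁ (⊆⇒↭ Y⊆) , ↭⇒≋ (proj₂ (⊆⇒↭ Y⊆))
                  lenY : length Y ≡ length Z
                  lenY = P.≋-length r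
                  σY : σ Y ~ 0G
                  σY = P.≈-trans (P.σ-resp r) σZ
                  Y-le : length Y ℕ.+ suc k ≤ 2 ℕ.* n
                  Y-le = subst (λ l → l ℕ.+ suc k ≤ 2 ℕ.* n) (sym lenY) le
                  1≤Y : 1 ≤ length Y
                  1≤Y = subst (1 ≤_) (sym lenY) 1≤Z
                  Y≈ : σ Y ≈ h
                  Y≈ = sum≈h T∈ Y (sub-respʳ (↭⇒≋ (Prop.↭-sym perm)) (sub-++ʳ T′ sub)) 1≤Y (≤-trans Y-le (*-monoˡ-≤ n {2} {3} (n≤1+n 2))) σY
                  both : σ Y ⊕ σ T′ ≈ h
                  both = subst (_≈ h) (σ-++ Y T′) (sum≈h T∈ (Y ++ T′) (sub-respʳ (≋-trans (++-comm R′ T′) (↭⇒≋ (Prop.↭-sym perm))) (sub-++ sub sub-refl))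
                      (≤-trans 1≤Y (≤-trans (m≤m+n _ _) (≤-reflexive (sym (List.length-++ Y)))))
                      (≤-trans (≤-reflexive (trans (cong (ℕ._+ suc k) (trans (List.length-++ Y) (trans (cong (length Y ℕ.+_) T′n) (+-comm (length Y) n)))) (+-assoc n (length Y) (suc k)))) (+-monoʳ-≤ n Y-le))
                      (subst (_~ 0G) (sym (σ-++ Y T′)) (~-⊕ σY σT′)))
              c~ : c ~ f₃
              c~ = All.lookup E₃~ (subst (c ∈_) (sym eq) (here refl))
              σR′ : σ R′ ~ σ R
              σR′ = P.comb₃ (+ 1) (- + 1) (+ 1) (both₄ ring-31 (σ T) (σ R) (σ T′) (σ R′))
                  (P.≈-trans (P.≈-reflexive (sym (σ-++ T′ R′))) (P.≈-trans (P.σ-resp (P.↭⇒≋ (Prop.↭-sym perm))) (P.≈-reflexive (σ-++ T R)))) σT′ (All.lookup T~0 T∈)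
              use : Dec (Any Low R′) → ⊥
              -- At least 2n - 2 terms of T R lie over f₁ or f₂, more than the n terms of T' can
              -- hold, because 2 ≤ k ≤ n - 1 makes n at least 3.
              use (no none) = <⇒≱ (≤-trans (≤-trans (≤-reflexive (+-comm 1 n)) (≤-trans (+-monoʳ-≤ n (≤-trans (s≤s z≤n) (≤-pred k≤))) (≤-reflexive (ringℕ-3 n′)))) many) few
                where
                W₂ : T ++ R ↭ (E₁ ++ E₂) ++ (E₃ ++ T)
                W₂ = Prop.trans (Prop.++-comm T R) (Prop.trans (Prop.++⁺ʳ T L↭) (Prop.↭-reflexive (trans (cong (_++ T) (sym (List.++-assoc E₁ E₂ E₃))) (List.++-assoc (E₁ ++ E₂) E₃ T))))
                few : length (filter low? (T ++ R)) ≤ n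
                few = ≤-trans (≤-reflexive (trans (Prop.↭-length (Prop.filter-↭ low? perm)) (cong length (trans (List.filter-++ low? T′ R′) (trans (cong (filter low? T′ ++_) (List.filter-none low? (All.¬Any⇒All¬ R′ none))) (List.++-identityʳ _))))))
                  (≤-trans (List.length-filter low? T′) T′≤)
                many : suc n′ ℕ.+ suc n′ ≤ length (filter low? (T ++ R))
                many = ≤-trans (≤-trans (≤-reflexive (sym (trans (List.length-++ E₁) (cong₂ ℕ._+_ len₁ len₂)))) (m≤m+n _ _)) (≤-reflexive (sym (trans (Prop.↭-length (Prop.filter-↭ low? W₂))
                  (trans (cong length (trans (List.filter-++ low? (E₁ ++ E₂) (E₃ ++ T)) (cong (_++ filter low? (E₃ ++ T)) (List.filter-all low? (All.++⁺ (All.map inj₁ E₁~) (All.map inj₂ E₂~)))))) (List.length-++ (E₁ ++ E₂))))))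
              use (yes some) = found (find some)
                where
                found : (∃[ g ] g ∈ R′ × Low g) → ⊥
                found (g , g∈ , low) = contradictory τ′ σR′ {t} {c} {g} far c~ low (assign {a = t} {c} {g} t≁c (t≁g low) (c≁g low) (near (here refl)) (near (there (here refl))) (near g∈))
                  where
                  τ′ : Triple k R′
                  τ′ = hyp (R′-length , free)
                  near : ∀ {v} → v ∈ R′ → Values.Near τ′ v
                  near = All.lookup (Values.all-near τ′)
                  t≁c : ¬ t ~ c
                  t≁c p = far (inj₂ (inj₂ (P.≈-trans p c~)))
                  t≁g : Low g → ¬ t ~ g
                  t≁g (inj₁ q) p = far (inj₁ (P.≈-trans p q))
                  t≁g (inj₂ q) p = far (inj₂ (inj₁ (P.≈-trans p q)))
                  c≁g : Low g → ¬ c ~ g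
                  c≁g (inj₁ q) p = f₃≁f₁ (P.≈-trans (P.≈-sym c~) (P.≈-trans p q))
                  c≁g (inj₂ q) p = f₃≁f₂ (P.≈-trans (P.≈-sym c~) (P.≈-trans p q))

  opaque
    coprime-cancel : ∀ {x c} → gcd x n ≡ 1 → D n (+ (c ℕ.* x)) → D n (+ c)
    coprime-cancel {x} {c} cp d = Sg.∣ᵤ⇒∣ (Coprime.coprime-divisor {n} {x} {c} (Coprime.sym (Coprime.gcd≡1⇒coprime cp)) (subst (n ℕ.∣_) (*-comm c x) (Sg.∣⇒∣ᵤ d)))

  module Uniform {k S} (Δ : Decomposition k S) (k≤ : k ≤ suc n′) (τ : Triple k (Decomposition.R Δ))
      (supp : ∀ {T t} → T ∈ Decomposition.Ts Δ → t ∈ T → Values.Near τ t) where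
    open Decomposition Δ
    open Triple τ
    open Values τ

    opaque
      -- With multiplicities a, b, c of the three values, n divides b + c and a + c x. Either b + c
      -- = 0, or b + c = n and a = 0; then n divides c x, hence c, so c is 0 or n.
      uniform : ∀ {T} → T ∈ Ts → All (_~ f₁) T ⊎ All (_~ f₂) T ⊎ All (_~ f₃) T
      uniform {T} T∈ = split (partition-⊎ (All.tabulate (supp T∈)))
        where
        Goal : Set
        Goal = All (_~ f₁) T ⊎ All (_~ f₂) T ⊎ All (_~ f₃) T
        split : (∃[ ps ] ∃[ qs ] T ↭ qs ++ ps × All (_~ f₁) ps × All (λ v → v ~ f₂ ⊎ v ~ f₃) qs) → Goal
        split (ps , qs , perm , aps , aqs) = split₂ (partition-⊎ aqs)
          where
          split₂ : (∃[ ps₂ ] ∃[ ps₃ ] qs ↭ ps₃ ++ ps₂ × All (_~ f₂) ps₂ × All (_~ f₃) ps₃) → Goal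
          split₂ (ps₂ , ps₃ , perm₂ , a₂ , a₃) = decide (m≤n⇒m<n∨m≡n bc≤)
            where
            a b c : ℕ
            a = length ps
            b = length ps₂
            c = length ps₃
            T↭ : T ↭ (ps₃ ++ ps₂) ++ ps
            T↭ = Prop.trans perm (Prop.++⁺ʳ ps perm₂)
            lens : n ≡ (c ℕ.+ b) ℕ.+ a
            lens = trans (sym (All.lookup T-length T∈)) (trans (Prop.↭-length T↭) (trans (List.length-++ (ps₃ ++ ps₂)) (cong (ℕ._+ a) (List.length-++ ps₃))))
            bc≤ : c ℕ.+ b ≤ n
            bc≤ = ≤-trans (m≤m+n _ a) (≤-reflexive (sym lens))
            sum : ((+ c) · f₃ ⊕ (+ b) · f₂) ⊕ (+ a) · f₁ ~ 0G
            sum = P.≈-trans (P.≈-sym (P.≈-trans (P.≈-reflexive (trans (σ-++ (ps₃ ++ ps₂) ps) (cong (_⊕ σ ps) (σ-++ ps₃ ps₂)))) (P.⊕-cong {σ ps₃ ⊕ σ ps₂} {(+ c) · f₃ ⊕ (+ b) · f₂} (P.⊕-cong {σ ps₃} {(+ c) · f₃} (σ-const a₃) (σ-const a₂)) (σ-const aps))))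
               (P.≈-trans (P.σ-resp (P.↭⇒≋ (Prop.↭-sym T↭))) (All.lookup T~0 T∈))
            ds : D n (+ a + + c * + x) × D n (+ c + + b)
            ds = PhiBasis.indep B {+ a + + c * + x} {+ c + + b} (P.comb₂ (+ 1) (- + c) (both₃ (ring-71 (+ a) (+ b) (+ c) (+ x)) f₁ f₂ f₃) sum f₃~)
            back : ∀ {Q : Elt → Set} → All Q ((ps₃ ++ ps₂) ++ ps) → All Q T
            back = Prop.All-resp-↭ (Prop.↭-sym T↭)
            none : ∀ {Q : Elt → Set} xs → length xs ≡ 0 → All Q xs
            none {Q} xs e = subst (All Q) (sym (length-0⇒[] e)) []
            decide : c ℕ.+ b < n ⊎ c ℕ.+ b ≡ n → Goal
            decide (inj₁ lt) = inj₁ (back (All.++⁺ (none (ps₃ ++ ps₂) (trans (List.length-++ ps₃) (D-small (proj₂ ds) lt))) aps))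
            decide (inj₂ e) = decide₂ (m≤n⇒m<n∨m≡n c≤)
              where
              a≡0 : a ≡ 0
              a≡0 = +-cancelˡ-≡ n _ _ (trans (cong (ℕ._+ a) (sym e)) (trans (sym lens) (sym (+-identityʳ n))))
              c≤ : c ≤ n
              c≤ = ≤-trans (m≤m+n c b) bc≤
              dc : D n (+ c)
              dc = coprime-cancel coprime (subst (D n) (trans (cong (λ i → + i + + c * + x) a≡0) (trans (ℤ.+-identityˡ _) (sym (ℤ.pos-* c x)))) (proj₁ ds))
              decide₂ : c < n ⊎ c ≡ n → Goal
              decide₂ (inj₁ lt) = inj₂ (inj₁ (back (All.++⁺ (All.++⁺ (none ps₃ (D-small dc lt)) a₂) (none ps a≡0))))
              decide₂ (inj₂ c≡n) = inj₂ (inj₂ (back (All.++⁺ (All.++⁺ a₃ (none ps₂ (+-cancelˡ-≡ n _ _ (trans (cong (ℕ._+ b) (sym c≡n)) (trans e (sym (+-identityʳ n))))))) (none ps a≡0))))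

  opaque
    -- A term of the block and a term of R with the same image can be exchanged while the sum stays
    -- h, so they are equal in G.
    lift-block : ∀ {k S} (Δ : Decomposition k S) (k≤ : k ≤ suc n′) → let open Decomposition Δ in
      ∀ {T r f} → T ∈ Ts → All (_~ f) T → r ∈ R → r ~ f → length T ≡ n × All (_≈ r) T × (+ n) · r ≈ h
    lift-block {k} Δ k≤ {T} {r} {f} T∈ T~ r∈ r~ = Tn , all≈ , const-multiple Tn all≈ (All.lookup T≈h T∈)
      where
      open Decomposition Δ
      Tn : length T ≡ n
      Tn = All.lookup T-length T∈
      one : ∀ {t} → t ∈ T → t ≈ r
      one {t} t∈ = go (∈⇒≋ t∈) (∈⇒≋ r∈)
        where
        go : (∃[ T′ ] T ≋ t ∷ T′) → (∃[ R′ ] R ≋ r ∷ R′) → t ≈ r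
        go (T′ , p) (R′ , q) = cancelʳ {t} {r} {σ T′} {h} (≈-trans (≈-sym (σ-resp p)) (All.lookup T≈h T∈)) (sum≈h T∈ (r ∷ T′)
            (sub-respʳ (++-comm R T) (sub-++ {r ∷ []} {R} {T′} {T} (R′ , q) (t ∷ [] , ≋-trans p (++-comm (t ∷ []) T′)))) (s≤s z≤n)
            (+-mono-≤ (≤-reflexive (trans (sym (≋-length p)) Tn)) (≤-trans (s≤s k≤) (m≤m+n n (n ℕ.+ 0))))
            (P.≈-trans (P.⊕-cong {r} {t} {σ T′} {σ T′} (P.≈-trans r~ (P.≈-sym (All.lookup T~ t∈))) P.≈-refl) (P.≈-trans (P.≈-sym (≈⇒~ (σ-resp p))) (All.lookup T~0 T∈))))
      all≈ : All (_≈ r) T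
      all≈ = All.tabulate one

  -- Counting blocks and the forms of items 3 and 4.

  Pure : Elt → Elt → List Elt → Set
  Pure h e T = length T ≡ n × All (_≈ e) T × (+ n) · e ≈ h

  -- a, b and c are the numbers of blocks with each value. A single block with value e already
  -- forces n e = h, hence the alternatives in `a-mult` and `b-mult`.
  record Counts (h e₁ e₂ e₃ : Elt) (k : ℕ) (S : List Elt) : Set where
    field
      a b c : ℕ
      total : a ℕ.+ (b ℕ.+ c) ≡ suc m′
      a-mult : a ≡ 0 ⊎ (+ n) · e₁ ≈ h
      b-mult : b ≡ 0 ⊎ (+ n) · e₂ ≈ h
      S≋ : S ≋ replicate (suc n′ ℕ.+ a ℕ.* n) e₁ ++ (replicate (suc n′ ℕ.+ b ℕ.* n) e₂ ++ replicate (c ℕ.* n ℕ.+ k) e₃)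

  opaque
    count : ∀ {h e₁ e₂ e₃ k S} Ts → length Ts ≡ suc m′ → All (λ T → Pure h e₁ T ⊎ Pure h e₂ T ⊎ Pure h e₃ T) Ts →
      S ≋ concat Ts ++ (replicate (suc n′) e₁ ++ (replicate (suc n′) e₂ ++ replicate k e₃)) → Counts h e₁ e₂ e₃ k S
    count {h} {e₁} {e₂} {e₃} {k} {S} Ts len all S≋ = split (partition-⊎ all)
      where
      split : (∃[ ps ] ∃[ qs ] Ts ↭ qs ++ ps × All (Pure h e₁) ps × All (λ T → Pure h e₂ T ⊎ Pure h e₃ T) qs) → Counts h e₁ e₂ e₃ k S
      split (ps , qs , perm , aps , aqs) = split₂ (partition-⊎ aqs)
        where
        split₂ : (∃[ ps₂ ] ∃[ ps₃ ] qs ↭ ps₃ ++ ps₂ × All (Pure h e₂) ps₂ × All (Pure h e₃) ps₃) → Counts h e₁ e₂ e₃ k S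
        split₂ (ps₂ , ps₃ , perm₂ , a₂ , a₃) = record { a = length ps ; b = length ps₂ ; c = length ps₃ ; total = tot ; a-mult = mult aps ; b-mult = mult a₂ ; S≋ = arranged }
          where
          Ts↭ : Ts ↭ ps ++ (ps₂ ++ ps₃)
          Ts↭ = Prop.trans perm (Prop.trans (Prop.++-comm qs ps) (Prop.++⁺ˡ ps (Prop.trans perm₂ (Prop.++-comm ps₃ ps₂))))
          tot : length ps ℕ.+ (length ps₂ ℕ.+ length ps₃) ≡ suc m′
          tot = trans (sym (trans (Prop.↭-length Ts↭) (trans (List.length-++ ps) (cong (length ps ℕ.+_) (List.length-++ ps₂))))) len
          mult : ∀ {e Us} → All (Pure h e) Us → length Us ≡ 0 ⊎ (+ n) · e ≈ h
          mult [] = inj₁ refl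
          mult ((_ , _ , p) ∷ _) = inj₂ p
          rep : ∀ {e Us} → All (Pure h e) Us → concat Us ≋ replicate (length Us ℕ.* n) e
          rep us = blocks-const (All.map (λ (l , a , _) → l , a) us)
          blocks : concat Ts ≋ replicate (length ps ℕ.* n) e₁ ++ (replicate (length ps₂ ℕ.* n) e₂ ++ replicate (length ps₃ ℕ.* n) e₃)
          blocks = ≋-trans (↭⇒≋ (concat-↭ Ts↭)) (≋-trans (≋-reflexive (trans (sym (List.concat-++ ps (ps₂ ++ ps₃))) (cong (concat ps ++_) (sym (List.concat-++ ps₂ ps₃)))))
            (++⁺ (rep aps) (++⁺ (rep a₂) (rep a₃))))
          join : ∀ i l e → replicate (l ℕ.* n) e ++ replicate i e ≋ replicate (i ℕ.+ l ℕ.* n) e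
          join i l e = ≋-reflexive (trans (sym (replicate-+ (l ℕ.* n) i e)) (cong (λ q → replicate q e) (+-comm (l ℕ.* n) i)))
          arranged : S ≋ replicate (suc n′ ℕ.+ length ps ℕ.* n) e₁ ++ (replicate (suc n′ ℕ.+ length ps₂ ℕ.* n) e₂ ++ replicate (length ps₃ ℕ.* n ℕ.+ k) e₃)
          arranged = ≋-trans S≋ (≋-trans (++⁺ʳ _ blocks) (≋-trans (interchange (replicate (length ps ℕ.* n) e₁) _ (replicate (suc n′) e₁) _)
            (++⁺ (join (suc n′) (length ps) e₁) (≋-trans (interchange (replicate (length ps₂ ℕ.* n) e₂) _ (replicate (suc n′) e₂) _)
              (++⁺ (join (suc n′) (length ps₂) e₂) (≋-reflexive (sym (replicate-+ (length ps₃ ℕ.* n) k e₃))))))))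

    m∸s : ∀ {b c} → b ℕ.+ c ≡ suc m′ → m ∸ suc b ≡ c
    m∸s {b} {c} e = trans (cong (_∸ b) (sym e)) (m+n∸m≡n b c)

    -- Here n e₁ = n e₃ - n e₂ = h - h = 0, which makes (e₁, e₂) a basis with the right orders.
    form-3a : ∀ {h e₁ e₂ e₃ k S b c} → Generator h → PhiBasis e₁ e₂ → e₃ ≈ e₁ ⊕ e₂ → (+ n) · e₃ ≈ h → (+ n) · e₂ ≈ h → b ℕ.+ c ≡ suc m′ →
      S ≋ replicate (suc n′) e₁ ++ (replicate (suc n′ ℕ.+ b ℕ.* n) e₂ ++ replicate (c ℕ.* n ℕ.+ k) e₃) → Form3a n m k S
    form-3a {h} {e₁} {e₂} {e₃} {k} {S} {b} {c} G B e₃≈ z₃ z₂ tot p = e₁ , e₂ , isBasis G B z₁ z₂ , suc b , s≤s z≤n , s≤s (≤-trans (m≤m+n b c) (≤-reflexive tot)) ,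
        toSeqEq (≋-trans p (++⁺ˡ (replicate (suc n′) e₁) (++⁺ˡ (replicate (suc n′ ℕ.+ b ℕ.* n) e₂) (≋-trans (const-≋′ (c ℕ.* n ℕ.+ k)) (≋-reflexive (cong (λ i → replicate (i ℕ.* n ℕ.+ k) (e₁ ⊕ e₂)) (sym (m∸s {b} {c} tot))))))))
      where
      const-≋′ : ∀ l → replicate l e₃ ≋ replicate l (e₁ ⊕ e₂)
      const-≋′ zero = ≋-refl
      const-≋′ (suc l) = Perm.prep e₃≈ (const-≋′ l)
      z₁ : (+ n) · e₁ ≈ 0G
      z₁ = comb₃ (+ 1) (- + 1) (- + n) (both₄ (ring-205 (+ n)) e₁ e₂ e₃ h) z₃ z₂ e₃≈

    form-3b : ∀ {h e₁ e₂ e₃ k S} → Generator h → PhiBasis e₁ e₂ → e₃ ≈ e₁ ⊕ e₂ → (+ n) · e₃ ≈ h →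
      S ≋ replicate (suc n′) e₁ ++ (replicate (suc n′) e₂ ++ replicate (suc m′ ℕ.* n ℕ.+ k) e₃) → Form3b n m k S
    form-3b {h} {e₁} {e₂} {e₃} {k} {S} G B e₃≈ z₃ p = e₁ , e₂ , isGoodGenSet G B (≈-trans (·-cong (+ n) (≈-sym e₃≈)) z₃) ,
        toSeqEq (≋-trans p (++⁺ˡ (replicate (suc n′) e₁) (++⁺ˡ (replicate (suc n′) e₂) (const-≋′ (suc m′ ℕ.* n ℕ.+ k)))))
      where
      const-≋′ : ∀ l → replicate l e₃ ≋ replicate l (e₁ ⊕ e₂)
      const-≋′ zero = ≋-refl
      const-≋′ (suc l) = Perm.prep e₃≈ (const-≋′ l)

    -- Blocks of value e₁ and of value e₂ cannot both occur: n e₁ = n e₂ = n (e₁ + e₂) = h would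
    -- give h = 0. One kind leads to form (a), up to exchanging e₁ and e₂; neither kind leads to
    -- form (b).
    finish-unit : ∀ {h e₁ e₂ e₃ k S} → Generator h → PhiBasis e₁ e₂ → e₃ ≈ e₁ ⊕ e₂ → (+ n) · e₃ ≈ h → Counts h e₁ e₂ e₃ k S → Form3a n m k S ⊎ Form3b n m k S
    finish-unit {h} {e₁} {e₂} {e₃} {k} {S} G B e₃≈ z₃ Γ = go (a ℕ.≟ 0) (b ℕ.≟ 0)
      where
      open Counts Γ
      mult : ∀ {i e} → i ≡ 0 ⊎ (+ n) · e ≈ h → ¬ i ≡ 0 → (+ n) · e ≈ h
      mult (inj₁ z) ne = ⊥-elim (ne z)
      mult (inj₂ z) _ = z
      zero-a : a ≡ 0 → S ≋ replicate (suc n′) e₁ ++ (replicate (suc n′ ℕ.+ b ℕ.* n) e₂ ++ replicate (c ℕ.* n ℕ.+ k) e₃)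
      zero-a e = ≋-trans S≋ (++⁺ʳ _ (≋-reflexive (cong (λ i → replicate i e₁) (trans (cong (λ i → suc n′ ℕ.+ i ℕ.* n) e) (+-identityʳ (suc n′))))))
      go : Dec (a ≡ 0) → Dec (b ≡ 0) → Form3a n m k S ⊎ Form3b n m k S
      go (yes a0) (yes b0) = inj₂ (form-3b G B e₃≈ z₃ (≋-trans (zero-a a0) (++⁺ˡ (replicate (suc n′) e₁) (++⁺ (≋-reflexive (cong (λ i → replicate i e₂) (trans (cong (λ i → suc n′ ℕ.+ i ℕ.* n) b0) (+-identityʳ (suc n′)))))
          (≋-reflexive (cong (λ i → replicate (i ℕ.* n ℕ.+ k) e₃) (trans (sym (cong₂ (λ i j → i ℕ.+ (j ℕ.+ c)) a0 b0)) total)))))))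
      go (yes a0) (no b1) = inj₁ (form-3a {b = b} {c} G B e₃≈ z₃ (mult b-mult b1) (trans (sym (cong (ℕ._+ (b ℕ.+ c)) a0)) total) (zero-a a0))
      go (no a1) (yes b0) = inj₁ (form-3a {b = a} {c} G (swap-basis B) (≈-trans e₃≈ (≈-reflexive (⊕-comm e₁ e₂))) z₃ (mult a-mult a1) (trans (sym (cong (λ i → a ℕ.+ (i ℕ.+ c)) b0)) total)
          (≋-trans S≋ (≋-trans (shifts (replicate (suc n′ ℕ.+ a ℕ.* n) e₁) (replicate (suc n′ ℕ.+ b ℕ.* n) e₂)) (++⁺ʳ _ (≋-reflexive (cong (λ i → replicate i e₂) (trans (cong (λ i → suc n′ ℕ.+ i ℕ.* n) b0) (+-identityʳ (suc n′)))))))))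
      go (no a1) (no b1) = ⊥-elim (Generator.order G 1 (s≤s z≤n) (s≤s (s≤s z≤n))
          (≈-trans (comb₃ (- + 1) (- + 1) (+ 1) (both₃ (ring-206 (+ n)) e₁ e₂ h) (mult a-mult a1) (mult b-mult b1) (≈-trans (≈-sym (·-cong (+ n) e₃≈)) z₃)) ≈-refl))

    last-count : ∀ i → i ℕ.* n ℕ.+ suc n′ ≡ i ℕ.* n ℕ.+ n ∸ 1
    last-count i = sym (cong (_∸ 1) (+-suc (i ℕ.* n) (suc n′)))

    -- Blocks of value e₁ are excluded, since they would sum to n e₁ = 0 and not to h.
    finish-twist : ∀ {h e₁ e₂ e₃ S} x → 1 ≤ x → x ≤ suc n′ → gcd x n ≡ 1 → Generator h → PhiBasis e₁ e₂ → e₃ ≈ (+ x) · e₁ ⊕ e₂ → (+ n) · e₁ ≈ 0G → (+ n) · e₂ ≈ h →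
      Counts h e₁ e₂ e₃ (suc n′) S → Form4a n m S
    finish-twist {h} {e₁} {e₂} {e₃} {S} x 1≤x x≤ cp G B e₃≈ z₁ z₂ Γ = e₁ , e₂ , isBasis G B z₁ z₂ , suc b , s≤s z≤n , s≤s (≤-trans (m≤m+n b c) (≤-reflexive tot)) , x , 1≤x , x≤ , cp ,
        toSeqEq (≋-trans S≋ (++⁺ (≋-reflexive (cong (λ i → replicate i e₁) (trans (cong (λ i → suc n′ ℕ.+ i ℕ.* n) a≡0) (+-identityʳ (suc n′)))))
          (++⁺ˡ (replicate (suc n′ ℕ.+ b ℕ.* n) e₂) (≋-trans (const-≋′ (c ℕ.* n ℕ.+ suc n′)) (≋-reflexive (cong (λ i → replicate i ((+ x) · e₁ ⊕ e₂)) (trans (last-count c) (cong (λ i → i ℕ.* n ℕ.+ n ∸ 1) (sym (m∸s {b} {c} tot))))))))))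
      where
      open Counts Γ
      a≡0 : a ≡ 0
      a≡0 = go a-mult
        where
        go : a ≡ 0 ⊎ (+ n) · e₁ ≈ h → a ≡ 0
        go (inj₁ e) = e
        go (inj₂ z) = ⊥-elim (Generator.order G 1 (s≤s z≤n) (s≤s (s≤s z≤n)) (≈-trans (≈-reflexive (cong₂ _,_ (ℤ.*-identityˡ (proj₁ h)) (ℤ.*-identityˡ (proj₂ h)))) (≈-trans (≈-sym z) z₁)))
      tot : b ℕ.+ c ≡ suc m′
      tot = trans (sym (cong (ℕ._+ (b ℕ.+ c)) a≡0)) total
      const-≋′ : ∀ l → replicate l e₃ ≋ replicate l ((+ x) · e₁ ⊕ e₂)
      const-≋′ zero = ≋-refl
      const-≋′ (suc l) = Perm.prep e₃≈ (const-≋′ l)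

    3a⇒4a : ∀ {S} → Form3a n m (suc n′) S → Form4a n m S
    3a⇒4a {S} (e₁ , e₂ , bas , s , 1≤s , s≤ , seq) = e₁ , e₂ , bas , s , 1≤s , s≤ , 1 , ≤-refl , s≤s z≤n , gcd-1 ,
      subst (λ v → SeqEq n m S (replicate (suc n′) e₁ ++ (replicate (s ℕ.* n ∸ 1) e₂ ++ replicate ((m ∸ s) ℕ.* n ℕ.+ n ∸ 1) (v ⊕ e₂)))) (cong₂ _,_ (sym (ℤ.*-identityˡ (proj₁ e₁))) (sym (ℤ.*-identityˡ (proj₂ e₁))))
        (subst (λ i → SeqEq n m S (replicate (suc n′) e₁ ++ (replicate (s ℕ.* n ∸ 1) e₂ ++ replicate i (e₁ ⊕ e₂)))) (last-count (m ∸ s)) seq)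

    3b⇒4b : ∀ {S} → Form3b n m (suc n′) S → Form4b n m S
    3b⇒4b {S} (g₁ , g₂ , good , seq) = g₁ , g₂ , good , subst (λ i → SeqEq n m S (replicate (suc n′) g₁ ++ (replicate (suc n′) g₂ ++ replicate i (g₁ ⊕ g₂)))) (last-count (suc m′)) seq

    -- The terms e₂ get coefficient 0 and the terms e₁ + e₂ coefficient 1; there are (m - s) n + 1
    -- of the latter, which is 1 modulo n.
    3a⇒2a : ∀ {S} → Form3a n m 1 S → Form2a n m S
    3a⇒2a {S} (e₁ , e₂ , bas , s , 1≤s , s≤ , seq) = use (indexed xs len F (InRange (+ 0) (+ suc n′)) (All.++⁺ (All.replicate⁺ p (ℤ.+≤+ z≤n , ℤ.+≤+ z≤n)) (All.replicate⁺ q (ℤ.+≤+ z≤n , ℤ.+≤+ (s≤s z≤n)))))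
      where
      F : ℤ → Elt
      F x = x · e₁ ⊕ e₂
      p q : ℕ
      p = s ℕ.* n ∸ 1
      q = (m ∸ s) ℕ.* n ℕ.+ 1
      xs : List ℤ
      xs = replicate p (+ 0) ++ replicate q (+ 1)
      len : length xs ≡ m ℕ.* n
      len = trans (List.length-++ (replicate p (+ 0))) (trans (cong₂ ℕ._+_ (List.length-replicate p) (List.length-replicate q)) (trans (trans (cong (p ℕ.+_) (+-comm _ 1)) (trans (sym (+-assoc p 1 _)) (cong (ℕ._+ (m ∸ s) ℕ.* n) (m∸n+n≡m (*-mono-≤ {1} {s} {1} {n} 1≤s (s≤s z≤n))))))
        (trans (sym (*-distribʳ-+ n s (m ∸ s))) (cong (ℕ._* n) (m+[n∸m]≡n s≤)))))
      sum-rep : ∀ j v → sumℤ (replicate j v) ≡ + j * v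
      sum-rep zero v = refl
      sum-rep (suc j) v = trans (cong (λ t → v + t) (sum-rep j v)) (ring-207 (+ j) v)
      sm : sumℤ xs - + 1 ≡ + (m ∸ s) * + n
      sm = trans (cong (ℤ._- + 1) (trans (sumℤ-++ (replicate p (+ 0)) (replicate q (+ 1))) (cong₂ ℤ._+_ (trans (sum-rep p (+ 0)) (ℤ.*-zeroʳ (+ p))) (sum-rep q (+ 1)))))
         (trans (ring-208 (+ ((m ∸ s) ℕ.* n))) (ℤ.pos-* (m ∸ s) n))
      map≋ : map F xs ≡ replicate p e₂ ++ replicate q (e₁ ⊕ e₂)
      map≋ = trans (List.map-++ F (replicate p (+ 0)) (replicate q (+ 1))) (cong₂ _++_ (trans (List.map-replicate F p (+ 0)) (cong (replicate p) (both₂ ring-209 e₁ e₂)))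
        (trans (List.map-replicate F q (+ 1)) (cong (replicate q) (both₂ ring-210 e₁ e₂))))
      use : (Σ (Fin (m ℕ.* n) → ℤ) λ x → (∀ i → InRange (+ 0) (+ suc n′) (x i)) × Σℤ x ≡ sumℤ xs × tabulate (λ i → F (x i)) ≡ map F xs) → Form2a n m S
      use (x , rg , sx , tb) = e₁ , e₂ , bas , x , rg , Sg.∣⇒∣ᵤ (divides (+ (m ∸ s)) (trans (cong (ℤ._- + 1) sx) sm)) ,
        subst (λ l → SeqEq n m S (replicate (suc n′) e₁ ++ l)) (sym (trans tb map≋)) seq

    -- The n - 1 terms g₂ are those of form (d) with all coefficients 0.
    3b⇒2d : ∀ {S} → Form3b n m 1 S → Form2d n m S
    3b⇒2d {S} (g₁ , g₂ , good , seq) = g₁ , g₂ , good , (λ _ → + 0) , (λ _ → ℤ.-≤+ , ℤ.+≤+ z≤n) , zeros (suc n′) ,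
        toSeqEq (≋-trans (fromSeqEq seq) (++⁺ˡ (replicate (suc n′) g₁) (≋-trans (++-comm (replicate (suc n′) g₂) (replicate (suc m′ ℕ.* n ℕ.+ 1) (g₁ ⊕ g₂))) (++⁺ˡ (replicate (suc m′ ℕ.* n ℕ.+ 1) (g₁ ⊕ g₂)) (≋-reflexive (tabs (suc n′)))))))
      where
      zeros : ∀ l → Σℤ {l} (λ _ → + 0) ≡ + 0
      zeros zero = refl
      zeros (suc l) = trans (ℤ.+-identityˡ _) (zeros l)
      tabs : ∀ l → replicate l g₂ ≡ tabulate {n = l} (λ i → (- (+ 0)) · g₁ ⊕ g₂)
      tabs zero = refl
      tabs (suc l) = cong₂ _∷_ (both₂ ring-163 g₁ g₂) (tabs l)

  -- The case k ≥ 2: equalities in G from exchanges between selections.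

  opaque
    all-equal : ∀ {E : List Elt} → (∀ {p q E′} → E ↭ p ∷ q ∷ E′ → p ≈ q) → ∀ {p q} → p ∈ E → q ∈ E → p ≈ q
    all-equal {E} f {p} {q} p∈ q∈ = go (∈∈⇒↭ p∈ q∈)
      where
      go : p ≡ q ⊎ (∃[ E′ ] E ↭ p ∷ q ∷ E′) → p ≈ q
      go (inj₁ e) = ≈-reflexive e
      go (inj₂ (_ , r)) = f r

    σ-const≈ : ∀ {e L} j → length L ≡ j → All (_≈ e) L → σ L ≈ (+ j) · e
    σ-const≈ {e} {L} j l a = ≈-trans (σ-resp (const-≋ a)) (≈-reflexive (trans (σ-replicate (length L) e) (cong (λ i → (+ i) · e) l)))

    inverse : ∀ {x} → gcd x n ≡ 1 → ∃[ y ] y < n × D n (+ y * + x - + 1)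
    inverse {x} cp = go (Coprime.coprime-Bézout (Coprime.gcd≡1⇒coprime cp))
      where
      reduce : ∀ w → D n (w * + x - + 1) → ∃[ y ] y < n × D n (+ y * + x - + 1)
      reduce w d = use (residue n w)
        where
        use : (∃[ r ] r < n × D n (w - + r)) → ∃[ y ] y < n × D n (+ y * + x - + 1)
        use (r , lt , e) = r , lt , D-comb₂ (+ 1) (- + x) (ring-169 w (+ r) (+ x)) d e
      go : Bézout.Identity 1 x n → ∃[ y ] y < n × D n (+ y * + x - + 1)
      go (Bézout.+- u v e) = reduce (+ u) (divides (+ v) (trans (cong (ℤ._- + 1) (trans (sym (ℤ.pos-* u x)) (trans (cong +_ (sym e)) (ℤ.pos-+ 1 (v ℕ.* n))))) (trans (ring-211 (+ (v ℕ.* n))) (ℤ.pos-* v n))))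
      go (Bézout.-+ u v e) = reduce (- + u) (divides (- + v) (trans (ring-212 (+ u) (+ x)) (trans (cong ℤ.-_ (trans (cong (λ i → + 1 + i) (sym (ℤ.pos-* u x))) (trans (cong +_ e) (ℤ.pos-* v n)))) (ℤ.neg-distribˡ-* (+ v) (+ n)))))

  module Level {k S} (Δ : Decomposition k S) (k≤ : k ≤ suc n′) (τ : Triple k (Decomposition.R Δ))
      (supp : ∀ {T t} → T ∈ Decomposition.Ts Δ → t ∈ T → Values.Near τ t) where
    open Decomposition Δ
    open Triple τ
    open Values τ
    open Uniform Δ k≤ τ supp

    first : ∃[ T ] T ∈ Ts
    first = go (uncons Ts Ts-length)
      where
      go : (∃[ x ] ∃[ ys ] Ts ≡ x ∷ ys) → ∃[ T ] T ∈ Ts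
      go (T , _ , e) = T , subst (T ∈_) (sym e) (here refl)

    -- Multiplicities of f₁, f₂, f₃ for which a selection from R is a zero-sum of the quotient and
    -- short enough to have sum h. With a₂ + a₃ = n the e₂-part vanishes.
    record Parts (a₁ a₂ a₃ : ℕ) : Set where
      field
        d₁ : D n (+ a₁ + + a₃ * + x)
        d₂ : a₂ ℕ.+ a₃ ≡ n
        small : a₁ ℕ.+ (a₂ ℕ.+ a₃) ℕ.+ suc k ≤ 3 ℕ.* n

    opaque
      sub-~ : ∀ {f A E} → Sub A E → All (_~ f) E → All (_~ f) A
      sub-~ {A = A} (A′ , p) a = All.++⁻ˡ A (All-resp-≋ (λ x≈y p → P.≈-trans (P.≈-sym (≈⇒~ x≈y)) p) p a)

      triple-sum : ∀ {a₁ a₂ a₃} → Parts a₁ a₂ a₃ → ∀ {A₁ A₂ A₃} → Sub A₁ E₁ → Sub A₂ E₂ → Sub A₃ E₃ → length A₁ ≡ a₁ → length A₂ ≡ a₂ → length A₃ ≡ a₃ →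
        σ A₁ ⊕ (σ A₂ ⊕ σ A₃) ≈ h
      triple-sum {a₁} {a₂} {a₃} pt {A₁} {A₂} {A₃} s₁ s₂ s₃ l₁ l₂ l₃ = ≈-trans (≈-reflexive (sym σ≡)) (sum≈h (proj₂ first) (A₁ ++ (A₂ ++ A₃))
          (sub-++ʳ (proj₁ first) (sub-respʳ (↭⇒≋ (Prop.↭-sym L↭)) (sub-++ s₁ (sub-++ s₂ s₃))))
          (subst (1 ≤_) (sym len) (≤-trans (≤-trans (s≤s z≤n) (≤-reflexive (sym d₂))) (m≤n+m (a₂ ℕ.+ a₃) a₁)))
          (subst (λ l → l ℕ.+ suc k ≤ 3 ℕ.* n) (sym len) small)
          (P.≈-trans (P.≈-reflexive σ≡) (P.≈-trans (P.⊕-cong {σ A₁} {(+ a₁) · f₁} (part l₁ (sub-~ s₁ E₁~)) (P.⊕-cong {σ A₂} {(+ a₂) · f₂} (part l₂ (sub-~ s₂ E₂~)) (part l₃ (sub-~ s₃ E₃~))))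
            (P.comb₃ (+ 1) (+ 1) (+ a₃) (both₃ (ring-213 (+ a₁) (+ a₂) (+ a₃) (+ x)) f₁ f₂ f₃)
              (D⇒·~0 f₁ d₁) (subst (λ i → (+ i) · f₂ ~ 0G) (sym d₂) (n·~0 f₂)) f₃~))))
        where
        open Parts pt
        σ≡ : σ (A₁ ++ (A₂ ++ A₃)) ≡ σ A₁ ⊕ (σ A₂ ⊕ σ A₃)
        σ≡ = trans (σ-++ A₁ (A₂ ++ A₃)) (cong (σ A₁ ⊕_) (σ-++ A₂ A₃))
        len : length (A₁ ++ (A₂ ++ A₃)) ≡ a₁ ℕ.+ (a₂ ℕ.+ a₃)
        len = trans (List.length-++ A₁) (cong₂ ℕ._+_ l₁ (trans (List.length-++ A₂) (cong₂ ℕ._+_ l₂ l₃)))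
        part : ∀ {f Z j} → length Z ≡ j → All (_~ f) Z → σ Z ~ (+ j) · f
        part {f} {Z} l a = P.≈-trans (σ-const a) (P.≈-reflexive (cong (λ i → (+ i) · f) l))

      -- Two selections that differ only in p and q have the same sum h. The selection must leave a
      -- term of E₁ out, which is the condition on a.
      vary₁ : ∀ {a a₂ a₃} → Parts (suc a) a₂ a₃ → a₂ ≤ suc n′ → a₃ ≤ k → ∀ {p q E′} → E₁ ↭ p ∷ q ∷ E′ → a ≤ length E′ → p ≈ q
      vary₁ {a} {a₂} {a₃} pt le₂ le₃ {p} {q} {E′} perm le = comb₂ (+ 1) (- + 1)
          (both₅ ring-214 p q (σ A) (σ A₂ ⊕ σ A₃) h)
          (sum p (q ∷ []) perm) (sum q (p ∷ []) (Prop.trans perm (Prop.swap p q Prop.refl)))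
        where
        A A₂ A₃ : List Elt
        A = take a E′
        A₂ = take a₂ E₂
        A₃ = take a₃ E₃
        sum : ∀ v ws → E₁ ↭ v ∷ (ws ++ E′) → (v ⊕ σ A) ⊕ (σ A₂ ⊕ σ A₃) ≈ h
        sum v ws pm = triple-sum pt {v ∷ A} (sub-respʳ (↭⇒≋ (Prop.↭-sym pm)) (sub-∷ v (sub-++ʳ ws (sub-take a E′)))) (sub-take a₂ E₂) (sub-take a₃ E₃)
          (cong suc (length-take-≤ a E′ le)) (length-take-≤ a₂ E₂ (≤-trans le₂ (≤-reflexive (sym len₂)))) (length-take-≤ a₃ E₃ (≤-trans le₃ (≤-reflexive (sym len₃))))

      vary₂ : ∀ {a₁ a a₃} → Parts a₁ (suc a) a₃ → a₁ ≤ suc n′ → a₃ ≤ k → ∀ {p q E′} → E₂ ↭ p ∷ q ∷ E′ → a ≤ length E′ → p ≈ q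
      vary₂ {a₁} {a} {a₃} pt le₁ le₃ {p} {q} {E′} perm le = comb₂ (+ 1) (- + 1)
          (both₆ ring-215 p q (σ A) (σ A₁) (σ A₃) h)
          (sum p (q ∷ []) perm) (sum q (p ∷ []) (Prop.trans perm (Prop.swap p q Prop.refl)))
        where
        A A₁ A₃ : List Elt
        A = take a E′
        A₁ = take a₁ E₁
        A₃ = take a₃ E₃
        sum : ∀ v ws → E₂ ↭ v ∷ (ws ++ E′) → σ A₁ ⊕ ((v ⊕ σ A) ⊕ σ A₃) ≈ h
        sum v ws pm = triple-sum pt {A₁} {v ∷ A} (sub-take a₁ E₁) (sub-respʳ (↭⇒≋ (Prop.↭-sym pm)) (sub-∷ v (sub-++ʳ ws (sub-take a E′)))) (sub-take a₃ E₃)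
          (length-take-≤ a₁ E₁ (≤-trans le₁ (≤-reflexive (sym len₁)))) (cong suc (length-take-≤ a E′ le)) (length-take-≤ a₃ E₃ (≤-trans le₃ (≤-reflexive (sym len₃))))

      vary₃ : ∀ {a₁ a₂} → Parts a₁ a₂ 1 → a₁ ≤ suc n′ → a₂ ≤ suc n′ → ∀ {p q E′} → E₃ ↭ p ∷ q ∷ E′ → p ≈ q
      vary₃ {a₁} {a₂} pt le₁ le₂ {p} {q} {E′} perm = comb₂ (+ 1) (- + 1)
          (both₅ ring-216 p q (σ A₁) (σ A₂) h)
          (sum p (q ∷ []) perm) (sum q (p ∷ []) (Prop.trans perm (Prop.swap p q Prop.refl)))
        where
        A₁ A₂ : List Elt
        A₁ = take a₁ E₁
        A₂ = take a₂ E₂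
        sum : ∀ v ws → E₃ ↭ v ∷ (ws ++ E′) → σ A₁ ⊕ (σ A₂ ⊕ (v ⊕ 0G)) ≈ h
        sum v ws pm = triple-sum pt {A₁} {A₂} {v ∷ []} (sub-take a₁ E₁) (sub-take a₂ E₂) (ws ++ E′ , ↭⇒≋ pm)
          (length-take-≤ a₁ E₁ (≤-trans le₁ (≤-reflexive (sym len₁)))) (length-take-≤ a₂ E₂ (≤-trans le₂ (≤-reflexive (sym len₂)))) refl

    record Constant₃ : Set where
      field
        {e₁ e₂ e₃} : Elt
        e₁∈ : e₁ ∈ E₁
        e₂∈ : e₂ ∈ E₂
        e₃∈ : e₃ ∈ E₃
        E₁≈ : All (_≈ e₁) E₁
        E₂≈ : All (_≈ e₂) E₂
        E₃≈ : All (_≈ e₃) E₃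

      opaque
        basis : PhiBasis e₁ e₂
        basis = resp-basis (swap-basis (resp-basis (swap-basis B) (All.lookup E₂~ e₂∈))) (All.lookup E₁~ e₁∈)

        level-sum : ∀ {a₁ a₂ a₃} → Parts a₁ a₂ a₃ → a₁ ≤ suc n′ → a₂ ≤ suc n′ → a₃ ≤ k → (+ a₁) · e₁ ⊕ ((+ a₂) · e₂ ⊕ (+ a₃) · e₃) ≈ h
        level-sum {a₁} {a₂} {a₃} pt le₁ le₂ le₃ = ≈-trans (≈-sym (⊕-cong {σ (take a₁ E₁)} {(+ a₁) · e₁} (σ-const≈ a₁ l₁ (All.take⁺ a₁ E₁≈))
              (⊕-cong {σ (take a₂ E₂)} {(+ a₂) · e₂} (σ-const≈ a₂ l₂ (All.take⁺ a₂ E₂≈)) (σ-const≈ a₃ l₃ (All.take⁺ a₃ E₃≈)))))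
            (triple-sum pt (sub-take a₁ E₁) (sub-take a₂ E₂) (sub-take a₃ E₃) l₁ l₂ l₃)
          where
          l₁ : length (take a₁ E₁) ≡ a₁
          l₁ = length-take-≤ a₁ E₁ (≤-trans le₁ (≤-reflexive (sym len₁)))
          l₂ : length (take a₂ E₂) ≡ a₂
          l₂ = length-take-≤ a₂ E₂ (≤-trans le₂ (≤-reflexive (sym len₂)))
          l₃ : length (take a₃ E₃) ≡ a₃
          l₃ = length-take-≤ a₃ E₃ (≤-trans le₃ (≤-reflexive (sym len₃)))

        counts : Counts h e₁ e₂ e₃ k S
        counts = count Ts Ts-length (All.tabulate block) (≋-trans S≋ (++⁺ˡ (concat Ts) (≋-trans (↭⇒≋ L↭) (++⁺ (rep len₁ E₁≈) (++⁺ (rep len₂ E₂≈) (rep len₃ E₃≈))))))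
          where
          rep : ∀ {e E j} → length E ≡ j → All (_≈ e) E → E ≋ replicate j e
          rep {e} l a = ≋-trans (const-≋ a) (≋-reflexive (cong (λ i → replicate i e) l))
          inR : ∀ {v} → v ∈ E₁ ++ (E₂ ++ E₃) → v ∈ R
          inR = Prop.∈-resp-↭ (Prop.↭-sym L↭)
          block : ∀ {T} → T ∈ Ts → Pure h e₁ T ⊎ Pure h e₂ T ⊎ Pure h e₃ T
          block {T} T∈ = go (uniform T∈)
            where
            go : All (_~ f₁) T ⊎ All (_~ f₂) T ⊎ All (_~ f₃) T → Pure h e₁ T ⊎ Pure h e₂ T ⊎ Pure h e₃ T
            go (inj₁ a) = inj₁ (lift-block Δ k≤ T∈ a (inR (∈-++⁺ˡ e₁∈)) (All.lookup E₁~ e₁∈))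
            go (inj₂ (inj₁ a)) = inj₂ (inj₁ (lift-block Δ k≤ T∈ a (inR (∈-++⁺ʳ E₁ (∈-++⁺ˡ e₂∈))) (All.lookup E₂~ e₂∈)))
            go (inj₂ (inj₂ a)) = inj₂ (inj₂ (lift-block Δ k≤ T∈ a (inR (∈-++⁺ʳ E₁ (∈-++⁺ʳ E₂ e₃∈))) (All.lookup E₃~ e₃∈)))

    opaque
      constant : 1 ≤ k → (∀ {p q} → p ∈ E₁ → q ∈ E₁ → p ≈ q) → (∀ {p q} → p ∈ E₂ → q ∈ E₂ → p ≈ q) → (∀ {p q} → p ∈ E₃ → q ∈ E₃ → p ≈ q) → Constant₃
      constant 1≤k c₁ c₂ c₃ = go (1≤length⇒∈ E₁ (subst (1 ≤_) (sym len₁) (s≤s z≤n))) (1≤length⇒∈ E₂ (subst (1 ≤_) (sym len₂) (s≤s z≤n))) (1≤length⇒∈ E₃ (subst (1 ≤_) (sym len₃) 1≤k))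
        where
        go : (∃[ e ] e ∈ E₁) → (∃[ e ] e ∈ E₂) → (∃[ e ] e ∈ E₃) → Constant₃
        go (e₁ , e₁∈) (e₂ , e₂∈) (e₃ , e₃∈) = record { e₁∈ = e₁∈ ; e₂∈ = e₂∈ ; e₃∈ = e₃∈ ; E₁≈ = All.tabulate (λ p → c₁ p e₁∈) ; E₂≈ = All.tabulate (λ p → c₂ p e₂∈) ; E₃≈ = All.tabulate (λ p → c₃ p e₃∈) }

      D-n : ∀ {z} → z ≡ + n → D n z
      D-n e = divides (+ 1) (trans e (sym (ℤ.*-identityˡ (+ n))))

      parts : ∀ {a₁ a₂ a₃} → D n (+ a₁ + + a₃ * + x) → a₂ ℕ.+ a₃ ≡ n → a₁ ≤ n → Parts a₁ a₂ a₃
      parts {a₁} {a₂} {a₃} d e le = record { d₁ = d ; d₂ = e ; small = ≤-trans (+-mono-≤ (+-mono-≤ le (≤-reflexive e)) (s≤s k≤)) (≤-reflexive (ringℕ-10 n)) }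

      rest-length : ∀ {E E′ : List Elt} {p q} → length E ≡ suc n′ → E ↭ p ∷ q ∷ E′ → suc (length E′) ≡ n′
      rest-length l pm = suc-injective (trans (sym (Prop.↭-length pm)) l)

      -- The multiplicities (n - 1, n - 1, 1) and (n - 2, n - 2, 2) both give h. Their difference is
      -- e₃ = e₁ + e₂, after which the second reads n e₃ = h. The first allows exchanges within E₃,
      -- the second within E₁ and E₂.
      unit-shape : x ≡ 1 → 2 ≤ k → Form3a n m k S ⊎ Form3b n m k S
      unit-shape x≡1 2≤k = go (1≤⇒suc n′ 1≤n′)
        where
        1≤n′ : 1 ≤ n′
        1≤n′ = ≤-pred (≤-trans 2≤k k≤)
        n′≤n : n′ ≤ n
        n′≤n = ≤-trans (n≤1+n n′) (n≤1+n (suc n′))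
        pt₁ : Parts (suc n′) (suc n′) 1
        pt₁ = parts (D-n (trans (cong (λ i → + suc n′ + + 1 * + i) x≡1) (cong +_ (+-comm (suc n′) 1)))) (+-comm (suc n′) 1) (n≤1+n (suc n′))
        pt₂ : Parts n′ n′ 2
        pt₂ = parts (D-n (trans (cong (λ i → + n′ + + 2 * + i) x≡1) (cong +_ (+-comm n′ 2)))) (+-comm n′ 2) n′≤n
        go : (∃[ a ] n′ ≡ suc a) → Form3a n m k S ⊎ Form3b n m k S
        go (a , eq) = finish (constant (≤-trans (n≤1+n 1) 2≤k)
            (all-equal (λ pm → vary₁ (subst (λ i → Parts i n′ 2) eq pt₂) (n≤1+n n′) 2≤k pm (short (rest-length len₁ pm))))
            (all-equal (λ pm → vary₂ (subst (λ i → Parts n′ i 2) eq pt₂) (n≤1+n n′) 2≤k pm (short (rest-length len₂ pm))))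
            (all-equal (vary₃ pt₁ ≤-refl ≤-refl)))
          where
          short : ∀ {l} → suc l ≡ n′ → a ≤ l
          short e = ≤-reflexive (suc-injective (trans (sym eq) (sym e)))
          finish : Constant₃ → Form3a n m k S ⊎ Form3b n m k S
          finish K = finish-unit h-gen basis e₃≈ ne₃ counts
            where
            open Constant₃ K
            one : (+ suc n′) · e₁ ⊕ ((+ suc n′) · e₂ ⊕ (+ 1) · e₃) ≈ h
            one = level-sum pt₁ ≤-refl ≤-refl (≤-trans (n≤1+n 1) 2≤k)
            two : (+ n′) · e₁ ⊕ ((+ n′) · e₂ ⊕ (+ 2) · e₃) ≈ h
            two = level-sum pt₂ (n≤1+n n′) (n≤1+n n′) 2≤k
            e₃≈ : e₃ ≈ e₁ ⊕ e₂
            e₃≈ = comb₂ (- + 1) (+ 1) (both₄ (ring-72 (+ n′)) e₁ e₂ e₃ h) one two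
            ne₃ : (+ n) · e₃ ≈ h
            ne₃ = comb₂ (+ 1) (+ n′) (both₄ (ring-73 (+ n′)) e₁ e₂ e₃ h) two e₃≈

      -- Let y be the inverse of x modulo n and z = n - y. The multiplicities (n - 1, z, y) and (n -
      -- 1 - x, z - 1, y + 1) differ by the relation e₃ = x e₁ + e₂. Given this, (1, y, z) and (n +
      -- 1 - x, y - 1, z + 1) differ by n e₁, so n e₁ = 0, and then the first reads n e₂ = h.
      twist-shape : k ≡ suc n′ → 2 ≤ x → x ≤ n′ → Form4a n m S
      twist-shape k≡ 2≤x x≤n′ = go (inverse coprime)
        where
        -- n = x + suc x₁ = suc y₁ + suc z₁ with x (suc y₁) ≡ 1 modulo n
        x₁ : ℕ
        x₁ = suc n′ ∸ x
        xx₁ : x ℕ.+ x₁ ≡ suc n′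
        xx₁ = m+[n∸m]≡n x≤
        xx : x ℕ.+ suc x₁ ≡ n
        xx = trans (+-suc x x₁) (cong suc xx₁)
        x₁≤ : 2 ℕ.+ x₁ ≤ suc n′
        x₁≤ = ≤-trans (+-monoˡ-≤ x₁ 2≤x) (≤-reflexive xx₁)
        dX : D n (+ x + + suc x₁)
        dX = D-n (cong +_ xx)
        1≤k : 1 ≤ k
        1≤k = ≤-trans (s≤s z≤n) (≤-reflexive (sym k≡))
        top≤k : ∀ {i} → i ≤ suc n′ → i ≤ k
        top≤k le = ≤-trans le (≤-reflexive (sym k≡))
        -- These two selections serve the exchanges: `pt₁` within E₁ and E₃, `pt₂` within E₂.
        pt₁ : Parts (suc x₁) (suc n′) 1
        pt₁ = parts (subst (D n) (trans (ℤ.+-comm (+ x) (+ suc x₁)) (cong (λ i → + suc x₁ + i) (sym (ℤ.*-identityˡ (+ x))))) dX) (+-comm (suc n′) 1) (≤-trans (≤-trans (n≤1+n (suc x₁)) x₁≤) (n≤1+n (suc n′)))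
        pt₂ : Parts x 1 (suc n′)
        pt₂ = parts (divides (+ x) (ring-170 (+ x) (+ suc n′))) refl (≤-trans x≤ (n≤1+n (suc n′)))
        K : Constant₃
        K = constant 1≤k
          (all-equal (λ {_} {_} {E′} pm → vary₁ pt₁ ≤-refl 1≤k pm (≤-pred (≤-trans (≤-pred x₁≤) (≤-reflexive (sym (rest-length len₁ pm)))))))
          (all-equal (λ pm → vary₂ pt₂ x≤ (top≤k ≤-refl) pm z≤n))
          (all-equal (vary₃ pt₁ (≤-trans (n≤1+n (suc x₁)) x₁≤) ≤-refl))
        open Constant₃ K
        go : (∃[ y ] y < n × D n (+ y * + x - + 1)) → Form4a n m S
        go (zero , _ , d) = ⊥-elim (1+n≢0 (D-small {n} {1} (D-comb₁ (- + 1) refl d) (s≤s (s≤s z≤n))))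
        go (suc y₁ , lt , d) = finish
          where
          z₁ : ℕ
          z₁ = n′ ∸ y₁
          yz₁ : y₁ ℕ.+ z₁ ≡ n′
          yz₁ = m+[n∸m]≡n (≤-pred (≤-pred lt))
          yz : suc y₁ ℕ.+ suc z₁ ≡ n
          yz = cong suc (trans (+-suc y₁ z₁) (cong suc yz₁))
          dY : D n (+ suc y₁ + + suc z₁)
          dY = D-n (cong +_ yz)
          x≤n : x < n
          x≤n = s≤s x≤
          -- Here y = 1 would mean x = 1, and below z = 1 would mean x = n - 1. Excluding both keeps
          -- y + 1 and z + 1 within the n - 1 terms of E₃.
          1≤y₁ : 1 ≤ y₁
          1≤y₁ = nonzero y₁ refl
            where
            nonzero : ∀ i → y₁ ≡ i → 1 ≤ i
            nonzero (suc i) _ = s≤s z≤n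
            nonzero zero e = ⊥-elim (<⇒≱ 2≤x (≤-reflexive (congruent-< {n} {x} {1} x≤n (s≤s (s≤s z≤n)) (subst (D n) (trans (cong (λ i → + suc i * + x - + 1) e) (cong (ℤ._- + 1) (ℤ.*-identityˡ (+ x)))) d))))
          1≤z₁ : 1 ≤ z₁
          1≤z₁ = nonzero z₁ refl
            where
            nonzero : ∀ i → z₁ ≡ i → 1 ≤ i
            nonzero (suc i) _ = s≤s z≤n
            nonzero zero e = ⊥-elim (1+n≢0 (D-small {n} {suc x} (D-comb₂ (- + 1) (+ x) (trans (ring-74 (+ x) (+ suc y₁)) (cong (λ i → - + 1 * (+ suc y₁ * + x - + 1) + + x * (+ suc y₁ + + suc i)) (sym e))) d dY) (s≤s (s≤s x≤n′))))
          y≤ : 2 ℕ.+ y₁ ≤ suc n′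
          y≤ = ≤-trans (≤-reflexive (cong suc (+-comm 1 y₁))) (s≤s (≤-trans (+-monoʳ-≤ y₁ 1≤z₁) (≤-reflexive yz₁)))
          z≤ : 2 ℕ.+ z₁ ≤ suc n′
          z≤ = s≤s (≤-trans (+-monoˡ-≤ z₁ 1≤y₁) (≤-reflexive yz₁))
          dZ : D n (+ 1 + + suc z₁ * + x)
          dZ = D-comb₂ (- + 1) (+ x) (ring-123 (+ x) (+ suc y₁) (+ suc z₁)) d dY
          dA : D n (+ (x ℕ.+ x₁) + + suc y₁ * + x)
          dA = D-comb₂ (+ 1) (+ 1) (ring-124 (+ x) (+ x₁) (+ suc y₁)) d dX
          s₁ : (+ (x ℕ.+ x₁)) · e₁ ⊕ ((+ suc z₁) · e₂ ⊕ (+ suc y₁) · e₃) ≈ h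
          s₁ = level-sum (parts dA (trans (+-comm (suc z₁) (suc y₁)) yz) (≤-trans (≤-reflexive xx₁) (n≤1+n (suc n′)))) (≤-reflexive xx₁) (≤-trans (n≤1+n _) z≤) (top≤k (≤-trans (n≤1+n _) y≤))
          s₂ : (+ x₁) · e₁ ⊕ ((+ z₁) · e₂ ⊕ (+ suc (suc y₁)) · e₃) ≈ h
          s₂ = level-sum (parts (D-comb₂ (+ 1) (+ 1) (ring-125 (+ x) (+ x₁) (+ suc y₁)) d dX) (trans (+-comm z₁ (suc (suc y₁))) (trans (cong suc (sym (+-suc y₁ z₁))) yz)) x₁≤n)
              (≤-trans (m≤n+m x₁ 2) x₁≤) (≤-trans (m≤n+m z₁ 2) z≤) (top≤k y≤)
            where
            x₁≤n : x₁ ≤ n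
            x₁≤n = ≤-trans (≤-trans (m≤n+m x₁ 2) x₁≤) (n≤1+n (suc n′))
          s₃ : (+ 1) · e₁ ⊕ ((+ suc y₁) · e₂ ⊕ (+ suc z₁) · e₃) ≈ h
          s₃ = level-sum (parts dZ yz (s≤s z≤n)) (s≤s z≤n) (≤-trans (n≤1+n _) y≤) (top≤k (≤-trans (n≤1+n _) z≤))
          s₄ : (+ (2 ℕ.+ x₁)) · e₁ ⊕ ((+ y₁) · e₂ ⊕ (+ suc (suc z₁)) · e₃) ≈ h
          s₄ = level-sum (parts (D-comb₂ (+ 1) (+ 1) (ring-126 (+ x) (+ x₁) (+ suc z₁)) dZ dX) (trans (+-suc y₁ (suc z₁)) yz) (≤-trans x₁≤ (n≤1+n (suc n′)))) x₁≤ (≤-trans (m≤n+m y₁ 2) y≤) (top≤k z≤)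
          e₃≈ : e₃ ≈ (+ x) · e₁ ⊕ e₂
          e₃≈ = comb₂ (- + 1) (+ 1) (both₄ (ring-127 (+ x) (+ x₁) (+ suc y₁) (+ z₁)) e₁ e₂ e₃ h) s₁ s₂
          ne₁ : (+ n) · e₁ ≈ 0G
          ne₁ = subst (λ i → (+ i) · e₁ ≈ 0G) xx (comb₃ (- + 1) (+ 1) (- + 1) (both₄ (ring-128 (+ x) (+ x₁) (+ y₁) (+ suc z₁)) e₁ e₂ e₃ h) s₃ s₄ e₃≈)
          ne₂ : (+ n) · e₂ ≈ h
          ne₂ = subst (λ i → (+ i) · e₂ ≈ h) yz (comb₃ (+ 1) (- + suc y₁) (- + 1) (both₄ (ring-129 (+ x) (+ x₁) (+ suc y₁) (+ suc z₁)) e₁ e₂ e₃ h)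
              s₁ e₃≈ (D⇒·≈ {+ (x ℕ.+ x₁) + + suc y₁ * + x} {+ 0} ne₁ (subst (D n) (sym (ℤ.+-identityʳ _)) dA)))
          finish : Form4a n m S
          finish = finish-twist x 1≤x x≤ coprime h-gen basis e₃≈ ne₁ ne₂ (subst (λ i → Counts h e₁ e₂ e₃ i S) k≡ counts)

  -- Items 2, 3 and 4 for S.

  opaque
    -- For x = n - 1 one has f₂ = f₁ + f₃, and E₂ and E₃ are equally long because k = n - 1;
    -- exchanging their roles reduces this case to x = 1.
    swap-triple : ∀ {k L} → k ≡ suc n′ → (τ : Triple k L) → Triple.x τ ≡ suc n′ → ∃[ τ′ ] Triple.x {k} {L} τ′ ≡ 1
    swap-triple {k} {L} k≡ τ x≡ = record { f₁ = f₁ ; f₂ = f₃ ; f₃ = f₂ ; E₁ = E₁ ; E₂ = E₃ ; E₃ = E₂ ; x = 1 ; 1≤x = ≤-refl ; x≤ = s≤s z≤n ; coprime = gcd-1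
        ; B = shear-basis (+ x) B f₃~ ; f₃~ = f₂~
        ; L↭ = Prop.trans L↭ (Prop.++⁺ˡ E₁ (Prop.++-comm E₂ E₃)) ; len₁ = len₁ ; len₂ = trans len₃ k≡ ; len₃ = trans len₂ (sym k≡) ; E₁~ = E₁~ ; E₂~ = E₃~ ; E₃~ = E₂~ ; kind = inj₁ refl } , refl
      where
      open Triple τ
      f₂~ : f₂ ~ (+ 1) · f₁ ⊕ f₃
      f₂~ = P.comb₂ (- + 1) (- + 1) (both₃ s f₁ f₂ f₃) f₃~ (n·~0 f₁)
        where
        s : ∀ a b c → b - (+ 1 * a + c) ≡ - + 1 * (c - ((+ x) * a + b)) + - + 1 * ((+ n) * a - + 0)
        s a b c = trans (ring-217 (+ x) a b c) (cong (λ i → - + 1 * (c - ((+ x) * a + b)) + - + 1 * ((+ suc i) * a - + 0)) x≡)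

    line-decomposition : ∀ {S} → length S ≡ m ℕ.* n ℕ.+ n ∸ 2 ℕ.+ 1 → ZeroFree (m ℕ.* n ℕ.+ n ∸ 1 ∸ 1) S → Decomposition 1 S
    line-decomposition {S} len free = decompose 1 (s≤s z≤n) short-one S len free

    residual : ∀ {k S} (Δ : Decomposition k S) → Residual k (Decomposition.R Δ)
    residual Δ = Decomposition.R-length Δ , Decomposition.R-free Δ

    -- The hypothesis enters through the structure of residual sequences and also, via
    -- `short-triple`, through the bound on the length of R.
    middle-shape : ∀ j → 2 ℕ.+ j ≤ n′ → 𝒞 n 1 (2 ℕ.+ j) → ∀ {S} → length S ≡ m ℕ.* n ℕ.+ n ∸ 2 ℕ.+ (2 ℕ.+ j) → ZeroFree (m ℕ.* n ℕ.+ n ∸ 1 ∸ (2 ℕ.+ j)) S →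
      Form3a n m (2 ℕ.+ j) S ⊎ Form3b n m (2 ℕ.+ j) S
    middle-shape j k≤′ hyp {S} len free = Level.unit-shape Δ k≤ (proj₁ τ) (Supported.support Δ k≤ (λ res → proj₁ (triple res)) (proj₁ τ)) (proj₂ τ) (s≤s (s≤s z≤n))
      where
      k≤ : 2 ℕ.+ j ≤ suc n′
      k≤ = ≤-trans k≤′ (n≤1+n n′)
      form : ∀ {L} → Conclusion n 1 (2 ℕ.+ j) L → ∃[ τ ] Triple.x {2 ℕ.+ j} {L} τ ≡ 1
      form (_ , _ , c , _) = triple-3a (proj₂ (c (s≤s (s≤s z≤n)) k≤′) refl)
      triple : ∀ {L} → Residual (2 ℕ.+ j) L → ∃[ τ ] Triple.x {2 ℕ.+ j} {L} τ ≡ 1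
      triple res = form (apply k≤ hyp res)
      Δ : Decomposition (2 ℕ.+ j) S
      Δ = decompose (2 ℕ.+ j) k≤ (short-triple (2 ℕ.+ j) k≤ (λ L l nz → form (hyp L (residual-length L l) nz))) S len free
      τ : ∃[ τ ] Triple.x {2 ℕ.+ j} {Decomposition.R Δ} τ ≡ 1
      τ = triple (residual Δ)

    top-shape : ∀ j → 2 ℕ.+ j ≡ suc n′ → 𝒞 n 1 (2 ℕ.+ j) → ∀ {S} → length S ≡ m ℕ.* n ℕ.+ n ∸ 2 ℕ.+ (2 ℕ.+ j) → ZeroFree (m ℕ.* n ℕ.+ n ∸ 1 ∸ (2 ℕ.+ j)) S → Form4a n m S ⊎ Form4b n m S
    top-shape j k≡ hyp {S} len free = go (triple (residual Δ))
      where
      k≤ : 2 ℕ.+ j ≤ suc n′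
      k≤ = ≤-reflexive k≡
      Δ : Decomposition (2 ℕ.+ j) S
      Δ = decompose (2 ℕ.+ j) k≤ (subst (Short n) (sym k≡) short-top) S len free
      triple : ∀ {L} → Residual (2 ℕ.+ j) L → Triple (2 ℕ.+ j) L
      triple {L} res = subst (λ i → Triple i L) (sym k≡) (triple-4a (proj₂ (proj₂ (proj₂ (proj₂ (apply k≤ hyp res))) k≡) refl))
      unit-case : (τ : Triple (2 ℕ.+ j) (Decomposition.R Δ)) → Triple.x τ ≡ 1 → Form4a n m S ⊎ Form4b n m S
      unit-case τ x≡1 = convert (Level.unit-shape Δ k≤ τ (Supported.support Δ k≤ triple τ) x≡1 (s≤s (s≤s z≤n)))
        where
        convert : Form3a n m (2 ℕ.+ j) S ⊎ Form3b n m (2 ℕ.+ j) S → Form4a n m S ⊎ Form4b n m S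
        convert (inj₁ f) = inj₁ (3a⇒4a (subst (λ i → Form3a n m i S) k≡ f))
        convert (inj₂ f) = inj₂ (3b⇒4b (subst (λ i → Form3b n m i S) k≡ f))
      go : Triple (2 ℕ.+ j) (Decomposition.R Δ) → Form4a n m S ⊎ Form4b n m S
      go τ = decide (Triple.x τ ℕ.≟ 1) (Triple.x τ ℕ.≟ suc n′)
        where
        decide : Dec (Triple.x τ ≡ 1) → Dec (Triple.x τ ≡ suc n′) → Form4a n m S ⊎ Form4b n m S
        decide (yes x≡1) _ = unit-case τ x≡1
        decide (no _) (yes x≡) = unit-case (proj₁ (swap-triple k≡ τ x≡)) (proj₂ (swap-triple k≡ τ x≡))
        decide (no ≢1) (no ≢top) = inj₁ (Level.twist-shape Δ k≤ τ (Supported.support Δ k≤ triple τ) k≡ (≤∧≢⇒< (Triple.1≤x τ) (λ e → ≢1 (sym e))) (≤-pred (≤∧≢⇒< (Triple.x≤ τ) ≢top)))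

    item-two : 1 ≤ n′ → (∀ {R} → Residual 1 R → Line R) → ∀ {S} → length S ≡ m ℕ.* n ℕ.+ n ∸ 2 ℕ.+ 1 → ZeroFree (m ℕ.* n ℕ.+ n ∸ 1 ∸ 1) S → Item2 n m S
    item-two 1≤n′ line {S} len free = line-shape 1≤n′ Δ (line (residual Δ)) , λ ()
      where
      Δ : Decomposition 1 S
      Δ = line-decomposition len free

  -- The case n = 2.

  module Pairs (n′≡0 : n′ ≡ 0) where

    n≡2 : n ≡ 2
    n≡2 = cong (2 ℕ.+_) n′≡0

    opaque
      double : ∀ u → (+ 2) · u ~ 0G
      double u = subst (λ i → (+ i) · u ~ 0G) n≡2 (n·~0 u)

    opaque
      -- The three terms of R lie over the three nonzero elements of C_2 ⊕ C_2, each of which is the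
      -- sum of the other two; so they form a triple, and `rotate` may permute it.
      line-triple : ∀ {R} → Line R → Triple 1 R
      line-triple {R} ℓ = go (uncons E E-length) (length-2⇒∷ C (trans C-length n≡2))
        where
        open Line ℓ
        go : (∃[ r₁ ] ∃[ E′ ] E ≡ r₁ ∷ E′) → (∃[ r₂ ] ∃[ r₃ ] C ≡ r₂ ∷ r₃ ∷ []) → Triple 1 R
        go (r₁ , E′ , eq) (r₂ , r₃ , eq₂) = use (All.lookup C∈ (subst (r₂ ∈_) (sym eq₂) (here refl)))
          where
          E≡ : E ≡ r₁ ∷ []
          E≡ = trans eq (cong (r₁ ∷_) (length-0⇒[] (suc-injective (trans (sym (cong length eq)) (trans E-length (cong suc n′≡0))))))
          r₁~ : r₁ ~ e₁
          r₁~ = All.lookup E~ (subst (r₁ ∈_) (sym eq) (here refl))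
          sum : σ (r₂ ∷ r₃ ∷ []) ~ e₁
          sum = subst (λ l → σ l ~ e₁) eq₂ σC~
          r₃~ : r₃ ~ (+ 1) · r₁ ⊕ r₂
          r₃~ = P.comb₃ (+ 1) (- + 1) (- + 1) (both₄ ring-130 r₁ r₂ r₃ e₁) sum r₁~ (double r₂)
          use : (∃[ x ] r₂ ~ x · e₁ ⊕ e₂) → Triple 1 R
          use (x , r₂~) = record { f₁ = r₁ ; f₂ = r₂ ; f₃ = r₃ ; E₁ = r₁ ∷ [] ; E₂ = r₂ ∷ [] ; E₃ = r₃ ∷ [] ; x = 1 ; 1≤x = ≤-refl ; x≤ = s≤s z≤n ; coprime = gcd-1
            ; B = resp-basis (shear-basis x B r₂~) r₁~ ; f₃~ = r₃~ ; L↭ = Prop.trans R↭ (Prop.↭-reflexive (cong₂ _++_ E≡ eq₂))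
            ; len₁ = sym (cong suc n′≡0) ; len₂ = sym (cong suc n′≡0) ; len₃ = refl ; E₁~ = P.≈-refl ∷ [] ; E₂~ = P.≈-refl ∷ [] ; E₃~ = P.≈-refl ∷ [] ; kind = inj₁ refl }

      f₃-sum : ∀ {R} (τ : Triple 1 R) → Triple.f₃ τ ~ Triple.f₁ τ ⊕ Triple.f₂ τ
      f₃-sum τ = Values.unit τ (≤-antisym (≤-trans (Triple.x≤ τ) (≤-reflexive (cong suc n′≡0))) (Triple.1≤x τ))

      rotate : ∀ {R} (τ : Triple 1 R) → ∃[ τ′ ] (Triple.f₃ {1} {R} τ′ ≡ Triple.f₁ τ × Triple.f₁ τ′ ≡ Triple.f₂ τ)
      rotate {R} τ = record { f₁ = f₂ ; f₂ = f₃ ; f₃ = f₁ ; E₁ = E₂ ; E₂ = E₃ ; E₃ = E₁ ; x = 1 ; 1≤x = ≤-refl ; x≤ = s≤s z≤n ; coprime = gcd-1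
          ; B = shear-basis (+ 1) (swap-basis B) (P.comb₁ (+ 1) (both₃ ring-218 f₁ f₂ f₃) (f₃-sum τ))
          ; f₃~ = P.comb₂ (- + 1) (- + 1) (both₃ ring-219 f₁ f₂ f₃) (f₃-sum τ) (double f₂)
          ; L↭ = Prop.trans L↭ (Prop.trans (Prop.++-comm E₁ (E₂ ++ E₃)) (Prop.↭-reflexive (List.++-assoc E₂ E₃ E₁))) ; len₁ = len₂ ; len₂ = trans len₃ (sym (cong suc n′≡0)) ; len₃ = trans len₁ (cong suc n′≡0) ; E₁~ = E₂~ ; E₂~ = E₃~ ; E₃~ = E₁~ ; kind = inj₁ refl } , refl , refl
        where
        open Triple τ

    module Pair {S} (Δ : Decomposition 1 S) where
      open Decomposition Δ

      opaque
        near : ∀ (τ : Triple 1 R) {T t} → T ∈ Ts → t ∈ T → Values.Near τ t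
        near τ {T} {t} T∈ t∈ = go (PhiBasis.gen B t)
          where
          open Triple τ
          open Values τ using (Near)
          go : (∃[ a ] ∃[ b ] t ~ a · f₁ ⊕ b · f₂) → Near t
          go (a , b , p) = go₂ (residue n a) (residue n b)
            where
            go₂ : (∃[ r ] r < n × D n (a - + r)) → (∃[ r ] r < n × D n (b - + r)) → Near t
            go₂ (r , r< , d) (s , s< , e) = cases r s (≤-trans r< (≤-reflexive n≡2)) (≤-trans s< (≤-reflexive n≡2)) (P.≈-trans p (P.⊕-cong {a · f₁} {(+ r) · f₁} {b · f₂} {(+ s) · f₂} (D⇒·~ {a} {+ r} f₁ d) (D⇒·~ {b} {+ s} f₂ e)))
              where
              cases : ∀ r s → r < 2 → s < 2 → t ~ (+ r) · f₁ ⊕ (+ s) · f₂ → Near t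
              cases 0 0 _ _ q = ⊥-elim (<⇒≱ (s≤s (s≤s z≤n)) (not-short T∈ (t ∷ []) (sub-++ˡ R (∈⇒≋ t∈)) ≤-refl (P.≈-trans (P.≈-reflexive (⊕-identityʳ t)) q)))
              cases 1 0 _ _ q = inj₁ (P.≈-trans q (P.≈-reflexive (both₂ ring-32 f₁ f₂)))
              cases 0 1 _ _ q = inj₂ (inj₁ (P.≈-trans q (P.≈-reflexive (both₂ ring-33 f₁ f₂))))
              cases 1 1 _ _ q = inj₂ (inj₂ (P.≈-trans q (P.≈-trans (P.≈-reflexive (both₂ ring-34 f₁ f₂)) (P.≈-sym (f₃-sum τ)))))
              cases (suc (suc _)) _ (s≤s (s≤s ())) _ _
              cases 0 (suc (suc _)) _ (s≤s (s≤s ())) _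
              cases 1 (suc (suc _)) _ (s≤s (s≤s ())) _

        -- A block over f₃ gives 2 e₃ = h; together with e₁ + e₂ + e₃ = h this yields e₃ = e₁ + e₂.
        -- A block over another value is first brought to this position by `rotate`.
        from-last : (τ : Triple 1 R) → ∀ {T} → T ∈ Ts → All (_~ Triple.f₃ τ) T → Form3a n m 1 S ⊎ Form3b n m 1 S
        from-last τ {T} T∈ T~ = finish (constant ≤-refl (single (trans len₁ (cong suc n′≡0))) (single (trans len₂ (cong suc n′≡0))) (single len₃))
          where
          open Triple τ
          open Level Δ (s≤s z≤n) τ (near τ)
          single : ∀ {E p q} → length E ≡ 1 → p ∈ E → q ∈ E → p ≈ q
          single l p∈ q∈ = ≈-reflexive (length-1⇒≡ l p∈ q∈)
          finish : Constant₃ → Form3a n m 1 S ⊎ Form3b n m 1 S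
          finish K = finish-unit h-gen basis e₃≈ ne₃ counts
            where
            open Constant₃ K
            ne₃ : (+ n) · e₃ ≈ h
            ne₃ = proj₂ (proj₂ (lift-block Δ (s≤s z≤n) T∈ T~ (Prop.∈-resp-↭ (Prop.↭-sym L↭) (∈-++⁺ʳ E₁ (∈-++⁺ʳ E₂ e₃∈))) (All.lookup E₃~ e₃∈)))
            sum : (+ 1) · e₁ ⊕ ((+ 1) · e₂ ⊕ (+ 1) · e₃) ≈ h
            sum = level-sum (parts (D-n (trans (cong (λ i → + 1 + + 1 * + i) (≤-antisym (≤-trans x≤ (≤-reflexive (cong suc n′≡0))) 1≤x)) (cong +_ (sym n≡2)))) (sym n≡2) (s≤s z≤n)) (s≤s z≤n) (s≤s z≤n) ≤-refl
            e₃≈ : e₃ ≈ e₁ ⊕ e₂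
            e₃≈ = comb₂ (+ 1) (- + 1) (both₄ ring-75 e₁ e₂ e₃ h) (subst (λ i → (+ i) · e₃ ≈ h) n≡2 ne₃) sum

        pair-shape : Line R → Form3a n m 1 S ⊎ Form3b n m 1 S
        pair-shape ℓ = go (Uniform.uniform Δ (s≤s z≤n) τ (near τ) (proj₂ T₁))
          where
          τ : Triple 1 R
          τ = line-triple ℓ
          T₁ : ∃[ T ] T ∈ Ts
          T₁ = Level.first Δ (s≤s z≤n) τ (near τ)
          open Triple τ using (f₁; f₂; f₃)
          go : All (_~ f₁) (proj₁ T₁) ⊎ All (_~ f₂) (proj₁ T₁) ⊎ All (_~ f₃) (proj₁ T₁) → Form3a n m 1 S ⊎ Form3b n m 1 S
          go (inj₁ a) = let (τ′ , e , _) = rotate τ in from-last τ′ (proj₂ T₁) (subst (λ f → All (_~ f) (proj₁ T₁)) (sym e) a)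
          go (inj₂ (inj₁ a)) = let (τ′ , _ , e′) = rotate τ ; (τ″ , e , _) = rotate τ′ in from-last τ″ (proj₂ T₁) (subst (λ f → All (_~ f) (proj₁ T₁)) (sym (trans e e′)) a)
          go (inj₂ (inj₂ a)) = from-last τ (proj₂ T₁) a

    opaque
      pair-item-two : (∀ {R} → Residual 1 R → Line R) → ∀ {S} → length S ≡ m ℕ.* n ℕ.+ n ∸ 2 ℕ.+ 1 → ZeroFree (m ℕ.* n ℕ.+ n ∸ 1 ∸ 1) S → Item2 n m S
      pair-item-two line {S} len free = convert (Pair.pair-shape Δ (line (residual Δ))) , λ ()
        where
        Δ : Decomposition 1 S
        Δ = line-decomposition len free
        convert : Form3a n m 1 S ⊎ Form3b n m 1 S → Shape2 S
        convert (inj₁ f) = inj₁ (3a⇒2a f)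
        convert (inj₂ f) = inj₂ (inj₂ (inj₂ (3b⇒2d f)))

      pair-item-four : 𝒞 n 1 1 → ∀ {S} → length S ≡ m ℕ.* n ℕ.+ n ∸ 2 ℕ.+ 1 → ZeroFree (m ℕ.* n ℕ.+ n ∸ 1 ∸ 1) S → Item4 n m S
      pair-item-four hyp {S} len free = convert (Pair.pair-shape Δ (line-one hyp (residual Δ))) , λ ()
        where
        Δ : Decomposition 1 S
        Δ = line-decomposition len free
        convert : Form3a n m 1 S ⊎ Form3b n m 1 S → Form4a n m S ⊎ Form4b n m S
        convert (inj₁ f) = inj₁ (3a⇒4a (subst (λ i → Form3a n m (suc i) S) (sym n′≡0) f))
        convert (inj₂ f) = inj₂ (3b⇒4b (subst (λ i → Form3b n m (suc i) S) (sym n′≡0) f))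

theorem1p2 : (n m k : ℕ) → 2 ≤ n → 2 ≤ m → k ≤ n ∸ 1 →
    𝒞 n 1 k → 𝒞 n m k
theorem1p2 (suc (suc n′)) (suc (suc m′)) k (s≤s (s≤s z≤n)) (s≤s (s≤s z≤n)) k≤ hyp S len nz =
    -- The items overlap, for instance k = 1 = n - 1 when n = 2, so each is proved separately;
    -- `item2` and `item4` split on n to set n = 2 apart.
    (λ { refl → item2 n′ refl (Main.line-zero n′ m′ hyp) (trans (List.length-++ S) (cong (ℕ._+ 1) (trans len (+-identityʳ _)))) (Main.extend-free n′ m′ len free) }) ,
    (λ { refl → item2 n′ refl (Main.line-one n′ m′ hyp) len free }) ,
    (λ 2≤k k≤′ → item3 k 2≤k k≤′ hyp len free) ,
    (λ { refl → item4 n′ refl hyp len free })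
  where
  n m : ℕ
  n = 2 ℕ.+ n′
  m = 2 ℕ.+ m′
  free : Grp.ZeroFree n m (m ℕ.* n ℕ.+ n ∸ 1 ∸ k) S
  free = Grp.fromZeroNotIn n m nz
  item2 : ∀ i → n′ ≡ i → (∀ {R} → Main.Residual n′ m′ 1 R → Main.Line n′ m′ R) → ∀ {S} →
    length S ≡ m ℕ.* n ℕ.+ n ∸ 2 ℕ.+ 1 → Grp.ZeroFree n m (m ℕ.* n ℕ.+ n ∸ 1 ∸ 1) S → Item2 n m S
  item2 zero e = Main.Pairs.pair-item-two n′ m′ e
  item2 (suc j) e = Main.item-two n′ m′ (≤-trans (s≤s z≤n) (≤-reflexive (sym e)))
  item4 : ∀ i → n′ ≡ i → 𝒞 n 1 (suc i) → ∀ {S} →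
    length S ≡ m ℕ.* n ℕ.+ n ∸ 2 ℕ.+ suc i → Grp.ZeroFree n m (m ℕ.* n ℕ.+ n ∸ 1 ∸ suc i) S → Item4 n m S
  item4 zero e = Main.Pairs.pair-item-four n′ m′ e
  item4 (suc j) e hyp len free = Main.top-shape n′ m′ j (cong suc (sym e)) hyp len free , λ ()
  item3 : ∀ k → 2 ≤ k → k ≤ n′ → 𝒞 n 1 k → ∀ {S} →
    length S ≡ m ℕ.* n ℕ.+ n ∸ 2 ℕ.+ k → Grp.ZeroFree n m (m ℕ.* n ℕ.+ n ∸ 1 ∸ k) S → Item3 n m k S
  item3 (suc (suc j)) _ k≤ hyp len free = Main.middle-shape n′ m′ j k≤ hyp len free , λ ()
  item3 (suc zero) (s≤s ()) _ _ _ _
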